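{- Let $G$ be a finite, simple, connected graph on $n$ vertices such that $\mathrm{EV}(G)$ is a subgraph of a graph in $\mathcal{G}$. Then $\mathrm{pn}(G)\le \lceil n/2\rceil$.
   Context: All graphs are finite and simple. A path decomposition of a graph $G$ is a collection of edge-disjoint paths of $G$ whose union covers $E(G)$; $\mathrm{pn}(G)$ (the path number) is the minimum cardinality of a path decomposition of $G$. The E-subgraph $\mathrm{EV}(G)$ is the subgraph of $G$ induced by the vertices of even degree in $G$. A block of a graph is a maximal 2-connected subgraph. $\mathcal{G}$ denotes the family of graphs $H$ such that (i) each block of $H$ has maximum degree at most $3$, and (ii) each connected component of $H$ either has maximum degree at most $3$ or has at most one block that contains a triangle. -}

module Defs where

open import Data.Nat using (ℕ; zero; suc; _+_; _≤_; ⌈_/2⌉)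
open import Data.Nat.Divisibility using (_∣_)
open import Data.Bool using (Bool; true; false; T; _∧_; _∨_; not; if_then_else_)
open import Data.Fin using (Fin; _≟_)
open import Data.List using (List; []; _∷_; length; map; allFin)
open import Data.Nat.ListAction using (sum)
open import Data.List.Relation.Unary.All using (All)
open import Data.List.Relation.Unary.Linked using (Linked)
open import Data.List.Relation.Unary.Unique.Propositional using (Unique)
open import Data.Product using (Σ; ∃; _×_; _,_)
open import Data.Sum using (_⊎_)
open import Relation.Nullary using (¬_)
open import Relation.Nullary.Decidable using (⌊_⌋)
open import Relation.Binary.PropositionalEquality using (_≡_; _≢_)

record Graph (n : ℕ) : Set where
  field
    adj    : Fin n → Fin n → Bool
    sym    : ∀ u v → adj u v ≡ adj v u
    irrefl : ∀ v → adj v v ≡ false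

open Graph public

countNbrs : {n : ℕ} → (Fin n → Fin n → Bool) → Fin n → ℕ
countNbrs {n} E v = sum (map (λ u → if E v u then 1 else 0) (allFin n))

degree : {n : ℕ} → Graph n → Fin n → ℕ
degree G v = countNbrs (adj G) v

data Walk {n : ℕ} (E : Fin n → Fin n → Bool) : Fin n → Fin n → Set where
  here : ∀ {v} → Walk E v v
  step : ∀ {u v w} → T (E u v) → Walk E v w → Walk E u w

Connected : {n : ℕ} → Graph n → Set
Connected G = ∀ u v → Walk (adj G) u v

IsPath : {n : ℕ} → Graph n → List (Fin n) → Set
IsPath G p = (1 ≤ length p) × Unique p × Linked (λ u v → T (adj G u v)) p

usesEdge : {n : ℕ} → List (Fin n) → Fin n → Fin n → Bool
usesEdge [] u v = false
usesEdge (x ∷ []) u v = false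
usesEdge (x ∷ y ∷ r) u v =
  ((⌊ x ≟ u ⌋ ∧ ⌊ y ≟ v ⌋) ∨ (⌊ x ≟ v ⌋ ∧ ⌊ y ≟ u ⌋)) ∨ usesEdge (y ∷ r) u v

edgeMultiplicity : {n : ℕ} → List (List (Fin n)) → Fin n → Fin n → ℕ
edgeMultiplicity D u v = sum (map (λ p → if usesEdge p u v then 1 else 0) D)

-- edge-disjoint paths of G whose union is E(G): every edge of G lies in
-- exactly one path (paths only use edges of G by IsPath)
IsPathDecomposition : {n : ℕ} → Graph n → List (List (Fin n)) → Set
IsPathDecomposition G D =
  All (IsPath G) D × (∀ u v → T (adj G u v) → edgeMultiplicity D u v ≡ 1)

-- EV(G) (induced on even-degree vertices) being a subgraph of H:
-- an injective map from the even-degree vertices of G into V(H)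
-- sending edges of EV(G) to edges of H.

EVSubgraphOf : {n m : ℕ} → Graph n → Graph m → Set
EVSubgraphOf {n} {m} G H =
  Σ ((v : Fin n) → 2 ∣ degree G v → Fin m) λ f →
    (∀ u v (pu : 2 ∣ degree G u) (pv : 2 ∣ degree G v) →
       f u pu ≡ f v pv → u ≡ v) ×
    (∀ u v (pu : 2 ∣ degree G u) (pv : 2 ∣ degree G v) →
       T (adj G u v) → T (adj H (f u pu) (f v pv)))

record Subgraph {m : ℕ} (H : Graph m) : Set where
  field
    inV     : Fin m → Bool
    inE     : Fin m → Fin m → Bool
    inE-sym : ∀ u v → inE u v ≡ inE v u
    inE-adj : ∀ u v → T (inE u v) → T (adj H u v)
    inE-inV : ∀ u v → T (inE u v) → T (inV u)

open Subgraph public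

_⊆S_ : {m : ℕ} {H : Graph m} → Subgraph H → Subgraph H → Set
B ⊆S B' = (∀ v → T (inV B v) → T (inV B' v)) ×
          (∀ u v → T (inE B u v) → T (inE B' u v))

deleteVertex : {m : ℕ} {H : Graph m} → Subgraph H → Fin m → Fin m → Fin m → Bool
deleteVertex B x u v = inE B u v ∧ not ⌊ x ≟ u ⌋ ∧ not ⌊ x ≟ v ⌋

TwoConnected : {m : ℕ} {H : Graph m} → Subgraph H → Set
TwoConnected {m} B =
  (∃ λ a → ∃ λ b → ∃ λ c → T (inV B a) × T (inV B b) × T (inV B c) ×
      a ≢ b × b ≢ c × a ≢ c) ×
  (∀ u v → T (inV B u) → T (inV B v) → Walk (inE B) u v) ×
  (∀ x → T (inV B x) → ∀ u v → T (inV B u) → T (inV B v) →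
      u ≢ x → v ≢ x → Walk (deleteVertex B x) u v)

IsBlock : {m : ℕ} (H : Graph m) → Subgraph H → Set
IsBlock H B = TwoConnected B × (∀ B' → TwoConnected B' → B ⊆S B' → B' ⊆S B)

subDegree : {m : ℕ} {H : Graph m} → Subgraph H → Fin m → ℕ
subDegree B v = countNbrs (inE B) v

-- B contains a triangle one of whose vertices lies in the component of v
-- (equivalently: B lies in the connected component of H containing v
-- and contains a triangle)
TriangleInComponentOf : {m : ℕ} (H : Graph m) → Fin m → Subgraph H → Set
TriangleInComponentOf H v B =
  ∃ λ a → ∃ λ b → ∃ λ c → Walk (adj H) v a ×
    T (inE B a b) × T (inE B b c) × T (inE B a c)

SameSubgraph : {m : ℕ} {H : Graph m} → Subgraph H → Subgraph H → Set
SameSubgraph B B' = (∀ v → inV B v ≡ inV B' v) × (∀ u v → inE B u v ≡ inE B' u v)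

InFamily : {m : ℕ} → Graph m → Set
InFamily H =
  (∀ B → IsBlock H B → ∀ v → subDegree B v ≤ 3) ×
  -- (ii) every component (the one containing v, for each v) has max degree
  --      ≤ 3, or has at most one block containing a triangle
  (∀ v → (∀ u → Walk (adj H) v u → degree H u ≤ 3) ⊎
         (∀ B₁ B₂ → IsBlock H B₁ → IsBlock H B₂ →
            TriangleInComponentOf H v B₁ → TriangleInComponentOf H v B₂ →
            SameSubgraph B₁ B₂))

{-# OPTIONS --safe #-}
module Submission where

-- Let tok v be the number of path ends at v in a path decomposition; its parity is that of
-- the degree of v, and the sum of all tok v is twice the number of paths. A missing edge ab
-- can be added at a, moving one token from b to a, by a chain of rotations of the paths
-- through a: the only obstacles are neighbours of a without token. Several edges at one
-- vertex can be added simultaneously, up to a choice from pairs of conflicting edges.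
--
-- For a graph of odd order N without exceptional components (an even triangle surrounded by
-- odd vertices, each joined to at least two of its corners) we find by induction on the
-- number of edges a decomposition into at most N / 2 paths. In the subgraph F of even
-- vertices, a vertex of degree 1, a suitable path through two vertices of degree 2, or a
-- suitable vertex of degree 3 allows us to delete one, two or three edges: their ends become
-- odd, hence carry tokens in a decomposition of the rest, and the edges can be added again.
-- If none of these occurs, then the hypothesis on the blocks forces F to consist of isolated
-- triangles and isolated vertices. In this case we delete edges at an odd vertex z with even
-- neighbours; and if every such z sees a single triangle only, two adjacent odd vertices can
-- be used together, the component is exceptional, or all even vertices are isolated in the
-- graph, where one of them serves as the end of a pendant edge.
--
-- For n odd, an exceptional component costs one more path, which ⌈ n /2⌉ allows; for n even we
-- add an isolated vertex.

open import Defs hiding (sym)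
open import Axiom.UniquenessOfIdentityProofs.WithK using (uip)
open import Data.Bool using (Bool; true; false; T; _∧_; _∨_; not; if_then_else_; _xor_)
open import Data.Bool.Properties using (¬-not; not-involutive; xor-assoc; xor-comm; xor-same; xor-identityʳ; ∨-comm; ∧-comm) renaming (_≟_ to _≟ᵇ_)
open import Data.Empty using (⊥; ⊥-elim)
open import Data.Fin using (Fin; zero; suc; _≟_)
open import Data.Fin.Properties using (any?; all?)
open import Data.List using (List; []; _∷_; _++_; length; map; allFin; tabulate; reverse; _ʳ++_; replicate)
open import Data.List.Membership.DecPropositional using (_∈?_)
open import Data.List.Membership.Propositional using (_∈_)
open import Data.List.Membership.Propositional.Properties using (∈-allFin; ∈-++⁺ˡ; ∈-++⁺ʳ; ∈-++⁻; ∈-map⁺)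
open import Data.List.Properties using (map-tabulate; ++-ʳ++; ++-assoc; length-++; length-map; length-replicate; length-tabulate; ++-identityʳ)
open import Data.List.Relation.Binary.Permutation.Propositional using (_↭_; prep; ↭-refl; ↭-sym; ↭-trans; ↭-reflexive) renaming (refl to prefl; swap to pswap; trans to ptrans)
open import Data.List.Relation.Binary.Permutation.Propositional.Properties using (∈-resp-↭; All-resp-↭; drop-∷; shift; shifts; ++⁺ˡ; ++⁺ʳ; ++-comm; ↭-length; map⁺)
open import Data.List.Relation.Unary.All as All using (All; []; _∷_)
open import Data.List.Relation.Unary.All.Properties as Allₚ using ()
open import Data.List.Relation.Unary.AllPairs using ([]; _∷_)
open import Data.List.Relation.Unary.Any using (here; there)
open import Data.List.Relation.Unary.Linked using (Linked; []; [-]; _∷_)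
open import Data.List.Relation.Unary.Unique.Propositional using (Unique)
open import Data.Nat as ℕ using (ℕ; zero; suc; _+_; _*_; _≤_; _<_; z≤n; s≤s; ⌈_/2⌉)
open import Data.Nat.Divisibility using (_∣_; divides)
open import Data.Nat.ListAction using (sum)
open import Data.Nat.Properties hiding (_≟_)
open import Data.Nat.Tactic.RingSolver using (solve-∀)
open import Data.Product using (Σ; ∃; _×_; _,_; proj₁; proj₂)
open import Data.Sum using (_⊎_; inj₁; inj₂) renaming (swap to ⊎-swap)
open import Data.Unit using (tt)
open import Function using (_∘_; id)
open import Relation.Binary.PropositionalEquality hiding ([_])
open import Relation.Nullary using (¬_; Dec; yes; no; contradiction)
open import Relation.Nullary.Decidable using (⌊_⌋; T?; _×-dec_; _⊎-dec_; _→-dec_; ¬?; map′; ¬¬-excluded-middle)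

-- Sums, parities and toggling of edges

-- The induction runs over graphs that need not be connected, because deletions disconnect, and it
-- aims at the floor of `N / 2`. A single triangle violates that bound: three vertices, two paths.
-- Exceptional components are those with the same defect, so every reduction must be shown not to
-- create one; this is why `R₄` is treated apart. The blocks enter only through the two conditions
-- of `Host`. Both pass to subgraphs, so a reduction merely has to shrink the even subgraph F. Odd
-- vertices have a token for free, hence obstacles are even vertices. Several tokens outweigh them:
-- k obstacles at one end are harmless against k + 1 tokens at the other. This explains the degree 3
-- in F: an edge to be inserted meets at most two obstacles, against three tokens, of which one
-- comes from parity and two from edges inserted before. Odd order matters because not all degrees
-- can then be odd: when F has no edge left, some even vertex is still available as an auxiliary
-- end.

∑ : {A : Set} → List A → (A → ℕ) → ℕ
∑ [] f = 0
∑ (x ∷ xs) f = f x + ∑ xs f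

+-swap : ∀ a b c d → (a + b) + (c + d) ≡ (a + c) + (b + d)
+-swap = solve-∀

+-rot : ∀ a b c → a + (b + c) ≡ b + (a + c)
+-rot = solve-∀

+congˡ : ∀ {a b c} → a ≡ b → a + c ≡ b + c
+congˡ refl = refl

+congʳ : ∀ {a b c} → b ≡ c → a + b ≡ a + c
+congʳ refl = refl

module _ {A : Set} where

  ∑-cong : ∀ (xs : List A) {f g} → (∀ x → f x ≡ g x) → ∑ xs f ≡ ∑ xs g
  ∑-cong [] e = refl
  ∑-cong (x ∷ xs) e = cong₂ _+_ (e x) (∑-cong xs e)

  ∑-++ : ∀ (xs ys : List A) f → ∑ (xs ++ ys) f ≡ ∑ xs f + ∑ ys f
  ∑-++ [] ys f = refl
  ∑-++ (x ∷ xs) ys f = trans (cong (f x +_) (∑-++ xs ys f)) (sym (+-assoc (f x) _ _))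

  ∑-+ : ∀ (xs : List A) f g → ∑ xs (λ x → f x + g x) ≡ ∑ xs f + ∑ xs g
  ∑-+ [] f g = refl
  ∑-+ (x ∷ xs) f g = trans (cong (f x + g x +_) (∑-+ xs f g)) (+-swap (f x) (g x) _ _)

  ∑-↭ : ∀ {xs ys : List A} f → xs ↭ ys → ∑ xs f ≡ ∑ ys f
  ∑-↭ f prefl = refl
  ∑-↭ f (prep x p) = cong (f x +_) (∑-↭ f p)
  ∑-↭ f (pswap x y p) = trans (cong (λ s → f x + (f y + s)) (∑-↭ f p)) (+-rot (f x) (f y) _)
  ∑-↭ f (ptrans p q) = trans (∑-↭ f p) (∑-↭ f q)

  ∑-mono : ∀ (xs : List A) {f g} → (∀ x → f x ≤ g x) → ∑ xs f ≤ ∑ xs g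
  ∑-mono [] e = z≤n
  ∑-mono (x ∷ xs) e = +-mono-≤ (e x) (∑-mono xs e)

  ∑-zero : ∀ (xs : List A) {f} → (∀ x → f x ≡ 0) → ∑ xs f ≡ 0
  ∑-zero [] e = refl
  ∑-zero (x ∷ xs) e = cong₂ _+_ (e x) (∑-zero xs e)

  ∑-one : ∀ (xs : List A) → ∑ xs (λ _ → 1) ≡ length xs
  ∑-one [] = refl
  ∑-one (x ∷ xs) = cong suc (∑-one xs)

  ∑-map : ∀ {B : Set} (g : B → A) (xs : List B) f → ∑ (map g xs) f ≡ ∑ xs (f ∘ g)
  ∑-map g [] f = refl
  ∑-map g (x ∷ xs) f = cong (f (g x) +_) (∑-map g xs f)

b2n : Bool → ℕ
b2n b = if b then 1 else 0

b2n≤1 : ∀ b → b2n b ≤ 1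
b2n≤1 true = ≤-refl
b2n≤1 false = z≤n

T⇒≡ : ∀ {b} → T b → b ≡ true
T⇒≡ {true} _ = refl

≡⇒T : ∀ {b} → b ≡ true → T b
≡⇒T refl = tt

true≢false : true ≢ false
true≢false ()

odd : ℕ → Bool
odd zero = false
odd (suc n) = not (odd n)

odd-+ : ∀ m n → odd (m + n) ≡ odd m xor odd n
odd-+ zero n = refl
odd-+ (suc m) n rewrite odd-+ m n with odd m
... | true = not-involutive (odd n)
... | false = refl

odd-b2n : ∀ b → odd (b2n b) ≡ b
odd-b2n true = refl
odd-b2n false = refl

odd-double : ∀ n → odd (n + n) ≡ false
odd-double n = trans (odd-+ n n) (xor-same (odd n))

odd⇒pos : ∀ n → odd n ≡ true → 1 ≤ n
odd⇒pos (suc n) _ = s≤s z≤n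

module _ {N : ℕ} where

  V : Set
  V = Fin N

  Adj : Set
  Adj = V → V → Bool

  eq-refl : ∀ (x : V) → ⌊ x ≟ x ⌋ ≡ true
  eq-refl x with x ≟ x
  ... | yes _ = refl
  ... | no q = contradiction refl q

  eq-≢ : ∀ {x y : V} → x ≢ y → ⌊ x ≟ y ⌋ ≡ false
  eq-≢ {x} {y} n with x ≟ y
  ... | yes p = contradiction p n
  ... | no _ = refl

  eq-sound : ∀ {x y : V} → ⌊ x ≟ y ⌋ ≡ true → x ≡ y
  eq-sound {x} {y} e with x ≟ y
  ... | yes p = p

  δ : V → V → ℕ
  δ x v = b2n ⌊ x ≟ v ⌋

  δ-refl : ∀ x → δ x x ≡ 1
  δ-refl x = cong b2n (eq-refl x)

  δ-≢ : ∀ {x y} → x ≢ y → δ x y ≡ 0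
  δ-≢ n = cong b2n (eq-≢ n)

  δ-sound : ∀ {x y} → 1 ≤ δ x y → x ≡ y
  δ-sound {x} {y} h with x ≟ y
  ... | yes p = p

  ε : V → V → V → V → Bool
  ε x y u v = (⌊ x ≟ u ⌋ ∧ ⌊ y ≟ v ⌋) ∨ (⌊ x ≟ v ⌋ ∧ ⌊ y ≟ u ⌋)

  εn : V → V → V → V → ℕ
  εn x y u v = b2n (ε x y u v)

  ε-swap : ∀ x y u v → ε x y u v ≡ ε y x u v
  ε-swap x y u v = trans (∨-comm (⌊ x ≟ u ⌋ ∧ ⌊ y ≟ v ⌋) _)
    (cong₂ _∨_ (∧-comm ⌊ x ≟ v ⌋ _) (∧-comm ⌊ x ≟ u ⌋ _))

  ε-sym : ∀ x y u v → ε x y u v ≡ ε x y v u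
  ε-sym x y u v = ∨-comm (⌊ x ≟ u ⌋ ∧ ⌊ y ≟ v ⌋) _

  ε-self : ∀ x y → ε x y x y ≡ true
  ε-self x y rewrite eq-refl x | eq-refl y = refl

  ε-sound : ∀ x y u v → ε x y u v ≡ true → (x ≡ u × y ≡ v) ⊎ (x ≡ v × y ≡ u)
  ε-sound x y u v e with x ≟ u | y ≟ v | x ≟ v | y ≟ u
  ... | yes p | yes q | _ | _ = inj₁ (p , q)
  ... | yes p | no q | yes r | yes s = inj₂ (r , s)
  ... | no p | _ | yes r | yes s = inj₂ (r , s)
  ε-sound x y u v () | yes p | no q | yes r | no s
  ε-sound x y u v () | yes p | no q | no r | _
  ε-sound x y u v () | no p | _ | yes r | no s
  ε-sound x y u v () | no p | _ | no r | _

  ε-false : ∀ x y u v → ¬ ((x ≡ u × y ≡ v) ⊎ (x ≡ v × y ≡ u)) → ε x y u v ≡ false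
  ε-false x y u v n with ε x y u v in e
  ... | true = contradiction (ε-sound x y u v e) n
  ... | false = refl

  ε-falseˡ : ∀ {x} y {u v} → x ≢ u → x ≢ v → ε x y u v ≡ false
  ε-falseˡ {x} y {u} {v} p q = ε-false x y u v λ { (inj₁ (e , _)) → p e ; (inj₂ (e , _)) → q e }

  ε-falseʳ : ∀ x {y u v} → y ≢ u → y ≢ v → ε x y u v ≡ false
  ε-falseʳ x {y} {u} {v} p q = ε-false x y u v λ { (inj₁ (_ , e)) → q e ; (inj₂ (_ , e)) → p e }

∑-allFin-suc : ∀ {n} (f : Fin (suc n) → ℕ) → ∑ (allFin (suc n)) f ≡ f zero + ∑ (allFin n) (f ∘ suc)
∑-allFin-suc {n} f = cong (f zero +_)
  (trans (cong (λ l → ∑ l f) (sym (map-tabulate id suc))) (∑-map suc (allFin n) f))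

δ-suc : ∀ {n} (x y : Fin n) → δ (suc x) (suc y) ≡ δ x y
δ-suc x y with x ≟ y
... | yes _ = refl
... | no _ = refl

∑-δ : ∀ {n} (x : Fin n) → ∑ (allFin n) (δ x) ≡ 1
∑-δ {suc n} zero = trans (∑-allFin-suc {n} (δ zero)) (cong suc (∑-zero (allFin n) {δ zero ∘ suc} λ _ → refl))
∑-δ {suc n} (suc x) = trans (∑-allFin-suc {n} (δ (suc x))) (trans (∑-cong (allFin n) {δ (suc x) ∘ suc} {δ x} (δ-suc x)) (∑-δ x))

module _ {N : ℕ} where

  deg : Adj {N} → V → ℕ
  deg E v = ∑ (allFin N) λ u → b2n (E v u)

  odd-∑-xor : ∀ (xs : List (Fin N)) f g →
    odd (∑ xs λ u → b2n (f u xor g u)) ≡ odd (∑ xs (b2n ∘ f)) xor odd (∑ xs (b2n ∘ g))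
  odd-∑-xor [] f g = refl
  odd-∑-xor (x ∷ xs) f g
    rewrite odd-+ (b2n (f x xor g x)) (∑ xs λ u → b2n (f u xor g u))
          | odd-+ (b2n (f x)) (∑ xs (b2n ∘ f)) | odd-+ (b2n (g x)) (∑ xs (b2n ∘ g))
          | odd-∑-xor xs f g
          | odd-b2n (f x xor g x) | odd-b2n (f x) | odd-b2n (g x)
    with f x | g x | odd (∑ xs (b2n ∘ f)) | odd (∑ xs (b2n ∘ g))
  ... | true | true | true | true = refl
  ... | true | true | true | false = refl
  ... | true | true | false | true = refl
  ... | true | true | false | false = refl
  ... | true | false | true | true = refl
  ... | true | false | true | false = refl
  ... | true | false | false | true = refl
  ... | true | false | false | false = refl
  ... | false | true | true | true = refl
  ... | false | true | true | false = refl
  ... | false | true | false | true = refl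
  ... | false | true | false | false = refl
  ... | false | false | true | true = refl
  ... | false | false | true | false = refl
  ... | false | false | false | true = refl
  ... | false | false | false | false = refl

  ∑-εn : ∀ {a b : Fin N} → a ≢ b → ∀ v → ∑ (allFin N) (εn a b v) ≡ δ a v + δ b v
  ∑-εn {a} {b} n v with a ≟ v | b ≟ v
  ... | yes p | yes q = contradiction (trans p (sym q)) n
  ... | yes refl | no q = trans (∑-cong (allFin N) lem) (∑-δ b)
    where
    lem : ∀ u → b2n (⌊ b ≟ u ⌋ ∨ (⌊ a ≟ u ⌋ ∧ false)) ≡ δ b u
    lem u with ⌊ b ≟ u ⌋ | ⌊ a ≟ u ⌋
    ... | true | _ = refl
    ... | false | true = refl
    ... | false | false = refl
  ... | no p | yes refl = trans (∑-cong (allFin N) lem) (∑-δ a)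
    where
    lem : ∀ u → b2n (⌊ a ≟ u ⌋ ∧ true) ≡ δ a u
    lem u with ⌊ a ≟ u ⌋
    ... | true = refl
    ... | false = refl
  ... | no p | no q = ∑-zero (allFin N) lem
    where
    lem : ∀ u → b2n (⌊ a ≟ u ⌋ ∧ false) ≡ 0
    lem u with ⌊ a ≟ u ⌋
    ... | true = refl
    ... | false = refl

  opaque

    -- Sealed together with `tog`: all later arguments use only the two defining equations, so a
    -- parity is never unfolded into a sum over all vertices.
    par : Adj {N} → Fin N → Bool
    par E v = odd (deg E v)

    -- Deletion and insertion are one operation. It is an involution and commutes with itself, so
    -- removing edges and putting them back in another order cancels by pure xor identities.
    tog : Fin N → Fin N → Adj {N} → Adj {N}
    tog a b E u v = E u v xor ε a b u v

    par-def : ∀ (E : Adj {N}) v → par E v ≡ odd (deg E v)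
    par-def E v = refl

    tog-def : ∀ a b (E : Adj {N}) u v → tog a b E u v ≡ E u v xor ε a b u v
    tog-def a b E u v = refl

  private
    xor-true : ∀ b → b xor true ≡ not b
    xor-true true = refl
    xor-true false = refl

  par-tog : ∀ {a b} (E : Adj {N}) → a ≢ b → ∀ v → par (tog a b E) v ≡ par E v xor (⌊ a ≟ v ⌋ xor ⌊ b ≟ v ⌋)
  par-tog {a} {b} E n v = begin
    par (tog a b E) v                                             ≡⟨ par-def (tog a b E) v ⟩
    odd (∑ (allFin N) λ u → b2n (tog a b E v u))                  ≡⟨ cong odd (∑-cong (allFin N) λ u → cong b2n (tog-def a b E v u)) ⟩
    odd (∑ (allFin N) λ u → b2n (E v u xor ε a b v u))            ≡⟨ odd-∑-xor (allFin N) (E v) (ε a b v) ⟩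
    odd (deg E v) xor odd (∑ (allFin N) (εn a b v))               ≡⟨ cong₂ _xor_ (sym (par-def E v)) (cong odd (∑-εn n v)) ⟩
    par E v xor odd (δ a v + δ b v)                               ≡⟨ cong (par E v xor_) (odd-+ (δ a v) (δ b v)) ⟩
    par E v xor (odd (δ a v) xor odd (δ b v))                     ≡⟨ cong₂ (λ s t → par E v xor (s xor t)) (odd-b2n ⌊ a ≟ v ⌋) (odd-b2n ⌊ b ≟ v ⌋) ⟩
    par E v xor (⌊ a ≟ v ⌋ xor ⌊ b ≟ v ⌋)                         ∎
    where open ≡-Reasoning

  par-togˡ : ∀ {a b} (E : Adj {N}) → a ≢ b → par (tog a b E) a ≡ not (par E a)
  par-togˡ {a} {b} E n = trans (par-tog E n a)
    (trans (cong₂ (λ s t → par E a xor (s xor t)) (eq-refl a) (eq-≢ (n ∘ sym))) (xor-true (par E a)))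

  par-togʳ : ∀ {a b} (E : Adj {N}) → a ≢ b → par (tog a b E) b ≡ not (par E b)
  par-togʳ {a} {b} E n = trans (par-tog E n b)
    (trans (cong₂ (λ s t → par E b xor (s xor t)) (eq-≢ n) (eq-refl b)) (xor-true (par E b)))

  par-tog-other : ∀ {a b v} (E : Adj {N}) → a ≢ b → v ≢ a → v ≢ b → par (tog a b E) v ≡ par E v
  par-tog-other {a} {b} {v} E n p q = trans (par-tog E n v)
    (trans (cong₂ (λ s t → par E v xor (s xor t)) (eq-≢ (p ∘ sym)) (eq-≢ (q ∘ sym))) (xor-identityʳ (par E v)))

  tog-tog : ∀ a b (E : Adj {N}) u v → tog a b (tog a b E) u v ≡ E u v
  tog-tog a b E u v = trans (tog-def a b (tog a b E) u v) (trans (cong (_xor ε a b u v) (tog-def a b E u v)) (trans (xor-assoc (E u v) _ _)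
    (trans (cong (E u v xor_) (xor-same (ε a b u v))) (xor-identityʳ (E u v)))))

  tog-cong : ∀ a b {E E' : Adj {N}} → (∀ u v → E u v ≡ E' u v) → ∀ u v → tog a b E u v ≡ tog a b E' u v
  tog-cong a b {E} {E'} e u v = trans (tog-def a b E u v) (trans (cong (_xor ε a b u v) (e u v)) (sym (tog-def a b E' u v)))

  tog-comm : ∀ a b c d (E : Adj {N}) u v → tog a b (tog c d E) u v ≡ tog c d (tog a b E) u v
  tog-comm a b c d E u v = trans (two a b c d) (trans (xor-assoc (E u v) _ _)
    (trans (cong (E u v xor_) (xor-comm (ε c d u v) _)) (trans (sym (xor-assoc (E u v) _ _)) (sym (two c d a b)))))
    where
    two : ∀ a b c d → tog a b (tog c d E) u v ≡ (E u v xor ε c d u v) xor ε a b u v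
    two a b c d = trans (tog-def a b (tog c d E) u v) (cong (_xor ε a b u v) (tog-def c d E u v))

  tog-swap : ∀ a b (E : Adj {N}) u v → tog a b E u v ≡ tog b a E u v
  tog-swap a b E u v = trans (tog-def a b E u v) (trans (cong (E u v xor_) (ε-swap a b u v)) (sym (tog-def b a E u v)))

  tog-self : ∀ a b (E : Adj {N}) → tog a b E a b ≡ not (E a b)
  tog-self a b E = trans (tog-def a b E a b) (trans (cong (E a b xor_) (ε-self a b)) (xor-true (E a b)))

  tog-other : ∀ a b (E : Adj {N}) {u v} → ε a b u v ≡ false → tog a b E u v ≡ E u v
  tog-other a b E {u} {v} e = trans (tog-def a b E u v) (trans (cong (E u v xor_) e) (xor-identityʳ (E u v)))

  tog-sym : ∀ a b {E : Adj {N}} → (∀ u v → E u v ≡ E v u) → ∀ u v → tog a b E u v ≡ tog a b E v u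
  tog-sym a b {E} s u v = trans (tog-def a b E u v) (trans (cong₂ _xor_ (s u v) (ε-sym a b u v)) (sym (tog-def a b E v u)))

  tog-irrefl : ∀ {a b} {E : Adj {N}} → a ≢ b → (∀ v → E v v ≡ false) → ∀ v → tog a b E v v ≡ false
  tog-irrefl {a} {b} {E} n i v = trans (tog-other a b E
    (ε-false a b v v λ { (inj₁ (p , q)) → n (trans p (sym q)) ; (inj₂ (p , q)) → n (trans p (sym q)) })) (i v)

  -- Multiplicities add while adjacencies are toggled; the two agree as long as the toggled pair was
  -- not yet an edge.
  b2n-tog : ∀ a b (E : Adj {N}) u v → (ε a b u v ≡ true → E u v ≡ false) → b2n (E u v) + εn a b u v ≡ b2n (tog a b E u v)
  b2n-tog a b E u v h = trans (l (E u v) (ε a b u v) h) (cong b2n (sym (tog-def a b E u v)))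
    where
    l : ∀ b c → (c ≡ true → b ≡ false) → b2n b + b2n c ≡ b2n (b xor c)
    l false c _ = refl
    l true false _ = refl
    l true true h = contradiction (h refl) λ ()

  -- Twice the number of edges, the measure of the induction.
  size : Adj {N} → ℕ
  size E = ∑ (allFin N) (deg E)

  module _ (G : Graph N) where

    adj-ε : ∀ a b {u v} → adj G a b ≡ true → ε a b u v ≡ true → adj G u v ≡ true
    adj-ε a b {u} {v} h e with ε-sound a b u v e
    ... | inj₁ (refl , refl) = h
    ... | inj₂ (refl , refl) = trans (Graph.sym G u v) h

    tog-⊆ : ∀ {a b} → adj G a b ≡ true → ∀ u v → tog a b (adj G) u v ≡ true → adj G u v ≡ true
    tog-⊆ {a} {b} h u v t with ε a b u v in e
    ... | true = adj-ε a b h e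
    ... | false = trans (sym (tog-other a b (adj G) e)) t

    adj⇒≢ : ∀ {a b} → adj G a b ≡ true → a ≢ b
    adj⇒≢ h refl = true≢false (trans (sym h) (Graph.irrefl G _))

    deg-tog : ∀ {a b} → adj G a b ≡ true → ∀ v → deg (adj G) v ≡ deg (tog a b (adj G)) v + (δ a v + δ b v)
    deg-tog {a} {b} h v = trans (∑-cong (allFin N) lem) (trans (∑-+ (allFin N) (λ u → b2n (tog a b (adj G) v u)) (εn a b v))
        (cong (deg (tog a b (adj G)) v +_) (∑-εn (adj⇒≢ h) v)))
      where
      off : ∀ u → ε a b v u ≡ true → tog a b (adj G) v u ≡ false
      off u e with ε-sound a b v u e
      ... | inj₁ (refl , refl) = trans (tog-self a b (adj G)) (cong not h)
      ... | inj₂ (refl , refl) = trans (tog-sym a b (Graph.sym G) v u) (trans (tog-self a b (adj G)) (cong not h))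
      lem : ∀ u → b2n (adj G v u) ≡ b2n (tog a b (adj G) v u) + εn a b v u
      lem u = sym (trans (b2n-tog a b (tog a b (adj G)) v u (off u)) (cong b2n (tog-tog a b (adj G) v u)))

    size-tog : ∀ {a b} → adj G a b ≡ true → size (adj G) ≡ size (tog a b (adj G)) + 2
    size-tog {a} {b} h = trans (∑-cong (allFin N) (deg-tog h))
      (trans (∑-+ (allFin N) (deg (tog a b (adj G))) _)
      (cong (size (tog a b (adj G)) +_) (trans (∑-+ (allFin N) (δ a) (δ b)) (cong₂ _+_ (∑-δ a) (∑-δ b)))))

  togG : ∀ (a b : Fin N) → a ≢ b → Graph N → Graph N
  togG a b n G = record { adj = tog a b (adj G) ; sym = tog-sym a b (Graph.sym G) ; irrefl = tog-irrefl n (Graph.irrefl G) }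

-- Paths and their ends

module _ {N : ℕ} where

  Path : Set
  Path = List (Fin N)

  cnt : Path → V → ℕ
  cnt p v = ∑ p λ x → δ x v

  -- Absence of repetitions as a bound on multiplicities: cutting, reversing and rejoining paths
  -- then become arithmetic on counts.
  Uq : Path → Set
  Uq p = ∀ v → cnt p v ≤ 1

  Ok : Path → Set
  Ok p = Uq p × 1 ≤ length p

  mulp : Path → V → V → ℕ
  mulp [] u v = 0
  mulp (x ∷ []) u v = 0
  mulp (x ∷ y ∷ r) u v = εn x y u v + mulp (y ∷ r) u v

  hd : Path → V → ℕ
  hd [] v = 0
  hd (x ∷ _) v = δ x v

  la : Path → V → ℕ
  la [] v = 0
  la (x ∷ []) v = δ x v
  la (x ∷ y ∷ r) v = la (y ∷ r) v

  tokp : Path → V → ℕ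
  tokp p v = hd p v + la p v

  mul : List Path → V → V → ℕ
  mul D u v = ∑ D λ p → mulp p u v

  -- The number of path ends at a vertex; a trivial path has both its ends there.
  tok : List Path → V → ℕ
  tok D v = ∑ D λ p → tokp p v

  cnt-∈ : ∀ {p v} → v ∈ p → 1 ≤ cnt p v
  cnt-∈ {x ∷ p} (here refl) rewrite δ-refl x = s≤s z≤n
  cnt-∈ {x ∷ p} {v} (there m) = ≤-trans (cnt-∈ m) (m≤n+m _ (δ x v))

  ∈-cnt : ∀ p {v} → 1 ≤ cnt p v → v ∈ p
  ∈-cnt (x ∷ p) {v} h with x ≟ v
  ... | yes refl = here refl
  ... | no _ = there (∈-cnt p h)

  cnt-ʳ++ : ∀ l r v → cnt (l ʳ++ r) v ≡ cnt l v + cnt r v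
  cnt-ʳ++ [] r v = refl
  cnt-ʳ++ (x ∷ l) r v = trans (cnt-ʳ++ l (x ∷ r) v)
    (trans (+-rot (cnt l v) (δ x v) _) (sym (+-assoc (δ x v) _ _)))

  cnt-reverse : ∀ l v → cnt (reverse l) v ≡ cnt l v
  cnt-reverse l v = trans (cnt-ʳ++ l [] v) (+-identityʳ _)

  mulp-ʳ++ : ∀ l a r u v → mulp (l ʳ++ (a ∷ r)) u v ≡ mulp (a ∷ l) u v + mulp (a ∷ r) u v
  mulp-ʳ++ [] a r u v = refl
  mulp-ʳ++ (x ∷ l) a r u v = trans (mulp-ʳ++ l x (a ∷ r) u v)
    (trans (+-rot (mulp (x ∷ l) u v) (εn x a u v) _)
    (trans (cong (_+ (mulp (x ∷ l) u v + mulp (a ∷ r) u v)) (cong b2n (ε-swap x a u v))) (sym (+-assoc (εn a x u v) _ _))))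

  hd-ʳ++ : ∀ l a r v → hd (l ʳ++ (a ∷ r)) v ≡ la (a ∷ l) v
  hd-ʳ++ [] a r v = refl
  hd-ʳ++ (x ∷ l) a r v = hd-ʳ++ l x (a ∷ r) v

  la-ʳ++ : ∀ l a r v → la (l ʳ++ (a ∷ r)) v ≡ la (a ∷ r) v
  la-ʳ++ [] a r v = refl
  la-ʳ++ (x ∷ l) a r v = la-ʳ++ l x (a ∷ r) v

  len-ʳ++ : ∀ (l : Path) (a : Fin N) (r : Path) → 1 ≤ length (l ʳ++ (a ∷ r))
  len-ʳ++ [] a r = s≤s z≤n
  len-ʳ++ (x ∷ l) a r = len-ʳ++ l x (a ∷ r)

  mulp-reverse : ∀ l u v → mulp (reverse l) u v ≡ mulp l u v
  mulp-reverse [] u v = refl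
  mulp-reverse (x ∷ l) u v = trans (mulp-ʳ++ l x [] u v) (+-identityʳ _)

  hd-reverse : ∀ l v → hd (reverse l) v ≡ la l v
  hd-reverse [] v = refl
  hd-reverse (x ∷ l) v = hd-ʳ++ l x [] v

  la-reverse : ∀ l v → la (reverse l) v ≡ hd l v
  la-reverse [] v = refl
  la-reverse (x ∷ l) v = la-ʳ++ l x [] v

  tokp-reverse : ∀ l v → tokp (reverse l) v ≡ tokp l v
  tokp-reverse l v = trans (cong₂ _+_ (hd-reverse l v) (la-reverse l v)) (+-comm (la l v) _)

  length-reverse⁺ : ∀ (l : Path) → 1 ≤ length l → 1 ≤ length (reverse l)
  length-reverse⁺ (x ∷ l) _ = len-ʳ++ l x []

  -- The part before `a` is returned reversed, so that both halves are listed outwards from `a`.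
  split : ∀ a (p : Path) → cnt p a ≡ 0 ⊎ ∃ λ l → ∃ λ r → p ≡ l ʳ++ (a ∷ r)
  split a [] = inj₁ refl
  split a (x ∷ p) with x ≟ a | split a p
  ... | yes refl | _ = inj₂ ([] , p , refl)
  ... | no n | inj₁ e = inj₁ e
  ... | no n | inj₂ (l , r , refl) = inj₂ (l ++ x ∷ [] , r , sym (++-ʳ++ l))

  module Focus (a : Fin N) where

    join : Path × Path → Path
    join (l , r) = l ʳ++ (a ∷ r)

    halves : List (Path × Path) → List Path
    halves [] = []
    halves ((l , r) ∷ ps) = l ∷ r ∷ halves ps

    OkPair : Path × Path → Set
    OkPair (l , r) = ∀ v → δ a v + (cnt l v + cnt r v) ≤ 1

    OkAway : Path → Set
    OkAway t = Ok t × cnt t a ≡ 0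

    -- A path through a is cut at a into two halves, listed outwards from a; a half is empty if
    -- the path ends at a. The list hs collects all halves, ts the paths avoiding a.
    record Real (hs ts : List Path) (L : ℕ) : Set where
      constructor real
      field
        ps : List (Path × Path)
        perm : halves ps ↭ hs
        okp : All OkPair ps
        okt : All OkAway ts
        len : length ps + length ts ≡ L

    permH : ∀ {hs hs' ts L} → hs ↭ hs' → Real hs ts L → Real hs' ts L
    permH q (real ps p x y z) = real ps (↭-trans p q) x y z

    permT : ∀ {hs ts ts' L} → ts ↭ ts' → Real hs ts L → Real hs ts' L
    permT q (real ps p x y z) = real ps p x (All-resp-↭ q y) (trans (cong (length ps +_) (sym (↭-length q))) z)

    -- Reversing a half does not change the vertex set of its path; it only changes which end of the
    -- half is joined to `a`.
    flipHalf : ∀ ps {h} → h ∈ halves ps → All OkPair ps →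
      ∃ λ ps' → ∃ λ R → halves ps ↭ h ∷ R × halves ps' ↭ reverse h ∷ R × All OkPair ps' × length ps' ≡ length ps
    flipHalf ((l , r) ∷ ps) (here refl) (o ∷ os) =
      (reverse l , r) ∷ ps , _ , ↭-refl , ↭-refl , (λ v → subst (λ s → δ a v + (s + cnt r v) ≤ 1) (sym (cnt-reverse l v)) (o v)) ∷ os , refl
    flipHalf ((l , r) ∷ ps) (there (here refl)) (o ∷ os) =
      (l , reverse r) ∷ ps , _ , pswap l r ↭-refl , pswap l (reverse r) ↭-refl ,
      (λ v → subst (λ s → δ a v + (cnt l v + s) ≤ 1) (sym (cnt-reverse r v)) (o v)) ∷ os , refl
    flipHalf ((l , r) ∷ ps) {h} (there (there m)) (o ∷ os) with flipHalf ps m os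
    ... | ps' , R , p , q , os' , e = (l , r) ∷ ps' , l ∷ r ∷ R , lem p , lem q , o ∷ os' , cong suc e
      where
      lem : ∀ {xs x} → xs ↭ x ∷ R → l ∷ r ∷ xs ↭ x ∷ l ∷ r ∷ R
      lem {x = x} p = ↭-trans (prep l (prep r p)) (shift x (l ∷ r ∷ []) R)

    flipH : ∀ {h hs ts L} → Real (h ∷ hs) ts L → Real (reverse h ∷ hs) ts L
    flipH (real ps p x y z) with flipHalf ps (∈-resp-↭ (↭-sym p) (here refl)) x
    ... | ps' , R , q , q' , x' , e =
      real ps' (↭-trans q' (prep _ (drop-∷ (↭-trans (↭-sym q) p)))) x' y (trans (cong (_+ _) e) z)

    flipT : ∀ {t hs ts L} → Real hs (t ∷ ts) L → Real hs (reverse t ∷ ts) L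
    flipT {t} (real ps p x (((u , n) , c) ∷ y) z) = real ps p x
      ((((λ v → subst (_≤ 1) (sym (cnt-reverse t v)) (u v)) , length-reverse⁺ t n) , trans (cnt-reverse t a) c) ∷ y) z

    -- The path `t` is prolonged by the edge from its first vertex to `a`, where it now ends: its
    -- second half is empty. The number of paths stays the same.
    attach : ∀ {t hs ts L} → Real hs (t ∷ ts) L → Real (t ∷ [] ∷ hs) ts L
    attach {t} {hs} {ts} (real ps p x (((u , n) , c) ∷ y) z) =
      real ((t , []) ∷ ps) (prep t (prep [] p)) (ok ∷ x) y (trans (sym (+-suc (length ps) (length ts))) z)
      where
      ok : OkPair (t , [])
      ok v rewrite +-identityʳ (cnt t v) with a ≟ v
      ... | yes refl rewrite c = ≤-refl
      ... | no _ = u v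

    -- Multiplicities and ends read off from halves. Each half is taken with `a` in front, so that
    -- an empty half contributes no edge but one end at `a`.
    CM : List Path → List Path → V → V → ℕ
    CM hs ts u v = ∑ hs (λ h → mulp (a ∷ h) u v) + ∑ ts (λ t → mulp t u v)

    CT : List Path → List Path → V → ℕ
    CT hs ts v = ∑ hs (λ h → la (a ∷ h) v) + ∑ ts (λ t → tokp t v)

    fromD : ∀ D → All Ok D → ∃ λ hs → ∃ λ ts → Real hs ts (length D) ×
      (∀ u v → mul D u v ≡ CM hs ts u v) × (∀ v → tok D v ≡ CT hs ts v)
    fromD [] [] = [] , [] , real [] ↭-refl [] [] refl , (λ _ _ → refl) , λ _ → refl
    fromD (p ∷ D) (o ∷ os) with split a p | fromD D os
    ... | inj₁ e | hs , ts , real ps q x y z , m , t =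
      hs , p ∷ ts , real ps q x ((o , e) ∷ y) (trans (+-suc _ _) (cong suc z)) ,
      (λ u v → trans (cong (mulp p u v +_) (m u v)) (+-rot (mulp p u v) (∑ hs λ h → mulp (a ∷ h) u v) (∑ ts λ t → mulp t u v))) ,
      (λ v → trans (cong (tokp p v +_) (t v)) (+-rot (tokp p v) (∑ hs λ h → la (a ∷ h) v) (∑ ts λ t → tokp t v)))
    ... | inj₂ (l , r , refl) | hs , ts , real ps q x y z , m , t =
      l ∷ r ∷ hs , ts , real ((l , r) ∷ ps) (prep l (prep r q)) (ok ∷ x) y (cong suc z) ,
      (λ u v → trans (cong₂ _+_ (mulp-ʳ++ l a r u v) (m u v)) (assoc4 (mulp (a ∷ l) u v) _ _ _)) ,
      (λ v → trans (cong₂ _+_ (cong₂ _+_ (hd-ʳ++ l a r v) (la-ʳ++ l a r v)) (t v)) (assoc4 (la (a ∷ l) v) _ _ _))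
      where
      assoc4 : ∀ w x y z → (w + x) + (y + z) ≡ (w + (x + y)) + z
      assoc4 = solve-∀
      ok : OkPair (l , r)
      ok v = subst (_≤ 1) (trans (cnt-ʳ++ l (a ∷ r) v) (+-rot (cnt l v) (δ a v) _)) (proj₁ o v)

    toD : ∀ {hs ts L} → Real hs ts L → ∃ λ D → All Ok D × length D ≡ L ×
      (∀ u v → mul D u v ≡ CM hs ts u v) × (∀ v → tok D v ≡ CT hs ts v)
    toD {hs} {ts} (real ps p x y z) = map join ps ++ ts , Allₚ.++⁺ (oks ps x) (All.map proj₁ y) ,
      trans (length-++ (map join ps)) (trans (cong (_+ length ts) (length-map join ps)) z) ,
      (λ u v → trans (∑-++ (map join ps) ts _) (cong (_+ _) (trans (sumM ps u v) (∑-↭ _ p)))) ,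
      (λ v → trans (∑-++ (map join ps) ts _) (cong (_+ _) (trans (sumT ps v) (∑-↭ _ p))))
      where
      oks : ∀ ps → All OkPair ps → All Ok (map join ps)
      oks [] [] = []
      oks ((l , r) ∷ ps) (o ∷ os) =
        ((λ v → subst (_≤ 1) (sym (trans (cnt-ʳ++ l (a ∷ r) v) (+-rot (cnt l v) (δ a v) _))) (o v)) , len-ʳ++ l a r) ∷ oks ps os
      sumM : ∀ ps u v → mul (map join ps) u v ≡ ∑ (halves ps) (λ h → mulp (a ∷ h) u v)
      sumM [] u v = refl
      sumM ((l , r) ∷ ps) u v = trans (cong₂ _+_ (mulp-ʳ++ l a r u v) (sumM ps u v)) (+-assoc (mulp (a ∷ l) u v) _ _)
      sumT : ∀ ps v → tok (map join ps) v ≡ ∑ (halves ps) (λ h → la (a ∷ h) v)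
      sumT [] v = refl
      sumT ((l , r) ∷ ps) v = trans (cong₂ _+_ (cong₂ _+_ (hd-ʳ++ l a r v) (la-ʳ++ l a r v)) (sumT ps v)) (+-assoc (la (a ∷ l) v) (la (a ∷ r) v) (∑ (halves ps) λ h → la (a ∷ h) v))

-- Adding edges at a vertex

module _ {A : Set} where

  ∑-pick : ∀ (xs : List A) f → 1 ≤ ∑ xs f → ∃ λ x → ∃ λ ys → xs ↭ x ∷ ys × 1 ≤ f x
  ∑-pick (x ∷ xs) f h with f x in e
  ... | suc _ = x , xs , ↭-refl , subst (1 ≤_) (sym e) (s≤s z≤n)
  ... | zero with ∑-pick xs f h
  ... | y , ys , p , q = y , x ∷ ys , ↭-trans (prep x p) (pswap x y ↭-refl) , q

  ∑-pick? : ∀ (xs : List A) f → (∃ λ x → ∃ λ ys → xs ↭ x ∷ ys × 1 ≤ f x) ⊎ ∑ xs f ≡ 0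
  ∑-pick? xs f with ∑ xs f in e
  ... | zero = inj₂ refl
  ... | suc _ = inj₁ (∑-pick xs f (subst (1 ≤_) (sym e) (s≤s z≤n)))

  ∑-≡0 : ∀ {xs : List A} {f x} → ∑ xs f ≡ 0 → x ∈ xs → f x ≡ 0
  ∑-≡0 {f = f} {x} e (here refl) = m+n≡0⇒m≡0 (f x) e
  ∑-≡0 {y ∷ xs} {f} e (there m) = ∑-≡0 {xs} {f} (m+n≡0⇒n≡0 (f y) e) m

  ∈⇒↭ : ∀ {x : A} {xs} → x ∈ xs → ∃ λ ys → xs ↭ x ∷ ys
  ∈⇒↭ {xs = _ ∷ ys} (here refl) = ys , ↭-refl
  ∈⇒↭ {x} {y ∷ xs} (there m) with ∈⇒↭ m
  ... | ys , p = y ∷ ys , ↭-trans (prep y p) (pswap y x ↭-refl)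

  flat : List (A × A) → List A
  flat [] = []
  flat ((x , y) ∷ ps) = x ∷ y ∷ flat ps

  pick : (A × A → Bool) → A × A → A
  pick f p = if f p then proj₁ p else proj₂ p

  rest : (A × A → Bool) → A × A → A
  rest f p = if f p then proj₂ p else proj₁ p

module _ {N : ℕ} where

  mulp-cons : ∀ a (l : Path {N}) {s} → 1 ≤ hd l s → ∀ u v → mulp (a ∷ l) u v ≡ εn a s u v + mulp l u v
  mulp-cons a (x ∷ l) h u v with δ-sound h
  ... | refl = refl

  la-cons : ∀ a (l : Path {N}) {s} → 1 ≤ hd l s → ∀ v → la (a ∷ l) v ≡ la l v
  la-cons a (x ∷ l) h v = refl

  la-δ : ∀ (l : Path {N}) {s} → 1 ≤ la l s → ∀ v → la l v ≡ δ s v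
  la-δ (x ∷ []) h v = cong (λ z → δ z v) (δ-sound h)
  la-δ (x ∷ y ∷ l) h v = la-δ (y ∷ l) h v

  hd-δ : ∀ (l : Path {N}) {s} → 1 ≤ hd l s → ∀ v → hd l v ≡ δ s v
  hd-δ (x ∷ l) h v = cong (λ z → δ z v) (δ-sound h)

  tokp-cases : ∀ (l : Path {N}) {s} → 1 ≤ tokp l s → 1 ≤ hd l s ⊎ 1 ≤ la l s
  tokp-cases l {s} h with hd l s
  ... | zero = inj₂ h
  ... | suc _ = inj₁ (s≤s z≤n)

  two-ends : ∀ (l : Path {N}) {x y z} → 1 ≤ tokp l x → 1 ≤ tokp l y → 1 ≤ tokp l z → x ≡ y ⊎ y ≡ z ⊎ x ≡ z
  two-ends l {x} {y} {z} a b c with tokp-cases l a | tokp-cases l b | tokp-cases l c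
  ... | inj₁ p | inj₁ q | _ = inj₁ (δ-sound (subst (1 ≤_) (hd-δ l p y) q))
  ... | inj₂ p | inj₂ q | _ = inj₁ (δ-sound (subst (1 ≤_) (la-δ l p y) q))
  ... | inj₁ p | _ | inj₁ q = inj₂ (inj₂ (δ-sound (subst (1 ≤_) (hd-δ l p z) q)))
  ... | inj₂ p | _ | inj₂ q = inj₂ (inj₂ (δ-sound (subst (1 ≤_) (la-δ l p z) q)))
  ... | _ | inj₁ p | inj₁ q = inj₂ (inj₁ (δ-sound (subst (1 ≤_) (hd-δ l p z) q)))
  ... | _ | inj₂ p | inj₂ q = inj₂ (inj₁ (δ-sound (subst (1 ≤_) (la-δ l p z) q)))

  cnt-↭ : ∀ {p q : Path {N}} → p ↭ q → ∀ v → cnt p v ≡ cnt q v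
  cnt-↭ p v = ∑-↭ _ p

  pigeonhole : ∀ (ws zs : Path {N}) → Uq ws → (∀ {v} → v ∈ ws → v ∈ zs) → length ws ≤ length zs
  pigeonhole [] zs u s = z≤n
  pigeonhole (w ∷ ws) zs u s with ∈⇒↭ (s (here refl))
  ... | zs' , p = subst (suc (length ws) ≤_) (sym (↭-length p))
        (s≤s (pigeonhole ws zs' (λ v → ≤-trans (m≤n+m _ (δ w v)) (u v)) sub))
    where
    sub : ∀ {v} → v ∈ ws → v ∈ zs'
    sub {v} m with ∈-resp-↭ p (s (there m))
    ... | there q = q
    ... | here refl = contradiction (u v) (<⇒≱ (subst (λ d → 1 < d + cnt ws v) (sym (δ-refl v)) (s≤s (cnt-∈ m))))

  module Chains (a : Fin N) where
    open Focus a public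

    -- Each half ends where its predecessor starts, the first one at s. Reversing all of them
    -- replaces the edge from a to w by the edge from a to s.
    data Chain : Fin N → Fin N → List (Path {N}) → Set where
      [] : ∀ {s} → Chain s s []
      link : ∀ {s x w h C} → 1 ≤ la (x ∷ h) s → Chain x w C → Chain s w ((x ∷ h) ∷ C)

    chainM : ∀ {s w C} → Chain s w C → ∀ u v →
      ∑ (map reverse C) (λ h → mulp (a ∷ h) u v) + εn a w u v ≡ ∑ C (λ h → mulp (a ∷ h) u v) + εn a s u v
    chainM [] u v = refl
    chainM {s} {w} {(x ∷ h) ∷ C} (link e c) u v =
      trans (cong (λ z → (z + ∑ (map reverse C) (λ h → mulp (a ∷ h) u v)) + εn a w u v)
              (trans (mulp-cons a (reverse (x ∷ h)) (subst (1 ≤_) (sym (hd-reverse (x ∷ h) s)) e) u v)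
                     (cong (εn a s u v +_) (mulp-reverse (x ∷ h) u v))))
            (lem (εn a s u v) (mulp (x ∷ h) u v) _ _ _ (εn a x u v) (chainM c u v))
      where
      l1 : ∀ s m X w → ((s + m) + X) + w ≡ (s + m) + (X + w)
      l1 = solve-∀
      l2 : ∀ s m Y x → (s + m) + (Y + x) ≡ ((x + m) + Y) + s
      l2 = solve-∀
      lem : ∀ s m X w Y x → X + w ≡ Y + x → ((s + m) + X) + w ≡ ((x + m) + Y) + s
      lem s m X w Y x e = trans (l1 s m X w) (trans (cong (s + m +_) e) (l2 s m Y x))

    chainT : ∀ {s w C} → Chain s w C → ∀ v →
      ∑ (map reverse C) (λ h → la (a ∷ h) v) + δ s v ≡ ∑ C (λ h → la (a ∷ h) v) + δ w v
    chainT [] v = refl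
    chainT {s} {w} {(x ∷ h) ∷ C} (link e c) v =
      trans (cong (λ z → (z + ∑ (map reverse C) (λ h → la (a ∷ h) v)) + δ s v)
              (trans (la-cons a (reverse (x ∷ h)) (subst (1 ≤_) (sym (hd-reverse (x ∷ h) s)) e) v) (la-reverse (x ∷ h) v)))
      (trans (lem (δ x v) _ (δ s v) _ (δ w v) (chainT c v))
             (cong (λ z → (z + ∑ C (λ h → la (a ∷ h) v)) + δ w v) (sym (la-δ (x ∷ h) e v))))
      where
      l1 : ∀ x X s → (x + X) + s ≡ s + (X + x)
      l1 = solve-∀
      lem : ∀ x X s Y w → X + x ≡ Y + w → (x + X) + s ≡ (s + Y) + w
      lem x X s Y w e = trans (l1 x X s) (trans (cong (s +_) e) (sym (+-assoc s Y w)))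

    -- Along a chain the ends of the halves are their starting vertices shifted by one link.
    -- Starting vertices are neighbours of `a`, each used by one edge, so this bounds how often a
    -- vertex can be an end or a target.
    chainH : ∀ {s w C} → Chain s w C → ∀ v →
      ∑ C (λ h → la (a ∷ h) v) + δ w v ≡ ∑ C (λ h → hd h v) + δ s v
    chainH [] v = refl
    chainH {s} {w} {(x ∷ h) ∷ C} (link e c) v =
      trans (cong (λ z → (z + ∑ C (λ h → la (a ∷ h) v)) + δ w v) (la-δ (x ∷ h) e v))
            (lem (δ s v) _ _ _ (δ x v) (chainH c v))
      where
      l2 : ∀ s Y x → s + (Y + x) ≡ (x + Y) + s
      l2 = solve-∀
      lem : ∀ s X w Y x → X + w ≡ Y + x → (s + X) + w ≡ (x + Y) + s
      lem s X w Y x e = trans (+-assoc s X w) (trans (cong (s +_) e) (l2 s Y x))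

    flipC : ∀ C {R ts L} → Real (C ++ R) ts L → Real (map reverse C ++ R) ts L
    flipC [] r = r
    flipC (h ∷ C) {R} r = permH (shift (reverse h) (map reverse C) R)
      (flipC C (permH (↭-sym (shift (reverse h) C R)) (flipH r)))

    walk : ∀ n hs s → length hs ≤ n → ∃ λ w → ∃ λ C → ∃ λ R →
      hs ↭ C ++ R × Chain s w C × ∑ R (λ h → la h w) ≡ 0
    walk n hs s b with ∑-pick? hs (λ h → la h s)
    walk n hs s b | inj₂ e = s , [] , hs , ↭-refl , [] , e
    walk zero [] s b | inj₁ (h , R , p , e) = contradiction (↭-length p) λ ()
    walk (suc n) hs s b | inj₁ (x ∷ h , R , p , e)
      with walk n R x (ℕ.s≤s⁻¹ (subst (_≤ suc n) (↭-length p) b))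
    ... | w , C , R' , q , c , z = w , (x ∷ h) ∷ C , R' , ↭-trans p (prep _ q) , link e c , z

    record Rec : Set where
      constructor rc
      field
        {src trg} : Fin N
        {body} : List (Path {N})
        chain : Chain src trg body
    open Rec public

    bodies : List Rec → List Path
    bodies [] = []
    bodies (r ∷ rs) = body r ++ bodies rs

    bodies-↭ : ∀ {rs rs'} → rs ↭ rs' → bodies rs ↭ bodies rs'
    bodies-↭ prefl = ↭-refl
    bodies-↭ (prep x p) = ++⁺ˡ (body x) (bodies-↭ p)
    bodies-↭ (pswap {ys = ys} x y p) = ↭-trans (++⁺ˡ (body x) (++⁺ˡ (body y) (bodies-↭ p))) (shifts (body x) (body y))
    bodies-↭ (ptrans p q) = ↭-trans (bodies-↭ p) (bodies-↭ q)

    bodiesH : ∀ rs v → ∑ (bodies rs) (λ h → la (a ∷ h) v) + ∑ rs (λ r → δ (trg r) v)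
                     ≡ ∑ (bodies rs) (λ h → hd h v) + ∑ rs (λ r → δ (src r) v)
    bodiesH [] v = refl
    bodiesH (r ∷ rs) v =
      trans (+congˡ (∑-++ (body r) (bodies rs) _))
      (trans (+-swap (∑ (body r) λ h → la (a ∷ h) v) (∑ (bodies rs) λ h → la (a ∷ h) v) (δ (trg r) v) (∑ rs λ r → δ (trg r) v))
      (trans (cong₂ _+_ (chainH (chain r) v) (bodiesH rs v))
      (trans (+-swap (∑ (body r) λ h → hd h v) (δ (src r) v) (∑ (bodies rs) λ h → hd h v) (∑ rs λ r → δ (src r) v))
             (cong (_+ ∑ (r ∷ rs) λ r → δ (src r) v) (sym (∑-++ (body r) (bodies rs) λ h → hd h v))))))

    -- Each chain is taken from the halves left by its predecessors, so the chains are disjoint. The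
    -- final leftover is contained in every earlier one, hence the stopping condition of the earlier
    -- chains persists.
    walks : ∀ hs ss → ∃ λ rs → ∃ λ R → map src rs ≡ ss × hs ↭ bodies rs ++ R ×
      All (λ r → ∑ R (λ h → la h (trg r)) ≡ 0) rs
    walks hs [] = [] , hs , refl , ↭-refl , []
    walks hs (s ∷ ss) with walk (length hs) hs s ≤-refl
    ... | w , C , R , p , c , z with walks R ss
    ... | rs , R' , e , q , zs = rc c ∷ rs , R' , cong (s ∷_) e ,
          ↭-trans p (↭-trans (++⁺ˡ C q) (↭-reflexive (sym (++-assoc C (bodies rs) R')))) ,
          m+n≡0⇒n≡0 (∑ (bodies rs) (λ h → la h w)) (trans (sym (trans (∑-↭ _ q) (∑-++ (bodies rs) R' _))) z) ∷ zs

    hd≤mulp : ∀ h v → hd h v ≤ mulp (a ∷ h) a v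
    hd≤mulp [] v = z≤n
    hd≤mulp (x ∷ h) v = ≤-trans lem (m≤m+n (εn a x a v) _)
      where
      lem : δ x v ≤ εn a x a v
      lem rewrite eq-refl a with ⌊ x ≟ v ⌋
      ... | true = ≤-refl
      ... | false = z≤n

    away : ∀ R {w} → w ≢ a → ∑ R (λ h → la h w) ≡ 0 → ∑ R (λ h → la (a ∷ h) w) ≡ 0
    away [] n e = refl
    away ([] ∷ R) n e = cong₂ _+_ (δ-≢ (n ∘ sym)) (away R n e)
    away ((x ∷ h) ∷ R) {w} n e = cong₂ _+_ (m+n≡0⇒m≡0 (la (x ∷ h) w) e) (away R n (m+n≡0⇒n≡0 (la (x ∷ h) w) e))

    -- Reversing the chain trades the edge from `a` to its target for the edge from `a` to its
    -- source; `t`, which starts at the target, takes up the freed edge. The balance is one new edge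
    -- at the source and one token moved from there to `a`.
    applyHead : ∀ {hs L R t ts} (r : Rec) → Real hs (t ∷ ts) L → hs ↭ body r ++ R → 1 ≤ hd t (trg r) →
      Real (t ∷ [] ∷ map reverse (body r) ++ R) ts L ×
      (∀ u v → CM (t ∷ [] ∷ map reverse (body r) ++ R) ts u v ≡ CM hs (t ∷ ts) u v + εn a (src r) u v) ×
      (∀ v → CT (t ∷ [] ∷ map reverse (body r) ++ R) ts v + δ (src r) v ≡ CT hs (t ∷ ts) v + δ a v)
    applyHead {hs} {L} {R} {t} {ts} r re p h = attach (flipC C (permH p re)) , nM , nT
      where
      C = body r
      w = trg r
      s = src r
      l1 : ∀ w m X Y Z → (w + m + (0 + (X + Y))) + Z ≡ ((X + w) + Y) + (m + Z)
      l1 = solve-∀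
      l2 : ∀ X s Y mZ → ((X + s) + Y) + mZ ≡ ((X + Y) + mZ) + s
      l2 = solve-∀
      nM : ∀ u v → CM (t ∷ [] ∷ map reverse C ++ R) ts u v ≡ CM hs (t ∷ ts) u v + εn a s u v
      nM u v = trans (cong₂ (λ m S → (m + (0 + S)) + ∑ ts (λ t → mulp t u v)) (mulp-cons a t h u v) (∑-++ (map reverse C) R _))
        (trans (l1 (εn a w u v) (mulp t u v) (∑ (map reverse C) (λ h → mulp (a ∷ h) u v)) (∑ R (λ h → mulp (a ∷ h) u v)) _)
        (trans (cong (λ z → (z + ∑ R (λ h → mulp (a ∷ h) u v)) + (mulp t u v + ∑ ts (λ t → mulp t u v))) (chainM (chain r) u v))
        (trans (l2 (∑ C (λ h → mulp (a ∷ h) u v)) (εn a s u v) (∑ R (λ h → mulp (a ∷ h) u v)) (mulp t u v + ∑ ts (λ t → mulp t u v)))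
               (cong (λ z → (z + (mulp t u v + ∑ ts (λ t → mulp t u v))) + εn a s u v) (sym (trans (∑-↭ _ p) (∑-++ C R _)))))))
      k1 : ∀ y a X Y Z s → ((y + (a + (X + Y))) + Z) + s ≡ (((X + s) + Y) + (y + Z)) + a
      k1 = solve-∀
      k2 : ∀ X w Y y Z a → (((X + w) + Y) + (y + Z)) + a ≡ ((X + Y) + ((w + y) + Z)) + a
      k2 = solve-∀
      nT : ∀ v → CT (t ∷ [] ∷ map reverse C ++ R) ts v + δ s v ≡ CT hs (t ∷ ts) v + δ a v
      nT v = trans (cong₂ (λ m S → ((m + (δ a v + S)) + ∑ ts (λ t → tokp t v)) + δ s v) (la-cons a t h v) (∑-++ (map reverse C) R _))
        (trans (k1 (la t v) (δ a v) (∑ (map reverse C) (λ h → la (a ∷ h) v)) (∑ R (λ h → la (a ∷ h) v)) (∑ ts (λ t → tokp t v)) (δ s v))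
        (trans (cong (λ z → ((z + ∑ R (λ h → la (a ∷ h) v)) + (la t v + ∑ ts (λ t → tokp t v))) + δ a v) (chainT (chain r) v))
        (trans (k2 (∑ C (λ h → la (a ∷ h) v)) (δ w v) (∑ R (λ h → la (a ∷ h) v)) (la t v) (∑ ts (λ t → tokp t v)) (δ a v))
               (cong (_+ δ a v) (cong₂ _+_ (sym (trans (∑-↭ _ p) (∑-++ C R _)))
                  (cong (λ z → (z + la t v) + ∑ ts (λ t → tokp t v)) (sym (hd-δ t h v))))))))

    applyRec : ∀ {hs ts L R t ts'} (r : Rec) → Real hs ts L → hs ↭ body r ++ R → ts ↭ t ∷ ts' → 1 ≤ tokp t (trg r) →
      ∃ λ t' → Real (t' ∷ [] ∷ map reverse (body r) ++ R) ts' L ×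
      (∀ u v → CM (t' ∷ [] ∷ map reverse (body r) ++ R) ts' u v ≡ CM hs ts u v + εn a (src r) u v) ×
      (∀ v → CT (t' ∷ [] ∷ map reverse (body r) ++ R) ts' v + δ (src r) v ≡ CT hs ts v + δ a v)
    applyRec {hs} {ts} {t = t} {ts'} r re p q e with tokp-cases t e
    ... | inj₁ h with applyHead r (permT q re) p h
    ... | re' , m , k = t , re' ,
          (λ u v → trans (m u v) (cong (λ z → (∑ hs (λ h → mulp (a ∷ h) u v) + z) + εn a (src r) u v) (sym (∑-↭ (λ t → mulp t u v) q)))) ,
          (λ v → trans (k v) (cong (λ z → (∑ hs (λ h → la (a ∷ h) v) + z) + δ a v) (sym (∑-↭ (λ t → tokp t v) q))))
    applyRec {hs} {ts} {t = t} {ts'} r re p q e | inj₂ h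
      with applyHead r (flipT (permT q re)) p (subst (1 ≤_) (sym (hd-reverse t (trg r))) h)
    ... | re' , m , k = reverse t , re' ,
          (λ u v → trans (m u v) (cong (λ z → (∑ hs (λ h → mulp (a ∷ h) u v) + z) + εn a (src r) u v)
            (trans (cong (_+ ∑ ts' (λ t → mulp t u v)) (mulp-reverse t u v)) (sym (∑-↭ (λ t → mulp t u v) q))))) ,
          (λ v → trans (k v) (cong (λ z → (∑ hs (λ h → la (a ∷ h) v) + z) + δ a v)
            (trans (cong (_+ ∑ ts' (λ t → tokp t v)) (tokp-reverse t v)) (sym (∑-↭ (λ t → tokp t v) q)))))

module _ {N : ℕ} where

  mem? : ∀ (x : Fin N) xs → Dec (x ∈ xs)
  mem? x xs = _∈?_ _≟_ x xs

module _ {N : ℕ} (a : Fin N) where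
  open Chains a

  targets : List Rec → V → ℕ
  targets rs v = ∑ rs λ r → δ (trg r) v

  token-in-ts : ∀ {hs ts rs R} → hs ↭ bodies rs ++ R → ∀ {w} → w ≢ a →
    ∑ R (λ h → la h w) ≡ 0 → ∑ (bodies rs) (λ h → la (a ∷ h) w) + ∑ ts (λ t → tokp t w) ≡ CT hs ts w
  token-in-ts {hs} {ts} {rs} {R} p {w} n z = sym (cong (_+ ∑ ts (λ t → tokp t w))
    (trans (∑-↭ _ p) (trans (∑-++ (bodies rs) R _) (trans (cong (∑ (bodies rs) (λ h → la (a ∷ h) w) +_) (away R n z)) (+-identityʳ _)))))

  heads≤ : ∀ {hs ts rs R} → hs ↭ bodies rs ++ R → ∀ v → ∑ (bodies rs) (λ h → hd h v) ≤ CM hs ts a v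
  heads≤ {hs} {ts} {rs} {R} p v = begin
    ∑ (bodies rs) (λ h → hd h v) ≤⟨ m≤m+n _ _ ⟩
    ∑ (bodies rs) (λ h → hd h v) + ∑ R (λ h → hd h v) ≡⟨ sym (trans (∑-↭ _ p) (∑-++ (bodies rs) R _)) ⟩
    ∑ hs (λ h → hd h v) ≤⟨ ∑-mono hs (λ h → hd≤mulp h v) ⟩
    ∑ hs (λ h → mulp (a ∷ h) a v) ≤⟨ m≤m+n _ _ ⟩
    CM hs ts a v ∎
    where open ≤-Reasoning

  ∑-map-src : ∀ rs v → ∑ rs (λ r → δ (src r) v) ≡ cnt (map src rs) v
  ∑-map-src rs v = sym (∑-map src rs _)

  ∑-map-trg : ∀ rs v → targets rs v ≡ cnt (map trg rs) v
  ∑-map-trg rs v = sym (∑-map trg rs _)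

  ∈-targets : ∀ {rs r} → r ∈ rs → 1 ≤ targets rs (trg r)
  ∈-targets {r ∷ rs} (here refl) rewrite δ-refl (trg r) = s≤s z≤n
  ∈-targets {r' ∷ rs} {r} (there m) = ≤-trans (∈-targets m) (m≤n+m _ (δ (trg r') (trg r)))

  Added : List Path → List Path → List V → Set
  Added D D' A = All Ok D' × length D' ≡ length D ×
    (∀ u v → mul D' u v ≡ mul D u v + ∑ A (λ s → εn a s u v)) ×
    (∀ v → tok D' v + cnt A v ≡ tok D v + length A * δ a v)

  cnt-replicate : ∀ d (b v : Fin N) → cnt (replicate d b) v ≡ d * δ b v
  cnt-replicate zero b v = refl
  cnt-replicate (suc d) b v = cong (δ b v +_) (cnt-replicate d b v)

  -- One chain is started for every token of `b`. Targets other than `b` are distinct neighbours of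
  -- `a`; as there are more chains than obstacles in `zs`, some chain stops at `b` or outside `zs`,
  -- and counting then finds a token on a path avoiding `a`.
  addOne : ∀ D → All Ok D → ∀ b zs → a ≢ b →
    (∀ v → mul D a v ≤ 1) → mul D a a ≡ 0 → mul D a b ≡ 0 →
    (∀ v → 1 ≤ mul D a v → 1 ≤ tok D v ⊎ v ∈ zs) → length zs < tok D b →
    ∃ λ D' → Added D D' (b ∷ [])
  addOne D ok b zs a≢b m1 maa mab pos lt with fromD D ok
  ... | hs , ts , re , eM , eT with walks hs (replicate (tok D b) b)
  ... | rs , R , es , p , z = finish (search rs)
    where
    d = tok D b
    bal : ∀ v → ∑ (bodies rs) (λ h → la (a ∷ h) v) + targets rs v ≡ ∑ (bodies rs) (λ h → hd h v) + d * δ b v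
    bal v = trans (bodiesH rs v) (cong (∑ (bodies rs) (λ h → hd h v) +_)
              (trans (∑-map-src rs v) (trans (cong (λ l → cnt l v) es) (cnt-replicate d b v))))
    heads : ∀ v → ∑ (bodies rs) (λ h → hd h v) ≤ mul D a v
    heads v = subst (∑ (bodies rs) (λ h → hd h v) ≤_) (sym (eM a v)) (heads≤ {ts = ts} {rs} p v)
    -- Away from `b` no chain starts, so used ends and targets at `v` together number at most the
    -- multiplicity of the edge `av`, that is, at most one.
    balo : ∀ v → v ≢ b → ∑ (bodies rs) (λ h → la (a ∷ h) v) + targets rs v ≤ mul D a v
    balo v n = subst (_≤ mul D a v) (sym (trans (bal v) (trans (cong (λ k → _ + d * k) (δ-≢ (n ∘ sym))) (trans (+congʳ (*-zeroʳ d)) (+-identityʳ _))))) (heads v)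
    good : Rec → Set
    good r = trg r ≡ b ⊎ (trg r ≢ b × ¬ (trg r ∈ zs))
    search : ∀ rs → (∃ λ r → r ∈ rs × good r) ⊎ (∀ {r} → r ∈ rs → ¬ good r)
    search [] = inj₂ λ ()
    search (r ∷ rs) with trg r ≟ b | mem? (trg r) zs | search rs
    ... | yes e | _ | _ = inj₁ (r , here refl , inj₁ e)
    ... | no n' | no n | _ = inj₁ (r , here refl , inj₂ (n' , n))
    ... | no _ | yes _ | inj₁ (r' , m , g) = inj₁ (r' , there m , g)
    ... | no n | yes i | inj₂ k = inj₂ λ { (here refl) (inj₁ e) → n e ; (here refl) (inj₂ (_ , g)) → g i ; (there m) g → k m g }
    trg≢a : ∀ {r} → r ∈ rs → trg r ≢ a
    trg≢a {r} m e = contradiction (subst (λ z → 1 ≤ targets rs z) e (∈-targets m))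
      (<⇒≱ (s≤s (≤-trans (m≤n+m _ _) (≤-trans (balo a a≢b) (≤-reflexive maa)))))
    success : ∀ {r} → r ∈ rs → 1 ≤ ∑ ts (λ t → tokp t (trg r)) → ∃ λ D' → Added D D' (b ∷ [])
    success {r} m h with ∑-pick ts _ h | ∈⇒↭ m
    ... | t , ts' , q , e | rs' , k
      with applyRec r re (↭-trans p (↭-trans (++⁺ʳ R (bodies-↭ k)) (↭-reflexive (++-assoc (body r) (bodies rs') R)))) q e
    ... | t' , re' , nM , nT with toD re'
    ... | D' , ok' , len , eM' , eT' = D' , ok' , len ,
          (λ u v → trans (eM' u v) (trans (nM u v) (cong₂ _+_ (sym (eM u v)) (trans (cong (λ s → εn a s u v) srcb) (sym (+-identityʳ _)))))) ,
          (λ v → trans (cong (tok D' v +_) (trans (+-identityʳ _) (cong (λ s → δ s v) (sym srcb))))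
             (trans (+congˡ (eT' v)) (trans (nT v) (cong₂ _+_ (sym (eT v)) (sym (+-identityʳ _))))))
      where
      inrep : ∀ {x} n → x ∈ replicate n b → x ≡ b
      inrep (suc n) (here e) = e
      inrep (suc n) (there m) = inrep n m
      insrc : ∀ {r rs} → r ∈ rs → src r ∈ map src rs
      insrc (here refl) = here refl
      insrc (there m) = there (insrc m)
      srcb : src r ≡ b
      srcb = inrep d (subst (src r ∈_) es (insrc m))
    finish : (∃ λ r → r ∈ rs × good r) ⊎ (∀ {r} → r ∈ rs → ¬ good r) → ∃ λ D' → Added D D' (b ∷ [])
    -- No half starts at `b`, since `ab` is not yet an edge. So the used ends and the targets at `b`
    -- number exactly `d`, as do the used ends and the tokens at `b` on paths avoiding `a`; a target
    -- at `b` thus yields such a token.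
    finish (inj₁ (r , m , inj₁ refl)) = success m (+-cancelˡ-≤ X 1 _ (begin
        X + 1 ≤⟨ +-monoʳ-≤ X (∈-targets m) ⟩
        X + targets rs b ≡⟨ trans (bal b) (cong₂ _+_ (n≤0⇒n≡0 (≤-trans (heads b) (≤-reflexive mab))) (trans (cong (d *_) (δ-refl b)) (*-identityʳ d))) ⟩
        d ≡⟨ eT b ⟩
        CT hs ts b ≡⟨ sym (token-in-ts {ts = ts} {rs} p (trg≢a m) (All.lookup z m)) ⟩
        X + ∑ ts (λ t → tokp t b) ∎))
      where
      open ≤-Reasoning
      X = ∑ (bodies rs) (λ h → la (a ∷ h) b)
    -- The target exhausts the bound at `w`, so no used half ends there, and a token at `w` must be
    -- on a path avoiding `a`.
    finish (inj₁ (r , m , inj₂ (n' , n))) = success m (subst (1 ≤_) tk pos1)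
      where
      w = trg r
      X = ∑ (bodies rs) (λ h → la (a ∷ h) w)
      le : X + targets rs w ≤ mul D a w
      le = balo w n'
      X0 : X ≡ 0
      X0 = n≤0⇒n≡0 (+-cancelʳ-≤ 1 X 0 (≤-trans (+-monoʳ-≤ X (∈-targets m)) (≤-trans le (m1 w))))
      pos1 : 1 ≤ tok D w
      pos1 with pos w (≤-trans (∈-targets m) (≤-trans (m≤n+m _ X) le))
      ... | inj₁ h = h
      ... | inj₂ h = contradiction h n
      tk : tok D w ≡ ∑ ts (λ t → tokp t w)
      tk = trans (eT w) (trans (sym (token-in-ts {ts = ts} {rs} p (trg≢a m) (All.lookup z m))) (+congˡ X0))
    finish (inj₂ none) = contradiction (pigeonhole (map trg rs) zs uq sub) (<⇒≱ (subst (length zs <_) (sym lens) lt))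
      where
      lens : length (map trg rs) ≡ d
      lens = trans (length-map trg rs) (trans (sym (length-map src rs)) (trans (cong length es) (length-replicate d)))
      trg∈ : ∀ {v} rs → v ∈ map trg rs → ∃ λ r → r ∈ rs × trg r ≡ v
      trg∈ (r ∷ rs) (here refl) = r , here refl , refl
      trg∈ (r ∷ rs) (there m) with trg∈ rs m
      ... | r' , k , e = r' , there k , e
      sub : ∀ {v} → v ∈ map trg rs → v ∈ zs
      sub {v} m with trg∈ rs m
      ... | r , k , refl with mem? (trg r) zs | trg r ≟ b
      ... | yes i | _ = i
      ... | no n | yes e = contradiction (inj₁ e) (none k)
      ... | no n | no n' = contradiction (inj₂ (n' , n)) (none k)
      uq : Uq (map trg rs)
      uq v with v ≟ b
      ... | no n = subst (_≤ 1) (∑-map-trg rs v) (≤-trans (m≤n+m _ (∑ (bodies rs) (λ h → la (a ∷ h) v))) (≤-trans (balo v n) (m1 v)))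
      ... | yes refl with cnt (map trg rs) b in e
      ... | zero = z≤n
      ... | suc k with trg∈ rs (∈-cnt (map trg rs) (subst (1 ≤_) (sym e) (s≤s z≤n)))
      ... | r , k' , e' = contradiction (inj₁ e') (none k')

  -- At most two chains have their targets at the ends of the same path t; of such a pair only
  -- one can be applied, and we may choose which.
  data Match : List Rec → List Path → Set where
    nil : ∀ {ts} → Match [] ts
    single : ∀ {rs r rs' ts t ts'} → rs ↭ r ∷ rs' → ts ↭ t ∷ ts' → 1 ≤ tokp t (trg r) → Match rs' ts' → Match rs ts
    pair : ∀ {rs r r' rs' ts t ts'} → rs ↭ r ∷ r' ∷ rs' → ts ↭ t ∷ ts' →
      1 ≤ tokp t (trg r) → 1 ≤ tokp t (trg r') → Match rs' ts' → Match rs ts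

  -- A path has only two ends and the targets are distinct, so the path `t` of a pair carries no
  -- third target: the remaining chains find their tokens on the remaining paths.
  match : ∀ n rs ts → length rs ≤ n → (∀ v → targets rs v ≤ 1) →
    (∀ {r} → r ∈ rs → 1 ≤ ∑ ts (λ t → tokp t (trg r))) → Match rs ts
  match n [] ts b u h = nil
  match (suc n) (r ∷ rs) ts (s≤s b) u h with ∑-pick ts _ (h (here refl))
  ... | t , ts' , q , e with ∑-pick? rs (λ r' → tokp t (trg r'))
  ... | inj₂ z = single ↭-refl q e (match n rs ts' b (λ v → ≤-trans (m≤n+m _ (δ (trg r) v)) (u v))
        λ {r'} m → subst (1 ≤_) (trans (∑-↭ _ q) (+congˡ (∑-≡0 {f = λ r' → tokp t (trg r')} z m))) (h (there m)))
  ... | inj₁ (r' , rs' , k , e') = pair (prep r k) q e e' (match n rs' ts' (≤-trans (n≤1+n _) (subst (_≤ n) (↭-length k) b))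
        (λ v → ≤-trans (m≤n+m _ (δ (trg r) v + δ (trg r') v)) (subst (_≤ 1) (trans (cong (δ (trg r) v +_) (∑-↭ (λ r → δ (trg r) v) k)) (sym (+-assoc (δ (trg r) v) _ _))) (u v)))
        tk)
    where
    dist : ∀ {x y zs} → (∀ v → δ (trg x) v + ∑ zs (λ r → δ (trg r) v) ≤ 1) → y ∈ zs → trg x ≢ trg y
    dist {x} {y} {zs} u m e = contradiction (u (trg x))
      (<⇒≱ (subst (λ d → 1 < d + targets zs (trg x)) (sym (δ-refl (trg x))) (s≤s (subst (λ z → 1 ≤ targets zs z) (sym e) (∈-targets m)))))
    u' : ∀ v → δ (trg r') v + ∑ rs' (λ r → δ (trg r) v) ≤ 1
    u' v = ≤-trans (m≤n+m _ (δ (trg r) v)) (subst (_≤ 1) (cong (δ (trg r) v +_) (∑-↭ (λ r → δ (trg r) v) k)) (u v))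
    tk : ∀ {x} → x ∈ rs' → 1 ≤ ∑ ts' (λ t → tokp t (trg x))
    tk {x} m with tokp t (trg x) in ez
    ... | zero = subst (1 ≤_) (trans (∑-↭ _ q) (+congˡ ez)) (h (there (∈-resp-↭ (↭-sym k) (there m))))
    ... | suc _ with two-ends t e e' (subst (1 ≤_) (sym ez) (s≤s z≤n))
    ... | inj₁ c = contradiction c (dist {r} {r'} {rs} u (∈-resp-↭ (↭-sym k) (here refl)))
    ... | inj₂ (inj₁ c) = contradiction c (dist {r'} {x} {rs'} u' m)
    ... | inj₂ (inj₂ c) = contradiction c (dist {r} {x} {rs} u (∈-resp-↭ (↭-sym k) (there m)))

  pairsOf : ∀ {rs ts} → Match rs ts → List (Fin N × Fin N)
  pairsOf nil = []
  pairsOf (single _ _ _ M) = pairsOf M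
  pairsOf (pair {r = r} {r'} _ _ _ _ M) = (src r , src r') ∷ pairsOf M

  singlesOf : ∀ {rs ts} → Match rs ts → List (Fin N)
  singlesOf nil = []
  singlesOf (single {r = r} _ _ _ M) = src r ∷ singlesOf M
  singlesOf (pair _ _ _ _ M) = singlesOf M

  match-↭ : ∀ {rs ts} (M : Match rs ts) → map src rs ↭ flat (pairsOf M) ++ singlesOf M
  match-↭ nil = ↭-refl
  match-↭ (single {r = r} p _ _ M) = ↭-trans (map⁺ src p) (↭-trans (prep (src r) (match-↭ M)) (↭-sym (shift (src r) (flat (pairsOf M)) (singlesOf M))))
  match-↭ (pair {r = r} {r'} p _ _ _ M) = ↭-trans (map⁺ src p) (prep _ (prep _ (match-↭ M)))

  chosen : (V × V → Bool) → ∀ {rs ts} → Match rs ts → List (Fin N)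
  chosen f M = singlesOf M ++ map (pick f) (pairsOf M)

  private
    combine : ∀ Z s A Y X d k → Y + s ≡ X + d → Z + A ≡ Y + k → Z + (s + A) ≡ X + (d + k)
    combine Z s A Y X d k e1 e2 = trans (+-rot Z s A) (trans (cong (s +_) e2) (trans (rot' s Y k) (trans (cong (_+ k) e1) (+-assoc X d k))))
      where
      rot' : ∀ s Y k → s + (Y + k) ≡ (Y + s) + k
      rot' = solve-∀

  applyMatch : ∀ f {rs ts hs R L} → Real hs ts L → hs ↭ bodies rs ++ R → (M : Match rs ts) →
    ∃ λ hs' → ∃ λ ts' → Real hs' ts' L ×
    (∀ u v → CM hs' ts' u v ≡ CM hs ts u v + ∑ (chosen f M) (λ s → εn a s u v)) ×
    (∀ v → CT hs' ts' v + cnt (chosen f M) v ≡ CT hs ts v + length (chosen f M) * δ a v)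
  applyMatch f {ts = ts} {hs} re p nil = hs , ts , re , (λ u v → sym (+-identityʳ _)) , λ v → refl
  applyMatch f {rs} {ts} {hs} {R} re p (single {r = r} {rs'} k q e M)
    with applyRec {R = bodies rs' ++ R} r re (↭-trans p (↭-trans (++⁺ʳ R (bodies-↭ k)) (↭-reflexive (++-assoc (body r) (bodies rs') R)))) q e
  ... | t' , re' , nM , nT with applyMatch f {R = t' ∷ [] ∷ map reverse (body r) ++ R} re' (shifts (t' ∷ [] ∷ map reverse (body r)) (bodies rs')) M
  ... | hs' , ts' , re'' , nM' , nT' = hs' , ts' , re'' ,
        (λ u v → trans (nM' u v) (trans (cong (_+ ∑ (chosen f M) (λ s → εn a s u v)) (nM u v)) (+-assoc (CM hs ts u v) _ _))) ,
        (λ v → combine (CT hs' ts' v) (δ (src r) v) (cnt (chosen f M) v) _ (CT hs ts v) (δ a v) (length (chosen f M) * δ a v) (nT v) (nT' v))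
  applyMatch f {rs} {ts} {hs} {R} re p (pair {r = r} {r'} {rs'} {t = t} k q e e' M) = go (f (src r , src r')) refl
    where
    A = chosen f M
    all-↭ : ∀ s → singlesOf M ++ s ∷ map (pick f) (pairsOf M) ↭ s ∷ A
    all-↭ s = shift s (singlesOf M) _
    use : ∀ r r' → rs ↭ r ∷ r' ∷ rs' → 1 ≤ tokp t (trg r) → ∃ λ hs' → ∃ λ ts' → Real hs' ts' _ ×
      (∀ u v → CM hs' ts' u v ≡ CM hs ts u v + ∑ (singlesOf M ++ src r ∷ map (pick f) (pairsOf M)) (λ s → εn a s u v)) ×
      (∀ v → CT hs' ts' v + cnt (singlesOf M ++ src r ∷ map (pick f) (pairsOf M)) v ≡ CT hs ts v + length (singlesOf M ++ src r ∷ map (pick f) (pairsOf M)) * δ a v)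
    use r r' k e with applyRec {R = body r' ++ bodies rs' ++ R} r re
      (↭-trans p (↭-trans (++⁺ʳ R (bodies-↭ k)) (↭-trans (↭-reflexive (++-assoc (body r) (body r' ++ bodies rs') R))
        (++⁺ˡ (body r) (↭-reflexive (++-assoc (body r') (bodies rs') R)))))) q e
    ... | t' , re' , nM , nT
      with applyMatch f {R = (t' ∷ [] ∷ map reverse (body r)) ++ (body r' ++ R)} re'
        (↭-trans (++⁺ˡ (t' ∷ [] ∷ map reverse (body r)) (shifts (body r') (bodies rs')))
                 (shifts (t' ∷ [] ∷ map reverse (body r)) (bodies rs'))) M
    ... | hs' , ts' , re'' , nM' , nT' = hs' , ts' , re'' ,
        (λ u v → trans (nM' u v) (trans (cong (_+ ∑ A (λ s → εn a s u v)) (nM u v)) (trans (+-assoc (CM hs ts u v) _ _)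
           (cong (CM hs ts u v +_) (sym (∑-↭ (λ s → εn a s u v) (all-↭ (src r)))))))) ,
        (λ v → trans (cong (CT hs' ts' v +_) (∑-↭ (λ s → δ s v) (all-↭ (src r))))
           (trans (combine (CT hs' ts' v) (δ (src r) v) (cnt A v) _ (CT hs ts v) (δ a v) (length A * δ a v) (nT v) (nT' v))
             (cong (λ l → CT hs ts v + l * δ a v) (sym (↭-length (all-↭ (src r)))))))
    go : ∀ b → f (src r , src r') ≡ b → ∃ λ hs' → ∃ λ ts' → Real hs' ts' _ ×
      (∀ u v → CM hs' ts' u v ≡ CM hs ts u v + ∑ (chosen f (pair {r = r} {r'} k q e e' M)) (λ s → εn a s u v)) ×
      (∀ v → CT hs' ts' v + cnt (chosen f (pair {r = r} {r'} k q e e' M)) v ≡ CT hs ts v + length (chosen f (pair {r = r} {r'} k q e e' M)) * δ a v)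
    go true eq rewrite eq = use r r' k e
    go false eq rewrite eq = use r' r (↭-trans k (pswap r r' ↭-refl)) e'

  -- Every old or future neighbour of `a` has a token here, so every chain ends at a token on a path
  -- avoiding `a`. The only conflict is between two targets at the ends of one path, since joining
  -- both to `a` would close a cycle. The choice `f` comes last, so that it may depend on the pairs.
  addMany : ∀ D → All Ok D → ∀ ss → (∀ v → mul D a v + cnt ss v ≤ 1) → mul D a a + cnt ss a ≡ 0 →
    (∀ v → 1 ≤ mul D a v + cnt ss v → 1 ≤ tok D v) →
    ∃ λ pairs → ∃ λ singles → ss ↭ flat pairs ++ singles ×
    (∀ f → ∃ λ D' → Added D D' (singles ++ map (pick f) pairs))
  addMany D ok ss m1 ma pos with fromD D ok
  ... | hs , ts , re , eM , eT with walks hs ss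
  ... | rs , R , es , p , z = pairsOf M , singlesOf M , subst (_↭ flat (pairsOf M) ++ singlesOf M) es (match-↭ M) , result
    where
    bal : ∀ v → ∑ (bodies rs) (λ h → la (a ∷ h) v) + targets rs v ≤ mul D a v + cnt ss v
    bal v = subst (_≤ mul D a v + cnt ss v) (sym (trans (bodiesH rs v) (cong (∑ (bodies rs) (λ h → hd h v) +_)
              (trans (∑-map-src rs v) (cong (λ l → cnt l v) es)))))
              (+-monoˡ-≤ (cnt ss v) (≤-trans (heads≤ {ts = ts} {rs} p v) (≤-reflexive (sym (eM a v)))))
    trg≢a : ∀ {r} → r ∈ rs → trg r ≢ a
    trg≢a {r} m e = contradiction (subst (λ z → 1 ≤ targets rs z) e (∈-targets m))
      (<⇒≱ (s≤s (≤-trans (m≤n+m _ _) (≤-trans (bal a) (≤-reflexive ma)))))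
    tk : ∀ {r} → r ∈ rs → 1 ≤ ∑ ts (λ t → tokp t (trg r))
    tk {r} m = subst (1 ≤_) (trans (eT w) (trans (sym (token-in-ts {ts = ts} {rs} p (trg≢a m) (All.lookup z m))) (+congˡ X0)))
        (pos w (≤-trans (∈-targets m) (≤-trans (m≤n+m _ X) (bal w))))
      where
      w = trg r
      X = ∑ (bodies rs) (λ h → la (a ∷ h) w)
      X0 : X ≡ 0
      X0 = n≤0⇒n≡0 (+-cancelʳ-≤ 1 X 0 (≤-trans (+-monoʳ-≤ X (∈-targets m)) (≤-trans (bal w) (m1 w))))
    M : Match rs ts
    M = match (length rs) rs ts ≤-refl (λ v → ≤-trans (m≤n+m _ _) (≤-trans (bal v) (m1 v))) tk
    result : ∀ f → ∃ λ D' → Added D D' (chosen f M)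
    result f with applyMatch f re p M
    ... | hs' , ts' , re' , nM , nT with toD re'
    ... | D' , ok' , len , eM' , eT' = D' , ok' , len ,
          (λ u v → trans (eM' u v) (trans (nM u v) (+congˡ (sym (eM u v))))) ,
          (λ v → trans (+congˡ (eT' v)) (trans (nT v) (+congˡ (sym (eT v)))))

-- Decompositions

∑-swap : ∀ {A B : Set} (xs : List A) (ys : List B) (f : A → B → ℕ) →
  ∑ xs (λ x → ∑ ys (f x)) ≡ ∑ ys (λ y → ∑ xs (λ x → f x y))
∑-swap [] ys f = sym (∑-zero ys λ _ → refl)
∑-swap (x ∷ xs) ys f = trans (+congʳ (∑-swap xs ys f)) (sym (∑-+ ys (f x) _))

b2n-inj : ∀ {b c} → b2n b ≡ b2n c → b ≡ c
b2n-inj {true} {true} _ = refl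
b2n-inj {false} {false} _ = refl

module _ {N : ℕ} where

  _≐_ : Adj {N} → Adj → Set
  E ≐ E' = ∀ u v → E u v ≡ E' u v

  mulp-sym : ∀ (p : Path {N}) u v → mulp p u v ≡ mulp p v u
  mulp-sym [] u v = refl
  mulp-sym (x ∷ []) u v = refl
  mulp-sym (x ∷ y ∷ r) u v = cong₂ _+_ (cong b2n (ε-sym x y u v)) (mulp-sym (y ∷ r) u v)

  Uq-tail : ∀ {x : Fin N} {p} → Uq (x ∷ p) → Uq p
  Uq-tail {x} u v = ≤-trans (m≤n+m _ (δ x v)) (u v)

  Uq-≢ : ∀ {x y : Fin N} {p} → Uq (x ∷ y ∷ p) → x ≢ y
  Uq-≢ {x} {p = p} u refl = contradiction (u x) (<⇒≱ (subst (λ d → 1 < d + (d + cnt p x)) (sym (δ-refl x)) (s≤s (s≤s z≤n))))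

  mulp-irrefl : ∀ (p : Path {N}) → Uq p → ∀ v → mulp p v v ≡ 0
  mulp-irrefl [] u v = refl
  mulp-irrefl (x ∷ []) u v = refl
  mulp-irrefl (x ∷ y ∷ r) u v = cong₂ _+_
    (cong b2n (ε-false x y v v λ { (inj₁ (p , q)) → Uq-≢ {p = r} u (trans p (sym q)) ; (inj₂ (p , q)) → Uq-≢ {p = r} u (trans p (sym q)) }))
    (mulp-irrefl (y ∷ r) (Uq-tail {x} {y ∷ r} u) v)

  mulp-cnt : ∀ (p : Path {N}) u v → 1 ≤ mulp p u v → 1 ≤ cnt p v
  mulp-cnt (x ∷ r) u v = go x r
    where
    go : ∀ x r → 1 ≤ mulp (x ∷ r) u v → 1 ≤ cnt (x ∷ r) v
    go x (y ∷ r) h with ε x y u v in e | go y r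
    ... | false | rec = ≤-trans (rec h) (m≤n+m _ (δ x v))
    ... | true | _ with ε-sound x y u v e
    ... | inj₁ (_ , refl) = cnt-∈ {p = x ∷ y ∷ r} (there (here refl))
    ... | inj₂ (refl , _) = cnt-∈ {p = x ∷ y ∷ r} (here refl)

  parity-path : ∀ (p : Path {N}) → Uq p → 1 ≤ length p → ∀ v → odd (∑ (allFin N) (mulp p v)) ≡ odd (tokp p v)
  parity-path (x ∷ []) u _ v = trans (cong odd (∑-zero (allFin N) λ _ → refl)) (sym (odd-double (δ x v)))
  parity-path (x ∷ y ∷ r) u _ v =
    trans (cong odd (trans (∑-+ (allFin N) (εn x y v) (mulp (y ∷ r) v)) (+congˡ (∑-εn {a = x} {y} (Uq-≢ {x} {y} {r} u) v))))
    (trans (odd-+ (δ x v + δ y v) (∑ (allFin N) (mulp (y ∷ r) v)))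
    (trans (cong (odd (δ x v + δ y v) xor_) (parity-path (y ∷ r) (Uq-tail {x} {y ∷ r} u) (s≤s z≤n) v))
    (trans (sym (odd-+ (δ x v + δ y v) (tokp (y ∷ r) v)))
    (trans (cong odd (l (δ x v) (δ y v) (la (y ∷ r) v)))
    (trans (odd-+ (δ x v + la (y ∷ r) v) (δ y v + δ y v)) (trans (cong (odd (δ x v + la (y ∷ r) v) xor_) (odd-double (δ y v))) (xor-identityʳ _)))))))
    where
    l : ∀ a b c → (a + b) + (b + c) ≡ (a + c) + (b + b)
    l = solve-∀

  ends-path : ∀ (p : Path {N}) → 1 ≤ length p → ∑ (allFin N) (tokp p) ≡ 2
  ends-path p@(x ∷ r) _ = trans (∑-+ (allFin N) (hd p) (la p)) (cong₂ _+_ (∑-δ x) (sl x r))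
    where
    sl : ∀ x r → ∑ (allFin N) (la (x ∷ r)) ≡ 1
    sl x [] = ∑-δ x
    sl x (y ∷ r) = sl y r

  record Dc (E : Adj {N}) (L : ℕ) : Set where
    constructor dc
    field
      D : List (Path {N})
      ok : All Ok D
      mult : ∀ u v → mul D u v ≡ b2n (E u v)
      len : length D ≡ L
  open Dc public

  tk : ∀ {E L} → Dc E L → Fin N → ℕ
  tk d v = tok (D d) v

  dc-≐ : ∀ {E E' L} → E ≐ E' → Dc E L → Dc E' L
  dc-≐ e (dc D o m l) = dc D o (λ u v → trans (m u v) (cong b2n (e u v))) l

  module _ {E : Adj {N}} {L : ℕ} (d : Dc E L) where

    dc-sym : ∀ u v → E u v ≡ E v u
    dc-sym u v = b2n-inj (trans (sym (mult d u v)) (trans (∑-cong (D d) λ p → mulp-sym p u v) (mult d v u)))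

    dc-irrefl : ∀ v → E v v ≡ false
    dc-irrefl v = b2n-inj (trans (sym (mult d v v)) (zeros (D d) (ok d)))
      where
      zeros : ∀ D → All Ok D → mul D v v ≡ 0
      zeros [] [] = refl
      zeros (p ∷ D) (o ∷ os) = cong₂ _+_ (mulp-irrefl p (proj₁ o) v) (zeros D os)

    parity : ∀ v → odd (tk d v) ≡ par E v
    parity v = trans (sym (go (D d) (ok d))) (trans (cong odd (trans (∑-swap (D d) (allFin N) (λ p → mulp p v)) (∑-cong (allFin N) (mult d v)))) (sym (par-def E v)))
      where
      go : ∀ D → All Ok D → odd (∑ D λ p → ∑ (allFin N) (mulp p v)) ≡ odd (tok D v)
      go [] [] = refl
      go (p ∷ D) (o ∷ os) = trans (odd-+ (∑ (allFin N) (mulp p v)) _)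
        (trans (cong₂ _xor_ (parity-path p (proj₁ o) (proj₂ o) v) (go D os)) (sym (odd-+ (tokp p v) _)))

    odd⇒tk : ∀ {v} → par E v ≡ true → 1 ≤ tk d v
    odd⇒tk {v} e = odd⇒pos (tk d v) (trans (parity v) e)

    sum-tk : ∑ (allFin N) (tk d) ≡ L + L
    sum-tk = trans (sym (∑-swap (D d) (allFin N) tokp)) (trans (go (D d) (ok d)) (cong₂ _+_ (len d) (len d)))
      where
      go : ∀ D → All Ok D → ∑ D (λ p → ∑ (allFin N) (tokp p)) ≡ length D + length D
      go [] [] = refl
      go (p ∷ D) (o ∷ os) = trans (cong₂ _+_ (ends-path p (proj₂ o)) (go D os)) (cong suc (sym (+-suc (length D) (length D))))

  -- Odd neighbours of `a` carry a token by parity, so only even ones have to be examined.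
  add1 : ∀ {E L} (d : Dc E L) {a b} zs → a ≢ b → E a b ≡ false →
    (∀ v → E a v ≡ true → par E v ≡ false → 1 ≤ tk d v ⊎ v ∈ zs) → length zs < tk d b →
    Σ (Dc (tog a b E) L) λ d' → ∀ v → tk d' v + δ b v ≡ tk d v + δ a v
  add1 {E} {L} d {a} {b} zs a≢b e h lt
    with addOne a (D d) (ok d) b zs a≢b (λ v → subst (_≤ 1) (sym (mult d a v)) (b2n≤1 _))
      (trans (mult d a a) (cong b2n (dc-irrefl d a))) (trans (mult d a b) (cong b2n e)) pos lt
    where
    pos : ∀ v → 1 ≤ mul (D d) a v → 1 ≤ tok (D d) v ⊎ v ∈ zs
    pos v k with E a v in ev | par E v in pv | mult d a v
    ... | true | true | _ = inj₁ (odd⇒tk d pv)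
    ... | true | false | _ = h v ev pv
    ... | false | _ | eq = contradiction (subst (1 ≤_) eq k) λ ()
  ... | D' , ok' , len' , m' , t' = dc D' ok' mm (trans len' (len d)) ,
        λ v → trans (+congʳ (sym (+-identityʳ (δ b v)))) (trans (t' v) (+congʳ (+-identityʳ (δ a v))))
    where
    mm : ∀ u v → mul D' u v ≡ b2n (tog a b E u v)
    mm u v = trans (m' u v) (trans (cong₂ _+_ (mult d u v) (+-identityʳ _)) (b2n-tog a b E u v off))
      where
      off : ε a b u v ≡ true → E u v ≡ false
      off q with ε-sound a b u v q
      ... | inj₁ (refl , refl) = e
      ... | inj₂ (refl , refl) = trans (dc-sym d u v) e

  togs : Fin N → List (Fin N) → Adj → Adj
  togs z [] E = E
  togs z (s ∷ A) E = tog z s (togs z A E)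

  togs-cong : ∀ z A {E E'} → E ≐ E' → togs z A E ≐ togs z A E'
  togs-cong z [] e = e
  togs-cong z (s ∷ A) e = tog-cong z s (togs-cong z A e)

  togs-↭ : ∀ z {A B} E → A ↭ B → togs z A E ≐ togs z B E
  togs-↭ z E prefl u v = refl
  togs-↭ z E (prep x p) = tog-cong z x (togs-↭ z E p)
  togs-↭ z E (pswap {xs} {ys} x y p) u v = trans (tog-cong z x (tog-cong z y (togs-↭ z E p)) u v) (tog-comm z x z y (togs z ys E) u v)
  togs-↭ z E (ptrans p q) u v = trans (togs-↭ z E p u v) (togs-↭ z E q u v)

  tog-togs : ∀ z s A E → tog z s (togs z A E) ≐ togs z A (tog z s E)
  tog-togs z s [] E u v = refl
  tog-togs z s (t ∷ A) E u v = trans (tog-comm z s z t (togs z A E) u v) (tog-cong z t (tog-togs z s A E) u v)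

  togs-cancel : ∀ z A B E → togs z A (togs z (A ++ B) E) ≐ togs z B E
  togs-cancel z [] B E u v = refl
  togs-cancel z (s ∷ A) B E u v = trans (tog-togs z s A (tog z s (togs z (A ++ B) E)) u v)
    (trans (togs-cong z A (tog-tog z s (togs z (A ++ B) E)) u v) (togs-cancel z A B E u v))

  togs-sym : ∀ z A {E : Adj {N}} → (∀ u v → E u v ≡ E v u) → ∀ u v → togs z A E u v ≡ togs z A E v u
  togs-sym z [] s = s
  togs-sym z (t ∷ A) s u v = tog-sym z t (togs-sym z A s) u v

  togs-∉ : ∀ (z : Fin N) A (E : Adj {N}) {v} → z ≢ v → cnt A v ≡ 0 → togs z A E z v ≡ E z v
  togs-∉ z [] E n c = refl
  togs-∉ z (s ∷ A) E {v} n c = trans (tog-other z s (togs z A E) (ε-false z s z v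
      λ { (inj₁ (_ , refl)) → contradiction (trans (sym (δ-refl s)) (m+n≡0⇒m≡0 (δ s s) c)) λ () ; (inj₂ (q , _)) → n q }))
    (togs-∉ z A E n (m+n≡0⇒n≡0 (δ s v) c))

  togs-off : ∀ (z : Fin N) A (E : Adj {N}) {u v} → u ≢ z → v ≢ z → togs z A E u v ≡ E u v
  togs-off z [] E n m = refl
  togs-off z (s ∷ A) E n m = trans (tog-other z s (togs z A E) (ε-falseˡ s (n ∘ sym) (m ∘ sym))) (togs-off z A E n m)

  cnt0 : ∀ {x : Fin N} {A} → Uq (x ∷ A) → cnt A x ≡ 0
  cnt0 {x} {A} u = n≤0⇒n≡0 (+-cancelˡ-≤ 1 _ 0 (subst (λ k → k + cnt A x ≤ 1) (δ-refl x) (u x)))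

  togs-∈ : ∀ (z : Fin N) A (E : Adj {N}) {v} → z ≢ v → Uq A → v ∈ A → togs z A E z v ≡ not (E z v)
  togs-∈ z (s ∷ A) E n u (here refl) = trans (tog-self z s (togs z A E)) (cong not (togs-∉ z A E n (cnt0 {A = A} u)))
  togs-∈ z (s ∷ A) E {v} n u (there m) = trans (tog-other z s (togs z A E) (ε-false z s z v
      λ { (inj₁ (_ , refl)) → contradiction (cnt-∈ m) (<⇒≱ (s≤s (≤-reflexive (cnt0 {A = A} u)))) ; (inj₂ (q , _)) → n q }))
    (togs-∈ z A E n (Uq-tail {s} {A} u) m)

  par-togs : ∀ (z : Fin N) A (E : Adj {N}) {v} → All (z ≢_) A → v ≢ z → par (togs z A E) v ≡ par E v xor odd (cnt A v)
  par-togs z [] E _ n = sym (xor-identityʳ _)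
  par-togs z (s ∷ A) E {v} (k ∷ ks) n = trans (par-tog (togs z A E) k v)
    (trans (cong₂ _xor_ (par-togs z A E ks n) (trans (cong (_xor ⌊ s ≟ v ⌋) (eq-≢ (n ∘ sym))) (sym (odd-b2n ⌊ s ≟ v ⌋))))
    (trans (xor-assoc (par E v) _ _) (cong (par E v xor_) (trans (xor-comm (odd (cnt A v)) _) (sym (odd-+ (δ s v) _))))))

  par-togs-z : ∀ (z : Fin N) A (E : Adj {N}) → All (z ≢_) A → par (togs z A E) z ≡ par E z xor odd (length A)
  par-togs-z z [] E _ = sym (xor-identityʳ _)
  par-togs-z z (s ∷ A) E (k ∷ ks) = trans (par-togˡ (togs z A E) k)
    (trans (cong not (par-togs-z z A E ks)) (l (par E z) (odd (length A))))
    where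
    l : ∀ a b → not (a xor b) ≡ a xor not b
    l true b = refl
    l false b = refl

  flat-↭ : ∀ f (ps : List (Fin N × Fin N)) → flat ps ↭ map (pick f) ps ++ map (rest f) ps
  flat-↭ f [] = ↭-refl
  flat-↭ f ((x , y) ∷ ps) with f (x , y)
  ... | true = prep x (↭-trans (prep y (flat-↭ f ps)) (↭-sym (shift y (map (pick f) ps) _)))
  ... | false = ↭-trans (pswap x y (flat-↭ f ps)) (prep y (↭-sym (shift x (map (pick f) ps) _)))

  addM : ∀ {E L} (d : Dc E L) z ss → Uq ss → (∀ {s} → s ∈ ss → z ≢ s × E z s ≡ false × 1 ≤ tk d s) →
    (∀ v → E z v ≡ true → par E v ≡ false → 1 ≤ tk d v) →
    ∃ λ pairs → ∃ λ singles → ss ↭ flat pairs ++ singles × ∀ f → let A = singles ++ map (pick f) pairs in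
    ss ↭ A ++ map (rest f) pairs ×
    Σ (Dc (togs z A E) L) λ d' → ∀ v → tk d' v + cnt A v ≡ tk d v + length A * δ z v
  addM {E} {L} d z ss uq hs h with addMany z (D d) (ok d) ss m1 ma pos
    where
    excl : ∀ v → 1 ≤ cnt ss v → E z v ≡ false
    excl v c = proj₁ (proj₂ (hs (∈-cnt ss c)))
    m1 : ∀ v → mul (D d) z v + cnt ss v ≤ 1
    m1 v rewrite mult d z v with E z v in e | cnt ss v in c
    ... | false | k = subst (_≤ 1) c (uq v)
    ... | true | zero = ≤-refl
    ... | true | suc k = contradiction (trans (sym e) (excl v (subst (1 ≤_) (sym c) (s≤s z≤n)))) λ ()
    ma : mul (D d) z z + cnt ss z ≡ 0
    ma rewrite mult d z z | dc-irrefl d z with cnt ss z in c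
    ... | zero = refl
    ... | suc k = contradiction refl (proj₁ (hs (∈-cnt ss (subst (1 ≤_) (sym c) (s≤s z≤n)))))
    pos : ∀ v → 1 ≤ mul (D d) z v + cnt ss v → 1 ≤ tok (D d) v
    pos v k rewrite mult d z v with E z v in e | par E v in p
    ... | false | _ = proj₂ (proj₂ (hs (∈-cnt ss k)))
    ... | true | true = odd⇒tk d p
    ... | true | false = h v e p
  ... | pairs , singles , q , use = pairs , singles , q , λ f → perm f , fin f
    where
    module _ (f : Fin N × Fin N → Bool) where
      A = singles ++ map (pick f) pairs
      perm : ss ↭ A ++ map (rest f) pairs
      perm = ↭-trans q (↭-trans (++⁺ʳ singles (flat-↭ f pairs)) (↭-trans (++-comm (map (pick f) pairs ++ map (rest f) pairs) singles)
        (↭-reflexive (sym (++-assoc singles (map (pick f) pairs) (map (rest f) pairs))))))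
      uqA : Uq A
      uqA v = ≤-trans (m≤m+n _ _) (subst (_≤ 1) (trans (cnt-↭ perm v) (∑-++ A (map (rest f) pairs) _)) (uq v))
      sumA : ∀ B → Uq B → (∀ {s} → s ∈ B → s ∈ ss) → ∀ u v → b2n (E u v) + ∑ B (λ s → εn z s u v) ≡ b2n (togs z B E u v)
      sumA [] _ _ u v = +-identityʳ _
      sumA (s ∷ B) ub sub u v = trans (l (b2n (E u v)) _ _) (trans (+congˡ (sumA B (Uq-tail {s} {B} ub) (sub ∘ there) u v)) (b2n-tog z s (togs z B E) u v off))
        where
        l : ∀ a b c → a + (b + c) ≡ (a + c) + b
        l = solve-∀
        zs : togs z B E z s ≡ false
        zs = trans (togs-∉ z B E (proj₁ (hs (sub (here refl)))) (cnt0 {A = B} ub)) (proj₁ (proj₂ (hs (sub (here refl)))))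
        off : ε z s u v ≡ true → togs z B E u v ≡ false
        off e with ε-sound z s u v e
        ... | inj₁ (refl , refl) = zs
        ... | inj₂ (refl , refl) = trans (togs-sym z B (dc-sym d) u v) zs
      subA : ∀ {s} → s ∈ A → s ∈ ss
      subA m = ∈-cnt ss (subst (1 ≤_) (sym (trans (cnt-↭ perm _) (∑-++ A (map (rest f) pairs) _))) (≤-trans (cnt-∈ m) (m≤m+n _ _)))
      fin : Σ (Dc (togs z A E) L) λ d' → ∀ v → tk d' v + cnt A v ≡ tk d v + length A * δ z v
      fin with use f
      ... | D' , ok' , len' , m' , t' = dc D' ok' (λ u v → trans (m' u v) (trans (+congˡ (mult d u v)) (sumA A uqA subA u v))) (trans len' (len d)) , t'

  edge? : ∀ (E : Adj {N}) → Dec (∃ λ u → ∃ λ v → E u v ≡ true)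
  edge? E = any? λ u → any? λ v → E u v ≟ᵇ true

  -- Every edge is a path of its own, so tokens are degrees. This settles matchings and also
  -- provides the handshake lemma.
  edges-Dc : ∀ n (G : Graph N) → size (adj G) ≤ n → ∃ λ L → Σ (Dc (adj G) L) λ d → ∀ v → tk d v ≡ deg (adj G) v
  edges-Dc n G b with edge? (adj G)
  edges-Dc n G b | no ne = 0 , dc [] [] (λ u v → sym (cong b2n (none u v))) refl , λ v → sym (∑-zero (allFin N) λ u → cong b2n (none v u))
    where
    none : ∀ u v → adj G u v ≡ false
    none u v = ¬-not λ e → ne (u , v , e)
  edges-Dc zero G b | yes (x , y , e) = contradiction (subst (_≤ 0) (size-tog G e) b) (<⇒≱ (≤-trans (s≤s z≤n) (m≤n+m 2 _)))
  edges-Dc (suc n) G b | yes (x , y , e) with edges-Dc n (togG x y (adj⇒≢ G e) G) (≤-trans (n≤1+n _) (ℕ.s≤s⁻¹ (subst (_≤ suc n) (trans (size-tog G e) (+-comm _ 2)) b)))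
  ... | L , d , t = suc L , dc ((x ∷ y ∷ []) ∷ D d) ((uq , s≤s z≤n) ∷ ok d) mm (cong suc (len d)) , tt'
    where
    x≢y = adj⇒≢ G e
    uq : Uq (x ∷ y ∷ [])
    uq v with x ≟ v | y ≟ v
    ... | yes refl | yes q = contradiction (sym q) x≢y
    ... | yes _ | no _ = ≤-refl
    ... | no _ | yes _ = ≤-refl
    ... | no _ | no _ = z≤n
    mm : ∀ u v → mul ((x ∷ y ∷ []) ∷ D d) u v ≡ b2n (adj G u v)
    mm u v = trans (cong₂ _+_ (+-identityʳ (εn x y u v)) (mult d u v)) (trans (+-comm (εn x y u v) _)
      (trans (b2n-tog x y (tog x y (adj G)) u v off) (cong b2n (tog-tog x y (adj G) u v))))
      where
      off : ε x y u v ≡ true → tog x y (adj G) u v ≡ false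
      off q with ε-sound x y u v q
      ... | inj₁ (refl , refl) = trans (tog-self x y (adj G)) (cong not e)
      ... | inj₂ (refl , refl) = trans (tog-sym x y (Graph.sym G) u v) (trans (tog-self x y (adj G)) (cong not e))
    tt' : ∀ v → tk (dc ((x ∷ y ∷ []) ∷ D d) ((uq , s≤s z≤n) ∷ ok d) mm (cong suc (len d))) v ≡ deg (adj G) v
    tt' v = trans (+congʳ (t v)) (trans (+-comm (δ x v + δ y v) _) (sym (deg-tog G e v)))

  odd-∑-all : ∀ (xs : List (Fin N)) f → (∀ v → odd (f v) ≡ true) → odd (∑ xs f) ≡ odd (length xs)
  odd-∑-all [] f h = refl
  odd-∑-all (x ∷ xs) f h = trans (odd-+ (f x) _) (cong₂ _xor_ (h x) (odd-∑-all xs f h))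

  -- Otherwise an odd number of odd token counts would add up to the even number `L + L`.
  exists-even : odd N ≡ true → (G : Graph N) → ∃ λ v → par (adj G) v ≡ false
  exists-even oN G with any? (λ v → par (adj G) v ≟ᵇ false)
  ... | yes r = r
  ... | no n with edges-Dc (size (adj G)) G ≤-refl
  ... | L , d , t = contradiction
    (trans (sym oN) (trans (cong odd (sym (length-tabulate {n = N} id))) (trans (sym (odd-∑-all (allFin N) (tk d) λ v → trans (parity d v) (all v)))
      (trans (cong odd (sum-tk d)) (odd-double L))))) λ ()
    where
    all : ∀ v → par (adj G) v ≡ true
    all v with par (adj G) v in e
    ... | true = refl
    ... | false = contradiction (v , e) n

  -- The path containing the pendant edge has to end at `s`; cut off there, it ends at `v`. This
  -- gives `v` a token whatever its parity.
  pendant : ∀ (G : Graph N) {v s L} → v ≢ s → (∀ x → adj G s x ≡ false) → Dc (tog v s (adj G)) L →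
    Σ (Dc (adj G) L) λ d → 1 ≤ tk d v
  pendant G {v} {s} {L} v≢s iso d = finish (split s p)
    where
    E = adj G
    E' = tog v s E
    vs : E' v s ≡ true
    vs = trans (tog-self v s E) (cong not (trans (Graph.sym G v s) (iso v)))
    P = ∑-pick (D d) (λ p → mulp p v s) (subst (1 ≤_) (sym (trans (mult d v s) (cong b2n vs))) ≤-refl)
    p = proj₁ P
    D' = proj₁ (proj₂ P)
    perm : D d ↭ p ∷ D'
    perm = proj₁ (proj₂ (proj₂ P))
    e : 1 ≤ mulp p v s
    e = proj₂ (proj₂ (proj₂ P))
    oks : All Ok (p ∷ D')
    oks = All-resp-↭ perm (ok d)
    okp : Ok p
    okp = All.head oks
    le : ∀ u w → mulp p u w ≤ b2n (E' u w)
    le u w = subst (mulp p u w ≤_) (trans (sym (∑-↭ (λ p → mulp p u w) perm)) (mult d u w)) (m≤m+n _ _)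
    only : ∀ {x} → 1 ≤ mulp p s x → x ≡ v
    only {x} h with v ≟ x
    ... | yes q = sym q
    ... | no q = contradiction (≤-trans h (subst (λ k → mulp p s x ≤ b2n k) (trans (tog-other v s E (ε-falseˡ s v≢s q)) (iso x)) (le s x))) λ ()
    shorten : ∀ h → Uq (v ∷ h) → (∀ u w → mulp p u w ≡ εn s v u w + mulp (v ∷ h) u w) → Σ (Dc E L) λ d → 1 ≤ tk d v
    shorten h uq em = dc ((v ∷ h) ∷ D') ((uq , s≤s z≤n) ∷ All.tail oks) mm (trans (sym (↭-length perm)) (len d)) ,
        ≤-trans (≤-reflexive (sym (δ-refl v))) (≤-trans (m≤m+n (δ v v) (la (v ∷ h) v)) (m≤m+n _ _))
      where
      tot : ∀ u w → εn v s u w + (mulp (v ∷ h) u w + mul D' u w) ≡ b2n (E' u w)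
      tot u w = trans (+congˡ (cong b2n (ε-swap v s u w))) (trans (sym (+-assoc (εn s v u w) _ _)) (trans (+congˡ (sym (em u w)))
        (trans (sym (∑-↭ (λ p → mulp p u w) perm)) (mult d u w))))
      mm : ∀ u w → mulp (v ∷ h) u w + mul D' u w ≡ b2n (E u w)
      mm u w = +-cancelˡ-≡ (εn v s u w) _ _ (trans (tot u w) (trans (sym (b2n-tog v s E u w off)) (+-comm (b2n (E u w)) _)))
        where
        off : ε v s u w ≡ true → E u w ≡ false
        off q with ε-sound v s u w q
        ... | inj₁ (refl , refl) = trans (Graph.sym G v s) (iso v)
        ... | inj₂ (refl , refl) = iso v
    finish : (cnt p s ≡ 0 ⊎ ∃ λ l → ∃ λ r → p ≡ l ʳ++ (s ∷ r)) → Σ (Dc E L) λ d → 1 ≤ tk d v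
    finish (inj₁ c) = contradiction (mulp-cnt p v s e) (<⇒≱ (s≤s (≤-reflexive c)))
    finish (inj₂ ([] , [] , q)) = contradiction (subst (λ z → 1 ≤ mulp z v s) q e) λ ()
    finish (inj₂ ([] , y ∷ r , q)) = go y r q (only (subst (λ z → 1 ≤ mulp z s y) (sym q) (≤-trans (≤-reflexive (sym (cong b2n (ε-self s y)))) (m≤m+n _ _))))
      where
      go : ∀ y r → p ≡ s ∷ y ∷ r → y ≡ v → Σ (Dc E L) λ d → 1 ≤ tk d v
      go y r q refl = shorten r (Uq-tail {s} {y ∷ r} (subst Uq q (proj₁ okp))) λ u w → cong (λ z → mulp z u w) q
    finish (inj₂ (x ∷ l , [] , q)) = go x l q (only (subst (1 ≤_) (sym (mp s x)) (≤-trans (≤-reflexive (sym (cong b2n (ε-self s x)))) (m≤m+n _ _))))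
      where
      mp : ∀ u w → mulp p u w ≡ mulp (s ∷ x ∷ l) u w
      mp u w = trans (cong (λ z → mulp z u w) q) (trans (mulp-ʳ++ (x ∷ l) s [] u w) (+-identityʳ _))
      go : ∀ x l → p ≡ (x ∷ l) ʳ++ (s ∷ []) → x ≡ v → Σ (Dc E L) λ d → 1 ≤ tk d v
      go x l q refl = shorten l
        (λ w → ≤-trans (m≤m+n (cnt (x ∷ l) w) _) (subst (_≤ 1) (trans (cong (λ z → cnt z w) q) (cnt-ʳ++ (x ∷ l) (s ∷ []) w)) (proj₁ okp w)))
        (λ u w → trans (cong (λ z → mulp z u w) q) (trans (mulp-ʳ++ (x ∷ l) s [] u w) (+-identityʳ _)))
    -- If `s` were interior, both its neighbours on the path would be `v`, which would occur twice.
    finish (inj₂ (x ∷ l , y ∷ r , q)) = contradiction (proj₁ okp v) (<⇒≱ two)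
      where
      mp : ∀ u w → mulp p u w ≡ mulp (s ∷ x ∷ l) u w + mulp (s ∷ y ∷ r) u w
      mp u w = trans (cong (λ z → mulp z u w) q) (mulp-ʳ++ (x ∷ l) s (y ∷ r) u w)
      x≡v : x ≡ v
      x≡v = only (subst (1 ≤_) (sym (mp s x)) (≤-trans (≤-trans (≤-reflexive (sym (cong b2n (ε-self s x)))) (m≤m+n (εn s x s x) (mulp (x ∷ l) s x))) (m≤m+n (mulp (s ∷ x ∷ l) s x) (mulp (s ∷ y ∷ r) s x))))
      y≡v : y ≡ v
      y≡v = only (subst (1 ≤_) (sym (mp s y)) (≤-trans (≤-trans (≤-reflexive (sym (cong b2n (ε-self s y)))) (m≤m+n (εn s y s y) (mulp (y ∷ r) s y))) (m≤n+m (mulp (s ∷ y ∷ r) s y) (mulp (s ∷ x ∷ l) s y))))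
      two : 1 < cnt p v
      two = subst (1 <_) (sym (trans (cong (λ z → cnt z v) q) (cnt-ʳ++ (x ∷ l) (s ∷ y ∷ r) v)))
        (+-mono-≤ (cnt-∈ {p = x ∷ l} (here (sym x≡v))) (cnt-∈ {p = s ∷ y ∷ r} (there (here (sym y≡v)))))

-- The even subgraph and its reductions

module _ {A : Set} where

  ∑-strict : ∀ {xs : List A} {f g x} → (∀ x → f x ≤ g x) → x ∈ xs → f x < g x → ∑ xs f < ∑ xs g
  ∑-strict {y ∷ xs} le (here refl) lt = +-mono-<-≤ lt (∑-mono xs le)
  ∑-strict {y ∷ xs} le (there m) lt = +-mono-≤-< (le y) (∑-strict le m lt)

  anyP? : ∀ {P : A → Set} → (∀ x → Dec (P x)) → ∀ xs → (∃ λ x → x ∈ xs × P x) ⊎ (∀ {x} → x ∈ xs → ¬ P x)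
  anyP? P? [] = inj₂ λ ()
  anyP? P? (x ∷ xs) with P? x | anyP? P? xs
  ... | yes p | _ = inj₁ (x , here refl , p)
  ... | no n | inj₁ (y , m , p) = inj₁ (y , there m , p)
  ... | no n | inj₂ k = inj₂ λ { (here refl) → n ; (there m) → k m }

module _ {N : ℕ} where

  Rel : Set₁
  Rel = Fin N → Fin N → Set

  -- Walks all of whose vertices, the ends included, differ from `c`; they stand for connectivity
  -- after deletion of `c`.
  data Av (R : Rel) (c : Fin N) : Fin N → Fin N → Set where
    stay : ∀ {u} → u ≢ c → Av R c u u
    via : ∀ {u v w} → u ≢ c → R u v → Av R c v w → Av R c u w

  Av-mono : ∀ {R R' : Rel} → (∀ {u v} → R u v → R' u v) → ∀ {c u v} → Av R c u v → Av R' c u v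
  Av-mono f (stay n) = stay n
  Av-mono f (via n r a) = via n (f r) (Av-mono f a)

  record Distinct4 (a b c d : Fin N) : Set where
    constructor dis4
    field
      ab : a ≢ b
      ac : a ≢ c
      ad : a ≢ d
      bc : b ≢ c
      bd : b ≢ d
      cd : c ≢ d

  -- What is used of the hypothesis on EV(G), in a form that passes to subgraphs: blocks have
  -- maximum degree at most 3, and the triangles of a component with a vertex c of degree at least
  -- 4 lie in one block, hence seen from c in one direction.
  record Host (R : Rel) : Set where
    field
      host₁ : ∀ c {d₁ d₂ d₃ d₄} → Distinct4 d₁ d₂ d₃ d₄ → R c d₁ → R c d₂ → R c d₃ → R c d₄ →
        Av R c d₁ d₂ → Av R c d₁ d₃ → Av R c d₁ d₄ → ⊥
      -- Doubly negated because it stems from blocks and reachability that are not decided; it is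
      -- only applied in the derivation of a contradiction.
      host₂ : ∀ c {d₁ d₂ d₃ d₄} → Distinct4 d₁ d₂ d₃ d₄ → R c d₁ → R c d₂ → R c d₃ → R c d₄ →
        ∀ {x v} → R c x → R c v → R x v →
        ¬ ¬ ∃ λ d → d ∈ d₁ ∷ d₂ ∷ d₃ ∷ d₄ ∷ [] × (∀ {x' v' c'} → R x' v' → R v' c' → R x' c' → x' ≢ c → ¬ Av R c d x')

  Host-mono : ∀ {R R' : Rel} → (∀ {u v} → R' u v → R u v) → Host R → Host R'
  Host-mono f h = record
    { host₁ = λ c dd a b e g p q r → host₁ c dd (f a) (f b) (f e) (f g) (Av-mono f p) (Av-mono f q) (Av-mono f r)
    ; host₂ = λ c dd a b e g p q r k → host₂ c dd (f a) (f b) (f e) (f g) (f p) (f q) (f r)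
        λ { (d , m , n) → k (d , m , λ s t u w z → n (f s) (f t) (f u) w (Av-mono f z)) } }
    where open Host h

  size-< : ∀ (G G' : Graph N) → (∀ u v → adj G' u v ≡ true → adj G u v ≡ true) →
    ∀ {a b} → adj G a b ≡ true → adj G' a b ≡ false → size (adj G') < size (adj G)
  size-< G G' sub {a} {b} e e' = ∑-strict (λ u → ∑-mono (allFin N) (λ v → le u v)) (∈-allFin a)
      (∑-strict (λ v → le a v) (∈-allFin b) (subst₂ (λ s t → b2n s < b2n t) (sym e') (sym e) ≤-refl))
    where
    le : ∀ u v → b2n (adj G' u v) ≤ b2n (adj G u v)
    le u v with adj G' u v in eq
    ... | false = z≤n
    ... | true rewrite sub u v eq = ≤-refl

  module _ (G : Graph N) where

    Ed : Rel
    Ed u v = adj G u v ≡ true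

    Ev Od : Fin N → Set
    Ev v = par (adj G) v ≡ false
    Od v = par (adj G) v ≡ true

    FE : Rel
    FE u v = Ed u v × Ev u × Ev v

    FE? : ∀ u v → Dec (FE u v)
    FE? u v = (adj G u v ≟ᵇ true) ×-dec (par (adj G) u ≟ᵇ false) ×-dec (par (adj G) v ≟ᵇ false)

    Ed-sym : ∀ {u v} → Ed u v → Ed v u
    Ed-sym {u} {v} e = trans (Graph.sym G v u) e

    FE-sym : ∀ {u v} → FE u v → FE v u
    FE-sym (e , a , b) = Ed-sym e , b , a

    Ed-≢ : ∀ {u v} → Ed u v → u ≢ v
    Ed-≢ = adj⇒≢ G

    FE-≢ : ∀ {u v} → FE u v → u ≢ v
    FE-≢ = Ed-≢ ∘ proj₁

    Two : Fin N → Fin N → Fin N → Fin N → Set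
    Two a b c u = (Ed u a × Ed u b) ⊎ (Ed u b × Ed u c) ⊎ (Ed u a × Ed u c)

    Two? : ∀ a b c u → Dec (Two a b c u)
    Two? a b c u = ((adj G u a ≟ᵇ true) ×-dec (adj G u b ≟ᵇ true)) ⊎-dec
      (((adj G u b ≟ᵇ true) ×-dec (adj G u c ≟ᵇ true)) ⊎-dec ((adj G u a ≟ᵇ true) ×-dec (adj G u c ≟ᵇ true)))

    -- A component of this kind (an even triangle together with odd vertices each joined to at
    -- least two of its corners) may need half a path more than its share.
    record Exc (a b c : Fin N) : Set where
      field
        ab : FE a b
        bc : FE b c
        ac : FE a c
        near : ∀ {u} → u ≢ a → u ≢ b → u ≢ c → Ed u a ⊎ Ed u b ⊎ Ed u c → Od u × Two a b c u
        closed : ∀ {u w} → Two a b c u → u ≢ a → u ≢ b → u ≢ c → Ed u w → (w ≡ a ⊎ w ≡ b ⊎ w ≡ c) ⊎ Two a b c w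

    NoExc : Set
    NoExc = ∀ a b c → ¬ Exc a b c

    -- For odd `N` this is one path less than the ceiling of `N / 2` allows, which leaves room for
    -- an exceptional graph.
    Φ : Set
    Φ = ∃ λ L → Dc (adj G) L × L + L ≤ N

  IH : Graph N → Set
  IH G = ∀ G' → size (adj G') < size (adj G) → Host (FE G') → NoExc G' → Φ G'

  Od≢Ev : ∀ (G : Graph N) {u} → Od G u → Ev G u → ⊥
  Od≢Ev G a b = true≢false (trans (sym a) b)

  record Untouched (G G' : Graph N) (t : List (Fin N)) : Set where
    field
      same-par : ∀ {u} → ¬ u ∈ t → par (adj G') u ≡ par (adj G) u
      same-adj : ∀ {u} → ¬ u ∈ t → ∀ w → adj G' u w ≡ adj G u w

    back : ∀ {u} → ¬ u ∈ t → ∀ {w} → Ed G' w u → Ed G w u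
    back {u} n {w} e = Ed-sym G (trans (sym (same-adj n w)) (Ed-sym G' e))

    forth : ∀ {u} → ¬ u ∈ t → ∀ {w} → Ed G w u → Ed G' w u
    forth {u} n {w} e = Ed-sym G' (trans (same-adj n w) (Ed-sym G e))

    Two-back : ∀ {a b c u} → ¬ a ∈ t → ¬ b ∈ t → ¬ c ∈ t → Two G' a b c u → Two G a b c u
    Two-back a b c (inj₁ (x , y)) = inj₁ (back a x , back b y)
    Two-back a b c (inj₂ (inj₁ (x , y))) = inj₂ (inj₁ (back b x , back c y))
    Two-back a b c (inj₂ (inj₂ (x , y))) = inj₂ (inj₂ (back a x , back c y))

    Two-forth : ∀ {a b c u} → ¬ a ∈ t → ¬ b ∈ t → ¬ c ∈ t → Two G a b c u → Two G' a b c u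
    Two-forth a b c (inj₁ (x , y)) = inj₁ (forth a x , forth b y)
    Two-forth a b c (inj₂ (inj₁ (x , y))) = inj₂ (inj₁ (forth b x , forth c y))
    Two-forth a b c (inj₂ (inj₂ (x , y))) = inj₂ (inj₂ (forth a x , forth c y))

    Exc-back : ∀ {a b c} → Exc G' a b c → ¬ a ∈ t → ¬ b ∈ t → ¬ c ∈ t →
      (∀ {u} → u ∈ t → ¬ Two G' a b c u) → Exc G a b c
    Exc-back {a} {b} {c} x na nb nc none = record
      { ab = fe na nb ab ; bc = fe nb nc bc ; ac = fe na nc ac
      ; near = λ {u} p q r e → nearG (near p q r (map₃ e))
      ; closed = closedG }
      where
      open Exc x
      fe : ∀ {u v} → ¬ u ∈ t → ¬ v ∈ t → FE G' u v → FE G u v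
      fe n m (e , p , q) = back m e , trans (sym (same-par n)) p , trans (sym (same-par m)) q
      map₃ : ∀ {u} → Ed G u a ⊎ Ed G u b ⊎ Ed G u c → Ed G' u a ⊎ Ed G' u b ⊎ Ed G' u c
      map₃ (inj₁ e) = inj₁ (forth na e)
      map₃ (inj₂ (inj₁ e)) = inj₂ (inj₁ (forth nb e))
      map₃ (inj₂ (inj₂ e)) = inj₂ (inj₂ (forth nc e))
      nearG : ∀ {u} → Od G' u × Two G' a b c u → Od G u × Two G a b c u
      nearG (o , w) = trans (sym (same-par λ m → none m w)) o , Two-back na nb nc w
      closedG : ∀ {u w} → Two G a b c u → u ≢ a → u ≢ b → u ≢ c → Ed G u w → (w ≡ a ⊎ w ≡ b ⊎ w ≡ c) ⊎ Two G a b c w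
      closedG {u} {w} tw p q r e with closed (Two-forth na nb nc tw) p q r (trans (same-adj (λ m → none m (Two-forth na nb nc tw)) w) e)
      ... | inj₁ k = inj₁ k
      ... | inj₂ k = inj₂ (Two-back na nb nc k)

  module _ (R : Rel) where

    -- Reducible configurations of the even subgraph; the edges removed are xy in R₁, xy and vu
    -- in R₂, the three edges at x in R₃. R₄ is a case of R₃ whose reduction never creates an
    -- exceptional component.
    R₁ : Fin N → Fin N → Set
    R₁ x y = R x y × ∀ w → R x w → w ≡ y

    record R₂ (x y v u : Fin N) : Set where
      constructor mkR₂
      field
        xy : R x y
        xv : R x v
        vu : R v u
        y≢v : y ≢ v
        u≢x : u ≢ x
        -- If both deleted edges ended at the same vertex, it would stay even and provide no token.
        y≢u : y ≢ u
        covx : ∀ w → R x w → w ≡ y ⊎ w ≡ v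
        covv : ∀ w → R v w → w ≡ x ⊎ w ≡ u

    Cov₃ : Fin N → Fin N → Fin N → Fin N → Set
    Cov₃ v x p q = ∀ w → R v w → w ≡ x ⊎ w ≡ p ⊎ w ≡ q

    record R₃ (x y v w : Fin N) : Set where
      constructor mkR₃
      field
        xy : R x y
        xv : R x v
        xw : R x w
        y≢v : y ≢ v
        y≢w : y ≢ w
        v≢w : v ≢ w
        covx : Cov₃ x y v w
        -- The last of the three edges may have to be inserted at `v` or at `w`, where the three
        -- tokens at `x` outweigh two obstacles. Nothing is asked of `y`, because `xy` is never the
        -- edge left over.
        covv : ∃ λ p → ∃ λ q → Cov₃ v x p q
        covw : ∃ λ p → ∃ λ q → Cov₃ w x p q

    record R₄ (a b c v : Fin N) : Set where
      constructor mkR₄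
      field
        ab : R a b
        ac : R a c
        bc : R b c
        av : R a v
        bv : R b v
        v≢c : v ≢ c
        cova : Cov₃ a b c v
        covb : Cov₃ b a c v
        covc : Cov₃ c a b v

    record IsoTri (a b c : Fin N) : Set where
      constructor mkTri
      field
        ab : R a b
        bc : R b c
        ac : R a c
        cova : ∀ w → R a w → w ≡ b ⊎ w ≡ c
        covb : ∀ w → R b w → w ≡ a ⊎ w ≡ c
        covc : ∀ w → R c w → w ≡ a ⊎ w ≡ b

  tog-untouched : ∀ {a b u : Fin N} (E : Adj {N}) → u ≢ a → u ≢ b → ∀ w → tog a b E u w ≡ E u w
  tog-untouched {a} {b} {u} E p q w = tog-other a b E (ε-false a b u w λ { (inj₁ (e , _)) → p (sym e) ; (inj₂ (_ , e)) → q (sym e) })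

  togs-untouched : ∀ (z : Fin N) A (E : Adj {N}) {u} → u ≢ z → ¬ u ∈ A → ∀ w → togs z A E u w ≡ E u w
  togs-untouched z [] E p q w = refl
  togs-untouched z (s ∷ A) E p q w = trans (tog-untouched (togs z A E) p (λ { refl → q (here refl) }) w) (togs-untouched z A E p (q ∘ there) w)

  ∉⇒cnt0 : ∀ {u : Fin N} A → ¬ u ∈ A → cnt A u ≡ 0
  ∉⇒cnt0 {u} A n with cnt A u in e
  ... | zero = refl
  ... | suc _ = contradiction (∈-cnt A (subst (1 ≤_) (sym e) (s≤s z≤n))) n

  par-togs-∉ : ∀ (z : Fin N) A (E : Adj {N}) {v} → All (z ≢_) A → v ≢ z → ¬ v ∈ A → par (togs z A E) v ≡ par E v
  par-togs-∉ z A E {v} nz n m = trans (par-togs z A E nz n) (trans (cong (λ k → par E v xor odd k) (∉⇒cnt0 A m)) (xor-identityʳ _))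

  par-togs-∈ : ∀ (z : Fin N) A (E : Adj {N}) {v} → All (z ≢_) A → v ≢ z → Uq A → v ∈ A → par (togs z A E) v ≡ not (par E v)
  par-togs-∈ z A E {v} nz n uq m = trans (par-togs z A E nz n) (trans (cong (λ k → par E v xor odd k) (≤-antisym (uq v) (cnt-∈ m))) (l (par E v)))
    where
    l : ∀ b → b xor true ≡ not b
    l true = refl
    l false = refl

  -- Reinserting the edges of a reducible configuration

  module Reduce (G : Graph N) where

    E : Adj
    E = adj G

    -- `y` has become odd and provides the token; an obstacle at `x` would be a second neighbour of
    -- `x` in F.
    red₁ : ∀ {x y L} → R₁ (FE G) x y → Dc (tog x y E) L → Dc E L
    red₁ {x} {y} ((xy , ex , ey) , only) d =
      dc-≐ (tog-tog x y E) (proj₁ (add1 d [] x≢y (trans (tog-self x y E) (cong not xy)) zs (odd⇒tk d (trans (par-togʳ E x≢y) (cong not ey)))))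
      where
      x≢y = Ed-≢ G xy
      zs : ∀ v → tog x y E x v ≡ true → par (tog x y E) v ≡ false → 1 ≤ tk d v ⊎ v ∈ []
      zs v e p with v ≟ y | v ≟ x
      ... | yes refl | _ = contradiction (trans (sym e) (trans (tog-self x y E) (cong not xy))) λ ()
      ... | no _ | yes refl = contradiction (trans (sym e) (dc-irrefl d x)) λ ()
      ... | no n | no m = contradiction (only v (trans (sym (tog-other x y E (ε-falseʳ x (x≢y ∘ sym) (n ∘ sym)))) e , ex , trans (sym (par-tog-other E x≢y m n)) p)) n

    -- While `v` is odd, `xy` can be inserted at `x` without obstacle. This leaves a token at `x`,
    -- although `x` is even again, and so clears the only possible obstacle for `vu` at `v`.
    red₂ : ∀ {x y v u L} → R₂ (FE G) x y v u → Dc (tog x y (tog v u E)) L → Dc E L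
    red₂ {x} {y} {v} {u} (mkR₂ (xy , ex , ey) (xv , _ , evv) (vu , _ , eu) y≢v u≢x y≢u covx covv) d = dc-≐ (tog-tog v u E) (proj₁ step₂)
      where
      x≢y = Ed-≢ G xy
      x≢v = Ed-≢ G xv
      v≢u = Ed-≢ G vu
      E₁ = tog v u E
      E₂ = tog x y E₁
      E₁xy : E₁ x y ≡ true
      E₁xy = trans (tog-other v u E (ε-falseˡ u (x≢v ∘ sym) (y≢v ∘ sym))) xy
      step₁ : Σ (Dc (tog x y E₂) _) λ d' → ∀ w → tk d' w + δ y w ≡ tk d w + δ x w
      step₁ = add1 d [] x≢y (trans (tog-self x y E₁) (cong not E₁xy)) zs
          (odd⇒tk d (trans (par-togʳ E₁ x≢y) (cong not (trans (par-tog-other E v≢u y≢v y≢u) ey))))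
        where
        zs : ∀ w → E₂ x w ≡ true → par E₂ w ≡ false → 1 ≤ tk d w ⊎ w ∈ []
        zs w e p with w ≟ y | w ≟ x | w ≟ v | w ≟ u
        ... | yes refl | _ | _ | _ = contradiction (trans (sym e) (trans (tog-self x y E₁) (cong not E₁xy))) λ ()
        ... | no _ | yes refl | _ | _ = contradiction (trans (sym e) (dc-irrefl d x)) λ ()
        ... | no _ | no _ | yes refl | _ = contradiction (trans (sym p) (trans (par-tog-other E₁ x≢y (x≢v ∘ sym) (y≢v ∘ sym)) (trans (par-togˡ E v≢u) (cong not evv)))) λ ()
        ... | no _ | no _ | no _ | yes refl = contradiction (trans (sym p) (trans (par-tog-other E₁ x≢y u≢x (y≢u ∘ sym)) (trans (par-togʳ E v≢u) (cong not eu)))) λ ()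
        ... | no n | no m | no k | no l with covx w (trans (sym (trans (tog-other x y E₁ (ε-falseʳ x (x≢y ∘ sym) (n ∘ sym))) (tog-other v u E (ε-falseˡ u (x≢v ∘ sym) (k ∘ sym))))) e , ex ,
                 trans (sym (trans (par-tog-other E₁ x≢y m n) (par-tog-other E v≢u k l))) p)
        ... | inj₁ q = contradiction q n
        ... | inj₂ q = contradiction q k
      d₁ : Dc E₁ _
      d₁ = dc-≐ (tog-tog x y E₁) (proj₁ step₁)
      tkx : 1 ≤ tk d₁ x
      tkx = subst (1 ≤_) (trans (sym (proj₂ step₁ x)) (trans (+congʳ (δ-≢ (x≢y ∘ sym))) (+-identityʳ _))) (subst (λ k → 1 ≤ tk d x + k) (sym (δ-refl x)) (m≤n+m 1 _))
      step₂ : Σ (Dc (tog v u E₁) _) λ d' → ∀ w → tk d' w + δ u w ≡ tk d₁ w + δ v w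
      step₂ = add1 d₁ [] v≢u (trans (tog-self v u E) (cong not vu)) zs (odd⇒tk d₁ (trans (par-togʳ E v≢u) (cong not eu)))
        where
        zs : ∀ w → E₁ v w ≡ true → par E₁ w ≡ false → 1 ≤ tk d₁ w ⊎ w ∈ []
        zs w e p with w ≟ u | w ≟ v
        ... | yes refl | _ = contradiction (trans (sym e) (trans (tog-self v u E) (cong not vu))) λ ()
        ... | no _ | yes refl = contradiction (trans (sym e) (dc-irrefl d₁ v)) λ ()
        ... | no n | no m with covv w (trans (sym (tog-other v u E (ε-falseʳ v (v≢u ∘ sym) (n ∘ sym)))) e , evv , trans (sym (par-tog-other E v≢u m n)) p)
        ... | inj₁ refl = inj₁ tkx
        ... | inj₂ q = contradiction q n

    -- The edge is inserted at its far end `r` with a token drawn from `x`: tokens accumulated at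
    -- `x` pay for the obstacles around `r`.
    last-edge : ∀ {x r L} (d : Dc (tog x r E) L) → Ed G x r → ∀ zs →
      (∀ w → w ≢ x → Ed G r w → Ev G w → 1 ≤ tk d w ⊎ w ∈ zs) → length zs < tk d x →
      Σ (Dc E L) λ d' → ∀ w → tk d' w + δ x w ≡ tk d w + δ r w
    last-edge {x} {r} d xr zs h lt = dc-≐ (λ u v → trans (tog-swap r x (tog x r E) u v) (tog-tog x r E u v)) (proj₁ added) , proj₂ added
      where
      x≢r = Ed-≢ G xr
      z : ∀ w → tog x r E r w ≡ true → par (tog x r E) w ≡ false → 1 ≤ tk d w ⊎ w ∈ zs
      z w e p with w ≟ x | w ≟ r
      ... | yes refl | _ = contradiction (trans (sym e) (trans (dc-sym d r x) (trans (tog-self x r E) (cong not xr)))) λ ()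
      ... | no n | yes refl = contradiction (trans (sym e) (dc-irrefl d r)) λ ()
      ... | no n | no m = h w n (trans (sym (tog-other x r E (ε-falseˡ r x≢r (n ∘ sym)))) e) (trans (sym (par-tog-other E x≢r n m)) p)
      added = add1 d zs (x≢r ∘ sym) (trans (dc-sym d r x) (trans (tog-self x r E) (cong not xr))) z lt

    uq₃ : ∀ {y v w : Fin N} → y ≢ v → y ≢ w → v ≢ w → Uq (y ∷ v ∷ w ∷ [])
    uq₃ {y} {v} {w} a b c u with y ≟ u | v ≟ u | w ≟ u
    ... | yes refl | yes q | _ = contradiction (sym q) a
    ... | yes refl | no _ | yes q = contradiction (sym q) b
    ... | yes _ | no _ | no _ = ≤-refl
    ... | no _ | yes refl | yes q = contradiction (sym q) c
    ... | no _ | yes _ | no _ = ≤-refl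
    ... | no _ | no _ | yes _ = ≤-refl
    ... | no _ | no _ | no _ = z≤n

    data Add₃ (E' : Adj {N}) (x y v w : Fin N) {L : ℕ} (d : Dc E' L) : Set where
      all₃ : (d' : Dc (togs x (y ∷ v ∷ w ∷ []) E') L) → tk d' x ≡ tk d x + 3 → Add₃ E' x y v w d
      two₃ : ∀ r A → r ≡ v ⊎ r ≡ w → y ∷ v ∷ w ∷ [] ↭ A ++ r ∷ [] → (d' : Dc (togs x A E') L) → tk d' x ≡ tk d x + 2 → Add₃ E' x y v w d

    -- Of three edges at x at least two, one of them xy, can be added at x.
    add₃ : ∀ {E' x y v w L} (d : Dc E' L) → Uq (y ∷ v ∷ w ∷ []) →
      (∀ {s} → s ∈ y ∷ v ∷ w ∷ [] → x ≢ s × E' x s ≡ false × 1 ≤ tk d s) →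
      (∀ u → E' x u ≡ true → par E' u ≡ false → 1 ≤ tk d u) → Add₃ E' x y v w d
    add₃ {E'} {x} {y} {v} {w} {L} d uq hs h = split₃ (proj₁ added) (proj₁ (proj₂ added)) (proj₁ (proj₂ (proj₂ added))) (proj₂ (proj₂ (proj₂ added)))
      where
      T₃ = y ∷ v ∷ w ∷ []
      added = addM d x T₃ uq hs h
      cx : cnt T₃ x ≡ 0
      cx with cnt T₃ x in e
      ... | zero = refl
      ... | suc k = contradiction refl (proj₁ (hs (∈-cnt T₃ (subst (1 ≤_) (sym e) (s≤s z≤n)))))
      gain : ∀ {E₁} A (d' : Dc E₁ L) → (∀ v → tk d' v + cnt A v ≡ tk d v + length A * δ x v) → cnt A x ≡ 0 → tk d' x ≡ tk d x + length A
      gain A d' t c = trans (sym (+-identityʳ _)) (trans (+congʳ (sym c)) (trans (t x) (+congʳ (trans (cong (length A *_) (δ-refl x)) (*-identityʳ (length A))))))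
      -- From the pair containing `y`, if there is one, `y` itself is picked, so the postponed edge
      -- ends at `v` or `w`.
      f : Fin N × Fin N → Bool
      f s = ⌊ proj₁ s ≟ y ⌋
      Use : List (Fin N × Fin N) → List (Fin N) → Set
      Use pairs singles = ∀ f → T₃ ↭ (singles ++ map (pick f) pairs) ++ map (rest f) pairs ×
        Σ (Dc (togs x (singles ++ map (pick f) pairs) E') L) λ d' → ∀ v → tk d' v + cnt (singles ++ map (pick f) pairs) v ≡ tk d v + length (singles ++ map (pick f) pairs) * δ x v
      split₃ : ∀ pairs singles → T₃ ↭ flat pairs ++ singles → Use pairs singles → Add₃ E' x y v w d
      split₃ [] singles q use = all₃ (dc-≐ (togs-↭ x E' (↭-sym perm)) d') (trans (gain A d' t (trans (sym (cnt-↭ perm x)) cx)) (+congʳ (sym (↭-length perm))))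
        where
        A = singles ++ []
        d' = proj₁ (proj₂ (use f))
        t = proj₂ (proj₂ (use f))
        perm : T₃ ↭ A
        perm = ↭-trans (proj₁ (use f)) (↭-reflexive (++-identityʳ A))
      split₃ ((p₁ , p₂) ∷ []) singles q use = two₃ r A isr perm d' (trans (gain A d' t cA) (+congʳ lA))
        where
        r = rest f (p₁ , p₂)
        A = singles ++ pick f (p₁ , p₂) ∷ []
        d' = proj₁ (proj₂ (use f))
        t = proj₂ (proj₂ (use f))
        perm : T₃ ↭ A ++ r ∷ []
        perm = proj₁ (use f)
        uqp : Uq (p₁ ∷ p₂ ∷ singles)
        uqp z = subst (_≤ 1) (cnt-↭ q z) (uq z)
        r≢y : r ≢ y
        r≢y with p₁ ≟ y
        ... | yes refl = Uq-≢ {p = singles} uqp ∘ sym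
        ... | no n = n
        in₃ : r ∈ T₃ → r ≡ v ⊎ r ≡ w
        in₃ (here e) = contradiction e r≢y
        in₃ (there (here e)) = inj₁ e
        in₃ (there (there (here e))) = inj₂ e
        isr : r ≡ v ⊎ r ≡ w
        isr = in₃ (∈-resp-↭ (↭-sym perm) (∈-cnt (A ++ r ∷ []) (subst (1 ≤_) (sym (∑-++ A (r ∷ []) (λ x → δ x r))) (≤-trans (≤-reflexive (sym (trans (+-identityʳ _) (δ-refl r)))) (m≤n+m (δ r r + 0) (cnt A r))))))
        cA : cnt A x ≡ 0
        cA = m+n≡0⇒m≡0 (cnt A x) (trans (sym (∑-++ A (r ∷ []) _)) (trans (sym (cnt-↭ perm x)) cx))
        lA : length A ≡ 2
        lA = suc-injective (sym (trans (↭-length perm) (trans (length-++ A) (+-comm _ 1))))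
      split₃ (p ∷ p' ∷ ps) singles q use = contradiction (↭-length q) λ ()

    -- After the deletion `x` is odd and has a token; two edges inserted at `x` raise this to three,
    -- enough against the two further neighbours of `v` or of `w`.
    red₃ : ∀ {x y v w L} → R₃ (FE G) x y v w → Dc (togs x (y ∷ v ∷ w ∷ []) E) L → Dc E L
    red₃ {x} {y} {v} {w} {L} (mkR₃ (xy , ex , ey) (xv , _ , evv) (xw , _ , ew) y≢v y≢w v≢w covx (p , q , cv) (p' , q' , cw)) d = conclude (add₃ {x = x} d uq hs h)
      where
      T₃ = y ∷ v ∷ w ∷ []
      uq = uq₃ y≢v y≢w v≢w
      nx : All (x ≢_) T₃
      nx = Ed-≢ G xy ∷ Ed-≢ G xv ∷ Ed-≢ G xw ∷ []
      edT : ∀ {s} → s ∈ T₃ → FE G x s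
      edT (here refl) = xy , ex , ey
      edT (there (here refl)) = xv , ex , evv
      edT (there (there (here refl))) = xw , ex , ew
      hs : ∀ {s} → s ∈ T₃ → x ≢ s × togs x T₃ E x s ≡ false × 1 ≤ tk d s
      hs {s} m = FE-≢ G (edT m) , trans (togs-∈ x T₃ E (FE-≢ G (edT m)) uq m) (cong not (proj₁ (edT m))) ,
            odd⇒tk d (trans (par-togs-∈ x T₃ E nx (FE-≢ G (edT m) ∘ sym) uq m) (cong not (proj₂ (proj₂ (edT m)))))
      h : ∀ u → togs x T₃ E x u ≡ true → par (togs x T₃ E) u ≡ false → 1 ≤ tk d u
      h u e p with x ≟ u | mem? u T₃
      ... | yes refl | _ = contradiction (trans (sym e) (dc-irrefl d x)) λ ()
      ... | no n | yes m = contradiction (trans (sym e) (proj₁ (proj₂ (hs m)))) λ ()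
      ... | no n | no m = contradiction (in₃ (covx u (trans (sym (togs-∉ x T₃ E n (∉⇒cnt0 T₃ m))) e , ex , trans (sym (par-togs-∉ x T₃ E nx (n ∘ sym) m)) p))) m
        where
        in₃ : u ≡ y ⊎ u ≡ v ⊎ u ≡ w → u ∈ T₃
        in₃ (inj₁ e) = here e
        in₃ (inj₂ (inj₁ e)) = there (here e)
        in₃ (inj₂ (inj₂ e)) = there (there (here e))
      conclude : Add₃ (togs x T₃ E) x y v w d → Dc E L
      conclude (all₃ d' _) = dc-≐ (λ u v → trans (togs-cong x T₃ (togs-↭ x E (↭-reflexive (sym (++-identityʳ T₃)))) u v) (togs-cancel x T₃ [] E u v)) d'
      conclude (two₃ r A isr perm d' tx) = finish isr
        where
        d₁ : Dc (tog x r E) L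
        d₁ = dc-≐ (λ u v → trans (togs-cong x A (togs-↭ x E perm) u v) (togs-cancel x A (r ∷ []) E u v)) d'
        three : 3 ≤ tk d₁ x
        three = subst (3 ≤_) (sym tx) (+-monoˡ-≤ 2 (odd⇒tk d (trans (par-togs-z x T₃ E nx) (cong (_xor true) ex))))
        fin : ∀ {p q} → Ed G x r → Ev G r → Cov₃ (FE G) r x p q → Dc E L
        fin {p} {q} e er cv = proj₁ (last-edge d₁ e (p ∷ q ∷ []) (λ u n ru eu → inj₂ (lem u n (cv u (ru , er , eu)))) three)
          where
          lem : ∀ u → u ≢ x → u ≡ x ⊎ u ≡ p ⊎ u ≡ q → u ∈ p ∷ q ∷ []
          lem u n (inj₁ e) = contradiction e n
          lem u n (inj₂ (inj₁ refl)) = here refl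
          lem u n (inj₂ (inj₂ refl)) = there (here refl)
        finish : r ≡ v ⊎ r ≡ w → Dc E L
        finish (inj₁ refl) = fin xv evv cv
        finish (inj₂ refl) = fin xw ew cw

-- Reductions create no exceptional components

module _ {N : ℕ} where

  togs-irrefl : ∀ z A {E : Adj {N}} → All (z ≢_) A → (∀ v → E v v ≡ false) → ∀ v → togs z A E v v ≡ false
  togs-irrefl z [] _ i v = i v
  togs-irrefl z (s ∷ A) (k ∷ ks) i = tog-irrefl k (togs-irrefl z A ks i)

  togsG : ∀ z A → All (z ≢_) A → Graph N → Graph N
  togsG z A nz G = record { adj = togs z A (adj G) ; sym = togs-sym z A (Graph.sym G) ; irrefl = togs-irrefl z A nz (Graph.irrefl G) }

  togs-⊆ : ∀ (G : Graph N) z A → Uq A → (∀ {s} → s ∈ A → Ed G z s) → ∀ u v → togs z A (adj G) u v ≡ true → adj G u v ≡ true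
  togs-⊆ G z A uq h u v e with u ≟ z | v ≟ z
  ... | no p | no q = trans (sym (togs-off z A (adj G) p q)) e
  ... | yes refl | _ = at v e
    where
    at : ∀ v → togs u A (adj G) u v ≡ true → adj G u v ≡ true
    at v e with mem? v A | u ≟ v
    ... | yes m | _ = h m
    ... | no m | no n = trans (sym (togs-∉ u A (adj G) n (∉⇒cnt0 A m))) e
    ... | no m | yes refl = contradiction (trans (sym e) (trans (togs-untouched' A m) (Graph.irrefl G u))) λ ()
      where
      togs-untouched' : ∀ A → ¬ u ∈ A → togs u A (adj G) u u ≡ adj G u u
      togs-untouched' [] m = refl
      togs-untouched' (s ∷ A) m = trans (tog-other u s (togs u A (adj G)) (ε-false u s u u λ { (inj₁ (_ , q)) → m (here (sym q)) ; (inj₂ (_ , q)) → m (here (sym q)) }))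
        (togs-untouched' A (m ∘ there))
  ... | no p | yes refl = trans (Graph.sym G u v) (at (trans (togs-sym v A (Graph.sym G) v u) e))
    where
    at : togs v A (adj G) v u ≡ true → adj G v u ≡ true
    at e with mem? u A
    ... | yes m = h m
    ... | no m = trans (sym (togs-∉ v A (adj G) (p ∘ sym) (∉⇒cnt0 A m))) e

  -- All touched vertices turn from even to odd, so F can only shrink and the conditions of `Host`
  -- are inherited.
  record Cut (G G' : Graph N) (t : List (Fin N)) : Set where
    field
      untouched : Untouched G G' t
      evs : ∀ {u} → u ∈ t → Ev G u
      ods : ∀ {u} → u ∈ t → Od G' u
      sub : ∀ u v → adj G' u v ≡ true → adj G u v ≡ true
    open Untouched untouched public

    ev∉ : ∀ {u} → Ev G' u → ¬ u ∈ t
    ev∉ e m = Od≢Ev G' (ods m) e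

    FE-sub : ∀ {u v} → FE G' u v → FE G u v
    FE-sub {u} {v} (e , p , q) = sub u v e , trans (sym (same-par (ev∉ p))) p , trans (sym (same-par (ev∉ q))) q

  -- Each of `v` and `w` is joined to `a` and to another corner, so the four neighbours `b`, `c`,
  -- `v`, `w` of `a` are connected off `a`, against `host₁`.
  K₅⁻ : ∀ {R : Rel {N}} → Host R → (∀ {u v} → R u v → u ≢ v) → (∀ {u v} → R u v → R v u) → ∀ {a b c v w} →
    R a b → R a c → R b c → R a v → R a w → R b v ⊎ R c v → R b w ⊎ R c w → b ≢ v → c ≢ v → b ≢ w → c ≢ w → v ≢ w → ⊥
  K₅⁻ {R} hst irr sm {a} {b} {c} {v} {w} ab ac bc av aw bcv bcw b≢v c≢v b≢w c≢w v≢w =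
    Host.host₁ hst a (dis4 (irr bc) b≢v b≢w c≢v c≢w v≢w) ab ac av aw (via (irr ab ∘ sym) bc (stay (irr ac ∘ sym))) (reach av bcv) (reach aw bcw)
    where
    reach : ∀ {v} → R a v → R b v ⊎ R c v → Av R a b v
    reach av (inj₁ r) = via (irr ab ∘ sym) r (stay (irr av ∘ sym))
    reach av (inj₂ r) = via (irr ab ∘ sym) bc (via (irr ac ∘ sym) r (stay (irr av ∘ sym)))

  -- A newly exceptional triangle owes this to a touched vertex `v`, formerly even, that sees two of
  -- its corners. `K₅⁻` makes `v` unique, so in F the corners have neighbours only in the triangle
  -- and `v`: this is `R₄`.
  safe : ∀ (G G' : Graph N) {t} → Cut G G' t → Host (FE G) → NoExc G → (∀ a b c v → ¬ R₄ (FE G) a b c v) → NoExc G'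
  safe G G' {t} cut hst nx nr a b c x with anyP? (Two? G' a b c) t
  ... | inj₂ none = nx a b c (Cut.Exc-back cut x (ev∉ (proj₁ (proj₂ ab))) (ev∉ (proj₁ (proj₂ bc))) (ev∉ (proj₂ (proj₂ bc))) none)
    where
    open Exc x
    open Cut cut
  ... | inj₁ (v , m , two) = finish two
    where
    open Exc x
    open Cut cut
    na = ev∉ (proj₁ (proj₂ ab))
    nb = ev∉ (proj₁ (proj₂ bc))
    nc = ev∉ (proj₂ (proj₂ bc))
    AB = FE-sub ab
    BC = FE-sub bc
    AC = FE-sub ac
    sm = FE-sym G
    irr : ∀ {u v} → FE G u v → u ≢ v
    irr = FE-≢ G
    ne : ∀ {z} → ¬ z ∈ t → ∀ {w} → w ∈ t → z ≢ w
    ne n k refl = n k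
    uniq : ∀ {w} → w ∈ t → Two G' a b c w → w ≡ v
    uniq {w} k tw with w ≟ v
    ... | yes e = e
    ... | no n = ⊥-elim (cases two tw)
      where
      f : ∀ {z u} → ¬ z ∈ t → FE G z z ⊎ Ev G z → u ∈ t → Ed G' u z → FE G z u
      f nz (inj₂ ez) k e = Ed-sym G (sub _ _ e) , ez , evs k
      f nz (inj₁ (_ , ez , _)) k e = Ed-sym G (sub _ _ e) , ez , evs k
      fa : ∀ {u} → u ∈ t → Ed G' u a → FE G a u
      fa = f na (inj₂ (proj₁ (proj₂ AB)))
      fb : ∀ {u} → u ∈ t → Ed G' u b → FE G b u
      fb = f nb (inj₂ (proj₁ (proj₂ BC)))
      fc : ∀ {u} → u ∈ t → Ed G' u c → FE G c u
      fc = f nc (inj₂ (proj₂ (proj₂ BC)))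
      atA : FE G a v → FE G a w → FE G b v ⊎ FE G c v → FE G b w ⊎ FE G c w → ⊥
      atA p q r s = K₅⁻ hst irr sm AB AC BC p q r s (ne nb m) (ne nc m) (ne nb k) (ne nc k) (n ∘ sym)
      atB : FE G b v → FE G b w → FE G a v ⊎ FE G c v → FE G a w ⊎ FE G c w → ⊥
      atB p q r s = K₅⁻ hst irr sm (sm AB) BC AC p q r s (ne na m) (ne nc m) (ne na k) (ne nc k) (n ∘ sym)
      atC : FE G c v → FE G c w → FE G a v ⊎ FE G b v → FE G a w ⊎ FE G b w → ⊥
      atC p q r s = K₅⁻ hst irr sm (sm AC) (sm BC) AB p q r s (ne na m) (ne nb m) (ne na k) (ne nb k) (n ∘ sym)
      -- Two pairs of corners have a corner in common, and `K₅⁻` is applied there.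
      cases : Two G' a b c v → Two G' a b c w → ⊥
      cases (inj₁ (va , vb)) (inj₁ (wa , wb)) = atA (fa m va) (fa k wa) (inj₁ (fb m vb)) (inj₁ (fb k wb))
      cases (inj₁ (va , vb)) (inj₂ (inj₁ (wb , wc))) = atB (fb m vb) (fb k wb) (inj₁ (fa m va)) (inj₂ (fc k wc))
      cases (inj₁ (va , vb)) (inj₂ (inj₂ (wa , wc))) = atA (fa m va) (fa k wa) (inj₁ (fb m vb)) (inj₂ (fc k wc))
      cases (inj₂ (inj₁ (vb , vc))) (inj₁ (wa , wb)) = atB (fb m vb) (fb k wb) (inj₂ (fc m vc)) (inj₁ (fa k wa))
      cases (inj₂ (inj₁ (vb , vc))) (inj₂ (inj₁ (wb , wc))) = atB (fb m vb) (fb k wb) (inj₂ (fc m vc)) (inj₂ (fc k wc))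
      cases (inj₂ (inj₁ (vb , vc))) (inj₂ (inj₂ (wa , wc))) = atC (fc m vc) (fc k wc) (inj₂ (fb m vb)) (inj₁ (fa k wa))
      cases (inj₂ (inj₂ (va , vc))) (inj₁ (wa , wb)) = atA (fa m va) (fa k wa) (inj₂ (fc m vc)) (inj₁ (fb k wb))
      cases (inj₂ (inj₂ (va , vc))) (inj₂ (inj₁ (wb , wc))) = atC (fc m vc) (fc k wc) (inj₁ (fa m va)) (inj₂ (fb k wb))
      cases (inj₂ (inj₂ (va , vc))) (inj₂ (inj₂ (wa , wc))) = atA (fa m va) (fa k wa) (inj₂ (fc m vc)) (inj₂ (fc k wc))
    outside : ∀ {w} → Ev G w → w ≢ a → w ≢ b → w ≢ c → Ed G' w a ⊎ Ed G' w b ⊎ Ed G' w c → w ≡ v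
    outside {w} ew p q r e with near p q r e | mem? w t
    ... | o , tw | yes k = uniq k tw
    ... | o , tw | no k = contradiction (trans (sym o) (trans (same-par k) ew)) λ ()
    cova : Cov₃ (FE G) a b c v
    cova w (e , ea , ew) with w ≟ b | w ≟ c
    ... | yes p | _ = inj₁ p
    ... | no _ | yes p = inj₂ (inj₁ p)
    ... | no p | no q = inj₂ (inj₂ (outside ew (Ed-≢ G e ∘ sym) p q (inj₁ (forth na (Ed-sym G e)))))
    covb : Cov₃ (FE G) b a c v
    covb w (e , ea , ew) with w ≟ a | w ≟ c
    ... | yes p | _ = inj₁ p
    ... | no _ | yes p = inj₂ (inj₁ p)
    ... | no p | no q = inj₂ (inj₂ (outside ew p (Ed-≢ G e ∘ sym) q (inj₂ (inj₁ (forth nb (Ed-sym G e))))))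
    covc : Cov₃ (FE G) c a b v
    covc w (e , ea , ew) with w ≟ a | w ≟ b
    ... | yes p | _ = inj₁ p
    ... | no _ | yes p = inj₂ (inj₁ p)
    ... | no p | no q = inj₂ (inj₂ (outside ew p q (Ed-≢ G e ∘ sym) (inj₂ (inj₂ (forth nc (Ed-sym G e))))))
    fz : ∀ {z} → Ev G z → Ed G' v z → FE G z v
    fz ez e = Ed-sym G (sub _ _ e) , ez , evs m
    eA = proj₁ (proj₂ AB)
    eB = proj₁ (proj₂ BC)
    eC = proj₂ (proj₂ BC)
    sw : ∀ {v p q r} → Cov₃ (FE G) v p q r → Cov₃ (FE G) v q p r
    sw h w e with h w e
    ... | inj₁ x = inj₂ (inj₁ x)
    ... | inj₂ (inj₁ x) = inj₁ x
    ... | inj₂ (inj₂ x) = inj₂ (inj₂ x)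
    finish : Two G' a b c v → ⊥
    finish (inj₁ (va , vb)) = nr a b c v (mkR₄ AB AC BC (fz eA va) (fz eB vb) (ne nc m ∘ sym) cova covb covc)
    finish (inj₂ (inj₁ (vb , vc))) = nr b c a v (mkR₄ BC (sm AB) (sm AC) (fz eB vb) (fz eC vc) (ne na m ∘ sym) (sw covb) (sw covc) cova)
    finish (inj₂ (inj₂ (va , vc))) = nr a c b v (mkR₄ AC AB (sm BC) (fz eA va) (fz eC vc) (ne nb m ∘ sym) (sw cova) covc covb)

  module Phase₁ (G : Graph N) (hst : Host (FE G)) (nx : NoExc G) (ih : IH G) where
    open Reduce G

    private
      F : Rel
      F = FE G

    star-cut : ∀ {x y v w} → F x y → F x v → F x w → (nz : All (x ≢_) (y ∷ v ∷ w ∷ [])) → Uq (y ∷ v ∷ w ∷ []) →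
      Cut G (togsG x (y ∷ v ∷ w ∷ []) nz G) (x ∷ y ∷ v ∷ w ∷ [])
    star-cut {x} {y} {v} {w} xy xv xw nz uq = record
      { untouched = record
        { same-par = λ n → par-togs-∉ x T₃ E nz (λ e → n (here e)) (n ∘ there)
        ; same-adj = λ n → togs-untouched x T₃ E (λ e → n (here e)) (n ∘ there) }
      ; evs = λ { (here refl) → proj₁ (proj₂ xy) ; (there k) → proj₂ (proj₂ (fe k)) }
      ; ods = λ { (here refl) → trans (par-togs-z x T₃ E nz) (cong (_xor true) (proj₁ (proj₂ xy)))
                ; (there k) → trans (par-togs-∈ x T₃ E nz (FE-≢ G (fe k) ∘ sym) uq k) (cong not (proj₂ (proj₂ (fe k)))) }
      ; sub = togs-⊆ G x T₃ uq (proj₁ ∘ fe) }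
      where
      T₃ = y ∷ v ∷ w ∷ []
      fe : ∀ {s} → s ∈ T₃ → F x s
      fe (here refl) = xy
      fe (there (here refl)) = xv
      fe (there (there (here refl))) = xw

    finish : ∀ {G' t} → Cut G G' t → ∀ {a b} → Ed G a b → adj G' a b ≡ false → NoExc G' → (∀ {L} → Dc (adj G') L → Dc E L) → Φ G
    finish {G'} cut e lost nx' red with ih G' (size-< G G' (Cut.sub cut) e lost) (Host-mono (Cut.FE-sub cut) hst) nx'
    ... | L , d , le = L , red d , le

    -- Afterwards `a`, `b`, `c` have no even neighbour. Only `v` could border on a new exceptional
    -- triangle, but its surviving edge to `b` would violate closedness.
    do₄ : ∀ {a b c v} → R₄ F a b c v → Φ G
    do₄ {a} {b} {c} {v} (mkR₄ ab ac bc av bv v≢c cova covb covc) =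
      -- `v`, whose degree in F is not bounded, takes the place in `R₃` that carries no degree
      -- condition.
      finish cut (proj₁ av) lost nx' (red₃ (mkR₃ av ab ac (FE-≢ G bv ∘ sym) v≢c (FE-≢ G bc) cova' (c , v , covb) (b , v , covc)))
      where
      T₃ = v ∷ b ∷ c ∷ []
      nz : All (a ≢_) T₃
      nz = FE-≢ G av ∷ FE-≢ G ab ∷ FE-≢ G ac ∷ []
      uq = uq₃ (FE-≢ G bv ∘ sym) v≢c (FE-≢ G bc)
      G' = togsG a T₃ nz G
      cut : Cut G G' (a ∷ T₃)
      cut = star-cut av ab ac nz uq
      open Cut cut
      lost : adj G' a v ≡ false
      lost = trans (togs-∈ a T₃ E (FE-≢ G av) uq (here refl)) (cong not (proj₁ av))
      cova' : Cov₃ F a v b c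
      cova' w e with cova w e
      ... | inj₁ p = inj₂ (inj₁ p)
      ... | inj₂ (inj₁ p) = inj₂ (inj₂ p)
      ... | inj₂ (inj₂ p) = inj₁ p
      nx' : NoExc G'
      nx' a₀ b₀ c₀ x = nx a₀ b₀ c₀ (Exc-back x na nb nc none)
        where
        open Exc x using () renaming (ab to ab₀; bc to bc₀; closed to closed₀)
        na = ev∉ (proj₁ (proj₂ ab₀))
        nb = ev∉ (proj₁ (proj₂ bc₀))
        nc = ev∉ (proj₂ (proj₂ bc₀))
        ne : ∀ {z} → ¬ z ∈ a ∷ T₃ → ∀ {w} → w ∈ a ∷ T₃ → w ≢ z
        ne n k refl = n k
        noF : ∀ {u z} → u ∈ a ∷ b ∷ c ∷ [] → Ev G' z → ¬ Ed G' u z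
        noF {u} {z} k ez e = ev∉ ez (inT (cov k))
          where
          fe : ∀ {u} → u ∈ a ∷ T₃ → Ed G' u z → F u z
          fe m e = sub _ _ e , evs m , trans (sym (same-par (ev∉ ez))) ez
          inT : z ≡ a ⊎ z ≡ b ⊎ z ≡ c ⊎ z ≡ v → z ∈ a ∷ T₃
          inT (inj₁ refl) = here refl
          inT (inj₂ (inj₁ refl)) = there (there (here refl))
          inT (inj₂ (inj₂ (inj₁ refl))) = there (there (there (here refl)))
          inT (inj₂ (inj₂ (inj₂ refl))) = there (here refl)
          cov : u ∈ a ∷ b ∷ c ∷ [] → z ≡ a ⊎ z ≡ b ⊎ z ≡ c ⊎ z ≡ v
          cov (here refl) with cova z (fe (here refl) e)
          ... | inj₁ p = inj₂ (inj₁ p)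
          ... | inj₂ (inj₁ p) = inj₂ (inj₂ (inj₁ p))
          ... | inj₂ (inj₂ p) = inj₂ (inj₂ (inj₂ p))
          cov (there (here refl)) with covb z (fe (there (there (here refl))) e)
          ... | inj₁ p = inj₁ p
          ... | inj₂ (inj₁ p) = inj₂ (inj₂ (inj₁ p))
          ... | inj₂ (inj₂ p) = inj₂ (inj₂ (inj₂ p))
          cov (there (there (here refl))) with covc z (fe (there (there (there (here refl)))) e)
          ... | inj₁ p = inj₁ p
          ... | inj₂ (inj₁ p) = inj₂ (inj₁ p)
          ... | inj₂ (inj₂ p) = inj₂ (inj₂ (inj₂ p))
        ea₀ = proj₁ (proj₂ ab₀)
        eb₀ = proj₁ (proj₂ bc₀)
        noTwo : ∀ {u} → u ∈ a ∷ b ∷ c ∷ [] → ¬ Two G' a₀ b₀ c₀ u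
        noTwo k (inj₁ (p , _)) = noF k ea₀ p
        noTwo k (inj₂ (inj₁ (p , _))) = noF k eb₀ p
        noTwo k (inj₂ (inj₂ (p , _))) = noF k ea₀ p
        vb' : Ed G' v b
        vb' = trans (togs-off a T₃ E (FE-≢ G av ∘ sym) (FE-≢ G ab ∘ sym)) (proj₁ (FE-sym G bv))
        none : ∀ {u} → u ∈ a ∷ T₃ → ¬ Two G' a₀ b₀ c₀ u
        none (here refl) = noTwo (here refl)
        none (there (there (here refl))) = noTwo (there (here refl))
        none (there (there (there (here refl)))) = noTwo (there (there (here refl)))
        none (there (here refl)) tw with closed₀ tw (ne na (there (here refl))) (ne nb (there (here refl))) (ne nc (there (here refl))) vb'
        ... | inj₂ tb = noTwo (there (here refl)) tb
        ... | inj₁ (inj₁ p) = ne na (there (there (here refl))) p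
        ... | inj₁ (inj₂ (inj₁ p)) = ne nb (there (there (here refl))) p
        ... | inj₁ (inj₂ (inj₂ p)) = ne nc (there (there (here refl))) p

    module _ (nr : ∀ a b c v → ¬ R₄ F a b c v) where

      do₁ : ∀ {x y} → R₁ F x y → Φ G
      do₁ {x} {y} r@((xy , ex , ey) , only) = finish cut xy (trans (tog-self x y E) (cong not xy)) (safe G G' cut hst nx nr) (red₁ r)
        where
        x≢y = Ed-≢ G xy
        G' = togG x y x≢y G
        cut : Cut G G' (x ∷ y ∷ [])
        cut = record
          { untouched = record
            { same-par = λ n → par-tog-other E x≢y (λ e → n (here e)) (λ e → n (there (here e)))
            ; same-adj = λ n → tog-untouched E (λ e → n (here e)) (λ e → n (there (here e))) }
          ; evs = λ { (here refl) → ex ; (there (here refl)) → ey }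
          ; ods = λ { (here refl) → trans (par-togˡ E x≢y) (cong not ex) ; (there (here refl)) → trans (par-togʳ E x≢y) (cong not ey) }
          ; sub = λ u v e → tog-⊆ G xy u v e }

      do₂ : ∀ {x y v u} → R₂ F x y v u → Φ G
      do₂ {x} {y} {v} {u} r@(mkR₂ (xy , ex , ey) (xv , _ , evv) (vu , _ , eu) y≢v u≢x y≢u covx covv) =
        finish cut xy (trans (tog-self x y E₁) (cong not E₁xy)) (safe G G' cut hst nx nr) (red₂ r)
        where
        x≢y = Ed-≢ G xy
        x≢v = Ed-≢ G xv
        v≢u = Ed-≢ G vu
        E₁ = tog v u E
        G₁ = togG v u v≢u G
        G' = togG x y x≢y G₁
        E₁xy : E₁ x y ≡ true
        E₁xy = trans (tog-other v u E (ε-falseˡ u (x≢v ∘ sym) (y≢v ∘ sym))) xy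
        t = x ∷ y ∷ v ∷ u ∷ []
        cut : Cut G G' t
        cut = record
          { untouched = record
            { same-par = λ n → trans (par-tog-other E₁ x≢y (λ e → n (here e)) (λ e → n (there (here e))))
                (par-tog-other E v≢u (λ e → n (there (there (here e)))) (λ e → n (there (there (there (here e))))))
            ; same-adj = λ n w → trans (tog-untouched E₁ (λ e → n (here e)) (λ e → n (there (here e))) w)
                (tog-untouched E (λ e → n (there (there (here e)))) (λ e → n (there (there (there (here e))))) w) }
          ; evs = λ { (here refl) → ex ; (there (here refl)) → ey ; (there (there (here refl))) → evv ; (there (there (there (here refl)))) → eu }
          ; ods = λ { (here refl) → trans (par-togˡ E₁ x≢y) (cong not (trans (par-tog-other E v≢u x≢v (u≢x ∘ sym)) ex))
                    ; (there (here refl)) → trans (par-togʳ E₁ x≢y) (cong not (trans (par-tog-other E v≢u y≢v y≢u) ey))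
                    ; (there (there (here refl))) → trans (par-tog-other E₁ x≢y (x≢v ∘ sym) (y≢v ∘ sym)) (trans (par-togˡ E v≢u) (cong not evv))
                    ; (there (there (there (here refl)))) → trans (par-tog-other E₁ x≢y u≢x (y≢u ∘ sym)) (trans (par-togʳ E v≢u) (cong not eu)) }
          ; sub = λ a b e → tog-⊆ G vu a b (tog-⊆ G₁ E₁xy a b e) }

      do₃ : ∀ {x y v w} → R₃ F x y v w → Φ G
      do₃ {x} {y} {v} {w} r@(mkR₃ xy xv xw y≢v y≢w v≢w covx cv cw) =
        finish cut (proj₁ xy) (trans (togs-∈ x T₃ E (FE-≢ G xy) uq (here refl)) (cong not (proj₁ xy))) (safe G (togsG x T₃ nz G) cut hst nx nr) (red₃ r)
        where
        T₃ = y ∷ v ∷ w ∷ []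
        nz : All (x ≢_) T₃
        nz = FE-≢ G xy ∷ FE-≢ G xv ∷ FE-≢ G xw ∷ []
        uq = uq₃ y≢v y≢w v≢w
        cut : Cut G (togsG x T₃ nz G) (x ∷ T₃)
        cut = star-cut xy xv xw nz uq

    R₄? : ∀ a b c v → Dec (R₄ F a b c v)
    R₄? a b c v = map′ (λ (p , q , r , s , t , u , x , y , z) → mkR₄ p q r s t u x y z)
        (λ (mkR₄ p q r s t u x y z) → p , q , r , s , t , u , x , y , z)
        (FE? G a b ×-dec FE? G a c ×-dec FE? G b c ×-dec FE? G a v ×-dec FE? G b v ×-dec ¬? (v ≟ c) ×-dec
         cov? a b c v ×-dec cov? b a c v ×-dec cov? c a b v)
      where
      cov? : ∀ v x p q → Dec (Cov₃ F v x p q)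
      cov? v x p q = all? λ w → FE? G v w →-dec ((w ≟ x) ⊎-dec ((w ≟ p) ⊎-dec (w ≟ q)))

    -- `R₄` has priority, since the other reductions are known to be safe only in its absence.
    phase₁ : (∃ λ x → ∃ λ y → R₁ F x y) ⊎ (∃ λ x → ∃ λ y → ∃ λ v → ∃ λ u → R₂ F x y v u) ⊎ (∃ λ x → ∃ λ y → ∃ λ v → ∃ λ w → R₃ F x y v w) → Φ G
    phase₁ cfg with any? (λ a → any? λ b → any? λ c → any? λ v → R₄? a b c v)
    phase₁ cfg | yes (_ , _ , _ , _ , r) = do₄ r
    phase₁ (inj₁ (_ , _ , r)) | no n = do₁ (λ a b c v r → n (a , b , c , v , r)) r
    phase₁ (inj₂ (inj₁ (_ , _ , _ , _ , r))) | no n = do₂ (λ a b c v r → n (a , b , c , v , r)) r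
    phase₁ (inj₂ (inj₂ (_ , _ , _ , _ , r))) | no n = do₃ (λ a b c v r → n (a , b , c , v , r)) r

-- Odd vertices whose even neighbours lie in one triangle

module _ {N : ℕ} where

  -- The counterpart of `Cut` for reductions around odd vertices, where touched vertices may also
  -- end up even. The three conditions keep `t` apart from every edge of the new F, so `t` neither
  -- meets nor borders on an exceptional triangle.
  record Local (G G' : Graph N) (t : List (Fin N)) : Set where
    field
      untouched : Untouched G G' t
      sub : ∀ u v → adj G' u v ≡ true → adj G u v ≡ true
      odd-t : ∀ {u} → u ∈ t → Od G u → ∀ w → Ed G' u w → Od G' w
      closed-t : ∀ {u} → u ∈ t → Ev G u → ∀ w → FE G u w → w ∈ t
      even-t : ∀ {u} → u ∈ t → Ev G' u → ∀ w → Ed G' u w → Od G' w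
    open Untouched untouched public

    FE∉ : ∀ {u v} → FE G' u v → ¬ u ∈ t
    FE∉ (e , p , q) m = Od≢Ev G' (even-t m p _ e) q

    FE-sub : ∀ {u v} → FE G' u v → FE G u v
    FE-sub {u} {v} f@(e , p , q) = sub u v e , trans (sym (same-par (FE∉ f))) p , trans (sym (same-par (FE∉ (FE-sym G' f)))) q

    no-exc : NoExc G → NoExc G'
    no-exc nx a b c x = nx a b c (Exc-back x (FE∉ ab) (FE∉ bc) (FE∉ (FE-sym G' bc)) none)
      where
      open Exc x
      noEd : ∀ {u z w} → u ∈ t → FE G' z w → ¬ Ed G' u z
      noEd {u} {z} m f e with par (adj G) u in pu
      ... | true = Od≢Ev G' (odd-t m pu z e) (proj₁ (proj₂ f))
      ... | false = FE∉ f (closed-t m pu z (sub u z e , pu , proj₁ (proj₂ (FE-sub f))))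
      none : ∀ {u} → u ∈ t → ¬ Two G' a b c u
      none m (inj₁ (p , _)) = noEd m ab p
      none m (inj₂ (inj₁ (p , _))) = noEd m bc p
      none m (inj₂ (inj₂ (p , _))) = noEd m ab p

  -- The parity of `z` is left open, because the configuration is also used after an edge from `z`
  -- to an odd vertex has been removed; hence `z` is listed among the possible even neighbours of
  -- the corners.
  record Corner (H : Graph N) (z a b c : Fin N) : Set where
    field
      ab : FE H a b
      bc : FE H b c
      ac : FE H a c
      za : Ed H z a
      zb : Ed H z b
      z≢c : z ≢ c
      covz : ∀ v → Ed H z v → v ∈ a ∷ b ∷ c ∷ [] ⊎ Od H v
      cova : ∀ v → Ed H a v → v ∈ z ∷ b ∷ c ∷ [] ⊎ Od H v
      covb : ∀ v → Ed H b v → v ∈ z ∷ a ∷ c ∷ [] ⊎ Od H v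
      covc : ∀ v → Ed H c v → v ∈ z ∷ a ∷ b ∷ [] ⊎ Od H v
    z≢a = Ed-≢ H za
    z≢b = Ed-≢ H zb
    a≢b = FE-≢ H ab
    b≢c = FE-≢ H bc
    a≢c = FE-≢ H ac
    ea = proj₁ (proj₂ ab)
    eb = proj₁ (proj₂ bc)
    ec = proj₂ (proj₂ bc)

  module _ {H : Graph N} {z a b c : Fin N} (co : Corner H z a b c) where
    open Corner co
    private
      E : Adj {N}
      E = adj H
      T₃ : List (Fin N)
      T₃ = a ∷ b ∷ c ∷ []

    nz₃ : All (z ≢_) (a ∷ b ∷ c ∷ [])
    nz₃ = z≢a ∷ z≢b ∷ z≢c ∷ []

    -- The flag tells whether `zc` is an edge. All three edges from `z` to the triangle are removed,
    -- or else `za` and the opposite side `bc`; either way exactly `z` and the three corners change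
    -- parity.
    stripG : Bool → Graph N
    stripG true = togsG z T₃ nz₃ H
    stripG false = togG b c b≢c (togG z a z≢a H)

    private
      uq : Uq T₃
      uq = Reduce.uq₃ H a≢b a≢c b≢c

    strip-untouched : ∀ s → Untouched H (stripG s) (z ∷ T₃)
    strip-untouched true = record
      { same-par = λ n → par-togs-∉ z T₃ E nz₃ (λ e → n (here e)) (n ∘ there)
      ; same-adj = λ n → togs-untouched z T₃ E (λ e → n (here e)) (n ∘ there) }
    strip-untouched false = record
      { same-par = λ n → trans (par-tog-other (tog z a E) b≢c (λ e → n (there (there (here e)))) (λ e → n (there (there (there (here e))))))
          (par-tog-other E z≢a (λ e → n (here e)) (λ e → n (there (here e))))
      ; same-adj = λ n w → trans (tog-untouched (tog z a E) (λ e → n (there (there (here e)))) (λ e → n (there (there (there (here e))))) w)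
          (tog-untouched E (λ e → n (here e)) (λ e → n (there (here e))) w) }

    strip-par : ∀ s {u} → u ∈ z ∷ T₃ → par (adj (stripG s)) u ≡ not (par E u)
    strip-par true (here refl) = trans (par-togs-z z T₃ E nz₃) (l (par E z))
      where
      l : ∀ b → b xor true ≡ not b
      l true = refl
      l false = refl
    strip-par true (there m) = par-togs-∈ z T₃ E nz₃ (λ { refl → neq m }) uq m
      where
      neq : z ∈ T₃ → ⊥
      neq (here e) = z≢a e
      neq (there (here e)) = z≢b e
      neq (there (there (here e))) = z≢c e
    strip-par false (here refl) = trans (par-tog-other (tog z a E) b≢c z≢b z≢c) (par-togˡ E z≢a)
    strip-par false (there (here refl)) = trans (par-tog-other (tog z a E) b≢c a≢b a≢c) (par-togʳ E z≢a)
    strip-par false (there (there (here refl))) = trans (par-togˡ (tog z a E) b≢c) (cong not (par-tog-other E z≢a (z≢b ∘ sym) (a≢b ∘ sym)))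
    strip-par false (there (there (there (here refl)))) = trans (par-togʳ (tog z a E) b≢c) (cong not (par-tog-other E z≢a (z≢c ∘ sym) (a≢c ∘ sym)))

    private
      bc₁ : tog z a E b c ≡ true
      bc₁ = trans (tog-other z a E (ε-falseˡ a z≢b z≢c)) (proj₁ bc)

    strip-sub : ∀ s → adj H z c ≡ s → ∀ u v → adj (stripG s) u v ≡ true → adj H u v ≡ true
    strip-sub true zc = togs-⊆ H z T₃ uq λ { (here refl) → za ; (there (here refl)) → zb ; (there (there (here refl))) → zc }
    strip-sub false zc u v e = tog-⊆ H za u v (tog-⊆ (togG z a z≢a H) bc₁ u v e)

    strip-lost : ∀ s → adj (stripG s) z a ≡ false
    strip-lost true = trans (togs-∈ z T₃ E z≢a uq (here refl)) (cong not za)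
    strip-lost false = trans (tog-other b c (tog z a E) (ε-falseˡ c (z≢b ∘ sym) (a≢b ∘ sym))) (trans (tog-self z a E) (cong not za))

    private
      even-cov : ∀ {l} {v} → v ∈ l ⊎ Od H v → Ev H v → v ∈ l
      even-cov (inj₁ m) e = m
      even-cov (inj₂ o) e = ⊥-elim (Od≢Ev H o e)

    -- `z` may be even in the stripped graph, hence the hypothesis on its token. With three edges at
    -- `z` the count is that of `R₃`, the obstacles being the two other corners. Otherwise `bc` is
    -- inserted at `b` first, which gives `b` the token required when `za` follows at `z`.
    unstrip : ∀ s → adj H z c ≡ s → ∀ {L} (d : Dc (adj (stripG s)) L) → 1 ≤ tk d z → Σ (Dc E L) λ d' → 2 ≤ tk d' z
    unstrip true zc {L} d tz = conclude (Reduce.add₃ H {x = z} d uq hs h)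
      where
      odd₃ : ∀ {s} → s ∈ T₃ → par (togs z T₃ E) s ≡ true
      odd₃ m@(here refl) = trans (strip-par true (there m)) (cong not ea)
      odd₃ m@(there (here refl)) = trans (strip-par true (there m)) (cong not eb)
      odd₃ m@(there (there (here refl))) = trans (strip-par true (there m)) (cong not ec)
      off : ∀ {s} → s ∈ T₃ → z ≢ s × Ed H z s
      off (here refl) = z≢a , za
      off (there (here refl)) = z≢b , zb
      off (there (there (here refl))) = z≢c , zc
      hs : ∀ {s} → s ∈ T₃ → z ≢ s × togs z T₃ E z s ≡ false × 1 ≤ tk d s
      hs m = proj₁ (off m) , trans (togs-∈ z T₃ E (proj₁ (off m)) uq m) (cong not (proj₂ (off m))) , odd⇒tk d (odd₃ m)
      h : ∀ u → togs z T₃ E z u ≡ true → par (togs z T₃ E) u ≡ false → 1 ≤ tk d u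
      h u e p with z ≟ u | mem? u T₃
      ... | yes refl | _ = tz
      ... | no n | yes m = contradiction (trans (sym (odd₃ m)) p) λ ()
      ... | no n | no m with covz u (strip-sub true zc z u e)
      ... | inj₁ k = contradiction k m
      ... | inj₂ o = contradiction (trans (sym o) (trans (sym (par-togs-∉ z T₃ E nz₃ (n ∘ sym) m)) p)) λ ()
      conclude : Reduce.Add₃ H (togs z T₃ E) z a b c d → Σ (Dc E L) λ d' → 2 ≤ tk d' z
      conclude (Reduce.all₃ d' tx) = dc-≐ (λ u v → trans (togs-cong z T₃ (togs-↭ z E (↭-reflexive (sym (++-identityʳ T₃)))) u v) (togs-cancel z T₃ [] E u v)) d' ,
          subst (2 ≤_) (sym tx) (≤-trans (s≤s (s≤s z≤n)) (m≤n+m 3 (tk d z)))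
      conclude (Reduce.two₃ r A isr perm d' tx) = finish isr
        where
        d₁ : Dc (tog z r E) L
        d₁ = dc-≐ (λ u v → trans (togs-cong z A (togs-↭ z E perm) u v) (togs-cancel z A (r ∷ []) E u v)) d'
        three : 3 ≤ tk d₁ z
        three = subst (3 ≤_) (sym tx) (+-monoˡ-≤ 2 tz)
        fin : ∀ p q → Ed H z r → (∀ v → Ed H r v → v ∈ z ∷ p ∷ q ∷ [] ⊎ Od H v) → Σ (Dc E L) λ d' → 2 ≤ tk d' z
        fin p q e cv with Reduce.last-edge H d₁ e (p ∷ q ∷ []) (λ w n rw ew → inj₂ (tl n (even-cov (cv w rw) ew))) three
          where
          tl : ∀ {w} → w ≢ z → w ∈ z ∷ p ∷ q ∷ [] → w ∈ p ∷ q ∷ []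
          tl n (here e) = contradiction e n
          tl n (there m) = m
        ... | d₂ , t = d₂ , +-cancelʳ-≤ 1 2 _ (≤-trans three (≤-trans (m≤m+n (tk d₁ z) (δ r z)) (≤-reflexive (trans (sym (t z)) (+congʳ (δ-refl z))))))
        finish : r ≡ b ⊎ r ≡ c → Σ (Dc E L) λ d' → 2 ≤ tk d' z
        finish (inj₁ refl) = fin a c zb covb
        finish (inj₂ refl) = fin a b zc covc
    unstrip false zc {L} d tz = proj₁ done , two
      where
      E₁ = tog z a E
      E₂ = tog b c E₁
      st : ∀ {u} → u ∈ z ∷ T₃ → par E₂ u ≡ not (par E u)
      st = strip-par false
      s₁ : Σ (Dc (tog b c E₂) L) λ d' → ∀ w → tk d' w + δ c w ≡ tk d w + δ b w
      s₁ = add1 d [] b≢c (trans (tog-self b c E₁) (cong not bc₁)) zs (odd⇒tk d (trans (st (there (there (there (here refl))))) (cong not ec)))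
        where
        zs : ∀ v → E₂ b v ≡ true → par E₂ v ≡ false → 1 ≤ tk d v ⊎ v ∈ []
        zs v e p with covb v (strip-sub false zc b v e)
        ... | inj₁ (here refl) = inj₁ tz
        ... | inj₁ (there (here refl)) = contradiction (trans (sym p) (trans (st (there (here refl))) (cong not ea))) λ ()
        ... | inj₁ (there (there (here refl))) = contradiction (trans (sym e) (trans (tog-self b c E₁) (cong not bc₁))) λ ()
        ... | inj₂ o with mem? v (z ∷ T₃)
        ... | no n = contradiction (trans (sym o) (trans (sym (Untouched.same-par (strip-untouched false) n)) p)) λ ()
        ... | yes (here refl) = inj₁ tz
        ... | yes (there (here refl)) = ⊥-elim (Od≢Ev H o ea)
        ... | yes (there (there (here refl))) = ⊥-elim (Od≢Ev H o eb)
        ... | yes (there (there (there (here refl)))) = ⊥-elim (Od≢Ev H o ec)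
      d₁ : Dc E₁ L
      d₁ = dc-≐ (tog-tog b c E₁) (proj₁ s₁)
      tkb : 1 ≤ tk d₁ b
      tkb = subst (1 ≤_) (trans (sym (proj₂ s₁ b)) (trans (+congʳ (δ-≢ (b≢c ∘ sym))) (+-identityʳ _))) (subst (λ k → 1 ≤ tk d b + k) (sym (δ-refl b)) (m≤n+m 1 _))
      tkz : 1 ≤ tk d₁ z
      tkz = subst (1 ≤_) (sym (trans (sym (trans (+congʳ (δ-≢ (z≢c ∘ sym))) (+-identityʳ _))) (trans (proj₂ s₁ z) (trans (+congʳ (δ-≢ (z≢b ∘ sym))) (+-identityʳ _))))) tz
      s₂ : Σ (Dc (tog z a E₁) L) λ d' → ∀ w → tk d' w + δ a w ≡ tk d₁ w + δ z w
      s₂ = add1 d₁ [] z≢a (trans (tog-self z a E) (cong not za)) zs (odd⇒tk d₁ (trans (par-togʳ E z≢a) (cong not ea)))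
        where
        zs : ∀ v → E₁ z v ≡ true → par E₁ v ≡ false → 1 ≤ tk d₁ v ⊎ v ∈ []
        zs v e p with covz v (tog-⊆ H za z v e)
        ... | inj₁ (here refl) = contradiction (trans (sym e) (trans (tog-self z a E) (cong not za))) λ ()
        ... | inj₁ (there (here refl)) = inj₁ tkb
        ... | inj₁ (there (there (here refl))) = contradiction (trans (sym (tog-⊆ H za z c e)) zc) λ ()
        ... | inj₂ o with v ≟ z | v ≟ a
        ... | yes refl | _ = inj₁ tkz
        ... | no _ | yes refl = ⊥-elim (Od≢Ev H o ea)
        ... | no n | no m = contradiction (trans (sym o) (trans (sym (par-tog-other E z≢a n m)) p)) λ ()
      done : Σ (Dc E L) λ d' → ∀ w → tk d' w + δ a w ≡ tk d₁ w + δ z w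
      done = dc-≐ (tog-tog z a E) (proj₁ s₂) , proj₂ s₂
      two : 2 ≤ tk (proj₁ done) z
      two = subst (2 ≤_) (trans (+-comm 1 _) (trans (+congʳ (sym (δ-refl z))) (trans (sym (proj₂ done z)) (trans (+congʳ (δ-≢ (z≢a ∘ sym))) (+-identityʳ _))))) (s≤s tkz)

module _ {N : ℕ} (G : Graph N) where

  record Alone (z a b c : Fin N) : Set where
    field
      tri : IsoTri (FE G) a b c
      zodd : Od G z
      za : Ed G z a
      zb : Ed G z b
      only : ∀ e → Ed G z e → Ev G e → e ∈ a ∷ b ∷ c ∷ []
    open IsoTri tri public
    ea = proj₁ (proj₂ ab)
    eb = proj₁ (proj₂ bc)
    ec = proj₂ (proj₂ bc)

    even-corner : ∀ {u} → u ∈ a ∷ b ∷ c ∷ [] → Ev G u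
    even-corner (here refl) = ea
    even-corner (there (here refl)) = eb
    even-corner (there (there (here refl))) = ec

    corner-closed : ∀ {u} → u ∈ a ∷ b ∷ c ∷ [] → ∀ w → FE G u w → w ∈ a ∷ b ∷ c ∷ []
    corner-closed (here refl) w f = lem (cova w f)
      where
      lem : w ≡ b ⊎ w ≡ c → w ∈ a ∷ b ∷ c ∷ []
      lem (inj₁ e) = there (here e)
      lem (inj₂ e) = there (there (here e))
    corner-closed (there (here refl)) w f = lem (covb w f)
      where
      lem : w ≡ a ⊎ w ≡ c → w ∈ a ∷ b ∷ c ∷ []
      lem (inj₁ e) = here e
      lem (inj₂ e) = there (there (here e))
    corner-closed (there (there (here refl))) w f = lem (covc w f)
      where
      lem : w ≡ a ⊎ w ≡ b → w ∈ a ∷ b ∷ c ∷ []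
      lem (inj₁ e) = here e
      lem (inj₂ e) = there (here e)

    z∉ : ¬ z ∈ a ∷ b ∷ c ∷ []
    z∉ m = Od≢Ev G zodd (even-corner m)

  corner : ∀ {z a b c} (al : Alone z a b c) (H : Graph N) {t} → Untouched G H t → (∀ u v → Ed H u v → Ed G u v) →
    (∀ {u} → u ∈ a ∷ b ∷ c ∷ [] → ¬ u ∈ t) → (∀ v → v ∈ t → ¬ Ed H z v) →
    (∀ {u} v → u ∈ a ∷ b ∷ c ∷ [] → v ∈ t → v ≢ z → ¬ Ed G u v) → Corner H z a b c
  corner {z} {a} {b} {c} al H {t} un sub out nz na = record
    { ab = keep (here refl) (there (here refl)) ab
    ; bc = keep (there (here refl)) (there (there (here refl))) bc
    ; ac = keep (here refl) (there (there (here refl))) ac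
    ; za = forth (out (here refl)) za
    ; zb = forth (out (there (here refl))) zb
    ; z≢c = λ { refl → z∉ (there (there (here refl))) }
    ; covz = covz'
    ; cova = λ v e → sel (here refl) (λ { (here e) n → contradiction e n ; (there (here e)) _ → there (here e) ; (there (there (here e))) _ → there (there (here e)) }) v e
    ; covb = λ v e → sel (there (here refl)) (λ { (there (here e)) n → contradiction e n ; (here e) _ → there (here e) ; (there (there (here e))) _ → there (there (here e)) }) v e
    ; covc = λ v e → sel (there (there (here refl))) (λ { (there (there (here e))) n → contradiction e n ; (here e) _ → there (here e) ; (there (here e)) _ → there (there (here e)) }) v e }
    where
    open Alone al
    open Untouched un
    keep : ∀ {u v} → u ∈ a ∷ b ∷ c ∷ [] → v ∈ a ∷ b ∷ c ∷ [] → FE G u v → FE H u v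
    keep m k (e , p , q) = forth (out k) e , trans (same-par (out m)) p , trans (same-par (out k)) q
    covz' : ∀ v → Ed H z v → v ∈ a ∷ b ∷ c ∷ [] ⊎ Od H v
    covz' v e = go (par (adj G) v) refl
      where
      go : ∀ p → par (adj G) v ≡ p → v ∈ a ∷ b ∷ c ∷ [] ⊎ Od H v
      go true p = inj₂ (trans (same-par (λ m → nz v m e)) p)
      go false p = inj₁ (only v (sub z v e) p)
    sel : ∀ {u l} → u ∈ a ∷ b ∷ c ∷ [] → (∀ {v} → v ∈ a ∷ b ∷ c ∷ [] → v ≢ u → v ∈ z ∷ l) → ∀ v → Ed H u v → v ∈ z ∷ l ⊎ Od H v
    sel {u} {l} m f v e = go (par (adj G) v) refl (v ≟ z)
      where
      go : ∀ p → par (adj G) v ≡ p → Dec (v ≡ z) → v ∈ z ∷ l ⊎ Od H v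
      go _ _ (yes q) = inj₁ (here q)
      go true p (no n) = inj₂ (trans (same-par (λ k → na v m k n (sub u v e))) p)
      go false p (no n) = inj₁ (f (corner-closed m v (sub u v e , even-corner m , p)) (Ed-≢ H e ∘ sym))

  -- Preparation of a second odd vertex: nothing if it has no even neighbour, otherwise its own
  -- triangle is stripped. This may make `y` even, so `restore` asks for a token at `y`, to be
  -- supplied by `join`.
  record Side (y : Fin N) (Gy : Graph N) (ty : List (Fin N)) : Set where
    field
      untouched : Untouched G Gy (y ∷ ty)
      sub : ∀ u v → Ed Gy u v → Ed G u v
      nbr : ∀ w → Ed Gy y w → Ev G w → Od Gy w
      evens : ∀ {u} → u ∈ ty → Ev G u
      odds : ∀ {u} → u ∈ ty → Od Gy u
      closed : ∀ {u} → u ∈ ty → ∀ w → FE G u w → w ∈ ty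
      restore : ∀ {L} (d : Dc (adj Gy) L) → 1 ≤ tk d y → Dc (adj G) L

  self-side : ∀ {y} → (∀ e → Ed G y e → ¬ Ev G e) → Side y G []
  self-side {y} none = record
    { untouched = record { same-par = λ _ → refl ; same-adj = λ _ _ → refl }
    ; sub = λ _ _ e → e
    ; nbr = λ w e p → contradiction p (none w e)
    ; evens = λ () ; odds = λ () ; closed = λ () ; restore = λ d _ → d }

  strip-side : ∀ {y a b c} (al : Alone y a b c) → ∃ λ Gy → Side y Gy (a ∷ b ∷ c ∷ [])
  strip-side {y} {a} {b} {c} al = stripG co s , record
    { untouched = strip-untouched co s
    ; sub = strip-sub co s refl
    ; nbr = λ w e p → trans (strip-par co s (there (only w (strip-sub co s refl y w e) p))) (cong not p)
    ; evens = even-corner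
    ; odds = λ m → trans (strip-par co s (there m)) (cong not (even-corner m))
    ; closed = corner-closed
    ; restore = λ d h → proj₁ (unstrip co s refl d h) }
    where
    open Alone al
    co : Corner G y a b c
    co = corner al G {[]} (record { same-par = λ _ → refl ; same-adj = λ _ _ → refl }) (λ _ _ e → e) (λ _ ()) (λ _ ()) (λ _ _ ())
    s = adj G y c

  module Join (hst : Host (FE G)) (nx : NoExc G) (ih : IH G) where

    -- Without the edge `zy` the vertex `z` is even, so its token has to come from undoing the strip
    -- at `z`. Inserting `zy` at `y`, whose neighbours in `H` are all odd, passes this token to `y`,
    -- where it restores the other side.
    join : ∀ {z a b c y Gy ty} → Alone z a b c → Ed G z y → Od G y → (∀ {u} → u ∈ a ∷ b ∷ c ∷ [] → ¬ Ed G u y) →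
      Side y Gy ty → (∀ {u} → u ∈ ty → ¬ u ∈ a ∷ b ∷ c ∷ []) → Φ G
    join {z} {a} {b} {c} {y} {Gy} {ty} al zy yodd far side dis = L , restore d₃ tky , le
      where
      open Alone al
      module S = Side side
      open Side side using (restore)
      T₃ = a ∷ b ∷ c ∷ []
      z≢y = Ed-≢ G zy
      z∉ty : ¬ z ∈ ty
      z∉ty m = Od≢Ev G zodd (S.evens m)
      z∉y : ¬ z ∈ y ∷ ty
      z∉y (here e) = z≢y e
      z∉y (there m) = z∉ty m
      y∉ty : ¬ y ∈ ty
      y∉ty m = Od≢Ev G yodd (S.evens m)
      y∉₃ : ¬ y ∈ T₃
      y∉₃ m = Od≢Ev G yodd (even-corner m)
      zy' : Ed Gy z y
      zy' = trans (Untouched.same-adj S.untouched z∉y y) zy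
      H : Graph N
      H = togG z y z≢y Gy
      E' = adj Gy
      Hsub : ∀ u v → Ed H u v → Ed G u v
      Hsub u v e = S.sub u v (tog-⊆ Gy zy' u v e)
      Hzy : adj H z y ≡ false
      Hzy = trans (tog-self z y E') (cong not zy')
      t = z ∷ y ∷ ty
      unH : Untouched G H t
      unH = record
        { same-par = λ n → trans (par-tog-other E' z≢y (λ e → n (here e)) (λ e → n (there (here e)))) (Untouched.same-par S.untouched (n ∘ there))
        ; same-adj = λ n w → trans (tog-untouched E' (λ e → n (here e)) (λ e → n (there (here e))) w) (Untouched.same-adj S.untouched (n ∘ there) w) }
      out : ∀ {u} → u ∈ T₃ → ¬ u ∈ t
      out m (here refl) = z∉ m
      out m (there (here refl)) = y∉₃ m
      out m (there (there k)) = dis k m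
      nzt : ∀ v → v ∈ t → ¬ Ed H z v
      nzt v (here refl) e = Ed-≢ H e refl
      nzt v (there (here refl)) e = true≢false (trans (sym e) Hzy)
      nzt v (there (there k)) e = dis k (only v (Hsub z v e) (S.evens k))
      nat : ∀ {u} v → u ∈ T₃ → v ∈ t → v ≢ z → ¬ Ed G u v
      nat v m (here e) n _ = n e
      nat v m (there (here refl)) n e = far m e
      nat v m (there (there k)) n e = dis k (corner-closed m v (e , even-corner m , S.evens k))
      co : Corner H z a b c
      co = corner al H unH Hsub out nzt nat
      s = adj H z c
      G' = stripG co s
      G'sub : ∀ u v → Ed G' u v → Ed H u v
      G'sub = strip-sub co s refl
      all-t = z ∷ y ∷ a ∷ b ∷ c ∷ ty
      in-t : ∀ {u} → ¬ u ∈ all-t → ¬ u ∈ t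
      in-t n (here e) = n (here e)
      in-t n (there (here e)) = n (there (here e))
      in-t n (there (there k)) = n (there (there (there (there (there k)))))
      in-z₃ : ∀ {u} → ¬ u ∈ all-t → ¬ u ∈ z ∷ T₃
      in-z₃ n (here e) = n (here e)
      in-z₃ n (there (here e)) = n (there (there (here e)))
      in-z₃ n (there (there (here e))) = n (there (there (there (here e))))
      in-z₃ n (there (there (there (here e)))) = n (there (there (there (there (here e)))))
      un' : Untouched G G' all-t
      un' = record
        { same-par = λ n → trans (Untouched.same-par (strip-untouched co s) (in-z₃ n)) (Untouched.same-par unH (in-t n))
        ; same-adj = λ n w → trans (Untouched.same-adj (strip-untouched co s) (in-z₃ n) w) (Untouched.same-adj unH (in-t n) w) }
      odd₃ : ∀ {u} → u ∈ T₃ → Od G' u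
      odd₃ m = trans (strip-par co s (there m)) (cong not (trans (Untouched.same-par unH (out m)) (even-corner m)))
      oddty : ∀ {u} → u ∈ ty → Od G' u
      oddty {u} m = trans (Untouched.same-par (strip-untouched co s) n) (trans (par-tog-other E' z≢y (λ { refl → z∉ty m }) (λ { refl → y∉ty m })) (S.odds m))
        where
        n : ¬ u ∈ z ∷ T₃
        n (here refl) = z∉ty m
        n (there k) = dis m k
      odd-other : ∀ {w} → Od G w → w ≢ z → w ≢ y → Od G' w
      odd-other {w} o p q = trans (Untouched.same-par un' n) o
        where
        n : ¬ w ∈ all-t
        n (here e) = p e
        n (there (here e)) = q e
        n (there (there (here e))) = Od≢Ev G o (even-corner (here e))
        n (there (there (there (here e)))) = Od≢Ev G o (even-corner (there (here e)))
        n (there (there (there (there (here e))))) = Od≢Ev G o (even-corner (there (there (here e))))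
        n (there (there (there (there (there k))))) = Od≢Ev G o (S.evens k)
      nbrz : ∀ w → Ed G' z w → Od G' w
      nbrz w e = go (par (adj G) w) refl
        where
        go : ∀ p → par (adj G) w ≡ p → Od G' w
        go false p = odd₃ (only w (Hsub z w (G'sub z w e)) p)
        go true p = odd-other p (Ed-≢ G' e ∘ sym) λ { refl → true≢false (trans (sym (G'sub z w e)) Hzy) }
      Hyz : adj H y z ≡ false
      Hyz = trans (Graph.sym H y z) Hzy
      evenH-nbr : ∀ w → Ed H y w → Od H w
      evenH-nbr w e = go (par (adj G) w) refl
        where
        w≢z : w ≢ z
        w≢z refl = true≢false (trans (sym e) Hyz)
        w≢y : w ≢ y
        w≢y refl = Ed-≢ H e refl
        go : ∀ p → par (adj G) w ≡ p → Od H w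
        go false p = trans (par-tog-other E' z≢y w≢z w≢y) (S.nbr w (tog-⊆ Gy zy' y w e) p)
        go true p = trans (Untouched.same-par unH n) p
          where
          n : ¬ w ∈ t
          n (here e) = w≢z e
          n (there (here e)) = w≢y e
          n (there (there k)) = Od≢Ev G p (S.evens k)
      nbry : ∀ w → Ed G' y w → Od G' w
      nbry w e = go (mem? w (z ∷ T₃))
        where
        go : Dec (w ∈ z ∷ T₃) → Od G' w
        go (yes (here refl)) = ⊥-elim (true≢false (trans (sym (G'sub y w e)) Hyz))
        go (yes (there m)) = odd₃ m
        go (no n) = trans (Untouched.same-par (strip-untouched co s) n) (evenH-nbr w (G'sub y w e))
      loc : Local G G' all-t
      loc = record
        { untouched = un'
        ; sub = λ u v e → Hsub u v (G'sub u v e)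
        ; odd-t = λ { (here refl) _ → nbrz ; (there (here refl)) _ → nbry
                    ; (there (there (here refl))) o → ⊥-elim (Od≢Ev G o ea)
                    ; (there (there (there (here refl)))) o → ⊥-elim (Od≢Ev G o eb)
                    ; (there (there (there (there (here refl))))) o → ⊥-elim (Od≢Ev G o ec)
                    ; (there (there (there (there (there k))))) o → ⊥-elim (Od≢Ev G o (S.evens k)) }
        ; closed-t = cl
        ; even-t = λ { (here refl) _ → nbrz ; (there (here refl)) _ → nbry
                    ; (there (there (here refl))) o → ⊥-elim (Od≢Ev G' (odd₃ (here refl)) o)
                    ; (there (there (there (here refl)))) o → ⊥-elim (Od≢Ev G' (odd₃ (there (here refl))) o)
                    ; (there (there (there (there (here refl))))) o → ⊥-elim (Od≢Ev G' (odd₃ (there (there (here refl)))) o)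
                    ; (there (there (there (there (there k))))) o → ⊥-elim (Od≢Ev G' (oddty k) o) } }
        where
        inj₃ : ∀ {w} → w ∈ T₃ → w ∈ all-t
        inj₃ (here e) = there (there (here e))
        inj₃ (there (here e)) = there (there (there (here e)))
        inj₃ (there (there (here e))) = there (there (there (there (here e))))
        cl : ∀ {u} → u ∈ all-t → Ev G u → ∀ w → FE G u w → w ∈ all-t
        cl (here refl) e = ⊥-elim (Od≢Ev G zodd e)
        cl (there (here refl)) e = ⊥-elim (Od≢Ev G yodd e)
        cl (there (there (here refl))) e w f = inj₃ (corner-closed (here refl) w f)
        cl (there (there (there (here refl)))) e w f = inj₃ (corner-closed (there (here refl)) w f)
        cl (there (there (there (there (here refl))))) e w f = inj₃ (corner-closed (there (there (here refl))) w f)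
        cl (there (there (there (there (there k))))) e w f = there (there (there (there (there (S.closed k w f)))))
      use : Φ G'
      use = ih G' (size-< G G' (λ u v e → Hsub u v (G'sub u v e)) za (strip-lost co s)) (Host-mono (Local.FE-sub loc) hst) (Local.no-exc loc nx)
      L = proj₁ use
      le = proj₂ (proj₂ use)
      d : Dc (adj G') L
      d = proj₁ (proj₂ use)
      zpar : par (adj G') z ≡ true
      zpar = trans (strip-par co s (here refl)) (cong not (trans (par-togˡ E' z≢y) (cong not (trans (Untouched.same-par S.untouched z∉y) zodd))))
      st = unstrip co s refl d (odd⇒tk d zpar)
      d₁ : Dc (adj H) L
      d₁ = proj₁ st
      s₂ : Σ (Dc (tog y z (adj H)) L) λ d' → ∀ v → tk d' v + δ z v ≡ tk d₁ v + δ y v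
      s₂ = add1 d₁ [] (z≢y ∘ sym) Hyz (λ v e p → contradiction (trans (sym (evenH-nbr v e)) p) λ ()) (≤-trans (s≤s z≤n) (proj₂ st))
      d₃ : Dc (adj Gy) L
      d₃ = dc-≐ (λ u v → trans (tog-swap y z (adj H) u v) (tog-tog z y E' u v)) (proj₁ s₂)
      tky : 1 ≤ tk d₃ y
      tky = subst (1 ≤_) (trans (sym (proj₂ s₂ y)) (trans (+congʳ (δ-≢ z≢y)) (+-identityʳ _))) (subst (λ k → 1 ≤ tk d₁ y + k) (sym (δ-refl y)) (m≤n+m 1 _))

-- Reduction at an odd vertex

module _ {A : Set} where

  ∑-mono-∈ : ∀ (xs : List A) {f g} → (∀ {x} → x ∈ xs → f x ≤ g x) → ∑ xs f ≤ ∑ xs g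
  ∑-mono-∈ [] e = z≤n
  ∑-mono-∈ (x ∷ xs) e = +-mono-≤ (e (here refl)) (∑-mono-∈ xs (e ∘ there))

  ∈-∑ : ∀ {xs : List A} {x} f → x ∈ xs → f x ≤ ∑ xs f
  ∈-∑ {x = x} f (here refl) = m≤m+n (f x) _
  ∈-∑ {xs = y ∷ xs} f (there m) = ≤-trans (∈-∑ f m) (m≤n+m _ (f y))

  ∈-flatˡ : ∀ {x y : A} {ps} → (x , y) ∈ ps → x ∈ flat ps
  ∈-flatˡ (here refl) = here refl
  ∈-flatˡ (there m) = there (there (∈-flatˡ m))

  ∈-flatʳ : ∀ {x y : A} {ps} → (x , y) ∈ ps → y ∈ flat ps
  ∈-flatʳ (here refl) = there (here refl)
  ∈-flatʳ (there m) = there (there (∈-flatʳ m))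

  ∈-flat : ∀ {x : A} ps → x ∈ flat ps → ∃ λ p → p ∈ ps × (x ≡ proj₁ p ⊎ x ≡ proj₂ p)
  ∈-flat ((a , b) ∷ ps) (here e) = (a , b) , here refl , inj₁ e
  ∈-flat ((a , b) ∷ ps) (there (here e)) = (a , b) , here refl , inj₂ e
  ∈-flat ((a , b) ∷ ps) (there (there m)) with ∈-flat ps m
  ... | p , k , e = p , there k , e

  length-flat : ∀ (ps : List (A × A)) → length (flat ps) ≡ length ps + length ps
  length-flat [] = refl
  length-flat (_ ∷ ps) = cong suc (trans (cong suc (length-flat ps)) (sym (+-suc (length ps) (length ps))))

δ-sym : ∀ {N} (x y : Fin N) → δ x y ≡ δ y x
δ-sym x y with x ≟ y | y ≟ x
... | yes _ | yes _ = refl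
... | no _ | no _ = refl
... | yes p | no q = contradiction (sym p) q
... | no p | yes q = contradiction (sym q) p

module _ {N : ℕ} where

  cnt-∈∉ : ∀ {A B W : List (Fin N)} {v} → (∀ v → cnt A v + cnt B v ≤ cnt W v) → Uq W → v ∈ A → ¬ v ∈ B
  cnt-∈∉ {A} {B} {v = v} h u m k = contradiction (≤-trans (+-mono-≤ (cnt-∈ m) (cnt-∈ k)) (≤-trans (h v) (u v))) λ { (s≤s ()) }

  -- The even neighbours of an odd vertex z: isolated ones (lw), and triangles of which one or
  -- two (lt), two (h2) or three (h3) corners are joined to z. The edges from z to tsOf and the
  -- edges in bcOf are removed.
  data It : Set where
    lw : Fin N → It
    lt h2 h3 : Fin N → Fin N → Fin N → It

  -- `lightOf` gives the ends that meet at most one obstacle when their edge to `z` comes last: an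
  -- isolated vertex meets none, and in a triangle `lt` the corner `b` has a token by then.
  tsOf vsOf lightOf : It → List (Fin N)
  tsOf (lw e) = e ∷ []
  tsOf (lt a b c) = a ∷ []
  tsOf (h2 a b c) = a ∷ b ∷ []
  tsOf (h3 a b c) = a ∷ b ∷ c ∷ []
  vsOf (lw e) = e ∷ []
  vsOf (lt a b c) = a ∷ b ∷ c ∷ []
  vsOf (h2 a b c) = a ∷ b ∷ c ∷ []
  vsOf (h3 a b c) = a ∷ b ∷ c ∷ []
  lightOf (lw e) = e ∷ []
  lightOf (lt a b c) = a ∷ []
  lightOf _ = []

  bcOf : It → List (Fin N × Fin N)
  bcOf (lt a b c) = (b , c) ∷ []
  bcOf _ = []

  -- Counters for `blocked`: `ν` is the number of single edges that an item forces there, `η` marks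
  -- the items `h2`, which force none.
  ν η : It → ℕ
  ν (h2 _ _ _) = 0
  ν _ = 1
  η (h2 _ _ _) = 1
  η _ = 0

  collect : ∀ {A : Set} → (It → List A) → List It → List A
  collect f [] = []
  collect f (i ∷ is) = f i ++ collect f is

  collect-∈ : ∀ {A : Set} (f : It → List A) {i is x} → i ∈ is → x ∈ f i → x ∈ collect f is
  collect-∈ f (here refl) m = ∈-++⁺ˡ m
  collect-∈ f {is = j ∷ is} (there k) m = ∈-++⁺ʳ (f j) (collect-∈ f k m)

  ∈-collect : ∀ {A : Set} (f : It → List A) is {x} → x ∈ collect f is → ∃ λ i → i ∈ is × x ∈ f i
  ∈-collect f (i ∷ is) m with ∈-++⁻ (f i) m
  ... | inj₁ k = i , here refl , k
  ... | inj₂ k with ∈-collect f is k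
  ... | j , l , e = j , there l , e

  ∑-collect : ∀ {A : Set} (f : It → List A) is g → ∑ (collect f is) g ≡ ∑ is (λ i → ∑ (f i) g)
  ∑-collect f [] g = refl
  ∑-collect f (i ∷ is) g = trans (∑-++ (f i) _ g) (+congʳ (∑-collect f is g))

  flat-++ : ∀ (ps qs : List (Fin N × Fin N)) → flat (ps ++ qs) ≡ flat ps ++ flat qs
  flat-++ [] qs = refl
  flat-++ ((a , b) ∷ ps) qs = cong (λ l → a ∷ b ∷ l) (flat-++ ps qs)

  cnt-split : ∀ is v → cnt (collect tsOf is) v + cnt (flat (collect bcOf is)) v ≤ cnt (collect vsOf is) v
  cnt-split [] v = z≤n
  cnt-split (i ∷ is) v = begin
    cnt (tsOf i ++ collect tsOf is) v + cnt (flat (bcOf i ++ collect bcOf is)) v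
      ≡⟨ cong₂ _+_ (∑-++ (tsOf i) _ _) (trans (cong (λ l → cnt l v) (flat-++ (bcOf i) _)) (∑-++ (flat (bcOf i)) _ _)) ⟩
    (cnt (tsOf i) v + cnt (collect tsOf is) v) + (cnt (flat (bcOf i)) v + cnt (flat (collect bcOf is)) v)
      ≡⟨ +-swap (cnt (tsOf i) v) (cnt (collect tsOf is) v) (cnt (flat (bcOf i)) v) _ ⟩
    (cnt (tsOf i) v + cnt (flat (bcOf i)) v) + (cnt (collect tsOf is) v + cnt (flat (collect bcOf is)) v)
      ≤⟨ +-mono-≤ (one i) (cnt-split is v) ⟩
    cnt (vsOf i) v + cnt (collect vsOf is) v ≡⟨ sym (∑-++ (vsOf i) _ _) ⟩
    cnt (collect vsOf (i ∷ is)) v ∎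
    where
    open ≤-Reasoning
    one : ∀ i → cnt (tsOf i) v + cnt (flat (bcOf i)) v ≤ cnt (vsOf i) v
    one (lw e) = ≤-reflexive (+-identityʳ _)
    one (lt a b c) = ≤-reflexive (+congˡ (+-identityʳ (δ a v)))
    one (h2 a b c) = ≤-trans (≤-reflexive (+-identityʳ (δ a v + (δ b v + 0)))) (+-monoʳ-≤ (δ a v) (+-monoʳ-≤ (δ b v) z≤n))
    one (h3 a b c) = ≤-reflexive (+-identityʳ _)

  bcsG : ∀ l → All (λ (p : Fin N × Fin N) → proj₁ p ≢ proj₂ p) l → Graph N → Graph N
  bcsG [] [] G = G
  bcsG ((b , c) ∷ l) (n ∷ ns) G = togG b c n (bcsG l ns G)

  module _ (G : Graph N) where

    bcs-par : ∀ l ns {v} → ¬ v ∈ flat l → par (adj (bcsG l ns G)) v ≡ par (adj G) v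
    bcs-par [] [] m = refl
    bcs-par ((b , c) ∷ l) (n ∷ ns) m = trans (par-tog-other _ n (λ e → m (here e)) (λ e → m (there (here e)))) (bcs-par l ns (λ k → m (there (there k))))

    bcs-adj : ∀ l ns {v} → ¬ v ∈ flat l → ∀ w → adj (bcsG l ns G) v w ≡ adj G v w
    bcs-adj [] [] m w = refl
    bcs-adj ((b , c) ∷ l) (n ∷ ns) m w = trans (tog-untouched _ (λ e → m (here e)) (λ e → m (there (here e))) w) (bcs-adj l ns (λ k → m (there (there k))) w)

    bcs-par-∈ : ∀ l ns {v} → Uq (flat l) → v ∈ flat l → par (adj (bcsG l ns G)) v ≡ not (par (adj G) v)
    bcs-par-∈ ((b , c) ∷ l) (n ∷ ns) u (here refl) = trans (par-togˡ _ n) (cong not (bcs-par l ns λ k → contradiction (u b)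
      (<⇒≱ (≤-trans (s≤s (cnt-∈ k)) (+-mono-≤ (≤-reflexive (sym (δ-refl b))) (m≤n+m _ (δ c b)))))))
    bcs-par-∈ ((b , c) ∷ l) (n ∷ ns) u (there (here refl)) = trans (par-togʳ _ n) (cong not (bcs-par l ns λ k → contradiction (u c)
      (<⇒≱ (≤-trans (+-mono-≤ (≤-reflexive (sym (δ-refl c))) (cnt-∈ k)) (m≤n+m _ (δ b c))))))
    bcs-par-∈ ((b , c) ∷ l) (n ∷ ns) {v} u (there (there m)) = trans (par-tog-other _ n
        (λ { refl → contradiction (u b) (<⇒≱ (≤-trans (s≤s (cnt-∈ m)) (+-mono-≤ (≤-reflexive (sym (δ-refl b))) (m≤n+m _ (δ c b))))) })
        (λ { refl → contradiction (u c) (<⇒≱ (≤-trans (+-mono-≤ (≤-reflexive (sym (δ-refl c))) (cnt-∈ m)) (m≤n+m _ (δ b c)))) }))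
      (bcs-par-∈ l ns (λ w → ≤-trans (m≤n+m _ (δ c w)) (≤-trans (m≤n+m _ (δ b w)) (u w))) m)

    bcs-edge : ∀ {b c l ns} → Uq (flat ((b , c) ∷ l)) → Ed G b c → adj (bcsG l ns G) b c ≡ true
    bcs-edge {b} {c} {l} {ns} u e = trans (bcs-adj l ns (λ k → contradiction (u b)
      (<⇒≱ (≤-trans (s≤s (cnt-∈ k)) (+-mono-≤ (≤-reflexive (sym (δ-refl b))) (m≤n+m _ (δ c b)))))) c) e

    bcs-⊆ : ∀ l ns → Uq (flat l) → (∀ {b c} → (b , c) ∈ l → Ed G b c) → ∀ u v → adj (bcsG l ns G) u v ≡ true → adj G u v ≡ true
    bcs-⊆ [] [] u h x y e = e
    bcs-⊆ ((b , c) ∷ l) (n ∷ ns) u h x y e = bcs-⊆ l ns (λ w → ≤-trans (m≤n+m _ (δ c w)) (≤-trans (m≤n+m _ (δ b w)) (u w))) (h ∘ there) x y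
      (tog-⊆ (bcsG l ns G) (bcs-edge {l = l} u (h (here refl))) x y e)

  module _ (G : Graph N) (z : Fin N) where

    Valid : It → Set
    Valid (lw e) = Ed G z e × Ev G e × (∀ w → ¬ FE G e w)
    Valid (lt a b c) = IsoTri (FE G) a b c × Ed G z a × adj G z c ≡ false
    Valid (h2 a b c) = IsoTri (FE G) a b c × Ed G z a × Ed G z b × adj G z c ≡ false
    Valid (h3 a b c) = IsoTri (FE G) a b c × Ed G z a × Ed G z b × Ed G z c

    tri-even : ∀ {a b c} → IsoTri (FE G) a b c → ∀ {v} → v ∈ a ∷ b ∷ c ∷ [] → Ev G v
    tri-even t (here refl) = proj₁ (proj₂ (IsoTri.ab t))
    tri-even t (there (here refl)) = proj₁ (proj₂ (IsoTri.bc t))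
    tri-even t (there (there (here refl))) = proj₂ (proj₂ (IsoTri.bc t))

    tri-closed : ∀ {a b c} → IsoTri (FE G) a b c → ∀ {v} → v ∈ a ∷ b ∷ c ∷ [] → ∀ w → FE G v w → w ∈ a ∷ b ∷ c ∷ []
    tri-closed t (here refl) w f with IsoTri.cova t w f
    ... | inj₁ e = there (here e)
    ... | inj₂ e = there (there (here e))
    tri-closed t (there (here refl)) w f with IsoTri.covb t w f
    ... | inj₁ e = here e
    ... | inj₂ e = there (there (here e))
    tri-closed t (there (there (here refl))) w f with IsoTri.covc t w f
    ... | inj₁ e = here e
    ... | inj₂ e = there (here e)

    item-even : ∀ i → Valid i → ∀ {v} → v ∈ vsOf i → Ev G v
    item-even (lw e) (_ , p , _) (here refl) = p
    item-even (lt a b c) (t , _) = tri-even t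
    item-even (h2 a b c) (t , _) = tri-even t
    item-even (h3 a b c) (t , _) = tri-even t

    item-closed : ∀ i → Valid i → ∀ {v} → v ∈ vsOf i → ∀ w → FE G v w → w ∈ vsOf i
    item-closed (lw e) (_ , _ , n) (here refl) w f = contradiction f (n w)
    item-closed (lt a b c) (t , _) = tri-closed t
    item-closed (h2 a b c) (t , _) = tri-closed t
    item-closed (h3 a b c) (t , _) = tri-closed t

    item-T : ∀ i → Valid i → ∀ {v} → v ∈ tsOf i → Ed G z v
    item-T (lw e) (p , _) (here refl) = p
    item-T (lt a b c) (_ , p , _) (here refl) = p
    item-T (h2 a b c) (_ , p , _) (here refl) = p
    item-T (h2 a b c) (_ , _ , p , _) (there (here refl)) = p
    item-T (h3 a b c) (_ , p , _) (here refl) = p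
    item-T (h3 a b c) (_ , _ , p , _) (there (here refl)) = p
    item-T (h3 a b c) (_ , _ , _ , p) (there (there (here refl))) = p

    record ZData : Set where
      field
        zodd : Od G z
        its : List It
        valid : ∀ {i} → i ∈ its → Valid i
        uqW : Uq (collect vsOf its)
        complete : ∀ e → Ed G z e → Ev G e → e ∈ collect vsOf its
        -- If `z` is adjacent to `b`, the insertion of `bc` at `b` needs a token at `z`; an even
        -- number of edges removed at `z` keeps `z` odd.
        even-lt : ∀ {a b c} → lt a b c ∈ its → Ed G z b → odd (length (collect tsOf its)) ≡ false
        -- Makes the number of unpaired edges even, so that fewer than two means none.
        even-h2 : ∀ {a b c} → h2 a b c ∈ its → odd (length (collect tsOf its)) ≡ false
        one-h2 : ∑ its η ≤ 1
        nonempty : its ≢ []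
        -- These two cases cannot be handled at `z` by itself; they are the vertices satisfying
        -- `Alone`.
        not-alone : ∀ {a b c} → its ≢ h2 a b c ∷ [] × its ≢ h3 a b c ∷ []

  module Zred (G : Graph N) (z : Fin N) (zd : ZData G z) (hst : Host (FE G)) (nx : NoExc G) (ih : IH G)
    (allTri : ∀ {x y} → FE G x y → ∃ λ v → IsoTri (FE G) x y v) where
    open ZData zd

    E : Adj {N}
    E = adj G
    T₀ W : List (Fin N)
    T₀ = collect tsOf its
    W = collect vsOf its
    B : List (Fin N × Fin N)
    B = collect bcOf its

    W-even : ∀ {v} → v ∈ W → Ev G v
    W-even m with ∈-collect vsOf its m
    ... | i , k , l = item-even G z i (valid k) l

    W-closed : ∀ {v} → v ∈ W → ∀ w → FE G v w → w ∈ W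
    W-closed m w f with ∈-collect vsOf its m
    ... | i , k , l = collect-∈ vsOf k (item-closed G z i (valid k) l w f)

    z∉W : ¬ z ∈ W
    z∉W m = Od≢Ev G zodd (W-even m)

    T⊆W : ∀ {v} → v ∈ T₀ → v ∈ W
    T⊆W {v} m = ∈-cnt W (≤-trans (cnt-∈ m) (≤-trans (m≤m+n _ _) (cnt-split its v)))

    B⊆W : ∀ {v} → v ∈ flat B → v ∈ W
    B⊆W {v} m = ∈-cnt W (≤-trans (cnt-∈ m) (≤-trans (m≤n+m _ (cnt T₀ v)) (cnt-split its v)))

    T∉B : ∀ {v} → v ∈ T₀ → ¬ v ∈ flat B
    T∉B = cnt-∈∉ {T₀} {flat B} {W} (cnt-split its) uqW

    T-edge : ∀ {v} → v ∈ T₀ → Ed G z v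
    T-edge m with ∈-collect tsOf its m
    ... | i , k , l = item-T G z i (valid k) l

    z∉T : ¬ z ∈ T₀
    z∉T = z∉W ∘ T⊆W

    uqT : Uq T₀
    uqT v = ≤-trans (m≤m+n _ _) (≤-trans (cnt-split its v) (uqW v))

    uqB : Uq (flat B)
    uqB v = ≤-trans (m≤n+m _ (cnt T₀ v)) (≤-trans (cnt-split its v) (uqW v))

    nzT : All (z ≢_) T₀
    nzT = All.tabulate λ m e → z∉T (subst (_∈ T₀) (sym e) m)

    B-lt : ∀ {b c} → (b , c) ∈ B → ∃ λ a → lt a b c ∈ its
    B-lt m with ∈-collect bcOf its m
    ... | lt a b c , k , here refl = a , k

    B-tri : ∀ {a b c} → lt a b c ∈ its → IsoTri (FE G) a b c
    B-tri k = proj₁ (valid k)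

    B-edge : ∀ {b c} → (b , c) ∈ B → Ed G b c
    B-edge m = proj₁ (IsoTri.bc (B-tri (proj₂ (B-lt m))))

    nB : All (λ (p : Fin N × Fin N) → proj₁ p ≢ proj₂ p) B
    nB = All.tabulate λ m → Ed-≢ G (B-edge m)

    G₁ : Graph N
    G₁ = togsG z T₀ nzT G

    E₁ : Adj {N}
    E₁ = adj G₁

    G₂ : Graph N
    G₂ = bcsG B nB G₁

    par₁-T : ∀ {v} → v ∈ T₀ → Od G₁ v
    par₁-T m = trans (par-togs-∈ z T₀ E nzT (λ e → z∉T (subst (_∈ T₀) e m)) uqT m) (cong not (W-even (T⊆W m)))

    par₁-o : ∀ {v} → v ≢ z → ¬ v ∈ T₀ → par E₁ v ≡ par E v
    par₁-o n m = par-togs-∉ z T₀ E nzT n m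

    par₁-z : par E₁ z ≡ not (odd (length T₀))
    par₁-z = trans (par-togs-z z T₀ E nzT) (cong (_xor odd (length T₀)) zodd)

    off₁ : ∀ {v} → v ∈ T₀ → E₁ z v ≡ false
    off₁ m = trans (togs-∈ z T₀ E (λ e → z∉T (subst (_∈ T₀) (sym e) m)) uqT m) (cong not (T-edge m))

    sub₁ : ∀ u v → Ed G₁ u v → Ed G u v
    sub₁ = togs-⊆ G z T₀ uqT T-edge

    B-edge₁ : ∀ {b c} → (b , c) ∈ B → Ed G₁ b c
    B-edge₁ {b} {c} m = trans (togs-off z T₀ E (λ e → z∉W (subst (_∈ W) e (B⊆W (∈-flatˡ m)))) (λ e → z∉W (subst (_∈ W) e (B⊆W (∈-flatʳ m))))) (B-edge m)

    sub₂ : ∀ u v → Ed G₂ u v → Ed G₁ u v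
    sub₂ = bcs-⊆ G₁ B nB uqB B-edge₁

    par₂-W : ∀ {v} → v ∈ T₀ ⊎ v ∈ flat B → Od G₂ v
    par₂-W (inj₁ m) = trans (bcs-par G₁ B nB (T∉B m)) (par₁-T m)
    par₂-W (inj₂ m) = trans (bcs-par-∈ G₁ B nB uqB m) (cong not (trans (par₁-o (λ e → z∉W (subst (_∈ W) e (B⊆W m))) (λ k → T∉B k m)) (W-even (B⊆W m))))

    par₂-o : ∀ {v} → v ≢ z → ¬ v ∈ W → par (adj G₂) v ≡ par E v
    par₂-o n m = trans (bcs-par G₁ B nB (m ∘ B⊆W)) (par₁-o n (m ∘ T⊆W))

    data Place (v : Fin N) : Set where
      inT : v ∈ T₀ → Place v
      inB : v ∈ flat B → Place v
      top : ∀ {a b} → h2 a b v ∈ its → Place v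

    place : ∀ {v} → v ∈ W → Place v
    place m with ∈-collect vsOf its m
    ... | lw e , k , here refl = inT (collect-∈ tsOf k (here refl))
    ... | lt a b c , k , here refl = inT (collect-∈ tsOf k (here refl))
    ... | lt a b c , k , there (here refl) = inB (∈-flatˡ (collect-∈ bcOf k (here refl)))
    ... | lt a b c , k , there (there (here refl)) = inB (∈-flatʳ (collect-∈ bcOf k (here refl)))
    ... | h2 a b c , k , here refl = inT (collect-∈ tsOf k (here refl))
    ... | h2 a b c , k , there (here refl) = inT (collect-∈ tsOf k (there (here refl)))
    ... | h2 a b c , k , there (there (here refl)) = top k
    ... | h3 a b c , k , l = inT (collect-∈ tsOf k l)

    nbrz : ∀ w → Ed G₂ z w → Od G₂ w
    nbrz w e = go (par E w) refl
      where
      go : ∀ p → par E w ≡ p → Od G₂ w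
      go true p = trans (par₂-o (Ed-≢ G₂ e ∘ sym) (λ m → Od≢Ev G p (W-even m))) p
      go false p with place (complete w (sub₁ z w (sub₂ z w e)) p)
      ... | inT m = par₂-W (inj₁ m)
      ... | inB m = par₂-W (inj₂ m)
      ... | top k = contradiction (trans (sym (sub₁ z w (sub₂ z w e))) (proj₂ (proj₂ (proj₂ (valid k))))) λ ()

    -- Only the third corner of an `h2` stays even; its two mates have become odd and `z` is not
    -- adjacent to it.
    even-W : ∀ {u} → u ∈ W → Ev G₂ u → ∀ w → Ed G₂ u w → Od G₂ w
    even-W {u} m p w e with place m
    ... | inT k = ⊥-elim (Od≢Ev G₂ (par₂-W (inj₁ k)) p)
    ... | inB k = ⊥-elim (Od≢Ev G₂ (par₂-W (inj₂ k)) p)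
    ... | top {a} {b} k = go (par E w) refl
      where
      e' : Ed G u w
      e' = sub₁ u w (sub₂ u w e)
      v = valid k
      go : ∀ p → par E w ≡ p → Od G₂ w
      go true q = trans (par₂-o (λ { refl → contradiction (trans (sym (Ed-sym G e')) (proj₂ (proj₂ (proj₂ v)))) λ () }) (λ m → Od≢Ev G q (W-even m))) q
      go false q with IsoTri.covc (proj₁ v) w (e' , W-even m , q)
      ... | inj₁ refl = par₂-W (inj₁ (collect-∈ tsOf k (here refl)))
      ... | inj₂ refl = par₂-W (inj₁ (collect-∈ tsOf k (there (here refl))))

    loc : Local G G₂ (z ∷ W)
    loc = record
      { untouched = record
        { same-par = λ n → par₂-o (λ e → n (here e)) (n ∘ there)
        ; same-adj = λ n w → trans (bcs-adj G₁ B nB (n ∘ there ∘ B⊆W) w) (togs-untouched z T₀ E (λ e → n (here e)) (n ∘ there ∘ T⊆W) w) }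
      ; sub = λ u v e → sub₁ u v (sub₂ u v e)
      ; odd-t = λ { (here refl) _ → nbrz ; (there m) o → ⊥-elim (Od≢Ev G o (W-even m)) }
      ; closed-t = λ { (here refl) e → ⊥-elim (Od≢Ev G zodd e) ; (there m) _ w f → there (W-closed m w f) }
      ; even-t = λ { (here refl) _ → nbrz ; (there m) → even-W m } }

    some-T : ∃ λ t → t ∈ T₀
    some-T = first its refl
      where
      first : ∀ is → its ≡ is → ∃ λ t → t ∈ T₀
      first [] e = contradiction e nonempty
      first (i ∷ is) e = proj₁ (pickT i) , collect-∈ tsOf (subst (i ∈_) (sym e) (here refl)) (proj₂ (pickT i))
        where
        pickT : ∀ i → ∃ λ t → t ∈ tsOf i
        pickT (lw e) = e , here refl
        pickT (lt a b c) = a , here refl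
        pickT (h2 a b c) = a , here refl
        pickT (h3 a b c) = a , here refl

    lost₂ : adj G₂ z (proj₁ some-T) ≡ false
    lost₂ = ¬-not λ e → true≢false (trans (sym (sub₂ z _ e)) (off₁ (proj₂ some-T)))

    induct : Φ G₂
    induct = ih G₂ (size-< G G₂ (λ u v e → sub₁ u v (sub₂ u v e)) (T-edge (proj₂ some-T)) lost₂) (Host-mono (Local.FE-sub loc) hst) (Local.no-exc loc nx)

    -- All neighbours of `b` are odd at this moment: `a` lost its edge to `z`, and `z` is odd by
    -- `even-lt` if it is adjacent. The token gained stays with `b`, which is therefore no obstacle
    -- when edges are added at `z`.
    addBC : ∀ l ns → (∀ {p} → p ∈ l → p ∈ B) → Uq (flat l) → ∀ {L} (d : Dc (adj (bcsG l ns G₁)) L) →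
      Σ (Dc E₁ L) λ d' → (∀ {b c} → (b , c) ∈ l → 1 ≤ tk d' b) × (∀ v → ¬ v ∈ flat l → tk d' v ≡ tk d v)
    addBC [] [] sub u d = d , (λ ()) , λ _ _ → refl
    addBC ((b , c) ∷ l) (n ∷ ns) sub u {L} d = proj₁ rec , pos , same
      where
      Gl = bcsG l ns G₁
      Gbl = bcsG ((b , c) ∷ l) (n ∷ ns) G₁
      mB = sub (here refl)
      a = proj₁ (B-lt mB)
      k : lt a b c ∈ its
      k = proj₂ (B-lt mB)
      tr = B-tri k
      aT : a ∈ T₀
      aT = collect-∈ tsOf k (here refl)
      flat-sub : ∀ {v} → v ∈ flat ((b , c) ∷ l) → v ∈ flat B
      flat-sub m with ∈-flat _ m
      ... | (x , y) , q , inj₁ refl = ∈-flatˡ (sub q)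
      ... | (x , y) , q , inj₂ refl = ∈-flatʳ (sub q)
      u' : Uq (flat l)
      u' w = ≤-trans (m≤n+m _ (δ c w)) (≤-trans (m≤n+m _ (δ b w)) (u w))
      ebc : adj Gl b c ≡ true
      ebc = bcs-edge G₁ {l = l} u (B-edge₁ mB)
      ebc' : adj Gbl b c ≡ false
      ebc' = trans (tog-self b c (adj Gl)) (cong not ebc)
      subl : ∀ u v → Ed Gbl u v → Ed G₁ u v
      subl = bcs-⊆ G₁ ((b , c) ∷ l) (n ∷ ns) u (λ m → B-edge₁ (sub m))
      bW : b ∈ W
      bW = B⊆W (∈-flatˡ mB)
      oddnbr : ∀ v → Ed Gbl b v → Od Gbl v
      oddnbr v e = go (v ≟ z) (par E v) refl
        where
        e' = sub₁ b v (subl b v e)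
        go : Dec (v ≡ z) → ∀ p → par E v ≡ p → Od Gbl v
        go (yes refl) p _ = trans (bcs-par G₁ ((b , c) ∷ l) (n ∷ ns) (λ m → z∉W (B⊆W (flat-sub m)))) (trans par₁-z (cong not (even-lt k (Ed-sym G e'))))
        go (no q) true p = trans (bcs-par G₁ ((b , c) ∷ l) (n ∷ ns) (λ m → Od≢Ev G p (W-even (B⊆W (flat-sub m))))) (trans (par₁-o q (λ m → Od≢Ev G p (W-even (T⊆W m)))) p)
        go (no q) false p with IsoTri.covb tr v (e' , W-even bW , p)
        ... | inj₁ refl = trans (bcs-par G₁ ((b , c) ∷ l) (n ∷ ns) (λ m → T∉B aT (flat-sub m))) (par₁-T aT)
        ... | inj₂ refl = contradiction (trans (sym e) ebc') λ ()
      cpar : par (adj Gbl) c ≡ true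
      cpar = trans (bcs-par-∈ G₁ ((b , c) ∷ l) (n ∷ ns) u (there (here refl)))
        (cong not (trans (par₁-o (λ q → z∉W (subst (_∈ W) q (B⊆W (∈-flatʳ mB)))) (λ m → T∉B m (∈-flatʳ mB))) (W-even (B⊆W (∈-flatʳ mB)))))
      s₁ = add1 d {b} {c} [] n ebc' (λ v e p → contradiction (trans (sym (oddnbr v e)) p) λ ()) (odd⇒tk d cpar)
      d₁ : Dc (adj Gl) L
      d₁ = dc-≐ (tog-tog b c (adj Gl)) (proj₁ s₁)
      rec = addBC l ns (sub ∘ there) u' d₁
      b∉l : ¬ b ∈ flat l
      b∉l m = contradiction (u b) (<⇒≱ (≤-trans (s≤s (cnt-∈ m)) (+-mono-≤ (≤-reflexive (sym (δ-refl b))) (m≤n+m _ (δ c b)))))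
      tkb : 1 ≤ tk d₁ b
      tkb = subst (1 ≤_) (trans (sym (proj₂ s₁ b)) (trans (+congʳ (δ-≢ (n ∘ sym))) (+-identityʳ _))) (subst (λ k → 1 ≤ tk d b + k) (sym (δ-refl b)) (m≤n+m 1 _))
      pos : ∀ {b' c'} → (b' , c') ∈ (b , c) ∷ l → 1 ≤ tk (proj₁ rec) b'
      pos (here refl) = subst (1 ≤_) (sym (proj₂ (proj₂ rec) b b∉l)) tkb
      pos (there m) = proj₁ (proj₂ rec) m
      same : ∀ v → ¬ v ∈ flat ((b , c) ∷ l) → tk (proj₁ rec) v ≡ tk d v
      same v m = trans (proj₂ (proj₂ rec) v (λ q → m (there (there q)))) (trans (sym (+-identityʳ _)) (trans (+congʳ (sym (δ-≢ λ q → m (there (here (sym q))))))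
        (trans (proj₂ s₁ v) (trans (+congʳ (δ-≢ λ q → m (here (sym q)))) (+-identityʳ _)))))

    mates : ∀ x → ∃ λ p → ∃ λ q → ∀ w → FE G x w → w ≡ p ⊎ w ≡ q
    mates x = go (any? (λ y → FE? G x y))
      where
      go : Dec (∃ λ y → FE G x y) → ∃ λ p → ∃ λ q → ∀ w → FE G x w → w ≡ p ⊎ w ≡ q
      go (yes (y , f)) = y , proj₁ (allTri f) , IsoTri.cova (proj₂ (allTri f))
      -- There are no mates; `x` itself fills both places.
      go (no n) = x , x , λ w f → contradiction (w , f) n

    -- A postponed edge `zx` is inserted at `x`. The two mates of `x` may lack tokens, so `z` needs
    -- three and spends one; over all of `rs` this amounts to `length rs + 2`. The tokens gained are
    -- recorded, as they remove obstacles for later edges.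
    addRem : ∀ rs fin → Uq (rs ++ fin) → (∀ {s} → s ∈ rs ++ fin → Ed G z s × Ev G s) → ∀ {L} (d : Dc (togs z (rs ++ fin) E) L) →
      length rs + 2 ≤ tk d z → Σ (Dc (togs z fin E) L) λ d' → tk d' z + length rs ≡ tk d z × (∀ v → v ≢ z → tk d' v ≡ tk d v + cnt rs v)
    addRem [] fin u h d le = d , +-identityʳ _ , λ v _ → sym (+-identityʳ _)
    addRem (x ∷ rs) fin u h {L} d le = proj₁ rec , tz , to
      where
      R = x ∷ rs ++ fin
      x≢z : x ≢ z
      x≢z = Ed-≢ G (proj₁ (h (here refl))) ∘ sym
      nz : All (z ≢_) R
      nz = All.tabulate λ m → Ed-≢ G (proj₁ (h m))
      E' = togs z R E
      xz : E' x z ≡ false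
      xz = trans (dc-sym d x z) (trans (togs-∈ z R E (x≢z ∘ sym) u (here refl)) (cong not (proj₁ (h (here refl)))))
      p = proj₁ (mates x)
      q = proj₁ (proj₂ (mates x))
      zs : ∀ v → E' x v ≡ true → par E' v ≡ false → 1 ≤ tk d v ⊎ v ∈ p ∷ q ∷ []
      zs v e pv = go (v ≟ z) (mem? v R)
        where
        go : Dec (v ≡ z) → Dec (v ∈ R) → 1 ≤ tk d v ⊎ v ∈ p ∷ q ∷ []
        go (yes refl) _ = contradiction (trans (sym e) xz) λ ()
        go (no n) (yes m) = contradiction (trans (sym pv) (trans (par-togs-∈ z R E nz n u m) (cong not (proj₂ (h m))))) λ ()
        go (no n) (no m) with proj₂ (proj₂ (mates x)) v (trans (sym (togs-off z R E x≢z n)) e , proj₂ (h (here refl)) , trans (sym (par-togs-∉ z R E nz n m)) pv)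
        ... | inj₁ e = inj₂ (here e)
        ... | inj₂ e = inj₂ (there (here e))
      s₁ = add1 d {x} {z} (p ∷ q ∷ []) x≢z xz zs (≤-trans (s≤s (m≤n+m 2 (length rs))) le)
      d₁ : Dc (togs z (rs ++ fin) E) L
      d₁ = dc-≐ (λ u v → trans (tog-swap x z E' u v) (tog-tog z x (togs z (rs ++ fin) E) u v)) (proj₁ s₁)
      tkz : tk d₁ z + 1 ≡ tk d z
      tkz = trans (+congʳ (sym (δ-refl z))) (trans (proj₂ s₁ z) (trans (+congʳ (δ-≢ x≢z)) (+-identityʳ _)))
      rec = addRem rs fin (Uq-tail {x = x} {rs ++ fin} u) (h ∘ there) d₁ (+-cancelʳ-≤ 1 _ _ (≤-trans (≤-reflexive (+-comm (length rs + 2) 1)) (≤-trans le (≤-reflexive (sym tkz)))))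
      tz : tk (proj₁ rec) z + suc (length rs) ≡ tk d z
      tz = trans (+-suc _ _) (trans (cong suc (proj₁ (proj₂ rec))) (trans (+-comm 1 _) tkz))
      to : ∀ v → v ≢ z → tk (proj₁ rec) v ≡ tk d v + (δ x v + cnt rs v)
      to v n = trans (proj₂ (proj₂ rec) v n) (trans (+congˡ (trans (sym (+-identityʳ _)) (trans (+congʳ (sym (δ-≢ (n ∘ sym)))) (proj₂ s₁ v)))) (+-assoc (tk d v) _ _))

    TokB : ∀ {L} → Dc E₁ L → Set
    TokB d = ∀ {b c} → (b , c) ∈ B → 1 ≤ tk d b

    Use : ∀ {L} → Dc E₁ L → List (Fin N × Fin N) → List (Fin N) → Set
    Use {L} d₁ pairs singles = ∀ f → T₀ ↭ (singles ++ map (pick f) pairs) ++ map (rest f) pairs ×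
      Σ (Dc (togs z (singles ++ map (pick f) pairs) E₁) L) λ d' →
        ∀ v → tk d' v + cnt (singles ++ map (pick f) pairs) v ≡ tk d₁ v + length (singles ++ map (pick f) pairs) * δ z v

    -- The only even neighbours that `z` still has are the corners `b` of items `lt`, and `TokB`
    -- grants them tokens.
    many : ∀ {L} (d₁ : Dc E₁ L) → TokB d₁ → ∃ λ pairs → ∃ λ singles → T₀ ↭ flat pairs ++ singles × Use d₁ pairs singles
    many d₁ tkB = addM d₁ z T₀ uqT (λ m → (λ e → z∉T (subst (_∈ T₀) (sym e) m)) , off₁ m , odd⇒tk d₁ (par₁-T m)) h
      where
      h : ∀ v → E₁ z v ≡ true → par E₁ v ≡ false → 1 ≤ tk d₁ v
      h v e p = go (mem? v T₀) (v ≟ z)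
        where
        at : ¬ v ∈ T₀ → v ∈ W → 1 ≤ tk d₁ v
        at n m with ∈-collect vsOf its m
        ... | lw _ , k , here refl = contradiction (collect-∈ tsOf k (here refl)) n
        ... | lt a b c , k , here refl = contradiction (collect-∈ tsOf k (here refl)) n
        ... | lt a b c , k , there (here refl) = tkB (collect-∈ bcOf k (here refl))
        ... | lt a b c , k , there (there (here refl)) = contradiction (trans (sym (sub₁ z v e)) (proj₂ (proj₂ (valid k)))) λ ()
        ... | h2 a b c , k , here refl = contradiction (collect-∈ tsOf k (here refl)) n
        ... | h2 a b c , k , there (here refl) = contradiction (collect-∈ tsOf k (there (here refl))) n
        ... | h2 a b c , k , there (there (here refl)) = contradiction (trans (sym (sub₁ z v e)) (proj₂ (proj₂ (proj₂ (valid k))))) λ ()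
        ... | h3 a b c , k , l = contradiction (collect-∈ tsOf k l) n
        go : Dec (v ∈ T₀) → Dec (v ≡ z) → 1 ≤ tk d₁ v
        go (yes m) _ = odd⇒tk d₁ (par₁-T m)
        go (no m) (yes refl) = contradiction (trans (sym e) (dc-irrefl d₁ z)) λ ()
        go (no m) (no n) = at m (complete v (sub₁ z v e) (trans (sym (par₁-o n m)) p))

-- Choosing which edges at z to postpone

module _ {N : ℕ} where

  -- Selection rule: from a pair keep for later a member of Q, if there is one.
  keep : List (Fin N) → Fin N × Fin N → Bool
  keep Q p = not ⌊ mem? (proj₁ p) Q ⌋

  rest-keep : ∀ Q p → proj₁ p ∈ Q ⊎ proj₂ p ∈ Q → rest (keep Q) p ∈ Q
  rest-keep Q p h with mem? (proj₁ p) Q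
  rest-keep Q p h | yes m = m
  rest-keep Q p (inj₁ m) | no n = contradiction m n
  rest-keep Q p (inj₂ m) | no n = m

  χ : List (Fin N) → Fin N → ℕ
  χ Q v = b2n ⌊ mem? v Q ⌋

  χ-∈ : ∀ {Q v} → v ∈ Q → χ Q v ≡ 1
  χ-∈ {Q} {v} m with mem? v Q
  ... | yes _ = refl
  ... | no n = contradiction m n

  χ-pos : ∀ {Q v} → 1 ≤ χ Q v → v ∈ Q
  χ-pos {Q} {v} h with mem? v Q
  ... | yes m = m

  χ≤1 : ∀ Q v → χ Q v ≤ 1
  χ≤1 Q v = b2n≤1 ⌊ mem? v Q ⌋

  -- A pair that meets `Q` postpones a member of `Q`, so at least half of the members of `Q`
  -- occurring in pairs are postponed.
  χ-flat : ∀ Q ps → ∑ (flat ps) (χ Q) ≤ ∑ (map (rest (keep Q)) ps) (χ Q) + ∑ (map (rest (keep Q)) ps) (χ Q)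
  χ-flat Q [] = z≤n
  χ-flat Q ((x , y) ∷ ps) = begin
    χ Q x + (χ Q y + ∑ (flat ps) (χ Q)) ≡⟨ sym (+-assoc (χ Q x) (χ Q y) _) ⟩
    (χ Q x + χ Q y) + ∑ (flat ps) (χ Q) ≤⟨ +-mono-≤ one (χ-flat Q ps) ⟩
    (r + r) + (S + S) ≡⟨ +-swap r r S S ⟩
    (r + S) + (r + S) ∎
    where
    open ≤-Reasoning
    r = χ Q (rest (keep Q) (x , y))
    S = ∑ (map (rest (keep Q)) ps) (χ Q)
    one : χ Q x + χ Q y ≤ r + r
    one = go (mem? x Q) (mem? y Q)
      where
      full : x ∈ Q ⊎ y ∈ Q → χ Q x + χ Q y ≤ r + r
      full h = ≤-trans (+-mono-≤ (χ≤1 Q x) (χ≤1 Q y)) (≤-reflexive (sym (cong₂ _+_ (χ-∈ {Q} (rest-keep Q (x , y) h)) (χ-∈ {Q} (rest-keep Q (x , y) h)))))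
      none : ∀ {v} → ¬ v ∈ Q → χ Q v ≡ 0
      none {v} n with mem? v Q
      ... | yes m = contradiction m n
      ... | no _ = refl
      go : Dec (x ∈ Q) → Dec (y ∈ Q) → χ Q x + χ Q y ≤ r + r
      go (yes m) _ = full (inj₁ m)
      go (no _) (yes m) = full (inj₂ m)
      go (no n) (no k) = ≤-trans (≤-reflexive (cong₂ _+_ (none n) (none k))) z≤n

  module Zfin (G : Graph N) (z : Fin N) (zd : ZData G z) (hst : Host (FE G)) (nx : NoExc G) (ih : IH G)
    (allTri : ∀ {x y} → FE G x y → ∃ λ v → IsoTri (FE G) x y v) where
    open ZData zd
    open Zred G z zd hst nx ih allTri

    module Select {L} (d₁ : Dc E₁ L) (tkB : TokB d₁) (pairs : List (Fin N × Fin N)) (singles : List (Fin N))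
      (part : T₀ ↭ flat pairs ++ singles) (use : Use d₁ pairs singles) where

      lenT : length T₀ ≡ (length pairs + length pairs) + length singles
      lenT = trans (↭-length part) (trans (length-++ (flat pairs)) (+congˡ (length-flat pairs)))

      module _ (f : Fin N × Fin N → Bool) where
        chs rem : List (Fin N)
        chs = singles ++ map (pick f) pairs
        rem = map (rest f) pairs

        perm : T₀ ↭ chs ++ rem
        perm = proj₁ (use f)

        dR : Dc (togs z rem E) L
        dR = dc-≐ (λ u v → trans (togs-cong z chs (togs-↭ z E perm) u v) (togs-cancel z chs rem E u v)) (proj₁ (proj₂ (use f)))

        cnt-perm : ∀ v → cnt T₀ v ≡ cnt chs v + cnt rem v
        cnt-perm v = trans (cnt-↭ perm v) (∑-++ chs rem _)

        uqR : Uq rem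
        uqR v = ≤-trans (m≤n+m _ (cnt chs v)) (subst (_≤ 1) (cnt-perm v) (uqT v))

        remT : ∀ {s} → s ∈ rem → s ∈ T₀
        remT m = ∈-resp-↭ (↭-sym perm) (∈-++⁺ʳ chs m)

        chs0 : ∀ {v} → ¬ v ∈ T₀ → cnt chs v ≡ 0
        chs0 {v} n = m+n≡0⇒m≡0 (cnt chs v) (trans (sym (cnt-perm v)) (∉⇒cnt0 T₀ n))

        tkR-z : tk dR z ≡ tk d₁ z + (length singles + length pairs)
        tkR-z = trans (sym (+-identityʳ _)) (trans (+congʳ (sym (chs0 z∉T))) (trans (proj₂ (proj₂ (use f)) z)
          (+congʳ (trans (cong (length chs *_) (δ-refl z)) (trans (*-identityʳ _) (trans (length-++ singles) (+congʳ (length-map (pick f) pairs))))))))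

        tkR-o : ∀ {v} → v ≢ z → ¬ v ∈ T₀ → tk dR v ≡ tk d₁ v
        tkR-o {v} n m = trans (sym (+-identityʳ _)) (trans (+congʳ (sym (chs0 m))) (trans (proj₂ (proj₂ (use f)) v)
          (trans (+congʳ (trans (cong (length chs *_) (δ-≢ (n ∘ sym))) (*-zeroʳ (length chs)))) (+-identityʳ _))))

        lenR : length rem ≡ length pairs
        lenR = length-map (rest f) pairs

        loose : length pairs + 2 ≤ tk dR z → Dc E L
        loose le = proj₁ (addRem rem [] (subst Uq (sym eq) uqR) (λ m → edge (subst (_ ∈_) eq m)) (dc-≐ (togs-↭ z E (↭-reflexive (sym eq))) dR)
            (subst (λ k → k + 2 ≤ tk dR z) (sym lenR) le))
          where
          eq : rem ++ [] ≡ rem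
          eq = ++-identityʳ rem
          edge : ∀ {s} → s ∈ rem → Ed G z s × Ev G s
          edge m = T-edge (remT m) , W-even (T⊆W (remT m))

        Good : Fin N → List (Fin N) → Set
        Good x rs = ∃ λ c → ∀ w → FE G x w → w ≡ c ⊎ (∃ λ c' → (w , c') ∈ B) ⊎ w ∈ rs

        -- One token less than for `loose`: the last edge finds two tokens at `z`, so its end `x`
        -- may have a single obstacle `c`. The other mate must have a token, either as a corner in
        -- `B` or because its own edge was inserted before.
        tight : ∀ x rs → rem ↭ x ∷ rs → Good x rs → length pairs + 1 ≤ tk dR z → Dc E L
        tight x rs p (c , good) le = proj₁ (Reduce.last-edge G d₃ (proj₁ (edge (here refl))) (c ∷ []) cond two)
          where
          p' : rem ↭ rs ++ x ∷ []
          p' = ↭-trans p (++-comm (x ∷ []) rs)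
          edge : ∀ {s} → s ∈ x ∷ rs → Ed G z s × Ev G s
          edge m = T-edge (remT (∈-resp-↭ (↭-sym p) m)) , W-even (T⊆W (remT (∈-resp-↭ (↭-sym p) m)))
          len1 : length pairs ≡ suc (length rs)
          len1 = trans (sym lenR) (↭-length p)
          le' : length rs + 2 ≤ tk dR z
          le' = ≤-trans (≤-reflexive (trans (+-suc (length rs) 1) (cong (_+ 1) (sym len1)))) le
          added = addRem rs (x ∷ []) (λ v → subst (_≤ 1) (cnt-↭ p' v) (uqR v)) (λ m → edge (∈-resp-↭ (++-comm rs (x ∷ [])) m)) (dc-≐ (togs-↭ z E p') dR) le'
          d₃ : Dc (tog z x E) L
          d₃ = proj₁ added
          two : 2 ≤ tk d₃ z
          two = +-cancelʳ-≤ (length rs) 2 _ (≤-trans (≤-reflexive (+-comm 2 (length rs))) (≤-trans le' (≤-reflexive (sym (proj₁ (proj₂ added))))))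
          cond : ∀ w → w ≢ z → Ed G x w → Ev G w → 1 ≤ tk d₃ w ⊎ w ∈ c ∷ []
          cond w n e ew with good w (e , proj₂ (edge (here refl)) , ew)
          ... | inj₁ q = inj₂ (here q)
          ... | inj₂ (inj₁ (c' , m)) = inj₁ (subst (1 ≤_) (sym (proj₂ (proj₂ added) w n))
                (≤-trans (subst (1 ≤_) (sym (tkR-o n λ k → T∉B k (∈-flatˡ m))) (tkB m)) (m≤m+n _ _)))
          ... | inj₂ (inj₂ m) = inj₁ (subst (1 ≤_) (sym (proj₂ (proj₂ added) w n)) (≤-trans (cnt-∈ m) (m≤n+m _ (tk dR w))))

      oddT : odd (length T₀) ≡ odd (length singles)
      oddT = trans (cong odd lenT) (trans (odd-+ (length pairs + length pairs) _) (cong (_xor odd (length singles)) (odd-double (length pairs))))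

      -- Every pair contributes one token, and a single one more. Without singles the number of
      -- removed edges is even, so `z` is odd and has the additional token from the start.
      enough : ∀ f → length pairs + 1 ≤ tk (dR f) z
      enough f = subst (length pairs + 1 ≤_) (sym (tkR-z f)) (go (length singles) refl)
        where
        p = length pairs
        go : ∀ s → length singles ≡ s → p + 1 ≤ tk d₁ z + (length singles + p)
        go zero e = ≤-trans (≤-reflexive (+-comm p 1)) (+-mono-≤ (odd⇒tk d₁ (trans par₁-z (cong not (trans oddT (cong odd e))))) (m≤n+m p (length singles)))
        go (suc s) e = ≤-trans (≤-reflexive (+-comm p 1)) (≤-trans (+-monoˡ-≤ p (subst (1 ≤_) (sym e) (s≤s z≤n))) (m≤n+m _ (tk d₁ z)))

      plenty : ∀ f → 2 ≤ length singles → length pairs + 2 ≤ tk (dR f) z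
      plenty f h = subst (length pairs + 2 ≤_) (sym (tkR-z f)) (≤-trans (≤-reflexive (+-comm (length pairs) 2)) (≤-trans (+-monoˡ-≤ (length pairs) h) (m≤n+m _ (tk d₁ z))))

      lights : List (Fin N)
      lights = collect lightOf its

      -- In a triangle `lt` the mate `b` already has a token from the reinsertion of `bc`, which
      -- leaves `c` as the only obstacle.
      light-good : ∀ f {x} rs → x ∈ lights → Good f x rs
      light-good f rs m with ∈-collect lightOf its m
      ... | lw e , k , here refl = e , λ w f → contradiction f (proj₂ (proj₂ (valid k)) w)
      ... | lt a b c , k , here refl = c , λ w f → lem (IsoTri.cova (proj₁ (valid k)) w f)
        where
        lem : ∀ {w} → w ≡ b ⊎ w ≡ c → w ≡ c ⊎ (∃ λ c' → (w , c') ∈ B) ⊎ w ∈ rs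
        lem (inj₁ refl) = inj₂ (inj₁ (c , collect-∈ bcOf k (here refl)))
        lem (inj₂ e) = inj₁ e

      by-light : ∀ {p} → p ∈ pairs → proj₁ p ∈ lights ⊎ proj₂ p ∈ lights → Dc E L
      by-light {p} m h = tight f (rest f p) (proj₁ rs) (proj₂ rs) (light-good f (proj₁ rs) (rest-keep lights p h)) (enough f)
        where
        f = keep lights
        rs = ∈⇒↭ (∈-map⁺ (rest f) m)

      -- Three corners occupy at least two pairs, so two of them can be postponed; when the edge of
      -- the last one is inserted, the other has already gained a token.
      by-triangle : ∀ {a b c} → h3 a b c ∈ its → (∀ {v} → v ∈ a ∷ b ∷ c ∷ [] → ¬ v ∈ singles) → Dc E L
      by-triangle {a} {b} {c} k out = tight f x rs px good (enough f)
        where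
        Q = a ∷ b ∷ c ∷ []
        f = keep Q
        tr = proj₁ (valid k)
        three : 3 ≤ ∑ T₀ (χ Q)
        three = subst (3 ≤_) (sym (∑-collect tsOf its (χ Q))) (≤-trans (≤-reflexive (sym all)) (∈-∑ (λ i → ∑ (tsOf i) (χ Q)) k))
          where
          all : ∑ Q (χ Q) ≡ 3
          all = cong₂ _+_ (χ-∈ {Q} (here refl)) (cong₂ _+_ (χ-∈ {Q} (there (here refl))) (cong (_+ 0) (χ-∈ {Q} (there (there (here refl))))))
        sing0 : ∑ singles (χ Q) ≡ 0
        sing0 = go singles λ m q → out q m
          where
          go : ∀ l → (∀ {v} → v ∈ l → ¬ v ∈ Q) → ∑ l (χ Q) ≡ 0
          go [] h = refl
          go (v ∷ l) h with mem? v Q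
          ... | yes m = contradiction m (h (here refl))
          ... | no _ = go l (h ∘ there)
        S = ∑ (rem f) (χ Q)
        dbl : 3 ≤ S + S
        dbl = ≤-trans three (≤-trans (≤-reflexive (trans (∑-↭ (χ Q) part) (trans (∑-++ (flat pairs) singles (χ Q)) (trans (+congʳ sing0) (+-identityʳ _))))) (χ-flat Q pairs))
        S2 : 2 ≤ S
        S2 = half S dbl
          where
          half : ∀ S → 3 ≤ S + S → 2 ≤ S
          half zero ()
          half (suc zero) (s≤s (s≤s ()))
          half (suc (suc S)) _ = s≤s (s≤s z≤n)
        pk = ∑-pick (rem f) (χ Q) (≤-trans (s≤s z≤n) S2)
        x = proj₁ pk
        rs = proj₁ (proj₂ pk)
        px : rem f ↭ x ∷ rs
        px = proj₁ (proj₂ (proj₂ pk))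
        xQ : x ∈ Q
        xQ = χ-pos {Q} (proj₂ (proj₂ (proj₂ pk)))
        pk' = ∑-pick rs (χ Q) (+-cancelˡ-≤ 1 1 _ (≤-trans S2 (≤-trans (≤-reflexive (∑-↭ (χ Q) px)) (+-monoˡ-≤ (∑ rs (χ Q)) (χ≤1 Q x)))))
        m = proj₁ pk'
        mQ : m ∈ Q
        mQ = χ-pos {Q} (proj₂ (proj₂ (proj₂ pk')))
        mrs : m ∈ rs
        mrs = ∈-resp-↭ (↭-sym (proj₁ (proj₂ (proj₂ pk')))) (here refl)
        x≢m : x ≢ m
        x≢m e = contradiction (subst (_≤ 1) (cnt-↭ px x) (uqR f x)) (<⇒≱ (≤-trans (s≤s (cnt-∈ (subst (_∈ rs) (sym e) mrs))) (+-monoˡ-≤ (cnt rs x) (≤-reflexive (sym (δ-refl x))))))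
        third : ∀ {w y} → w ≡ m ⊎ w ≡ y → w ≡ y ⊎ (∃ λ c' → (w , c') ∈ B) ⊎ w ∈ rs
        third (inj₁ refl) = inj₂ (inj₂ mrs)
        third (inj₂ e) = inj₁ e
        good : Good f x rs
        good = go xQ mQ
          where
          go : x ∈ Q → m ∈ Q → Good f x rs
          go (here p) (here q) = contradiction (trans p (sym q)) x≢m
          go (here p) (there (here q)) = c , λ w fe → third (subst (λ y → w ≡ y ⊎ w ≡ c) (sym q) (IsoTri.cova tr w (subst (λ y → FE G y w) p fe)))
          go (here p) (there (there (here q))) = b , λ w fe → third (subst (λ y → w ≡ y ⊎ w ≡ b) (sym q) (⊎-swap (IsoTri.cova tr w (subst (λ y → FE G y w) p fe))))
          go (there (here p)) (here q) = c , λ w fe → third (subst (λ y → w ≡ y ⊎ w ≡ c) (sym q) (IsoTri.covb tr w (subst (λ y → FE G y w) p fe)))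
          go (there (here p)) (there (here q)) = contradiction (trans p (sym q)) x≢m
          go (there (here p)) (there (there (here q))) = a , λ w fe → third (subst (λ y → w ≡ y ⊎ w ≡ a) (sym q) (⊎-swap (IsoTri.covb tr w (subst (λ y → FE G y w) p fe))))
          go (there (there (here p))) (here q) = b , λ w fe → third (subst (λ y → w ≡ y ⊎ w ≡ b) (sym q) (IsoTri.covc tr w (subst (λ y → FE G y w) p fe)))
          go (there (there (here p))) (there (here q)) = a , λ w fe → third (subst (λ y → w ≡ y ⊎ w ≡ a) (sym q) (⊎-swap (IsoTri.covc tr w (subst (λ y → FE G y w) p fe))))
          go (there (there (here p))) (there (there (here q))) = contradiction (trans p (sym q)) x≢m

      IsFree : It → Set
      IsFree (h3 a b c) = ¬ a ∈ singles × ¬ b ∈ singles × ¬ c ∈ singles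
      IsFree _ = ⊥

      free? : ∀ i → Dec (IsFree i)
      free? (lw _) = no λ ()
      free? (lt _ _ _) = no λ ()
      free? (h2 _ _ _) = no λ ()
      free? (h3 a b c) = ¬? (mem? a singles) ×-dec ¬? (mem? b singles) ×-dec ¬? (mem? c singles)

      -- In this situation every light end is a single and every `h3` has a corner among the
      -- singles, so each item other than `h2` uses up a single of its own. At most one single
      -- leaves at most one such item; an `h2` forces even parity, hence no single, and is unique.
      -- What remains is one item, excluded by `not-alone` or by the existence of a pair.
      blocked : pairs ≢ [] → length singles ≤ 1 → (∀ {p} → p ∈ pairs → ¬ (proj₁ p ∈ lights ⊎ proj₂ p ∈ lights)) →
        (∀ {i} → i ∈ its → ¬ IsFree i) → ⊥
      blocked pne s1 nol nof = shape its refl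
        where
        cs : Fin N → ℕ
        cs v = cnt singles v
        hit : ∀ {v} → v ∈ T₀ → ¬ v ∈ flat pairs → v ∈ singles
        hit m n with ∈-++⁻ (flat pairs) (∈-resp-↭ part m)
        ... | inj₁ k = contradiction k n
        ... | inj₂ k = k
        light-hit : ∀ {v} → v ∈ lights → v ∈ T₀ → v ∈ singles
        light-hit {v} l m = hit m λ k → nol (proj₁ (proj₂ (∈-flat pairs k))) (lem (proj₂ (proj₂ (∈-flat pairs k))))
          where
          lem : ∀ {p : Fin N × Fin N} → v ≡ proj₁ p ⊎ v ≡ proj₂ p → proj₁ p ∈ lights ⊎ proj₂ p ∈ lights
          lem (inj₁ refl) = inj₁ l
          lem (inj₂ refl) = inj₂ l
        one : ∀ {i} → i ∈ its → ν i ≤ ∑ (tsOf i) cs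
        one {lw e} k = ≤-trans (cnt-∈ (light-hit (collect-∈ lightOf k (here refl)) (collect-∈ tsOf k (here refl)))) (m≤m+n _ _)
        one {lt a b c} k = ≤-trans (cnt-∈ (light-hit (collect-∈ lightOf k (here refl)) (collect-∈ tsOf k (here refl)))) (m≤m+n _ _)
        one {h2 a b c} k = z≤n
        one {h3 a b c} k with mem? a singles | mem? b singles | mem? c singles
        ... | yes m | _ | _ = ≤-trans (cnt-∈ m) (m≤m+n _ _)
        ... | no _ | yes m | _ = ≤-trans (cnt-∈ m) (≤-trans (m≤m+n (cs b) _) (m≤n+m _ (cs a)))
        ... | no _ | no _ | yes m = ≤-trans (cnt-∈ m) (≤-trans (m≤m+n (cs c) _) (≤-trans (m≤n+m _ (cs b)) (m≤n+m _ (cs a))))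
        ... | no p | no q | no r = contradiction (p , q , r) (nof k)
        total : ∑ its ν ≤ length singles
        total = begin
          ∑ its ν ≤⟨ ∑-mono-∈ its one ⟩
          ∑ its (λ i → ∑ (tsOf i) cs) ≡⟨ sym (∑-collect tsOf its cs) ⟩
          ∑ T₀ (λ v → ∑ singles (λ s → δ s v)) ≡⟨ ∑-swap T₀ singles (λ v s → δ s v) ⟩
          ∑ singles (λ s → ∑ T₀ (λ v → δ s v)) ≡⟨ ∑-cong singles (λ s → ∑-cong T₀ λ v → δ-sym s v) ⟩
          ∑ singles (λ s → cnt T₀ s) ≤⟨ ∑-mono singles uqT ⟩
          ∑ singles (λ _ → 1) ≡⟨ ∑-one singles ⟩
          length singles ∎
          where open ≤-Reasoning
        no-h2 : ∀ {a b c} → h2 a b c ∈ its → ∑ its ν ≡ 0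
        no-h2 k = n≤0⇒n≡0 (≤-trans total (zero-of (length singles) s1 (trans (sym oddT) (even-h2 k))))
          where
          zero-of : ∀ n → n ≤ 1 → odd n ≡ false → n ≤ 0
          zero-of zero _ _ = z≤n
          zero-of (suc zero) _ ()
          zero-of (suc (suc n)) (s≤s ()) _
        pairs-pos : 1 ≤ length pairs
        pairs-pos = go pairs refl
          where
          go : ∀ l → pairs ≡ l → 1 ≤ length pairs
          go [] e = contradiction e pne
          go (p ∷ l) e = subst (λ l → 1 ≤ length l) (sym e) (s≤s z≤n)
        long : 2 ≤ length T₀
        long = subst (2 ≤_) (sym lenT) (≤-trans (+-mono-≤ pairs-pos pairs-pos) (m≤m+n _ _))
        shape : ∀ l → its ≡ l → ⊥
        shape [] e = nonempty e
        shape (lw _ ∷ []) e = contradiction (subst (λ l → 2 ≤ length (collect tsOf l)) e long) λ { (s≤s ()) }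
        shape (lt _ _ _ ∷ []) e = contradiction (subst (λ l → 2 ≤ length (collect tsOf l)) e long) λ { (s≤s ()) }
        shape (h2 _ _ _ ∷ []) e = proj₁ not-alone e
        shape (h3 _ _ _ ∷ []) e = proj₂ not-alone e
        shape (i ∷ j ∷ l) e = pr i j refl refl
          where
          tot : ν i + (ν j + ∑ l ν) ≤ 1
          tot = ≤-trans (subst (λ l → ∑ l ν ≤ length singles) e total) s1
          etot : η i + (η j + ∑ l η) ≤ 1
          etot = subst (λ l → ∑ l η ≤ 1) e one-h2
          first : i ∈ its
          first = subst (i ∈_) (sym e) (here refl)
          second : j ∈ its
          second = subst (j ∈_) (sym e) (there (here refl))
          zero-tot : ∀ {a b c} → h2 a b c ∈ its → ν i + (ν j + ∑ l ν) ≡ 0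
          zero-tot k = subst (λ l → ∑ l ν ≡ 0) e (no-h2 k)
          ν+η : ∀ (i : It {N}) → ν i + η i ≡ 1
          ν+η (lw _) = refl
          ν+η (lt _ _ _) = refl
          ν+η (h2 _ _ _) = refl
          ν+η (h3 _ _ _) = refl
          both : η i ≡ 1 → η j ≡ 1 → ⊥
          both p q = contradiction (≤-trans (≤-reflexive (sym (cong₂ _+_ p q))) (≤-trans (+-monoʳ-≤ (η i) (m≤m+n (η j) _)) etot)) λ { (s≤s ()) }
          neither : ν i ≡ 1 → ν j ≡ 1 → ⊥
          neither p q = contradiction (≤-trans (≤-reflexive (sym (cong₂ _+_ p q))) (≤-trans (+-monoʳ-≤ (ν i) (m≤m+n (ν j) _)) tot)) λ { (s≤s ()) }
          νj0 : ∀ {a b c} → h2 a b c ∈ its → ν j ≡ 0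
          νj0 k = m+n≡0⇒m≡0 (ν j) (m+n≡0⇒n≡0 (ν i) (zero-tot k))
          νi0 : ∀ {a b c} → h2 a b c ∈ its → ν i ≡ 0
          νi0 k = m+n≡0⇒m≡0 (ν i) (zero-tot k)
          isη : ∀ {i : It {N}} → ν i ≡ 0 → η i ≡ 1
          isη {i} e = trans (sym (cong (_+ η i) e)) (ν+η i)
          pr : ∀ i' j' → i ≡ i' → j ≡ j' → ⊥
          pr (h2 a b c) j' refl _ = both refl (isη {j} (νj0 first))
          pr i' (h2 a b c) _ refl = both (isη {i} (νi0 second)) refl
          pr (lw _) (lw _) refl refl = neither refl refl
          pr (lw _) (lt _ _ _) refl refl = neither refl refl
          pr (lw _) (h3 _ _ _) refl refl = neither refl refl
          pr (lt _ _ _) (lw _) refl refl = neither refl refl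
          pr (lt _ _ _) (lt _ _ _) refl refl = neither refl refl
          pr (lt _ _ _) (h3 _ _ _) refl refl = neither refl refl
          pr (h3 _ _ _) (lw _) refl refl = neither refl refl
          pr (h3 _ _ _) (lt _ _ _) refl refl = neither refl refl
          pr (h3 _ _ _) (h3 _ _ _) refl refl = neither refl refl

      solved : Dc E L
      solved = go pairs refl (2 ≤? length singles)
        where
        f₀ : Fin N × Fin N → Bool
        f₀ _ = true
        search : pairs ≢ [] → length singles ≤ 1 → Dc E L
        search pne s1 with anyP? (λ p → mem? (proj₁ p) lights ⊎-dec mem? (proj₂ p) lights) pairs
        ... | inj₁ (p , m , h) = by-light m h
        ... | inj₂ nol with anyP? free? its
        ... | inj₁ (h3 a b c , k , p , q , r) = by-triangle k λ { (here refl) → p ; (there (here refl)) → q ; (there (there (here refl))) → r }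
        ... | inj₂ nof = ⊥-elim (blocked pne s1 nol nof)
        go : ∀ l → pairs ≡ l → Dec (2 ≤ length singles) → Dc E L
        go _ _ (yes h) = loose f₀ (plenty f₀ h)
        go [] e (no _) = dc-≐ (togs-↭ z E (↭-reflexive (cong (map (rest f₀)) e))) (dR f₀)
        go (p ∷ l) e (no n) = search (λ e' → contradiction (trans (sym e) e') λ ()) (ℕ.s≤s⁻¹ (≰⇒> n))

    result : Φ G
    result = conclude induct
      where
      conclude : Φ G₂ → Φ G
      conclude (L , d₂ , le) = L , after (addBC B nB id uqB d₂) , le
        where
        after : Σ (Dc E₁ L) (λ d' → (∀ {b c} → (b , c) ∈ B → 1 ≤ tk d' b) × (∀ v → ¬ v ∈ flat B → tk d' v ≡ tk d₂ v)) → Dc E L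
        after (d₁ , tkB , _) = choose (many d₁ tkB)
          where
          choose : (∃ λ pairs → ∃ λ singles → T₀ ↭ flat pairs ++ singles × Use d₁ pairs singles) → Dc E L
          choose (pairs , singles , part , use) = Select.solved d₁ tkB pairs singles part use

-- Classification of odd vertices by their even neighbours

module _ {N : ℕ} where

  collect-↭ : ∀ {A : Set} (f : It {N} → List A) {is js} → is ↭ js → collect f is ↭ collect f js
  collect-↭ f prefl = ↭-refl
  collect-↭ f (prep x p) = ++⁺ˡ (f x) (collect-↭ f p)
  collect-↭ f (pswap x y p) = ↭-trans (++⁺ˡ (f x) (++⁺ˡ (f y) (collect-↭ f p))) (shifts (f x) (f y))
  collect-↭ f (ptrans p q) = ↭-trans (collect-↭ f p) (collect-↭ f q)

  AllTri : Graph N → Set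
  AllTri G = ∀ {x y} → FE G x y → ∃ λ v → IsoTri (FE G) x y v

  tri-swap : ∀ {G : Graph N} {a b c} → IsoTri (FE G) a b c → IsoTri (FE G) a c b
  tri-swap {G} (mkTri ab bc ac ca cb cc) = mkTri ac (FE-sym G bc) ab (λ w f → ⊎-swap (ca w f)) cc cb

  module _ (G : Graph N) (allTri : AllTri G) (z : Fin N) (zodd : Od G z) where

    No2 : List (It {N}) → Set
    No2 its = ∀ {a b c} → ¬ h2 a b c ∈ its

    record Groups (es : List (Fin N)) : Set where
      field
        its : List (It {N})
        valid : ∀ {i} → i ∈ its → Valid G z i
        uqW : Uq (collect vsOf its)
        no2 : No2 its
        cover : ∀ {e} → e ∈ es → Ed G z e → Ev G e → e ∈ collect vsOf its

    -- A triangle with exactly two corners joined to `z` is recorded as `lt`; `classify` may turn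
    -- one of them into `h2` to correct a parity.
    new : ∀ {e} → Ed G z e → Ev G e → ∃ λ i → Valid G z i × e ∈ vsOf i × Uq (vsOf i) ×
      (∀ {v} → v ∈ vsOf i → v ≡ e ⊎ FE G v e) × (∀ {a b c} → i ≢ h2 a b c)
    new {e} ze ev = go (any? (λ y → FE? G e y))
      where
      Res = ∃ λ i → Valid G z i × e ∈ vsOf i × Uq (vsOf i) × (∀ {v} → v ∈ vsOf i → v ≡ e ⊎ FE G v e) × (∀ {a b c} → i ≢ h2 a b c)
      uq1 : Uq (e ∷ [])
      uq1 v = subst (_≤ 1) (sym (+-identityʳ _)) (b2n≤1 ⌊ e ≟ v ⌋)
      link : ∀ {b c} → IsoTri (FE G) e b c → ∀ {v} → v ∈ e ∷ b ∷ c ∷ [] → v ≡ e ⊎ FE G v e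
      link t (here q) = inj₁ q
      link t (there (here refl)) = inj₂ (FE-sym G (IsoTri.ab t))
      link t (there (there (here refl))) = inj₂ (FE-sym G (IsoTri.ac t))
      uqt : ∀ {b c} → IsoTri (FE G) e b c → Uq (e ∷ b ∷ c ∷ [])
      uqt t = Reduce.uq₃ G (FE-≢ G (IsoTri.ab t)) (FE-≢ G (IsoTri.ac t)) (FE-≢ G (IsoTri.bc t))
      kind : ∀ y v → IsoTri (FE G) e y v → ∀ p q → adj G z y ≡ p → adj G z v ≡ q → Res
      kind y v t true true p q = h3 e y v , (t , ze , p , q) , here refl , uqt t , link t , λ ()
      kind y v t p false _ q = lt e y v , (t , ze , q) , here refl , uqt t , link t , λ ()
      kind y v t false true p q = lt e v y , (tri-swap {G} t , ze , p) , here refl , uqt (tri-swap {G} t) , link (tri-swap {G} t) , λ ()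
      go : Dec (∃ λ y → FE G e y) → Res
      go (no n) = lw e , (ze , ev , λ w f → n (w , f)) , here refl , uq1 , (λ { (here q) → inj₁ q }) , λ ()
      go (yes (y , f)) = kind y (proj₁ (allTri f)) (proj₂ (allTri f)) _ _ refl refl

    groups : ∀ es → Groups es
    groups [] = record { its = [] ; valid = λ () ; uqW = λ _ → z≤n ; no2 = λ () ; cover = λ () }
    groups (e ∷ es) = go (groups es)
      where
      go : Groups es → Groups (e ∷ es)
      go g = decide ((adj G z e ≟ᵇ true) ×-dec (par (adj G) e ≟ᵇ false)) (mem? e W)
        where
        open Groups g
        W = collect vsOf its
        same : (Ed G z e → Ev G e → e ∈ W) → Groups (e ∷ es)
        same h = record { its = its ; valid = valid ; uqW = uqW ; no2 = no2 ; cover = λ { (here refl) → h ; (there m) → cover m } }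
        extend : ¬ e ∈ W → (∃ λ i → Valid G z i × e ∈ vsOf i × Uq (vsOf i) × (∀ {v} → v ∈ vsOf i → v ≡ e ⊎ FE G v e) × (∀ {a b c} → i ≢ h2 a b c)) → Groups (e ∷ es)
        extend n (i , vi , ei , ui , li , nh) = record
          { its = i ∷ its
          ; valid = λ { (here refl) → vi ; (there m) → valid m }
          ; uqW = λ v → subst (_≤ 1) (sym (∑-++ (vsOf i) W _)) (uq v (mem? v (vsOf i)))
          ; no2 = λ { (here q) → nh (sym q) ; (there m) → no2 m }
          ; cover = λ { (here refl) _ _ → ∈-++⁺ˡ ei ; (there m) p q → ∈-++⁺ʳ (vsOf i) (cover m p q) } }
          where
          out : ∀ {v} → v ∈ vsOf i → ¬ v ∈ W
          out {v} m k = lem (li m) (∈-collect vsOf its k)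
            where
            lem : v ≡ e ⊎ FE G v e → (∃ λ j → j ∈ its × v ∈ vsOf j) → ⊥
            lem (inj₁ refl) _ = n k
            lem (inj₂ f) (j , q , r) = n (collect-∈ vsOf q (item-closed G z j (valid q) r e f))
          uq : ∀ v → Dec (v ∈ vsOf i) → cnt (vsOf i) v + cnt W v ≤ 1
          uq v (yes m) = subst (_≤ 1) (sym (trans (+congʳ (∉⇒cnt0 W (out m))) (+-identityʳ _))) (ui v)
          uq v (no m) = subst (_≤ 1) (sym (+congˡ (∉⇒cnt0 (vsOf i) m))) (uqW v)
        decide : Dec (Ed G z e × Ev G e) → Dec (e ∈ W) → Groups (e ∷ es)
        decide (no k) _ = same λ p q → contradiction (p , q) k
        decide (yes _) (yes m) = same λ _ _ → m
        decide (yes (p , q)) (no m) = extend m (new p q)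

    None : Set
    None = ∀ e → Ed G z e → ¬ Ev G e

    Class : Set
    Class = None ⊎ (∃ λ a → ∃ λ b → ∃ λ c → Alone G z a b c) ⊎ ZData G z

    no2-η : ∀ is → No2 is → ∑ is η ≡ 0
    no2-η [] n = refl
    no2-η (lw _ ∷ is) n = no2-η is (n ∘ there)
    no2-η (lt _ _ _ ∷ is) n = no2-η is (n ∘ there)
    no2-η (h3 _ _ _ ∷ is) n = no2-η is (n ∘ there)
    no2-η (h2 _ _ _ ∷ is) n = contradiction (here refl) n

    -- Only `even-lt` can fail, and then the number of removed edges at `z` is odd. Turning one
    -- offending `lt` into `h2` removes one more edge at `z` and mends the parity for all of them,
    -- which is why a single `h2` suffices.
    classify : Class
    classify = go (groups (allFin N))
      where
      IsLt : It {N} → Set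
      IsLt (lt a b c) = Ed G z b
      IsLt _ = ⊥
      isLt? : ∀ i → Dec (IsLt i)
      isLt? (lw _) = no λ ()
      isLt? (lt a b c) = adj G z b ≟ᵇ true
      isLt? (h2 _ _ _) = no λ ()
      isLt? (h3 _ _ _) = no λ ()
      go : Groups (allFin N) → Class
      go g = decide (odd (length (collect tsOf its)) ≟ᵇ true) (anyP? isLt? its)
        where
        open Groups g
        complete : ∀ e → Ed G z e → Ev G e → e ∈ collect vsOf its
        complete e = cover (∈-allFin e)
        plain : (∀ {a b c} → lt a b c ∈ its → Ed G z b → odd (length (collect tsOf its)) ≡ false) → Class
        plain h = shape its refl
          where
          zd : its ≢ [] → (∀ {a b c} → its ≢ h3 a b c ∷ []) → Class
          zd ne na = inj₂ (inj₂ (record { zodd = zodd ; its = its ; valid = valid ; uqW = uqW ; complete = complete ; even-lt = h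
            ; even-h2 = λ m → contradiction m no2 ; one-h2 = subst (_≤ 1) (sym (no2-η its no2)) z≤n ; nonempty = ne
            ; not-alone = λ {a} {b} {c} → (λ e → no2 (subst (h2 a b c ∈_) (sym e) (here refl))) , na }))
          shape : ∀ l → its ≡ l → Class
          shape [] e = inj₁ λ v ze ev → contradiction (subst (λ l → v ∈ collect vsOf l) e (complete v ze ev)) λ ()
          shape (h3 a b c ∷ []) e = inj₂ (inj₁ (a , b , c , record { tri = proj₁ vi ; zodd = zodd ; za = proj₁ (proj₂ vi) ; zb = proj₁ (proj₂ (proj₂ vi))
              ; only = λ v ze ev → subst (λ l → v ∈ collect vsOf l) e (complete v ze ev) }))
            where
            vi = valid (subst (h3 a b c ∈_) (sym e) (here refl))
          shape (lw _ ∷ []) e = zd (λ e' → contradiction (trans (sym e) e') λ ()) (λ e' → contradiction (trans (sym e) e') λ ())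
          shape (lt _ _ _ ∷ []) e = zd (λ e' → contradiction (trans (sym e) e') λ ()) (λ e' → contradiction (trans (sym e) e') λ ())
          shape (h2 _ _ _ ∷ []) e = zd (λ e' → contradiction (trans (sym e) e') λ ()) (λ e' → contradiction (trans (sym e) e') λ ())
          shape (_ ∷ _ ∷ _) e = zd (λ e' → contradiction (trans (sym e) e') λ ()) (λ e' → contradiction (trans (sym e) e') λ ())
        special : ∀ {a b c} → lt a b c ∈ its → Ed G z b → odd (length (collect tsOf its)) ≡ true → Class
        special {a} {b} {c} m zb od = shape r refl
          where
          r = proj₁ (∈⇒↭ m)
          p : its ↭ lt a b c ∷ r
          p = proj₂ (∈⇒↭ m)
          its' = h2 a b c ∷ r
          vi = valid m
          no2r : No2 r
          no2r k = no2 (∈-resp-↭ (↭-sym p) (there k))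
          even : odd (length (collect tsOf its')) ≡ false
          even = trans (cong (not ∘ odd) (sym (↭-length (collect-↭ tsOf p)))) (cong not od)
          complete' : ∀ e → Ed G z e → Ev G e → e ∈ collect vsOf its'
          complete' e ze ev = ∈-resp-↭ (collect-↭ vsOf p) (complete e ze ev)
          shape : ∀ l → r ≡ l → Class
          shape [] e = inj₂ (inj₁ (a , b , c , record { tri = proj₁ vi ; zodd = zodd ; za = proj₁ (proj₂ vi) ; zb = zb
            ; only = λ v ze ev → subst (λ l → v ∈ collect vsOf (h2 a b c ∷ l)) e (complete' v ze ev) }))
          shape (j ∷ l) e = inj₂ (inj₂ (record
            { zodd = zodd ; its = its'
            ; valid = λ { (here refl) → proj₁ vi , proj₁ (proj₂ vi) , zb , proj₂ (proj₂ vi) ; (there k) → valid (∈-resp-↭ (↭-sym p) (there k)) }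
            ; uqW = λ v → subst (_≤ 1) (cnt-↭ (collect-↭ vsOf p) v) (uqW v)
            ; complete = complete'
            ; even-lt = λ _ _ → even ; even-h2 = λ _ → even
            ; one-h2 = s≤s (≤-reflexive (no2-η r no2r))
            ; nonempty = λ ()
            ; not-alone = (λ e' → contradiction (trans (sym e) (cong tailI e')) λ ()) , λ () }))
            where
            tailI : List (It {N}) → List (It {N})
            tailI [] = []
            tailI (_ ∷ l) = l
        decide : Dec (odd (length (collect tsOf its)) ≡ true) → (∃ λ i → i ∈ its × IsLt i) ⊎ (∀ {i} → i ∈ its → ¬ IsLt i) → Class
        decide (no n) _ = plain λ _ _ → ¬-not n
        decide (yes _) (inj₂ k) = plain λ m e → contradiction e (k m)
        decide (yes o) (inj₁ (lt a b c , m , e)) = special m e o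

  -- Graphs in which all even vertices are isolated

  module Base (G : Graph N) (oN : odd N ≡ true) (hst : Host (FE G)) (ih : IH G) (iso : ∀ {v w} → Ev G v → adj G v w ≡ false) where

    E : Adj {N}
    E = adj G

    base : Φ G
    base = go (any? λ u → any? λ v → any? λ z → (E u v ≟ᵇ true) ×-dec (E u z ≟ᵇ true) ×-dec ¬? (v ≟ z))
      where
      nonisolated : ∀ {u v} → Ed G u v → Od G u
      nonisolated {u} {v} e = ¬false (par E u) refl
        where
        ¬false : ∀ p → par E u ≡ p → Od G u
        ¬false true p = p
        ¬false false p = contradiction (trans (sym e) (iso p)) λ ()
      -- Without `uv` both `u` and `v` would be even and might lack tokens. A pendant edge from `v`
      -- to an isolated vertex `s` keeps `v` odd and later hands a token to `v`. Removing `zu` as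
      -- well makes the graph smaller and keeps `u` odd; `z` becomes even, but all its neighbours
      -- are odd.
      pendants : ∀ {u v z} → Ed G u v → Ed G u z → v ≢ z → Φ G
      pendants {u} {v} {z} uv uz v≢z = conclude (ih G₅ small (Host-mono (λ f → ⊥-elim (noF f)) hst) (λ a b c x → noF (Exc.ab x)))
        where
        s = proj₁ (exists-even oN G)
        es : Ev G s
        es = proj₂ (exists-even oN G)
        ou = nonisolated uv
        ov = nonisolated (Ed-sym G uv)
        oz = nonisolated (Ed-sym G uz)
        odd≢ : ∀ {x} → Od G x → x ≢ s
        odd≢ o refl = Od≢Ev G o es
        u≢s = odd≢ ou
        v≢s = odd≢ ov
        z≢s = odd≢ oz
        u≢v = Ed-≢ G uv
        u≢z = Ed-≢ G uz
        E₃ = tog u v E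
        G₃ = togG u v u≢v G
        E₄ = tog z u E₃
        G₄ = togG z u (u≢z ∘ sym) G₃
        E₅ = tog v s E₄
        G₅ = togG v s v≢s G₄
        zu₃ : E₃ z u ≡ true
        zu₃ = trans (tog-other u v E (ε-falseʳ u v≢z (u≢v ∘ sym))) (Ed-sym G uz)
        zu₅ : E₅ z u ≡ false
        zu₅ = trans (tog-other v s E₄ (ε-falseʳ v (z≢s ∘ sym) (u≢s ∘ sym))) (trans (tog-self z u E₃) (cong not zu₃))
        sv₃ : ∀ x → E₃ s x ≡ false
        sv₃ x = trans (tog-untouched E (u≢s ∘ sym) (v≢s ∘ sym) x) (iso es)
        vs₅ : E₅ v s ≡ true
        vs₅ = trans (tog-self v s E₄) (cong not (trans (Graph.sym G₄ v s) (trans (tog-untouched E₃ (z≢s ∘ sym) (u≢s ∘ sym) v) (sv₃ v))))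
        small : size E₅ < size E
        small = ≤-trans (≤-reflexive (cong suc (trans (size-tog G₅ vs₅) (+congˡ same)))) (≤-trans (s≤s (≤-reflexive (sym (size-tog G₃ zu₃))))
            (≤-trans (≤-reflexive (+-comm 1 _)) (≤-trans (+-monoʳ-≤ (size E₃) (s≤s z≤n)) (≤-reflexive (sym (size-tog G uv))))))
          where
          same : size (tog v s E₅) ≡ size E₄
          same = ∑-cong (allFin N) λ x → ∑-cong (allFin N) λ y → cong b2n (tog-tog v s E₄ x y)
        par₅ : ∀ {x} → par E₅ x ≡ false → x ≡ z ⊎ (Ev G x × x ≢ u × x ≢ v × x ≢ s)
        par₅ {x} p = go (x ≟ z) (x ≟ u) (x ≟ v) (x ≟ s)
          where
          go : Dec (x ≡ z) → Dec (x ≡ u) → Dec (x ≡ v) → Dec (x ≡ s) → x ≡ z ⊎ (Ev G x × x ≢ u × x ≢ v × x ≢ s)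
          go (yes q) _ _ _ = inj₁ q
          go (no _) (yes refl) _ _ = contradiction (trans (sym p) pu) λ ()
            where
            pu : par E₅ u ≡ true
            pu = trans (par-tog-other E₄ v≢s u≢v u≢s) (trans (par-togʳ E₃ (u≢z ∘ sym)) (cong not (trans (par-togˡ E u≢v) (cong not ou))))
          go (no _) (no _) (yes refl) _ = contradiction (trans (sym p) pv) λ ()
            where
            pv : par E₅ v ≡ true
            pv = trans (par-togˡ E₄ v≢s) (cong not (trans (par-tog-other E₃ (u≢z ∘ sym) v≢z (u≢v ∘ sym)) (trans (par-togʳ E u≢v) (cong not ov))))
          go (no _) (no _) (no _) (yes refl) = contradiction (trans (sym p) ps) λ ()
            where
            ps : par E₅ s ≡ true
            ps = trans (par-togʳ E₄ v≢s) (cong not (trans (par-tog-other E₃ (u≢z ∘ sym) (z≢s ∘ sym) (u≢s ∘ sym)) (trans (par-tog-other E u≢v (u≢s ∘ sym) (v≢s ∘ sym)) es)))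
          go (no a) (no b) (no c) (no d) = inj₂ (trans (sym (trans (par-tog-other E₄ v≢s c d) (trans (par-tog-other E₃ (u≢z ∘ sym) a b) (par-tog-other E u≢v b c)))) p , b , c , d)
        lonely : ∀ {x} w → Ev G x → x ≢ u → x ≢ v → x ≢ z → x ≢ s → E₅ x w ≡ false
        lonely w e a b c d = trans (tog-untouched E₄ b d w) (trans (tog-untouched E₃ c a w) (trans (tog-untouched E a b w) (iso e)))
        noF : ∀ {x y} → FE G₅ x y → ⊥
        noF {x} {y} (e , p , q) = go (par₅ p) (par₅ q) (x ≟ z) (y ≟ z)
          where
          go : x ≡ z ⊎ (Ev G x × x ≢ u × x ≢ v × x ≢ s) → y ≡ z ⊎ (Ev G y × y ≢ u × y ≢ v × y ≢ s) → Dec (x ≡ z) → Dec (y ≡ z) → ⊥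
          go _ _ (yes refl) (yes refl) = Ed-≢ G₅ e refl
          go (inj₁ k) _ (no n) _ = n k
          go (inj₂ (ex , a , b , c)) _ (no n) _ = true≢false (trans (sym e) (lonely y ex a b n c))
          go _ (inj₁ k) (yes _) (no n) = n k
          go _ (inj₂ (ey , a , b , c)) (yes _) (no n) = true≢false (trans (sym (Ed-sym G₅ e)) (lonely x ey a b n c))
        zev : par E₅ z ≡ false
        zev = trans (par-tog-other E₄ v≢s (v≢z ∘ sym) z≢s) (trans (par-togˡ E₃ (u≢z ∘ sym)) (cong not (trans (par-tog-other E u≢v (u≢z ∘ sym) (v≢z ∘ sym)) oz)))
        conclude : Φ G₅ → Φ G
        conclude (L , d₅ , le) = L , dc-≐ (tog-tog u v E) (proj₁ s₃) , le
          where
          upar : par E₅ u ≡ true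
          upar = trans (par-tog-other E₄ v≢s u≢v u≢s) (trans (par-togʳ E₃ (u≢z ∘ sym)) (cong not (trans (par-togˡ E u≢v) (cong not ou))))
          s₁ = add1 d₅ {z} {u} [] (u≢z ∘ sym) zu₅ (λ w e p → ⊥-elim (noF (e , zev , p))) (odd⇒tk d₅ upar)
          d₆ : Dc (tog v s E₃) L
          d₆ = dc-≐ (λ x y → trans (tog-comm z u v s E₄ x y) (tog-cong v s (tog-tog z u E₃) x y)) (proj₁ s₁)
          pd = pendant G₃ v≢s sv₃ d₆
          s₃ = add1 (proj₁ pd) {u} {v} [] u≢v (trans (tog-self u v E) (cong not uv)) zs (proj₂ pd)
            where
            zs : ∀ w → E₃ u w ≡ true → par E₃ w ≡ false → 1 ≤ tk (proj₁ pd) w ⊎ w ∈ []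
            zs w e p = ⊥-elim (go (w ≟ u) (w ≟ v))
              where
              go : Dec (w ≡ u) → Dec (w ≡ v) → ⊥
              go (yes refl) _ = Ed-≢ G₃ e refl
              go _ (yes refl) = true≢false (trans (sym e) (trans (tog-self u v E) (cong not uv)))
              go (no a) (no b) = true≢false (trans (sym (Ed-sym G (tog-⊆ G uv u w e))) (iso (trans (sym (par-tog-other E u≢v a b)) p)))
      -- Tokens are degrees, which are at most one, so their sum `L + L` is at most `N`.
      matching : (∀ u v z → Ed G u v → Ed G u z → v ≡ z) → Φ G
      matching uniq = conclude (edges-Dc (size E) G ≤-refl)
        where
        deg≤1 : ∀ v → deg E v ≤ 1
        deg≤1 v = go (any? λ w → E v w ≟ᵇ true)
          where
          go : Dec (∃ λ w → Ed G v w) → deg E v ≤ 1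
          go (yes (w , e)) = ≤-trans (∑-mono (allFin N) le) (≤-reflexive (∑-δ w))
            where
            le : ∀ u → b2n (E v u) ≤ δ w u
            le u = at (E v u) refl
              where
              at : ∀ b → E v u ≡ b → b2n (E v u) ≤ δ w u
              at true q = subst (λ x → b2n (E v x) ≤ δ w x) (uniq v w u e q) (≤-trans (b2n≤1 _) (≤-reflexive (sym (δ-refl w))))
              at false q = subst (λ b → b2n b ≤ δ w u) (sym q) z≤n
          go (no n) = ≤-trans (≤-reflexive (∑-zero (allFin N) λ u → cong b2n (¬-not λ e → n (u , e)))) z≤n
        conclude : (∃ λ L → Σ (Dc E L) λ d → ∀ v → tk d v ≡ deg E v) → Φ G
        conclude (L , d , t) = L , d , ≤-trans (≤-reflexive (trans (sym (sum-tk d)) (∑-cong (allFin N) t)))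
          (≤-trans (∑-mono (allFin N) deg≤1) (≤-reflexive (trans (∑-one (allFin N)) (length-tabulate {n = N} id))))
      go : Dec (∃ λ u → ∃ λ v → ∃ λ z → Ed G u v × Ed G u z × v ≢ z) → Φ G
      go (yes (u , v , z , a , b , c)) = pendants a b c
      go (no n) = matching λ u v z a b → decide u v z a b (v ≟ z)
        where
        decide : ∀ u v z → Ed G u v → Ed G u z → Dec (v ≡ z) → v ≡ z
        decide u v z a b (yes e) = e
        decide u v z a b (no k) = contradiction (u , v , z , a , b , k) n

-- The induction

module _ {N : ℕ} where

  module Phase₂ (G : Graph N) (oN : odd N ≡ true) (hst : Host (FE G)) (nx : NoExc G) (ih : IH G) (allTri : AllTri G) where

    Calm : Fin N → Set
    Calm z = (∀ e → Ed G z e → ¬ Ev G e) ⊎ (∃ λ a → ∃ λ b → ∃ λ c → Alone G z a b c)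

    scan : ∀ l → (∃ λ z → ZData G z) ⊎ (∀ {z} → z ∈ l → Od G z → Calm z)
    scan [] = inj₂ λ ()
    scan (z ∷ l) = go (par (adj G) z) refl (scan l)
      where
      Res = (∃ λ z → ZData G z) ⊎ (∀ {x} → x ∈ z ∷ l → Od G x → Calm x)
      go : ∀ p → par (adj G) z ≡ p → (∃ λ z → ZData G z) ⊎ (∀ {x} → x ∈ l → Od G x → Calm x) → Res
      go _ _ (inj₁ r) = inj₁ r
      go false p (inj₂ k) = inj₂ λ { (here refl) o → ⊥-elim (Od≢Ev G o p) ; (there m) o → k m o }
      go true p (inj₂ k) = cl (classify G allTri z p)
        where
        cl : Class G allTri z p → Res
        cl (inj₁ n) = inj₂ λ { (here refl) _ → inj₁ n ; (there m) o → k m o }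
        cl (inj₂ (inj₁ a)) = inj₂ λ { (here refl) _ → inj₂ a ; (there m) o → k m o }
        cl (inj₂ (inj₂ d)) = inj₁ (z , d)

    module _ (calm : ∀ {z} → Od G z → Calm z) where

      module _ {a b c : Fin N} (tr : IsoTri (FE G) a b c) where
        private
          Δ : List (Fin N)
          Δ = a ∷ b ∷ c ∷ []

        clos : ∀ {v} → v ∈ Δ → ∀ w → FE G v w → w ∈ Δ
        clos = tri-closed G a tr

        evΔ : ∀ {v} → v ∈ Δ → Ev G v
        evΔ = tri-even G a tr

        ∉Δ : ∀ {u} → u ≢ a → u ≢ b → u ≢ c → ¬ u ∈ Δ
        ∉Δ p q r (here e) = p e
        ∉Δ p q r (there (here e)) = q e
        ∉Δ p q r (there (there (here e))) = r e

        adjΔ : ∀ {u} → Ed G u a ⊎ Ed G u b ⊎ Ed G u c → ∃ λ p → p ∈ Δ × Ed G u p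
        adjΔ (inj₁ e) = a , here refl , e
        adjΔ (inj₂ (inj₁ e)) = b , there (here refl) , e
        adjΔ (inj₂ (inj₂ e)) = c , there (there (here refl)) , e

        two-of : ∀ {u p q} → p ∈ Δ → q ∈ Δ → p ≢ q → Ed G u p → Ed G u q → Two G a b c u
        two-of (here refl) (here refl) n _ _ = contradiction refl n
        two-of (here refl) (there (here refl)) n e f = inj₁ (e , f)
        two-of (here refl) (there (there (here refl))) n e f = inj₂ (inj₂ (e , f))
        two-of (there (here refl)) (here refl) n e f = inj₁ (f , e)
        two-of (there (here refl)) (there (here refl)) n _ _ = contradiction refl n
        two-of (there (here refl)) (there (there (here refl))) n e f = inj₂ (inj₁ (e , f))
        two-of (there (there (here refl))) (here refl) n e f = inj₂ (inj₂ (f , e))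
        two-of (there (there (here refl))) (there (here refl)) n e f = inj₂ (inj₁ (f , e))
        two-of (there (there (here refl))) (there (there (here refl))) n _ _ = contradiction refl n

        alone-Δ : ∀ {u a' b' c' p} → Alone G u a' b' c' → p ∈ Δ → p ∈ a' ∷ b' ∷ c' ∷ [] → ∀ {v} → v ∈ a' ∷ b' ∷ c' ∷ [] → v ∈ Δ
        alone-Δ {u} {a'} {b'} {c'} {p} al pΔ p' m = go p' m
          where
          open Alone al using (ab; bc; ac)
          st : ∀ {v} → FE G p v → v ∈ Δ
          st = clos pΔ _
          sy = FE-sym G
          go : p ∈ a' ∷ b' ∷ c' ∷ [] → ∀ {v} → v ∈ a' ∷ b' ∷ c' ∷ [] → v ∈ Δ
          go (here refl) (here refl) = pΔ
          go (here refl) (there (here refl)) = st ab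
          go (here refl) (there (there (here refl))) = st ac
          go (there (here refl)) (here refl) = st (sy ab)
          go (there (here refl)) (there (here refl)) = pΔ
          go (there (here refl)) (there (there (here refl))) = st bc
          go (there (there (here refl))) (here refl) = st (sy ac)
          go (there (there (here refl))) (there (here refl)) = st (sy bc)
          go (there (there (here refl))) (there (there (here refl))) = pΔ

        near-odd : ∀ {u p} → ¬ u ∈ Δ → p ∈ Δ → Ed G u p → Od G u
        near-odd {u} {p} n m e = go (par (adj G) u) refl
          where
          go : ∀ q → par (adj G) u ≡ q → Od G u
          go true q = q
          go false q = contradiction (clos m u (Ed-sym G e , evΔ m , q)) n

        near-alone : ∀ {u p} → ¬ u ∈ Δ → p ∈ Δ → Ed G u p →
          ∃ λ a' → ∃ λ b' → ∃ λ c' → Alone G u a' b' c' × (∀ {v} → v ∈ a' ∷ b' ∷ c' ∷ [] → v ∈ Δ)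
        near-alone {u} {p} n m e = go (calm (near-odd n m e))
          where
          go : Calm u → ∃ λ a' → ∃ λ b' → ∃ λ c' → Alone G u a' b' c' × (∀ {v} → v ∈ a' ∷ b' ∷ c' ∷ [] → v ∈ Δ)
          go (inj₁ k) = contradiction (evΔ m) (k p e)
          go (inj₂ (a' , b' , c' , al)) = a' , b' , c' , al , alone-Δ al m (Alone.only al p e (evΔ m))

        -- A calm vertex adjacent to the triangle is `Alone` with it, and that includes two corners.
        near-two : ∀ {u p} → ¬ u ∈ Δ → p ∈ Δ → Ed G u p → Two G a b c u
        near-two n m e = go (near-alone n m e)
          where
          go : (∃ λ a' → ∃ λ b' → ∃ λ c' → Alone G _ a' b' c' × (∀ {v} → v ∈ a' ∷ b' ∷ c' ∷ [] → v ∈ Δ)) → Two G a b c _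
          go (a' , b' , c' , al , s) = two-of (s (here refl)) (s (there (here refl))) (FE-≢ G (Alone.ab al)) (Alone.za al) (Alone.zb al)

        two-adj : ∀ {u} → Two G a b c u → ∃ λ p → p ∈ Δ × Ed G u p
        two-adj (inj₁ (e , _)) = a , here refl , e
        two-adj (inj₂ (inj₁ (e , _))) = b , there (here refl) , e
        two-adj (inj₂ (inj₂ (e , _))) = a , here refl , e

        -- `w` is odd because `u` has no even neighbours outside the triangle, and `w` sees no
        -- corner because it would then see two. So `join` applies, and a triangle belonging to `w`
        -- is disjoint from this one.
        leak : ∀ {u w} → Two G a b c u → ¬ u ∈ Δ → Ed G u w → ¬ w ∈ Δ → ¬ Two G a b c w → Φ G
        leak {u} {w} tw n uw wn ntw = go (near-alone n (proj₁ (proj₂ (two-adj tw))) (proj₂ (proj₂ (two-adj tw))))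
          where
          far : ∀ {p} → p ∈ Δ → ¬ Ed G p w
          far m e = ntw (near-two wn m (Ed-sym G e))
          go : (∃ λ a' → ∃ λ b' → ∃ λ c' → Alone G u a' b' c' × (∀ {v} → v ∈ a' ∷ b' ∷ c' ∷ [] → v ∈ Δ)) → Φ G
          go (a' , b' , c' , al , s) = side (calm wodd)
            where
            wodd : Od G w
            wodd = oe (par (adj G) w) refl
              where
              oe : ∀ q → par (adj G) w ≡ q → Od G w
              oe true q = q
              oe false q = contradiction (s (Alone.only al w uw q)) wn
            side : Calm w → Φ G
            side (inj₁ none) = Join.join G hst nx ih al uw wodd (λ m → far (s m)) (self-side G none) λ ()
            side (inj₂ (a'' , b'' , c'' , al'')) = Join.join G hst nx ih al uw wodd (λ m → far (s m)) (proj₂ (strip-side G al''))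
              λ m k → far (alone-Δ al'' (s k) m (here refl)) (Ed-sym G (Alone.za al''))

        -- If no edge leaks, the triangle and its neighbours form an exceptional component, which
        -- `nx` excludes.
        triangle : Φ G
        triangle = go (any? λ u → any? λ w → Two? G a b c u ×-dec ¬? (mem? u Δ) ×-dec (adj G u w ≟ᵇ true) ×-dec ¬? (mem? w Δ) ×-dec ¬? (Two? G a b c w))
          where
          go : Dec (∃ λ u → ∃ λ w → Two G a b c u × ¬ u ∈ Δ × Ed G u w × ¬ w ∈ Δ × ¬ Two G a b c w) → Φ G
          go (yes (u , w , tw , n , e , wn , ntw)) = leak tw n e wn ntw
          go (no k) = contradiction exc (nx a b c)
            where
            cls : ∀ {u w} → Two G a b c u → u ≢ a → u ≢ b → u ≢ c → Ed G u w → (w ≡ a ⊎ w ≡ b ⊎ w ≡ c) ⊎ Two G a b c w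
            cls {u} {w} tw p q r e = dec (mem? w Δ) (Two? G a b c w)
              where
              dec : Dec (w ∈ Δ) → Dec (Two G a b c w) → (w ≡ a ⊎ w ≡ b ⊎ w ≡ c) ⊎ Two G a b c w
              dec (yes (here x)) _ = inj₁ (inj₁ x)
              dec (yes (there (here x))) _ = inj₁ (inj₂ (inj₁ x))
              dec (yes (there (there (here x)))) _ = inj₁ (inj₂ (inj₂ x))
              dec (no _) (yes t) = inj₂ t
              dec (no m) (no t) = contradiction (u , w , tw , ∉Δ p q r , e , m , t) k
            exc : Exc G a b c
            exc = record { ab = IsoTri.ab tr ; bc = IsoTri.bc tr ; ac = IsoTri.ac tr
              ; near = λ p q r e → near-odd (∉Δ p q r) (proj₁ (proj₂ (adjΔ e))) (proj₂ (proj₂ (adjΔ e))) ,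
                                    near-two (∉Δ p q r) (proj₁ (proj₂ (adjΔ e))) (proj₂ (proj₂ (adjΔ e)))
              ; closed = cls }

      finish : Φ G
      finish = go (any? λ x → any? λ y → FE? G x y)
        where
        go : Dec (∃ λ x → ∃ λ y → FE G x y) → Φ G
        go (yes (x , y , f)) = triangle (proj₂ (allTri f))
        go (no k) = Base.base G oN hst ih λ {v} {w} e → ¬-not λ d → absurd e d
          where
          absurd : ∀ {v w} → Ev G v → Ed G v w → ⊥
          absurd {v} {w} e d = oe (par (adj G) w) refl
            where
            oe : ∀ q → par (adj G) w ≡ q → ⊥
            oe false q = k (v , w , d , e , q)
            oe true q = cl (calm q)
              where
              cl : Calm w → ⊥
              cl (inj₁ n) = n v (Ed-sym G d) e
              cl (inj₂ (a , b , c , al)) = k (a , b , Alone.ab al)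

    phase₂ : Φ G
    phase₂ = go (scan (allFin N))
      where
      go : (∃ λ z → ZData G z) ⊎ (∀ {z} → z ∈ allFin N → Od G z → Calm z) → Φ G
      go (inj₁ (z , zd)) = Zfin.result G z zd hst nx ih allTri
      go (inj₂ calm) = finish λ o → calm (∈-allFin _) o

  Config : Rel {N} → Set
  Config R = ((∃ λ x → ∃ λ y → R₁ R x y) ⊎ (∃ λ x → ∃ λ y → ∃ λ v → ∃ λ u → R₂ R x y v u) ⊎ (∃ λ x → ∃ λ y → ∃ λ v → ∃ λ w → R₃ R x y v w))
    ⊎ (∀ {x y} → R x y → ∃ λ v → IsoTri R x y v)

  main : odd N ≡ true → (∀ G → Host (FE G) → Config (FE G)) → ∀ n (G : Graph N) → size (adj G) < n → Host (FE G) → NoExc G → Φ G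
  main oN str (suc n) G bd hst nx = go (str G hst)
    where
    ih : IH G
    ih G' lt' hst' nx' = main oN str n G' (≤-trans lt' (ℕ.s≤s⁻¹ bd)) hst' nx'
    go : Config (FE G) → Φ G
    go (inj₁ c) = Phase₁.phase₁ G hst nx ih c
    go (inj₂ t) = Phase₂.phase₂ G oN hst nx ih t

-- Structure of irreducible even subgraphs

¬¬-bind : ∀ {A B : Set} → ¬ ¬ A → (A → ¬ ¬ B) → ¬ ¬ B
¬¬-bind a f k = a λ x → f x k

¬¬-all : ∀ {n} {P : Fin n → Set} → (∀ i → ¬ ¬ P i) → ¬ ¬ (∀ i → P i)
¬¬-all {zero} h k = k λ ()
¬¬-all {suc n} h k = h zero λ p → ¬¬-all (λ i → h (suc i)) λ q → k λ { zero → p ; (suc i) → q i }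

module Structure {N : ℕ} (R : Rel {N}) (R? : ∀ u v → Dec (R u v)) (R-sym : ∀ {u v} → R u v → R v u)
  (R-irr : ∀ {u v} → R u v → u ≢ v) (hst : Host R) where

  open Host hst

  Av-≢ˡ : ∀ {c u v} → Av R c u v → u ≢ c
  Av-≢ˡ (stay n) = n
  Av-≢ˡ (via n _ _) = n

  Av-≢ʳ : ∀ {c u v} → Av R c u v → v ≢ c
  Av-≢ʳ (stay n) = n
  Av-≢ʳ (via _ _ a) = Av-≢ʳ a

  Av-trans : ∀ {c u v w} → Av R c u v → Av R c v w → Av R c u w
  Av-trans (stay _) b = b
  Av-trans (via n r a) b = via n r (Av-trans a b)

  Av-sym : ∀ {c u v} → Av R c u v → Av R c v u
  Av-sym (stay n) = stay n
  Av-sym (via n r a) = Av-trans (Av-sym a) (via (Av-≢ˡ a) (R-sym r) (stay n))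

  snoc : ∀ {c u v w} → Av R c u v → R v w → w ≢ c → Av R c u w
  snoc a r n = Av-trans a (via (Av-≢ʳ a) r (stay n))

  -- A walk off `k` that visited `c` would contain a walk from `e` to `c` off `k`.
  reroute : ∀ {k c e v} → ¬ Av R k e c → Av R k e v → Av R c e v
  reroute {k} {c} {e} n (stay p) = stay λ { refl → n (stay p) }
  reroute {k} {c} {e} n (via p r a) = via (λ { refl → n (stay p) }) r (reroute (λ b → n (via p r b)) a)

  module Reachable (reach : ∀ c d v → Dec (Av R c d v)) where

    vol : Fin N → Fin N → ℕ
    vol c d = ∑ (allFin N) λ v → b2n ⌊ reach c d v ⌋

    vol-< : ∀ {c d k e} → (∀ v → Av R k e v → Av R c d v) → ∀ {x} → Av R c d x → ¬ Av R k e x → vol k e < vol c d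
    vol-< {c} {d} {k} {e} sub {x} p q = ∑-strict le (∈-allFin x) strict
      where
      le : ∀ v → b2n ⌊ reach k e v ⌋ ≤ b2n ⌊ reach c d v ⌋
      le v with reach k e v | reach c d v
      ... | yes a | yes _ = ≤-refl
      ... | yes a | no n = contradiction (sub v a) n
      ... | no _ | _ = z≤n
      strict : b2n ⌊ reach k e x ⌋ < b2n ⌊ reach c d x ⌋
      strict with reach k e x | reach c d x
      ... | yes a | _ = contradiction a q
      ... | no _ | yes _ = ≤-refl
      ... | no _ | no n = contradiction p n

    -- No vertex of the component of d in R − c is a cut vertex.
    Minimal : Fin N → Fin N → Set
    Minimal c d = ∀ k → Av R c d k → ∀ e → R k e → Av R k e c

    -- If `k` separates its neighbour `e` from `c`, then everything on the side of `e` lies on the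
    -- side of `d` at `c`, which also contains `k`; passing to `k` and `e` makes the side strictly
    -- smaller.
    descend : ∀ n c d → vol c d < n → R c d → ∃ λ c' → ∃ λ d' → R c' d' × Minimal c' d' × (∀ v → Av R c' d' v → Av R c d v) × (c' ≡ c ⊎ Av R c d c')
    descend (suc n) c d b r = go (any? λ k → any? λ e → reach c d k ×-dec R? k e ×-dec ¬? (reach k e c))
      where
      go : Dec (∃ λ k → ∃ λ e → Av R c d k × R k e × ¬ Av R k e c) → ∃ λ c' → ∃ λ d' → R c' d' × Minimal c' d' × (∀ v → Av R c' d' v → Av R c d v) × (c' ≡ c ⊎ Av R c d c')
      go (no m) = c , d , r , min , (λ _ a → a) , inj₁ refl
        where
        min : Minimal c d
        min k a e f with reach k e c
        ... | yes p = p
        ... | no p = contradiction (k , e , a , f , p) m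
      go (yes (k , e , a , f , m)) = cont (descend n k e (≤-trans (vol-< sub a (λ p → Av-≢ʳ p refl)) (ℕ.s≤s⁻¹ b)) f)
        where
        e≢c : e ≢ c
        e≢c refl = m (stay (R-irr f ∘ sym))
        sub : ∀ v → Av R k e v → Av R c d v
        sub v p = Av-trans (snoc a f e≢c) (reroute m p)
        cont : (∃ λ c' → ∃ λ d' → R c' d' × Minimal c' d' × (∀ v → Av R c' d' v → Av R k e v) × (c' ≡ k ⊎ Av R k e c')) →
          ∃ λ c' → ∃ λ d' → R c' d' × Minimal c' d' × (∀ v → Av R c' d' v → Av R c d v) × (c' ≡ c ⊎ Av R c d c')
        cont (c' , d' , r' , min' , s' , q) = c' , d' , r' , min' , (λ v p → sub v (s' v p)) , inj₂ (loc q)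
          where
          loc : c' ≡ k ⊎ Av R k e c' → Av R c d c'
          loc (inj₁ refl) = a
          loc (inj₂ p) = sub _ p

  third : ∀ x p q → (∃ λ w → R x w × w ≢ p × w ≢ q) ⊎ (∀ w → R x w → w ≡ p ⊎ w ≡ q)
  third x p q = go (any? λ w → R? x w ×-dec ¬? (w ≟ p) ×-dec ¬? (w ≟ q))
    where
    go : Dec (∃ λ w → R x w × w ≢ p × w ≢ q) → (∃ λ w → R x w × w ≢ p × w ≢ q) ⊎ (∀ w → R x w → w ≡ p ⊎ w ≡ q)
    go (yes r) = inj₁ r
    go (no n) = inj₂ cov
      where
      cov : ∀ w → R x w → w ≡ p ⊎ w ≡ q
      cov w f with w ≟ p | w ≟ q
      ... | yes e | _ = inj₁ e
      ... | no _ | yes e = inj₂ e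
      ... | no a | no b = contradiction (w , f , a , b) n

  fourth : ∀ x p q s → (∃ λ w → R x w × w ≢ p × w ≢ q × w ≢ s) ⊎ Cov₃ R x p q s
  fourth x p q s = go (any? λ w → R? x w ×-dec ¬? (w ≟ p) ×-dec ¬? (w ≟ q) ×-dec ¬? (w ≟ s))
    where
    go : Dec (∃ λ w → R x w × w ≢ p × w ≢ q × w ≢ s) → (∃ λ w → R x w × w ≢ p × w ≢ q × w ≢ s) ⊎ Cov₃ R x p q s
    go (yes r) = inj₁ r
    go (no n) = inj₂ cov
      where
      cov : Cov₃ R x p q s
      cov w f with w ≟ p | w ≟ q | w ≟ s
      ... | yes e | _ | _ = inj₁ e
      ... | no _ | yes e | _ = inj₂ (inj₁ e)
      ... | no _ | no _ | yes e = inj₂ (inj₂ e)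
      ... | no a | no b | no c = contradiction (w , f , a , b , c) n

  module _ (n₁ : ∀ x y → ¬ R₁ R x y) (n₂ : ∀ x y v u → ¬ R₂ R x y v u) (n₃ : ∀ x y v w → ¬ R₃ R x y v w) where

    second : ∀ {x y} → R x y → ∃ λ w → R x w × w ≢ y
    second {x} {y} r = go (third x y y)
      where
      go : (∃ λ w → R x w × w ≢ y × w ≢ y) ⊎ (∀ w → R x w → w ≡ y ⊎ w ≡ y) → ∃ λ w → R x w × w ≢ y
      go (inj₁ (w , f , p , _)) = w , f , p
      go (inj₂ c) = contradiction (r , λ w f → mer (c w f)) (n₁ x y)
        where
        mer : ∀ {w} → w ≡ y ⊎ w ≡ y → w ≡ y
        mer (inj₁ e) = e
        mer (inj₂ e) = e

    Tops : Fin N → Set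
    Tops c = ∃ λ d₁ → ∃ λ d₂ → ∃ λ d₃ → ∃ λ d₄ → Distinct4 d₁ d₂ d₃ d₄ × R c d₁ × R c d₂ × R c d₃ × R c d₄

    module _ {c d : Fin N} (r : R c d) (min : ∀ k → Av R c d k → ∀ e → R k e → Av R k e c) where

      -- By minimality the neighbours of `k` all reach `c` off `k`, hence one another, and `host₁`
      -- forbids four of them.
      small : ∀ k → Av R c d k → ∀ {p q s w} → R k p → R k q → R k s → R k w → ¬ Distinct4 p q s w
      small k a kp kq ks kw dd = host₁ k dd kp kq ks kw (con kq) (con ks) (con kw)
        where
        con : ∀ {v} → R k v → Av R k _ v
        con kv = Av-trans (min k a _ kp) (Av-sym (min k a _ kv))

      cov₃ : ∀ k → Av R c d k → ∀ {x} → R k x → ∃ λ p → ∃ λ q → Cov₃ R k x p q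
      cov₃ k a {x} kx = go (second kx)
        where
        go : (∃ λ w → R k w × w ≢ x) → ∃ λ p → ∃ λ q → Cov₃ R k x p q
        go (p , kp , p≢x) = st (third k x p)
          where
          st : (∃ λ w → R k w × w ≢ x × w ≢ p) ⊎ (∀ w → R k w → w ≡ x ⊎ w ≡ p) → ∃ λ p → ∃ λ q → Cov₃ R k x p q
          st (inj₂ c) = p , p , λ w f → ex (c w f)
            where
            ex : ∀ {w} → w ≡ x ⊎ w ≡ p → w ≡ x ⊎ w ≡ p ⊎ w ≡ p
            ex (inj₁ e) = inj₁ e
            ex (inj₂ e) = inj₂ (inj₁ e)
          st (inj₁ (q , kq , q≢x , q≢p)) = fo (fourth k x p q)
            where
            fo : (∃ λ w → R k w × w ≢ x × w ≢ p × w ≢ q) ⊎ Cov₃ R k x p q → ∃ λ p → ∃ λ q → Cov₃ R k x p q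
            fo (inj₂ c) = p , q , c
            fo (inj₁ (w , kw , a' , b' , c')) = contradiction (dis4 (p≢x ∘ sym) (q≢x ∘ sym) (a' ∘ sym) (q≢p ∘ sym) (b' ∘ sym) (c' ∘ sym)) (small k a kx kp kq kw)

      inK : ∀ k → Av R c d k → ∀ {e} → R k e → e ≢ c → Av R c d e
      inK k a f n = snoc a f n

      -- A third neighbour would produce `R₃` at `k`. The degree of `c` is not under control, but
      -- `c` can be put in the place of `y`; the other neighbours lie in the minimal side.
      deg2 : ∀ k → Av R c d k → ∀ {p q} → R k p → R k q → p ≢ q → ∀ w → R k w → w ≡ p ⊎ w ≡ q
      deg2 k a {p} {q} kp kq p≢q = go (third k p q)
        where
        go : (∃ λ w → R k w × w ≢ p × w ≢ q) ⊎ (∀ w → R k w → w ≡ p ⊎ w ≡ q) → ∀ w → R k w → w ≡ p ⊎ w ≡ q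
        go (inj₂ c) = c
        go (inj₁ (s , ks , s≢p , s≢q)) = fo (fourth k p q s)
          where
          fo : (∃ λ w → R k w × w ≢ p × w ≢ q × w ≢ s) ⊎ Cov₃ R k p q s → ∀ w → R k w → w ≡ p ⊎ w ≡ q
          fo (inj₁ (w , kw , a' , b' , c')) = contradiction (dis4 p≢q (s≢p ∘ sym) (a' ∘ sym) (s≢q ∘ sym) (b' ∘ sym) (c' ∘ sym)) (small k a kp kq ks kw)
          fo (inj₂ cv) = ⊥-elim (choose (p ≟ c) (q ≟ c))
            where
            cv₁ : ∀ {e} → R k e → e ≢ c → ∃ λ x → ∃ λ y → Cov₃ R e k x y
            cv₁ {e} ke n = cov₃ e (inK k a ke n) (R-sym ke)
            rot : Cov₃ R k q p s
            rot w f with cv w f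
            ... | inj₁ x = inj₂ (inj₁ x)
            ... | inj₂ (inj₁ x) = inj₁ x
            ... | inj₂ (inj₂ x) = inj₂ (inj₂ x)
            rot' : Cov₃ R k s p q
            rot' w f with cv w f
            ... | inj₁ x = inj₂ (inj₁ x)
            ... | inj₂ (inj₁ x) = inj₂ (inj₂ x)
            ... | inj₂ (inj₂ x) = inj₁ x
            choose : Dec (p ≡ c) → Dec (q ≡ c) → ⊥
            choose (yes refl) _ = n₃ k p q s (mkR₃ kp kq ks p≢q (s≢p ∘ sym) (s≢q ∘ sym) cv (cv₁ kq (p≢q ∘ sym)) (cv₁ ks s≢p))
            choose (no n) (yes refl) = n₃ k q p s (mkR₃ kq kp ks (p≢q ∘ sym) (s≢q ∘ sym) (s≢p ∘ sym) rot (cv₁ kp n) (cv₁ ks s≢q))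
            choose (no n) (no m) = n₃ k s p q (mkR₃ ks kp kq s≢p s≢q p≢q rot' (cv₁ kp n) (cv₁ kq m))

      -- With `d` and `v` of degree two, the absence of `R₂` closes the path to a triangle. Degree
      -- three at `c` would be `R₃`, so the triangle is isolated or `c` has four neighbours, as
      -- `host₂` requires.
      terminal : ∃ λ v → R c v × R d v × (IsoTri R c d v ⊎ Tops c)
      terminal = go (second (R-sym r))
        where
        aD : Av R c d d
        aD = stay (R-irr r ∘ sym)
        go : (∃ λ v → R d v × v ≢ c) → ∃ λ v → R c v × R d v × (IsoTri R c d v ⊎ Tops c)
        go (v , dv , v≢c) = st (second (R-sym dv))
          where
          aV : Av R c d v
          aV = inK d aD dv v≢c
          covd : ∀ w → R d w → w ≡ c ⊎ w ≡ v
          covd = deg2 d aD (R-sym r) dv (v≢c ∘ sym)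
          st : (∃ λ u → R v u × u ≢ d) → ∃ λ v → R c v × R d v × (IsoTri R c d v ⊎ Tops c)
          st (u , vu , u≢d) = fin (c ≟ u)
            where
            covv : ∀ w → R v w → w ≡ d ⊎ w ≡ u
            covv = deg2 v aV (R-sym dv) vu (u≢d ∘ sym)
            fin : Dec (c ≡ u) → ∃ λ v → R c v × R d v × (IsoTri R c d v ⊎ Tops c)
            fin (no n) = contradiction (mkR₂ (R-sym r) dv vu (v≢c ∘ sym) u≢d n covd covv) (n₂ d c v u)
            fin (yes refl) = v , R-sym vu , dv , top (third c d v)
              where
              cv = R-sym vu
              top : (∃ λ w → R c w × w ≢ d × w ≢ v) ⊎ (∀ w → R c w → w ≡ d ⊎ w ≡ v) → IsoTri R c d v ⊎ Tops c
              top (inj₂ covc) = inj₁ (mkTri r dv cv covc covd λ w f → ⊎-swap (covv w f))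
              top (inj₁ (y , cy , y≢d , y≢v)) = inj₂ (fo (fourth c y d v))
                where
                fo : (∃ λ w → R c w × w ≢ y × w ≢ d × w ≢ v) ⊎ Cov₃ R c y d v → Tops c
                fo (inj₁ (w , cw , p , q , s)) = d , v , y , w , dis4 (R-irr dv) (y≢d ∘ sym) (q ∘ sym) (y≢v ∘ sym) (s ∘ sym) (p ∘ sym) , r , cv , cy , cw
                fo (inj₂ cv₃) = contradiction (mkR₃ cy r cv y≢d y≢v (R-irr dv) cv₃ (v , v , λ w f → ex (covd w f)) (d , d , λ w f → ex' (covv w f))) (n₃ c y d v)
                  where
                  ex : ∀ {w} → w ≡ c ⊎ w ≡ v → w ≡ c ⊎ w ≡ v ⊎ w ≡ v
                  ex (inj₁ e) = inj₁ e
                  ex (inj₂ e) = inj₂ (inj₁ e)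
                  ex' : ∀ {w} → w ≡ d ⊎ w ≡ c → w ≡ c ⊎ w ≡ d ⊎ w ≡ d
                  ex' (inj₁ e) = inj₂ (inj₁ e)
                  ex' (inj₂ e) = inj₁ e

    iso-closed : ∀ {a b c} → IsoTri R a b c → ∀ {x y} → x ∈ a ∷ b ∷ c ∷ [] → R x y → y ∈ a ∷ b ∷ c ∷ []
    iso-closed t (here refl) r with IsoTri.cova t _ r
    ... | inj₁ e = there (here e)
    ... | inj₂ e = there (there (here e))
    iso-closed t (there (here refl)) r with IsoTri.covb t _ r
    ... | inj₁ e = here e
    ... | inj₂ e = there (there (here e))
    iso-closed t (there (there (here refl))) r with IsoTri.covc t _ r
    ... | inj₁ e = here e
    ... | inj₂ e = there (here e)

    iso-reach : ∀ {a b c x z} → IsoTri R a b c → x ∈ a ∷ b ∷ c ∷ [] → ∀ {k} → Av R k x z → z ∈ a ∷ b ∷ c ∷ []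
    iso-reach t m (stay _) = m
    iso-reach t m (via _ r a) = iso-reach t (iso-closed t m r) a

    IsoTri? : ∀ a b c → Dec (IsoTri R a b c)
    IsoTri? a b c = map′ (λ (p , q , r , s , t , u) → mkTri p q r s t u) (λ (mkTri p q r s t u) → p , q , r , s , t , u)
      (R? a b ×-dec R? b c ×-dec R? a c ×-dec cov? a b c ×-dec cov? b a c ×-dec cov? c a b)
      where
      cov? : ∀ x p q → Dec (∀ w → R x w → w ≡ p ⊎ w ≡ q)
      cov? x p q = all? λ w → R? x w →-dec ((w ≟ p) ⊎-dec (w ≟ q))

    permute : ∀ {a b c x y} → IsoTri R a b c → x ∈ a ∷ b ∷ c ∷ [] → R x y → ∃ λ v → IsoTri R x y v
    permute {a} {b} {c} t@(mkTri ab bc ac ca cb cc) (here refl) r with ca _ r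
    ... | inj₁ refl = c , t
    ... | inj₂ refl = b , mkTri ac (R-sym bc) ab (λ w f → ⊎-swap (ca w f)) cc cb
    permute {a} {b} {c} t@(mkTri ab bc ac ca cb cc) (there (here refl)) r with cb _ r
    ... | inj₁ refl = c , mkTri (R-sym ab) ac bc cb ca (λ w f → ⊎-swap (cc w f))
    ... | inj₂ refl = a , mkTri bc (R-sym ac) (R-sym ab) (λ w f → ⊎-swap (cb w f)) (λ w f → ⊎-swap (cc w f)) ca
    permute {a} {b} {c} t@(mkTri ab bc ac ca cb cc) (there (there (here refl))) r with cc _ r
    ... | inj₁ refl = b , mkTri (R-sym ac) ab (R-sym bc) cc (λ w f → ⊎-swap (ca w f)) (λ w f → ⊎-swap (cb w f))
    ... | inj₂ refl = a , mkTri (R-sym bc) (R-sym ab) (R-sym ac) (λ w f → ⊎-swap (cc w f)) (λ w f → ⊎-swap (cb w f)) (λ w f → ⊎-swap (ca w f))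

    -- Every minimal side ends in a triangle. If the triangle found at `c` is not isolated, `host₂`
    -- names a direction at `c` without triangles, yet the descent in that direction finds another
    -- one.
    all-tri : ∀ {x y} → R x y → ∃ λ v → IsoTri R x y v
    all-tri {x} {y} r = go (any? λ v → IsoTri? x y v)
      where
      go : Dec (∃ λ v → IsoTri R x y v) → ∃ λ v → IsoTri R x y v
      go (yes t) = t
      -- The existence of `v` is decidable, so only a contradiction is needed, and for that
      -- reachability may be assumed decided.
      go (no n) = ⊥-elim (¬¬-all (λ c → ¬¬-all (λ d → ¬¬-all (λ v → ¬¬-excluded-middle {A = Av R c d v}))) absurd)
        where
        absurd : ¬ (∀ c d v → Dec (Av R c d v))
        absurd reach = first (descend (suc (vol x y)) x y ≤-refl r)
          where
          open Reachable reach
          first : (∃ λ c → ∃ λ d → R c d × Minimal c d × (∀ v → Av R c d v → Av R x y v) × (c ≡ x ⊎ Av R x y c)) → ⊥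
          first (c , d , cd , min , sub , loc) = next (terminal cd min)
            where
            next : (∃ λ v → R c v × R d v × (IsoTri R c d v ⊎ Tops c)) → ⊥
            next (v , cv , dv , inj₁ t) = n (permute t (x∈ loc) r)
              where
              x∈ : c ≡ x ⊎ Av R x y c → x ∈ c ∷ d ∷ v ∷ []
              x∈ (inj₁ e) = here (sym e)
              x∈ (inj₂ a) = iso-closed t (iso-reach t (here refl) (Av-sym a)) (R-sym r)
            next (v , cv , dv , inj₂ (d₁ , d₂ , d₃ , d₄ , dd , a₁ , a₂ , a₃ , a₄)) = host₂ c dd a₁ a₂ a₃ a₄ cd cv dv other
              where
              other : ¬ (∃ λ e → e ∈ d₁ ∷ d₂ ∷ d₃ ∷ d₄ ∷ [] × (∀ {x' v' c'} → R x' v' → R v' c' → R x' c' → x' ≢ c → ¬ Av R c e x'))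
              other (e , m , no-tri) = again (descend (suc (vol c e)) c e ≤-refl (ce m))
                where
                ce : e ∈ d₁ ∷ d₂ ∷ d₃ ∷ d₄ ∷ [] → R c e
                ce (here refl) = a₁
                ce (there (here refl)) = a₂
                ce (there (there (here refl))) = a₃
                ce (there (there (there (here refl)))) = a₄
                again : (∃ λ c' → ∃ λ d' → R c' d' × Minimal c' d' × (∀ v → Av R c' d' v → Av R c e v) × (c' ≡ c ⊎ Av R c e c')) → ⊥
                again (c' , d' , r' , min' , sub' , _) = tri (terminal r' min')
                  where
                  ad : Av R c e d'
                  ad = sub' d' (stay (R-irr r' ∘ sym))
                  tri : (∃ λ v' → R c' v' × R d' v' × (IsoTri R c' d' v' ⊎ Tops c')) → ⊥
                  tri (v' , cv' , dv' , _) = no-tri dv' (R-sym cv') (R-sym r') (Av-≢ʳ ad) ad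

  config : Config R
  config = go (any? λ x → any? λ y → r₁? x y) (any? λ x → any? λ y → any? λ v → any? λ u → r₂? x y v u) (any? λ x → any? λ y → any? λ v → any? λ w → r₃? x y v w)
    where
    r₁? : ∀ x y → Dec (R₁ R x y)
    r₁? x y = R? x y ×-dec all? λ w → R? x w →-dec (w ≟ y)
    r₂? : ∀ x y v u → Dec (R₂ R x y v u)
    r₂? x y v u = map′ (λ (p , q , r , s , t , z , a , b) → mkR₂ p q r s t z a b) (λ (mkR₂ p q r s t z a b) → p , q , r , s , t , z , a , b)
      (R? x y ×-dec R? x v ×-dec R? v u ×-dec ¬? (y ≟ v) ×-dec ¬? (u ≟ x) ×-dec ¬? (y ≟ u) ×-dec
       (all? λ w → R? x w →-dec ((w ≟ y) ⊎-dec (w ≟ v))) ×-dec (all? λ w → R? v w →-dec ((w ≟ x) ⊎-dec (w ≟ u))))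
    cov? : ∀ v x p q → Dec (Cov₃ R v x p q)
    cov? v x p q = all? λ w → R? v w →-dec ((w ≟ x) ⊎-dec ((w ≟ p) ⊎-dec (w ≟ q)))
    r₃? : ∀ x y v w → Dec (R₃ R x y v w)
    r₃? x y v w = map′ (λ (p , q , r , s , t , z , a , b , c) → mkR₃ p q r s t z a b c) (λ (mkR₃ p q r s t z a b c) → p , q , r , s , t , z , a , b , c)
      (R? x y ×-dec R? x v ×-dec R? x w ×-dec ¬? (y ≟ v) ×-dec ¬? (y ≟ w) ×-dec ¬? (v ≟ w) ×-dec cov? x y v w ×-dec
       (any? λ p → any? λ q → cov? v x p q) ×-dec (any? λ p → any? λ q → cov? w x p q))
    go : Dec (∃ λ x → ∃ λ y → R₁ R x y) → Dec (∃ λ x → ∃ λ y → ∃ λ v → ∃ λ u → R₂ R x y v u) → Dec (∃ λ x → ∃ λ y → ∃ λ v → ∃ λ w → R₃ R x y v w) → Config R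
    go (yes r) _ _ = inj₁ (inj₁ r)
    go (no _) (yes r) _ = inj₁ (inj₂ (inj₁ r))
    go (no _) (no _) (yes r) = inj₁ (inj₂ (inj₂ r))
    go (no a) (no b) (no c) = inj₂ (all-tri (λ x y r → a (x , y , r)) (λ x y v u r → b (x , y , v , u , r)) (λ x y v w r → c (x , y , v , w , r)))

-- Blocks

¬¬-→ : ∀ {A P : Set} → Dec A → (A → ¬ ¬ P) → ¬ ¬ (A → P)
¬¬-→ (yes a) h k = h a λ p → k λ _ → p
¬¬-→ (no n) h k = k λ a → contradiction a n

T∧ : ∀ {a b} → T a → T b → T (a ∧ b)
T∧ {true} _ q = q

T∧ˡ : ∀ {a b} → T (a ∧ b) → T a
T∧ˡ {true} _ = tt

T∧ʳ : ∀ {a b} → T (a ∧ b) → T b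
T∧ʳ {true} q = q

T∨ˡ : ∀ {a b} → T a → T (a ∨ b)
T∨ˡ {true} _ = tt

T∨ʳ : ∀ {a b} → T b → T (a ∨ b)
T∨ʳ {true} _ = tt
T∨ʳ {false} q = q

T∨ : ∀ {a b} → T (a ∨ b) → T a ⊎ T b
T∨ {true} _ = inj₁ tt
T∨ {false} q = inj₂ q

Tnot : ∀ {b} → ¬ T b → T (not b)
Tnot {true} n = ⊥-elim (n tt)
Tnot {false} _ = tt

¬Tnot : ∀ {b} → T (not b) → ¬ T b
¬Tnot {false} _ ()

countNbrs-∑ : ∀ {m} (E : Fin m → Fin m → Bool) v → countNbrs E v ≡ deg E v
countNbrs-∑ E v = go (allFin _)
  where
  go : ∀ l → sum (map (λ u → if E v u then 1 else 0) l) ≡ ∑ l (λ u → b2n (E v u))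
  go [] = refl
  go (x ∷ l) = cong (b2n (E v x) +_) (go l)

module _ {m : ℕ} where

  Teq : ∀ {x y : Fin m} → T ⌊ x ≟ y ⌋ → x ≡ y
  Teq t = eq-sound (T⇒≡ t)

  eqT : ∀ (x : Fin m) → T ⌊ x ≟ x ⌋
  eqT x = ≡⇒T (eq-refl x)

  neqT : ∀ {x y : Fin m} → x ≢ y → T (not ⌊ x ≟ y ⌋)
  neqT n = Tnot λ t → n (Teq t)

  Walk-mono : ∀ {E E' : Fin m → Fin m → Bool} → (∀ u v → T (E u v) → T (E' u v)) → ∀ {u v} → Walk E u v → Walk E' u v
  Walk-mono f here = here
  Walk-mono f (step e w) = step (f _ _ e) (Walk-mono f w)

  Walk-trans : ∀ {E : Fin m → Fin m → Bool} {u v w} → Walk E u v → Walk E v w → Walk E u w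
  Walk-trans here b = b
  Walk-trans (step e a) b = step e (Walk-trans a b)

  Walk-sym : ∀ {E : Fin m → Fin m → Bool} → (∀ u v → T (E u v) → T (E v u)) → ∀ {u v} → Walk E u v → Walk E v u
  Walk-sym s here = here
  Walk-sym s (step e w) = Walk-trans (Walk-sym s w) (step (s _ _ e) here)

  few-nbrs : ∀ {E : Fin m → Fin m → Bool} {c d₁ d₂ d₃ d₄} → Distinct4 d₁ d₂ d₃ d₄ →
    T (E c d₁) → T (E c d₂) → T (E c d₃) → T (E c d₄) → ¬ countNbrs E c ≤ 3
  few-nbrs {E} {c} {d₁} {d₂} {d₃} {d₄} (dis4 p q r s t u) e₁ e₂ e₃ e₄ le = contradiction (≤-trans four (subst (_≤ 3) (countNbrs-∑ E c) le)) (<⇒≱ ≤-refl)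
    where
    l = d₁ ∷ d₂ ∷ d₃ ∷ d₄ ∷ []
    none : ∀ {x v : Fin m} → x ≢ v → δ x v ≡ 0
    none = δ-≢
    uq : ∀ v → v ∈ l → cnt l v ≤ 1
    uq v (here refl) rewrite δ-refl v | none (p ∘ sym) | none (q ∘ sym) | none (r ∘ sym) = ≤-refl
    uq v (there (here refl)) rewrite δ-refl v | none p | none (s ∘ sym) | none (t ∘ sym) = ≤-refl
    uq v (there (there (here refl))) rewrite δ-refl v | none q | none s | none (u ∘ sym) = ≤-refl
    uq v (there (there (there (here refl)))) rewrite δ-refl v | none r | none t | none u = ≤-refl
    hit : ∀ {v} → v ∈ l → E c v ≡ true
    hit (here refl) = T⇒≡ e₁
    hit (there (here refl)) = T⇒≡ e₂
    hit (there (there (here refl))) = T⇒≡ e₃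
    hit (there (there (there (here refl)))) = T⇒≡ e₄
    le' : ∀ v → cnt l v ≤ b2n (E c v)
    le' v with mem? v l
    ... | yes k = ≤-trans (uq v k) (≤-reflexive (sym (cong b2n (hit k))))
    ... | no n = ≤-trans (≤-reflexive (∉⇒cnt0 l n)) z≤n
    four : 4 ≤ deg E c
    four = ≤-trans (≤-reflexive (sym (trans (sym (∑-swap l (allFin m) δ)) (trans (∑-cong l ∑-δ) (∑-one l))))) (∑-mono (allFin m) le')

  module Blocks (H : Graph m) where

    A : Fin m → Fin m → Bool
    A = adj H

    A-sym : ∀ u v → T (A u v) → T (A v u)
    A-sym u v t = subst T (Graph.sym H u v) t

    ⊆S-dec : ∀ (B B' : Subgraph H) → Dec (B ⊆S B')
    ⊆S-dec B B' = (all? λ v → T? (inV B v) →-dec T? (inV B' v)) ×-dec (all? λ u → all? λ v → T? (inE B u v) →-dec T? (inE B' u v))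

    -- The number of missing vertices and ordered pairs; it drops whenever a subgraph is properly
    -- enlarged.
    gap : Subgraph H → ℕ
    gap B = ∑ (allFin m) (λ v → b2n (not (inV B v))) + ∑ (allFin m) (λ u → ∑ (allFin m) (λ v → b2n (not (inE B u v))))

    gap-< : ∀ {B B' : Subgraph H} → B ⊆S B' → ¬ (B' ⊆S B) → gap B' < gap B
    gap-< {B} {B'} (sv , se) n = go (any? λ v → T? (inV B' v) ×-dec ¬? (T? (inV B v))) (any? λ u → any? λ v → T? (inE B' u v) ×-dec ¬? (T? (inE B u v)))
      where
      le : ∀ {a b} → (T a → T b) → b2n (not b) ≤ b2n (not a)
      le {true} {true} h = ≤-refl
      le {true} {false} h = ⊥-elim (h tt)
      le {false} {true} h = z≤n
      le {false} {false} h = ≤-refl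
      str : ∀ {a b} → ¬ T a → T b → b2n (not b) < b2n (not a)
      str {true} n _ = ⊥-elim (n tt)
      str {false} {true} _ _ = ≤-refl
      leV : ∀ v → b2n (not (inV B' v)) ≤ b2n (not (inV B v))
      leV v = le (sv v)
      leE : ∀ u → ∑ (allFin m) (λ v → b2n (not (inE B' u v))) ≤ ∑ (allFin m) (λ v → b2n (not (inE B u v)))
      leE u = ∑-mono (allFin m) λ v → le (se u v)
      go : Dec (∃ λ v → T (inV B' v) × ¬ T (inV B v)) → Dec (∃ λ u → ∃ λ v → T (inE B' u v) × ¬ T (inE B u v)) → gap B' < gap B
      go (yes (v , p , q)) _ = +-mono-<-≤ (∑-strict leV (∈-allFin v) (str q p)) (∑-mono (allFin m) leE)
      go (no _) (yes (u , v , p , q)) = +-mono-≤-< (∑-mono (allFin m) leV) (∑-strict leE (∈-allFin u) (∑-strict (λ v → le (se u v)) (∈-allFin v) (str q p)))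
      go (no a) (no b) = contradiction ((λ v p → st p (T? (inV B v)) λ q → a (v , p , q)) , λ u v p → st p (T? (inE B u v)) λ q → b (u , v , p , q)) n
        where
        st : ∀ {x y} → T x → Dec (T y) → ¬ ¬ T y → T y
        st _ (yes t) _ = t
        st _ (no k) h = contradiction k h

    ⊆S-trans : ∀ {B B' B'' : Subgraph H} → B ⊆S B' → B' ⊆S B'' → B ⊆S B''
    ⊆S-trans (a , b) (c , d) = (λ v x → c v (a v x)) , λ u v x → d u v (b u v x)

    -- Enlarging ends at a maximal 2-connected subgraph. Whether a larger one exists is not decided,
    -- hence the double negation.
    block⊇ : ∀ n (B : Subgraph H) → gap B < n → TwoConnected B → ¬ ¬ ∃ λ B* → IsBlock H B* × B ⊆S B*
    block⊇ (suc n) B bd tc = ¬¬-bind ¬¬-excluded-middle go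
      where
      go : Dec (∃ λ B' → TwoConnected B' × B ⊆S B' × ¬ (B' ⊆S B)) → ¬ ¬ ∃ λ B* → IsBlock H B* × B ⊆S B*
      go (no k) h = h (B , (tc , max) , (λ _ x → x) , λ _ _ x → x)
        where
        max : ∀ B' → TwoConnected B' → B ⊆S B' → B' ⊆S B
        max B' t s with ⊆S-dec B' B
        ... | yes p = p
        ... | no p = contradiction (B' , t , s , p) k
      go (yes (B' , t , s , p)) = ¬¬-bind (block⊇ n B' (≤-trans (gap-< {B} {B'} s p) (ℕ.s≤s⁻¹ bd)) t)
        λ { (B* , ib , s') h → h (B* , ib , ⊆S-trans {B} {B'} {B*} s s') }

    module _ (c d₀ d₁ : Fin m) (ds : List (Fin m)) (d₀∈ : d₀ ∈ ds) (d₁∈ : d₁ ∈ ds) (d₀≢d₁ : d₀ ≢ d₁)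
      (nbr : ∀ {d} → d ∈ ds → T (A c d)) (con : ∀ {d} → d ∈ ds → Av (Ed H) c d₀ d) where

      c≢ : ∀ {d} → d ∈ ds → c ≢ d
      c≢ k = Ed-≢ H (T⇒≡ (nbr k))

      res : (Fin m → Bool) → Fin m → Fin m → Bool
      res Q u v = A u v ∧ (Q u ∧ Q v)

      res-sym : ∀ Q u v → T (res Q u v) → T (res Q v u)
      res-sym Q u v t = T∧ (A-sym u v (T∧ˡ t)) (T∧ (T∧ʳ {Q u} (T∧ʳ {A u v} t)) (T∧ˡ {Q u} (T∧ʳ {A u v} t)))

      record GoodQ (Q : Fin m → Bool) : Set where
        field
          c∉ : ¬ T (Q c)
          ds⊆ : ∀ {d} → d ∈ ds → T (Q d)
          conn : ∀ q → T (Q q) → Walk (res Q) d₀ q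

      -- An inclusion-minimal connected set that contains `ds` and avoids `c`. Minimality is what
      -- makes the graph induced on it together with `c` 2-connected.
      Tight : (Fin m → Bool) → Set
      Tight Q = GoodQ Q × (∀ Q' → GoodQ Q' → (∀ v → T (Q' v) → T (Q v)) → ∀ v → T (Q v) → T (Q' v))

      sizeQ : (Fin m → Bool) → ℕ
      sizeQ Q = ∑ (allFin m) λ v → b2n (Q v)

      tighten : ∀ n Q → sizeQ Q < n → GoodQ Q → ¬ ¬ ∃ Tight
      tighten (suc n) Q bd g = ¬¬-bind ¬¬-excluded-middle go
        where
        go : Dec (∃ λ Q' → GoodQ Q' × (∀ v → T (Q' v) → T (Q v)) × ∃ λ v → T (Q v) × ¬ T (Q' v)) → ¬ ¬ ∃ Tight
        go (no k) h = h (Q , g , λ Q' g' s v t → st v t Q' g' s (T? (Q' v)))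
          where
          st : ∀ v → T (Q v) → ∀ Q' → GoodQ Q' → (∀ v → T (Q' v) → T (Q v)) → Dec (T (Q' v)) → T (Q' v)
          st v t Q' g' s (yes p) = p
          st v t Q' g' s (no p) = contradiction (Q' , g' , s , v , t , p) k
        go (yes (Q' , g' , s , v , t , p)) = tighten n Q' (≤-trans (∑-strict (λ v → le (s v)) (∈-allFin v) (str t p)) (ℕ.s≤s⁻¹ bd)) g'
          where
          le : ∀ {a b} → (T a → T b) → b2n a ≤ b2n b
          le {true} {true} h = ≤-refl
          le {true} {false} h = ⊥-elim (h tt)
          le {false} h = z≤n
          str : ∀ {a b} → T b → ¬ T a → b2n a < b2n b
          str {true} _ n = ⊥-elim (n tt)
          str {false} {true} _ _ = ≤-refl

      start : ¬ ¬ ∃ GoodQ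
      start = ¬¬-bind (¬¬-all λ v → ¬¬-excluded-middle {A = Av (Ed H) c d₀ v}) λ reach h → h (Q₀ reach , good reach)
        where
        Q₀ : (∀ v → Dec (Av (Ed H) c d₀ v)) → Fin m → Bool
        Q₀ reach v = ⌊ reach v ⌋
        good : ∀ reach → GoodQ (Q₀ reach)
        good reach = record { c∉ = λ t → end (snd c t) refl ; ds⊆ = λ k → fst _ (con k) ; conn = λ q t → wk (stay (c≢ d₀∈ ∘ sym)) (snd q t) }
          where
          fst : ∀ v → Av (Ed H) c d₀ v → T (Q₀ reach v)
          fst v a with reach v
          ... | yes _ = tt
          ... | no n = contradiction a n
          snd : ∀ v → T (Q₀ reach v) → Av (Ed H) c d₀ v
          snd v t with reach v
          ... | yes a = a
          end : ∀ {u v} → Av (Ed H) c u v → v ≢ c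
          end (stay n) = n
          end (via _ _ a) = end a
          app : ∀ {u v w} → Av (Ed H) c u v → Ed H v w → w ≢ c → Av (Ed H) c u w
          app (stay n) e k = via n e (stay k)
          app (via n r a) e k = via n r (app a e k)
          beg : ∀ {u v} → Av (Ed H) c u v → u ≢ c
          beg (stay n) = n
          beg (via n _ _) = n
          wk : ∀ {x y} → Av (Ed H) c d₀ x → Av (Ed H) c x y → Walk (res (Q₀ reach)) x y
          wk a (stay _) = here
          wk a (via n e b) = step (T∧ (≡⇒T e) (T∧ (fst _ a) (fst _ (app a e (beg b))))) (wk (app a e (beg b)) b)

      module _ (Q : Fin m → Bool) (g : GoodQ Q) (tight : ∀ Q' → GoodQ Q' → (∀ v → T (Q' v) → T (Q v)) → ∀ v → T (Q v) → T (Q' v)) where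
        open GoodQ g

        inVQ : Fin m → Bool
        inVQ v = Q v ∨ ⌊ c ≟ v ⌋

        B : Subgraph H
        B = record
          { inV = inVQ
          ; inE = λ u v → A u v ∧ (inVQ u ∧ inVQ v)
          ; inE-sym = λ u v → sm u v
          ; inE-adj = λ u v t → T∧ˡ t
          ; inE-inV = λ u v t → T∧ˡ {inVQ u} (T∧ʳ {A u v} t) }
          where
          sm : ∀ u v → A u v ∧ (inVQ u ∧ inVQ v) ≡ A v u ∧ (inVQ v ∧ inVQ u)
          sm u v = cong₂ _∧_ (Graph.sym H u v) (∧-comm (inVQ u) (inVQ v))

        Qv : ∀ {v} → T (Q v) → T (inVQ v)
        Qv t = T∨ˡ t

        cv : T (inVQ c)
        cv = T∨ʳ {Q c} (eqT c)

        eQ : ∀ {u v} → T (A u v) → T (inVQ u) → T (inVQ v) → T (inE B u v)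
        eQ a p q = T∧ a (T∧ p q)

        edc : ∀ {d} → d ∈ ds → T (inE B c d)
        edc k = eQ (nbr k) cv (Qv (ds⊆ k))

        B-sym : ∀ u v → T (inE B u v) → T (inE B v u)
        B-sym u v t = subst T (inE-sym B u v) t

        res⊆ : ∀ u v → T (res Q u v) → T (inE B u v)
        res⊆ u v t = eQ (T∧ˡ t) (Qv (T∧ˡ {Q u} (T∧ʳ {A u v} t))) (Qv (T∧ʳ {Q u} (T∧ʳ {A u v} t)))

        toC : ∀ u → T (inVQ u) → Walk (inE B) u c
        toC u t with T∨ {Q u} t
        ... | inj₂ e = subst (λ x → Walk (inE B) x c) (Teq e) here
        ... | inj₁ q = Walk-trans (Walk-sym B-sym (Walk-mono res⊆ (conn u q))) (step (B-sym c d₀ (edc d₀∈)) here)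

        del-sym : ∀ x u v → T (deleteVertex B x u v) → T (deleteVertex B x v u)
        del-sym x u v t = T∧ (B-sym u v (T∧ˡ t)) (T∧ (T∧ʳ {not ⌊ x ≟ u ⌋} (T∧ʳ {inE B u v} t)) (T∧ˡ {not ⌊ x ≟ u ⌋} (T∧ʳ {inE B u v} t)))

        del : ∀ x {u v} → T (inE B u v) → x ≢ u → x ≢ v → T (deleteVertex B x u v)
        del x e p q = T∧ e (T∧ (neqT p) (neqT q))

        delC : ∀ u v → T (res Q u v) → T (deleteVertex B c u v)
        delC u v t = del c (res⊆ u v t) (ne (T∧ˡ {Q u} (T∧ʳ {A u v} t))) (ne (T∧ʳ {Q u} (T∧ʳ {A u v} t)))
          where
          ne : ∀ {w} → T (Q w) → c ≢ w
          ne t refl = c∉ t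

        -- Let J be what `u` reaches in `Q` without `q`. If J meets `ds`, there is a way to `c`. If
        -- not, `Q` without J is still connected through `q` and contains `ds`, against minimality.
        detour : ∀ q → T (Q q) → ∀ u → T (Q u) → u ≢ q → ¬ ¬ Walk (deleteVertex B q) u c
        detour q tq u tu u≢q = ¬¬-bind (¬¬-all λ j → ¬¬-excluded-middle {A = Walk (λ x y → res Q x y ∧ (not ⌊ q ≟ x ⌋ ∧ not ⌊ q ≟ y ⌋)) u j}) cases
          where
          rq : Fin m → Fin m → Bool
          rq x y = res Q x y ∧ (not ⌊ q ≟ x ⌋ ∧ not ⌊ q ≟ y ⌋)
          rq⊆ : ∀ x y → T (rq x y) → T (deleteVertex B q x y)
          rq⊆ x y t = T∧ (res⊆ x y (T∧ˡ t)) (T∧ʳ {res Q x y} t)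
          q≢c : q ≢ c
          q≢c refl = c∉ tq
          wend : ∀ {x y} → x ≢ q → Walk rq x y → y ≢ q
          wend n here = n
          wend n (step {v = v} e w) = wend (λ p → ¬Tnot (T∧ʳ {not ⌊ q ≟ _ ⌋} (T∧ʳ {res Q _ v} e)) (subst (λ z → T ⌊ q ≟ z ⌋) (sym p) (eqT q))) w
          cases : (∀ j → Dec (Walk rq u j)) → ¬ ¬ Walk (deleteVertex B q) u c
          cases J = go (any? λ d → mem? d ds ×-dec J d)
            where
            go : Dec (∃ λ d → d ∈ ds × Walk rq u d) → ¬ ¬ Walk (deleteVertex B q) u c
            go (yes (d , k , w)) h = h (Walk-trans (Walk-mono rq⊆ w) (step (del q (B-sym c d (edc k)) (wend u≢q w ∘ sym) q≢c) here))
            go (no none) h = ¬Tnot (T∧ʳ {Q u} (tight Q' good' (λ v t → T∧ˡ t) u tu)) (yesJ here)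
              where
              Q' : Fin m → Bool
              Q' v = Q v ∧ not ⌊ J v ⌋
              yesJ : ∀ {v} → Walk rq u v → T ⌊ J v ⌋
              yesJ {v} w with J v
              ... | yes _ = tt
              ... | no n = contradiction w n
              isJ : ∀ {v} → T ⌊ J v ⌋ → Walk rq u v
              isJ {v} t with J v
              ... | yes w = w
              mk : ∀ {v} → T (Q v) → ¬ Walk rq u v → T (Q' v)
              mk t n = T∧ t (Tnot λ p → n (isJ p))
              -- The walk is followed until it is about to enter J; an edge of `Q` from outside into
              -- J can only start at `q`.
              prefix : ∀ {r s} → Walk (res Q) r s → T (Q r) → ¬ Walk rq u r → Walk rq u s → Walk (res Q') r q
              prefix here t n w = contradiction w n
              prefix {r} (step {v = r'} e w) t n ws = split' (J r')
                where
                tr' = T∧ʳ {Q r} (T∧ʳ {A r r'} e)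
                split' : Dec (Walk rq u r') → Walk (res Q') r q
                split' (no n') = step (T∧ {A r r'} (T∧ˡ {A r r'} e) (T∧ (mk t n) (mk tr' n'))) (prefix w tr' n' ws)
                split' (yes w') = back (q ≟ r)
                  where
                  back : Dec (q ≡ r) → Walk (res Q') r q
                  back (yes refl) = here
                  back (no k) = contradiction (Walk-trans w' (step (T∧ (res-sym Q r r' e) (T∧ (neqT (wend u≢q w' ∘ sym)) (neqT k))) here)) n
              toq : ∀ r → T (Q' r) → Walk (res Q') r q
              toq r t = prefix (Walk-trans (Walk-sym (res-sym Q) (conn r (T∧ˡ t))) (conn u tu)) (T∧ˡ t) (λ w → ¬Tnot (T∧ʳ {Q r} t) (yesJ w)) here
              good' : GoodQ Q'
              good' = record
                { c∉ = λ t → c∉ (T∧ˡ t)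
                ; ds⊆ = λ k → mk (ds⊆ k) λ w → none (_ , k , w)
                ; conn = λ r t → Walk-trans (toq d₀ (mk (ds⊆ d₀∈) λ w → none (d₀ , d₀∈ , w))) (Walk-sym (res-sym Q') (toq r t)) }

        around : ∀ x → T (inVQ x) → ∀ u → T (inVQ u) → u ≢ x → x ≢ c → ¬ ¬ Walk (deleteVertex B x) u c
        around x tx u tu n k with T∨ {Q x} tx | T∨ {Q u} tu
        ... | inj₂ e | _ = contradiction (sym (Teq e)) k
        ... | inj₁ _ | inj₂ e = λ h → h (subst (λ z → Walk (deleteVertex B x) z c) (Teq e) here)
        ... | inj₁ q | inj₁ r = detour x q u r n

        two-connected : ¬ ¬ TwoConnected B
        two-connected = ¬¬-bind (¬¬-all λ x → ¬¬-→ (T? (inVQ x)) λ tx → ¬¬-all λ u → ¬¬-all λ v → ¬¬-→ (T? (inVQ u)) λ tu → ¬¬-→ (T? (inVQ v)) λ tv →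
            ¬¬-→ (¬? (u ≟ x)) λ un → ¬¬-→ (¬? (v ≟ x)) λ vn → pathsx x tx u v tu tv un vn)
          λ del h → h ((c , d₀ , d₁ , cv , Qv (ds⊆ d₀∈) , Qv (ds⊆ d₁∈) , c≢ d₀∈ , d₀≢d₁ , c≢ d₁∈) ,
            (λ u v tu tv → Walk-trans (toC u tu) (Walk-sym B-sym (toC v tv))) , del)
          where
          pathsx : ∀ x → T (inVQ x) → ∀ u v → T (inVQ u) → T (inVQ v) → u ≢ x → v ≢ x → ¬ ¬ Walk (deleteVertex B x) u v
          pathsx x tx u v tu tv un vn = go (x ≟ c)
            where
            inQ : ∀ {w} → T (inVQ w) → w ≢ c → T (Q w)
            inQ {w} t n with T∨ {Q w} t
            ... | inj₁ q = q
            ... | inj₂ e = contradiction (sym (Teq e)) n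
            go : Dec (x ≡ c) → ¬ ¬ Walk (deleteVertex B x) u v
            go (yes refl) h = h (Walk-mono delC (Walk-trans (Walk-sym (res-sym Q) (conn u (inQ tu un))) (conn v (inQ tv vn))))
            go (no n) = ¬¬-bind (around x tx u tu un n) λ a → ¬¬-bind (around x tx v tv vn n) λ b h → h (Walk-trans a (Walk-sym (del-sym x) b))

      Through : Set
      Through = ∃ λ B → IsBlock H B × (∀ {d} → d ∈ ds → T (inE B c d)) × (∀ {d e} → d ∈ ds → e ∈ ds → T (A d e) → T (inE B d e))

      -- The subgraph on `Q` and `c` is induced, so the edges inside `ds` come along; this puts a
      -- whole triangle into one block.
      block-through : ¬ ¬ Through
      block-through = ¬¬-bind start λ { (Q₀ , g₀) → ¬¬-bind (tighten (suc (sizeQ Q₀)) Q₀ ≤-refl g₀) enlarge }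
        where
        enlarge : ∃ Tight → ¬ ¬ Through
        enlarge (Q , g , tight) = ¬¬-bind (two-connected Q g tight) λ tc → ¬¬-bind (block⊇ (suc (gap BQ)) BQ ≤-refl tc) through
          where
          BQ = B Q g tight
          through : (∃ λ B* → IsBlock H B* × BQ ⊆S B*) → ¬ ¬ Through
          through (B* , ib , _ , se) h = h (B* , ib , (λ k → se _ _ (edc Q g tight k)) ,
            λ k l a → se _ _ (eQ Q g tight a (Qv Q g tight (GoodQ.ds⊆ g k)) (Qv Q g tight (GoodQ.ds⊆ g l))))

  -- The family satisfies the host conditions

  module _ (H : Graph m) (fam : InFamily H) where
    open Blocks H

    private
      S : Rel {m}
      S = Ed H
      av-trans : ∀ {c u v w} → Av S c u v → Av S c v w → Av S c u w
      av-trans (stay _) b = b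
      av-trans (via n r a) b = via n r (av-trans a b)
      av-beg : ∀ {c u v} → Av S c u v → u ≢ c
      av-beg (stay n) = n
      av-beg (via n _ _) = n
      av-sym : ∀ {c u v} → Av S c u v → Av S c v u
      av-sym (stay n) = stay n
      av-sym (via n r a) = av-trans (av-sym a) (via (av-beg a) (Ed-sym H r) (stay n))
      av-walk : ∀ {c u v} → Av S c u v → Walk A u v
      av-walk (stay _) = here
      av-walk (via _ r a) = step (≡⇒T r) (av-walk a)

    fam-host₁ : ∀ c {d₁ d₂ d₃ d₄} → Distinct4 d₁ d₂ d₃ d₄ → S c d₁ → S c d₂ → S c d₃ → S c d₄ →
      Av S c d₁ d₂ → Av S c d₁ d₃ → Av S c d₁ d₄ → ⊥
    fam-host₁ c {d₁} {d₂} {d₃} {d₄} dd e₁ e₂ e₃ e₄ a₂ a₃ a₄ =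
      block-through c d₁ d₂ (d₁ ∷ d₂ ∷ d₃ ∷ d₄ ∷ []) (here refl) (there (here refl)) (Distinct4.ab dd) nbr con
        λ { (B , ib , ed , _) → few-nbrs {E = inE B} dd (ed (here refl)) (ed (there (here refl))) (ed (there (there (here refl)))) (ed (there (there (there (here refl))))) (proj₁ fam B ib c) }
      where
      nbr : ∀ {d} → d ∈ d₁ ∷ d₂ ∷ d₃ ∷ d₄ ∷ [] → T (A c d)
      nbr (here refl) = ≡⇒T e₁
      nbr (there (here refl)) = ≡⇒T e₂
      nbr (there (there (here refl))) = ≡⇒T e₃
      nbr (there (there (there (here refl)))) = ≡⇒T e₄
      con : ∀ {d} → d ∈ d₁ ∷ d₂ ∷ d₃ ∷ d₄ ∷ [] → Av S c d₁ d
      con (here refl) = stay (Ed-≢ H e₁ ∘ sym)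
      con (there (here refl)) = a₂
      con (there (there (here refl))) = a₃
      con (there (there (there (here refl)))) = a₄

    tri-block : ∀ {c x v} → S c x → S c v → S x v → ¬ ¬ ∃ λ B → IsBlock H B × T (inE B c x) × T (inE B x v) × T (inE B c v)
    tri-block {c} {x} {v} cx cv xv = ¬¬-bind (block-through c x v (x ∷ v ∷ []) (here refl) (there (here refl)) (Ed-≢ H xv)
        (λ { (here refl) → ≡⇒T cx ; (there (here refl)) → ≡⇒T cv })
        (λ { (here refl) → stay (Ed-≢ H cx ∘ sym) ; (there (here refl)) → via (Ed-≢ H cx ∘ sym) xv (stay (Ed-≢ H cv ∘ sym)) }))
      λ { (B , ib , e , f) h → h (B , ib , e (here refl) , f (here refl) (there (here refl)) (≡⇒T xv) , e (there (here refl))) }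

    -- A degree above 3 at `c` leaves the second alternative of (ii), so both triangles lie in the
    -- same block, and a block stays connected when `c` is deleted.
    same-side : ∀ {c x v x' v' c'} → ¬ degree H c ≤ 3 → S c x → S c v → S x v → S x' v' → S v' c' → S x' c' → x' ≢ c → Walk A c x' → ¬ ¬ Av S c x x'
    same-side {c} {x} {v} {x'} {v'} {c'} big cx cv xv e₁ e₂ e₃ n w =
      ¬¬-bind (tri-block cx cv xv) λ { (B₁ , ib₁ , p₁ , p₂ , p₃) → ¬¬-bind (tri-block e₁ e₃ e₂) λ { (B₂ , ib₂ , q₁ , q₂ , q₃) h →
        h (alt (proj₂ fam c) B₁ ib₁ p₁ p₂ p₃ B₂ ib₂ q₁ q₂ q₃) } }
      where
      alt : (∀ u → Walk A c u → degree H u ≤ 3) ⊎ (∀ B₁ B₂ → IsBlock H B₁ → IsBlock H B₂ → TriangleInComponentOf H c B₁ → TriangleInComponentOf H c B₂ → SameSubgraph B₁ B₂) →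
        ∀ B₁ → IsBlock H B₁ → T (inE B₁ c x) → T (inE B₁ x v) → T (inE B₁ c v) → ∀ B₂ → IsBlock H B₂ → T (inE B₂ x' v') → T (inE B₂ v' c') → T (inE B₂ x' c') → Av S c x x'
      alt (inj₁ small) _ _ _ _ _ _ _ _ _ _ = contradiction (small c here) big
      alt (inj₂ uni) B₁ ib₁ p₁ p₂ p₃ B₂ ib₂ q₁ q₂ q₃ = conv (proj₂ (proj₂ (proj₁ ib₁)) c (inE-inV B₁ c x p₁) x x' (inE-inV B₁ x v p₂) inx' (Ed-≢ H cx ∘ sym) n) (Ed-≢ H cx ∘ sym)
        where
        same = uni B₁ B₂ ib₁ ib₂ (c , x , v , here , p₁ , p₂ , p₃) (x' , v' , c' , w , q₁ , q₂ , q₃)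
        inx' : T (inV B₁ x')
        inx' = subst T (sym (proj₁ same x')) (inE-inV B₂ x' v' q₁)
        conv : ∀ {a b} → Walk (deleteVertex B₁ c) a b → a ≢ c → Av S c a b
        conv here k = stay k
        conv (step {u} {v} t w) k = via k (T⇒≡ (inE-adj B₁ u v (T∧ˡ t))) (conv w λ p → ¬Tnot (T∧ʳ {not ⌊ c ≟ u ⌋} (T∧ʳ {inE B₁ u v} t)) (subst (λ z → T ⌊ c ≟ z ⌋) (sym p) (eqT c)))

    family-host : Host S
    family-host = record { host₁ = fam-host₁ ; host₂ = host₂' }
      where
      -- If all four directions led to triangles, `same-side` would connect each of them with `x`
      -- off `c`, against `fam-host₁`.
      host₂' : ∀ c {d₁ d₂ d₃ d₄} → Distinct4 d₁ d₂ d₃ d₄ → S c d₁ → S c d₂ → S c d₃ → S c d₄ → ∀ {x v} → S c x → S c v → S x v →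
        ¬ ¬ ∃ λ d → d ∈ d₁ ∷ d₂ ∷ d₃ ∷ d₄ ∷ [] × (∀ {x' v' c'} → S x' v' → S v' c' → S x' c' → x' ≢ c → ¬ Av S c d x')
      host₂' c {d₁} {d₂} {d₃} {d₄} dd e₁ e₂ e₃ e₄ {x} {v} cx cv xv h =
        pick-d (here refl) e₁ λ a₁ → pick-d (there (here refl)) e₂ λ a₂ → pick-d (there (there (here refl))) e₃ λ a₃ → pick-d (there (there (there (here refl)))) e₄ λ a₄ →
          fam-host₁ c dd e₁ e₂ e₃ e₄ (av-trans (av-sym a₁) a₂) (av-trans (av-sym a₁) a₃) (av-trans (av-sym a₁) a₄)
        where
        big : ¬ degree H c ≤ 3
        big = few-nbrs {E = A} dd (≡⇒T e₁) (≡⇒T e₂) (≡⇒T e₃) (≡⇒T e₄)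
        pick-d : ∀ {d} → d ∈ d₁ ∷ d₂ ∷ d₃ ∷ d₄ ∷ [] → S c d → ¬ ¬ Av S c x d
        pick-d {d} k cd n = h (d , k , λ s t u p a → same-side big cx cv xv s t u p (step (≡⇒T cd) (av-walk a)) λ b → n (av-trans b (av-sym a)))

  -- A partial injection, since only some vertices have an image. The image is computed from a proof
  -- of membership, whence the requirement `irr`.
  record Emb {k : ℕ} (R : Rel {k}) (S : Rel {m}) : Set₁ where
    field
      P : Fin k → Set
      im : ∀ u → P u → Fin m
      irr : ∀ u p q → im u p ≡ im u q
      inj : ∀ u v p q → im u p ≡ im v q → u ≡ v
      dom : ∀ {u v} → R u v → P u
      cod : ∀ {u v} → R u v → P v
      pres : ∀ {u v} → R u v → ∀ p q → S (im u p) (im v q)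

    emb-av : ∀ {c u v} → Av R c u v → ∀ pc pu pv → Av S (im c pc) (im u pu) (im v pv)
    emb-av {c} {u} (stay n) pc pu pv = subst (Av S (im c pc) (im u pu)) (irr u pu pv) (stay λ e → n (inj _ _ _ _ e))
    emb-av (via n r a) pc pu pv = via (λ e → n (inj _ _ _ _ e)) (pres r pu (cod r)) (emb-av a pc (cod r) pv)

    emb-host : Host S → Host R
    emb-host h = record
      { host₁ = λ c dd a₁ a₂ a₃ a₄ p q s → Host.host₁ h (im c (dom a₁)) (dis dd (cod a₁) (cod a₂) (cod a₃) (cod a₄))
          (pres a₁ _ _) (pres a₂ _ _) (pres a₃ _ _) (pres a₄ _ _) (emb-av p _ _ _) (emb-av q _ _ _) (emb-av s _ _ _)
      ; host₂ = λ c dd a₁ a₂ a₃ a₄ cx cv xv k → Host.host₂ h (im c (dom a₁)) (dis dd (cod a₁) (cod a₂) (cod a₃) (cod a₄))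
          (pres a₁ _ _) (pres a₂ _ _) (pres a₃ _ _) (pres a₄ _ _) (pres cx _ (cod cx)) (pres cv _ (cod cv)) (pres xv _ _)
          λ { (d , here refl , f) → k (_ , here refl , back (cod a₁) (dom a₁) f)
            ; (d , there (here refl) , f) → k (_ , there (here refl) , back (cod a₂) (dom a₁) f)
            ; (d , there (there (here refl)) , f) → k (_ , there (there (here refl)) , back (cod a₃) (dom a₁) f)
            ; (d , there (there (there (here refl))) , f) → k (_ , there (there (there (here refl))) , back (cod a₄) (dom a₁) f) } }
      where
      dis : ∀ {a b c d} → Distinct4 a b c d → ∀ p q r s → Distinct4 (im a p) (im b q) (im c r) (im d s)
      dis (dis4 x y z u v w) p q r s = dis4 (x ∘ inj _ _ _ _) (y ∘ inj _ _ _ _) (z ∘ inj _ _ _ _) (u ∘ inj _ _ _ _) (v ∘ inj _ _ _ _) (w ∘ inj _ _ _ _)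
      back : ∀ {c d} (pd : P d) (pc : P c) → (∀ {x' v' c'} → S x' v' → S v' c' → S x' c' → x' ≢ im c pc → ¬ Av S (im c pc) (im d pd) x') →
        ∀ {x' v' c'} → R x' v' → R v' c' → R x' c' → x' ≢ c → ¬ Av R c d x'
      back pd pc f r s t n a = f (pres r (dom r) (cod r)) (pres s (cod r) (cod s)) (pres t (dom r) (cod s)) (λ e → n (inj _ _ _ _ e)) (emb-av a pc pd (dom r))

-- Exceptional components and the parity of n

even⇒2∣ : ∀ n → odd n ≡ false → 2 ∣ n
even⇒2∣ zero e = divides 0 refl
even⇒2∣ (suc (suc n)) e with even⇒2∣ n (trans (sym (not-involutive (odd n))) e)
... | divides q eq = divides (suc q) (cong (λ x → ℕ.suc (ℕ.suc x)) eq)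

module _ {N : ℕ} where

  Ev⇒2∣ : ∀ (G : Graph N) {v} → Ev G v → 2 ∣ degree G v
  Ev⇒2∣ G {v} e = even⇒2∣ (degree G v) (trans (cong odd (countNbrs-∑ (adj G) v)) (trans (sym (par-def (adj G) v)) e))

  subgraph-emb : ∀ {m} (G : Graph N) (H : Graph m) → EVSubgraphOf G H → Emb (FE G) (Ed H)
  subgraph-emb G H (f , inj , pres) = record
    { P = Ev G
    ; im = λ u e → f u (Ev⇒2∣ G e)
    -- Evenness is an equation between Booleans, whose proofs coincide; so the proof handed to `f`
    -- is always the same.
    ; irr = λ u p q → cong (λ e → f u (Ev⇒2∣ G e)) (uip p q)
    ; inj = λ u v p q → inj u v _ _
    ; dom = λ r → proj₁ (proj₂ r)
    ; cod = λ r → proj₂ (proj₂ r)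
    ; pres = λ {u} {v} r p q → T⇒≡ (pres u v _ _ (≡⇒T (proj₁ r))) }

  -- Path decompositions in the sense of the statement

  Uq⇒Unique : ∀ (p : Path {N}) → Uq p → Unique p
  Uq⇒Unique [] u = []
  Uq⇒Unique (x ∷ p) u = All.tabulate (λ m e → contradiction (subst (λ y → 1 ≤ cnt p y) (sym e) (cnt-∈ m)) (<⇒≱ (s≤s (≤-reflexive (cnt0 {A = p} u))))) ∷ Uq⇒Unique p (Uq-tail {x = x} {p} u)

  uses≤ : ∀ (p : Path {N}) u v → usesEdge p u v ≡ true → 1 ≤ mulp p u v
  uses≤ (x ∷ r) u v = go x r
    where
    go : ∀ x r → usesEdge (x ∷ r) u v ≡ true → 1 ≤ mulp (x ∷ r) u v
    go x (y ∷ r) h with ε x y u v | go y r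
    ... | true | _ = s≤s z≤n
    ... | false | rec = rec h

  ≤uses : ∀ (p : Path {N}) u v → usesEdge p u v ≡ false → mulp p u v ≡ 0
  ≤uses [] u v h = refl
  ≤uses (x ∷ r) u v = go x r
    where
    go : ∀ x r → usesEdge (x ∷ r) u v ≡ false → mulp (x ∷ r) u v ≡ 0
    go x [] h = refl
    go x (y ∷ r) h with ε x y u v | go y r
    go x (y ∷ r) () | true | _
    ... | false | rec = rec h

  -- One side counts the paths using an edge, the other their passages through it; with at most one
  -- passage in total there is no difference.
  multiplicity : ∀ D (u v : Fin N) → mul D u v ≤ 1 → edgeMultiplicity D u v ≡ mul D u v
  multiplicity [] u v le = refl
  multiplicity (p ∷ D) u v le = cong₂ _+_ (one (usesEdge p u v) refl) (multiplicity D u v (≤-trans (m≤n+m _ (mulp p u v)) le))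
    where
    one : ∀ b → usesEdge p u v ≡ b → b2n (usesEdge p u v) ≡ mulp p u v
    one true e = trans (cong b2n e) (≤-antisym (uses≤ p u v e) (≤-trans (m≤m+n _ _) le))
    one false e = trans (cong b2n e) (sym (≤uses p u v e))

  linked : ∀ (G : Graph N) p → (∀ u v → 1 ≤ mulp p u v → Ed G u v) → Linked (λ u v → T (adj G u v)) p
  linked G [] h = []
  linked G (x ∷ r) = go x r
    where
    go : ∀ x r → (∀ u v → 1 ≤ mulp (x ∷ r) u v → Ed G u v) → Linked (λ u v → T (adj G u v)) (x ∷ r)
    go x [] h = [-]
    go x (y ∷ r) h = ≡⇒T (h x y (≤-trans (≤-reflexive (sym (cong b2n (ε-self x y)))) (m≤m+n _ _))) ∷ go y r λ u v k → h u v (≤-trans k (m≤n+m _ (εn x y u v)))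

  decomposition : ∀ (G : Graph N) {L} (d : Dc (adj G) L) → IsPathDecomposition G (D d)
  decomposition G d = paths (D d) (ok d) (λ u v h → edge u v h) ,
    λ u v t → trans (multiplicity (D d) u v (subst (_≤ 1) (sym (mult d u v)) (b2n≤1 _))) (trans (mult d u v) (cong b2n (T⇒≡ t)))
    where
    edge : ∀ u v → 1 ≤ mul (D d) u v → Ed G u v
    edge u v h with adj G u v | mult d u v
    ... | true | _ = refl
    ... | false | e = contradiction (subst (1 ≤_) e h) λ ()
    paths : ∀ D → All Ok D → (∀ u v → 1 ≤ mul D u v → Ed G u v) → All (IsPath G) D
    paths [] [] h = []
    paths (p ∷ D) ((u , l) ∷ os) h = (l , Uq⇒Unique p u , linked G p λ x y k → h x y (≤-trans k (m≤m+n _ _))) ∷ paths D os λ x y k → h x y (≤-trans k (m≤n+m _ (mulp p x y)))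

  solve : odd N ≡ true → (G : Graph N) → Host (FE G) → NoExc G → Φ G
  solve oN G h n = main oN (λ G h → Structure.config (FE G) (FE? G) (FE-sym G) (FE-≢ G) h) (suc (size (adj G))) G ≤-refl h n

  Exc? : ∀ (G : Graph N) a b c → Dec (Exc G a b c)
  Exc? G a b c = map′ (λ (p , q , r , s , t) → record { ab = p ; bc = q ; ac = r ; near = λ {u} → s u ; closed = λ {u} {w} → t u w })
      (λ e → Exc.ab e , Exc.bc e , Exc.ac e , (λ u → Exc.near e {u}) , λ u w → Exc.closed e {u} {w})
      (FE? G a b ×-dec FE? G b c ×-dec FE? G a c ×-dec
       (all? λ u → ¬? (u ≟ a) →-dec (¬? (u ≟ b) →-dec (¬? (u ≟ c) →-dec ((e? u a ⊎-dec (e? u b ⊎-dec e? u c)) →-dec ((par (adj G) u ≟ᵇ true) ×-dec Two? G a b c u))))) ×-dec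
       (all? λ u → all? λ w → Two? G a b c u →-dec (¬? (u ≟ a) →-dec (¬? (u ≟ b) →-dec (¬? (u ≟ c) →-dec (e? u w →-dec (((w ≟ a) ⊎-dec ((w ≟ b) ⊎-dec (w ≟ c))) ⊎-dec Two? G a b c w)))))))
    where
    e? : ∀ u v → Dec (Ed G u v)
    e? u v = adj G u v ≟ᵇ true

  -- The vertices of an exceptional triangle and their neighbours form a union of components.
  module _ {G : Graph N} {a b c : Fin N} (x : Exc G a b c) where
    open Exc x

    In : Fin N → Set
    In v = (v ≡ a ⊎ v ≡ b ⊎ v ≡ c) ⊎ (v ≢ a × v ≢ b × v ≢ c × Two G a b c v)

    into : ∀ {v} → (v ≡ a ⊎ v ≡ b ⊎ v ≡ c) ⊎ Two G a b c v → In v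
    into (inj₁ e) = inj₁ e
    into {v} (inj₂ t) = go (v ≟ a) (v ≟ b) (v ≟ c)
      where
      go : Dec (v ≡ a) → Dec (v ≡ b) → Dec (v ≡ c) → In v
      go (yes e) _ _ = inj₁ (inj₁ e)
      go (no _) (yes e) _ = inj₁ (inj₂ (inj₁ e))
      go (no _) (no _) (yes e) = inj₁ (inj₂ (inj₂ e))
      go (no p) (no q) (no r) = inj₂ (p , q , r , t)

    In-step : ∀ {v w} → In v → Ed G v w → In w
    In-step {v} {w} (inj₂ (p , q , r , t)) e = into (closed t p q r e)
    In-step {v} {w} (inj₁ k) e = go (w ≟ a) (w ≟ b) (w ≟ c)
      where
      adjc : v ≡ a ⊎ v ≡ b ⊎ v ≡ c → Ed G w a ⊎ Ed G w b ⊎ Ed G w c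
      adjc (inj₁ refl) = inj₁ (Ed-sym G e)
      adjc (inj₂ (inj₁ refl)) = inj₂ (inj₁ (Ed-sym G e))
      adjc (inj₂ (inj₂ refl)) = inj₂ (inj₂ (Ed-sym G e))
      go : Dec (w ≡ a) → Dec (w ≡ b) → Dec (w ≡ c) → In w
      go (yes e) _ _ = inj₁ (inj₁ e)
      go (no _) (yes e) _ = inj₁ (inj₂ (inj₁ e))
      go (no _) (no _) (yes e) = inj₁ (inj₂ (inj₂ e))
      go (no p) (no q) (no r) = inj₂ (p , q , r , proj₂ (near p q r (adjc k)))

    In-walk : ∀ {v w} → In v → Walk (adj G) v w → In w
    In-walk i here = i
    In-walk i (step e w) = In-walk (In-step i (T⇒≡ e)) w

    In-odd : ∀ {v} → In v → v ≢ a → v ≢ b → v ≢ c → Od G v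
    In-odd (inj₁ (inj₁ e)) p q r = contradiction e p
    In-odd (inj₁ (inj₂ (inj₁ e))) p q r = contradiction e q
    In-odd (inj₁ (inj₂ (inj₂ e))) p q r = contradiction e r
    In-odd (inj₂ (_ , _ , _ , t)) p q r = proj₁ (near p q r (any t))
      where
      any : ∀ {v} → Two G a b c v → Ed G v a ⊎ Ed G v b ⊎ Ed G v c
      any (inj₁ (e , _)) = inj₁ e
      any (inj₂ (inj₁ (e , _))) = inj₂ (inj₁ e)
      any (inj₂ (inj₂ (e , _))) = inj₁ e

  half : ∀ k L → L + L ≤ suc (k + k) → L ≤ k
  half k L h with L ℕ.≤? k
  ... | yes p = p
  ... | no n = contradiction (≤-trans (+-mono-≤ (≰⇒> n) (≰⇒> n)) h) (<⇒≱ (≤-reflexive (cong suc (sym (+-suc k k)))))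

  -- If `G` has an exceptional triangle, connectedness makes all vertices outside it odd. Without
  -- `ab` only `c` is even, so F has no edges and the floor bound holds; as `N` is odd, it is strict
  -- for `L + L`, which pays for `ab` as an additional path.
  odd-case : odd N ≡ true → (G : Graph N) → Connected G → Host (FE G) → ∃ λ L → Dc (adj G) L × L + L ≤ suc N
  odd-case oN G conn hst = go (any? λ a → any? λ b → any? λ c → Exc? G a b c)
    where
    go : Dec (∃ λ a → ∃ λ b → ∃ λ c → Exc G a b c) → ∃ λ L → Dc (adj G) L × L + L ≤ suc N
    go (no n) with solve oN G hst (λ a b c x → n (a , b , c , x))
    ... | L , d , le = L , d , ≤-trans le (n≤1+n N)
    go (yes (a , b , c , x)) = conclude (solve oN G' (Host-mono (λ f → ⊥-elim (noF f)) hst) (λ _ _ _ y → noF (Exc.ab y)))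
      where
      open Exc x using (ab; bc; ac)
      E = adj G
      a≢b = FE-≢ G ab
      G' = togG a b a≢b G
      evens : ∀ {v} → Ev G' v → v ≡ c
      evens {v} e = go' (v ≟ a) (v ≟ b) (v ≟ c)
        where
        go' : Dec (v ≡ a) → Dec (v ≡ b) → Dec (v ≡ c) → v ≡ c
        go' (yes refl) _ _ = contradiction (trans (sym e) (trans (par-togˡ E a≢b) (cong not (proj₁ (proj₂ ab))))) λ ()
        go' (no _) (yes refl) _ = contradiction (trans (sym e) (trans (par-togʳ E a≢b) (cong not (proj₂ (proj₂ ab))))) λ ()
        go' (no _) (no _) (yes q) = q
        go' (no p) (no q) (no r) = contradiction (trans (sym e) (trans (par-tog-other E a≢b p q) (In-odd x (In-walk x (inj₁ (inj₁ refl)) (conn a v)) p q r))) λ ()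
      noF : ∀ {u v} → FE G' u v → ⊥
      noF (e , p , q) = Ed-≢ G' e (trans (evens p) (sym (evens q)))
      conclude : Φ G' → ∃ λ L → Dc E L × L + L ≤ suc N
      conclude (L , d , le) = suc L , dc ((a ∷ b ∷ []) ∷ D d) ((uq , s≤s z≤n) ∷ ok d) mm (cong suc (len d)) ,
          ≤-trans (≤-reflexive (cong suc (+-suc L L))) (s≤s (tight N oN le))
        where
        tight : ∀ n → odd n ≡ true → L + L ≤ n → suc (L + L) ≤ n
        tight n o h with m≤n⇒m<n∨m≡n h
        ... | inj₁ k = k
        ... | inj₂ refl = contradiction (trans (sym o) (odd-double L)) λ ()
        uq : Uq (a ∷ b ∷ [])
        uq v with a ≟ v | b ≟ v
        ... | yes refl | yes q = contradiction (sym q) a≢b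
        ... | yes _ | no _ = ≤-refl
        ... | no _ | yes _ = ≤-refl
        ... | no _ | no _ = z≤n
        mm : ∀ u v → mul ((a ∷ b ∷ []) ∷ D d) u v ≡ b2n (E u v)
        mm u v = trans (cong₂ _+_ (+-identityʳ (εn a b u v)) (mult d u v)) (trans (+-comm (εn a b u v) _)
          (trans (b2n-tog a b (tog a b E) u v off) (cong b2n (tog-tog a b E u v))))
          where
          off : ε a b u v ≡ true → tog a b E u v ≡ false
          off q with ε-sound a b u v q
          ... | inj₁ (refl , refl) = trans (tog-self a b E) (cong not (proj₁ ab))
          ... | inj₂ (refl , refl) = trans (tog-sym a b (Graph.sym G) u v) (trans (tog-self a b E) (cong not (proj₁ ab)))

-- Even order: adding an isolated vertex

isolate : ∀ {n} → Graph n → Graph (suc n)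
isolate {n} G = record { adj = ad ; sym = sm ; irrefl = ir }
  where
  ad : Fin (suc n) → Fin (suc n) → Bool
  ad (suc u) (suc v) = adj G u v
  ad _ _ = false
  sm : ∀ u v → ad u v ≡ ad v u
  sm zero zero = refl
  sm zero (suc v) = refl
  sm (suc u) zero = refl
  sm (suc u) (suc v) = Graph.sym G u v
  ir : ∀ v → ad v v ≡ false
  ir zero = refl
  ir (suc v) = Graph.irrefl G v

module _ {n : ℕ} (G : Graph n) where

  private
    G⁺ : Graph (suc n)
    G⁺ = isolate G

  par-suc : ∀ v → par (adj G⁺) (suc v) ≡ par (adj G) v
  par-suc v = trans (par-def (adj G⁺) (suc v)) (trans (cong odd (∑-allFin-suc {n} λ u → b2n (adj G⁺ (suc v) u))) (sym (par-def (adj G) v)))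

  isolate-emb : Emb (FE G⁺) (FE G)
  isolate-emb = record
    { P = λ u → ∃ λ v → u ≡ suc v
    ; im = λ u p → proj₁ p
    ; irr = λ { u (v , refl) (.v , refl) → refl }
    ; inj = λ { u v (x , refl) (.x , refl) refl → refl }
    ; dom = λ {u} {v} r → dm u v (proj₁ r)
    ; cod = λ {u} {v} r → dm v u (Ed-sym G⁺ {u} {v} (proj₁ r))
    ; pres = λ { (e , p , q) (u , refl) (v , refl) → e , trans (sym (par-suc u)) p , trans (sym (par-suc v)) q } }
    where
    dm : ∀ u v → Ed G⁺ u v → ∃ λ w → u ≡ suc w
    dm (suc u) v e = u , refl

  -- An exceptional triangle would lie in `G`, with all other vertices of `G` odd. Toggling `ab` and
  -- joining the new vertex to `c` would then make all degrees odd in a graph of odd order.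
  even-case : odd n ≡ false → Connected G → Host (FE G) → Φ G⁺
  even-case on conn hst = solve (cong not on) G⁺ (Emb.emb-host isolate-emb hst) noExc
    where
    noExc : NoExc G⁺
    noExc zero b c x = contradiction (proj₁ (Exc.ab x)) λ ()
    noExc (suc a) zero c x = contradiction (proj₁ (Exc.ab x)) λ ()
    noExc (suc a) (suc b) zero x = contradiction (proj₁ (Exc.ac x)) λ ()
    noExc (suc a) (suc b) (suc c) x = contradiction (proj₂ (exists-even (cong not on) G'')) (all-odd (proj₁ (exists-even (cong not on) G'')))
      where
      open Exc x using (ab; bc; ac)
      E = adj G⁺
      a≢b = FE-≢ G⁺ ab
      b≢c = FE-≢ G⁺ bc
      a≢c = FE-≢ G⁺ ac
      z≢c : zero ≢ suc c
      z≢c ()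
      E' = tog (suc a) (suc b) E
      G'' = togG zero (suc c) z≢c (togG (suc a) (suc b) a≢b G⁺)
      lift : ∀ {u v} → Walk (adj G) u v → Walk E (suc u) (suc v)
      lift here = here
      lift (step e w) = step e (lift w)
      zero-even : par E zero ≡ false
      zero-even = trans (par-def E zero) (cong odd (∑-zero (allFin (suc n)) λ _ → refl))
      all-odd : ∀ v → par (adj G'') v ≢ false
      all-odd zero e = contradiction (trans (sym e) (trans (par-togˡ E' z≢c) (cong not (trans (par-tog-other E a≢b (λ ()) (λ ())) zero-even)))) λ ()
      all-odd (suc v) e = go (suc v ≟ suc a) (suc v ≟ suc b) (suc v ≟ suc c)
        where
        go : Dec (suc v ≡ suc a) → Dec (suc v ≡ suc b) → Dec (suc v ≡ suc c) → ⊥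
        go (yes refl) _ _ = contradiction (trans (sym e) (trans (par-tog-other E' z≢c (λ ()) a≢c) (trans (par-togˡ E a≢b) (cong not (proj₁ (proj₂ ab)))))) λ ()
        go (no _) (yes refl) _ = contradiction (trans (sym e) (trans (par-tog-other E' z≢c (λ ()) b≢c) (trans (par-togʳ E a≢b) (cong not (proj₂ (proj₂ ab)))))) λ ()
        go (no p) (no q) (yes refl) = contradiction (trans (sym e) (trans (par-togʳ E' z≢c) (cong not (trans (par-tog-other E a≢b p q) (proj₂ (proj₂ bc)))))) λ ()
        go (no p) (no q) (no r) = contradiction (trans (sym e) (trans (par-tog-other E' z≢c (λ ()) r) (trans (par-tog-other E a≢b p q)
          (In-odd x (In-walk x (inj₁ (inj₁ refl)) (lift (conn a v))) p q r)))) λ ()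

  -- The isolated vertex occurs only as a trivial path, which may be moved anywhere.
  project : ∀ (x₀ : Fin n) {L} → Dc (adj G⁺) L → ∃ λ D → IsPathDecomposition G D × length D ≡ L
  project x₀ {L} d = map (map π) (D d) , (paths (D d) (proj₁ pd) , mults) , trans (length-map (map π) (D d)) (len d)
    where
    π : Fin (suc n) → Fin n
    π zero = x₀
    π (suc v) = v
    pd = decomposition G⁺ d
    un : ∀ p → Linked (λ u v → T (adj G⁺ u v)) p → (∃ λ q → p ≡ map suc q) ⊎ p ≡ zero ∷ []
    un [] [] = inj₁ ([] , refl)
    un (zero ∷ []) [-] = inj₂ refl
    un (suc v ∷ []) [-] = inj₁ (v ∷ [] , refl)
    un (suc v ∷ suc w ∷ p) (e ∷ l) with un (suc w ∷ p) l
    ... | inj₁ (q , eq) = inj₁ (v ∷ q , cong (suc v ∷_) eq)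
    back : ∀ q → map π (map suc q) ≡ q
    back [] = refl
    back (x ∷ q) = cong (x ∷_) (back q)
    unl : ∀ q → Linked (λ u v → T (adj G⁺ u v)) (map suc q) → Linked (λ u v → T (adj G u v)) q
    unl [] _ = []
    unl (x ∷ []) _ = [-]
    unl (x ∷ y ∷ q) (e ∷ l) = e ∷ unl (y ∷ q) l
    uniq : ∀ q → Unique (map suc q) → Unique q
    uniq [] [] = []
    uniq (x ∷ q) (h ∷ u) = All.tabulate (λ m e → All.lookup h (∈-map⁺ suc m) (cong suc e)) ∷ uniq q u
    path : ∀ p → IsPath G⁺ p → IsPath G (map π p)
    path p (l , u , k) with un p k
    ... | inj₂ refl = s≤s z≤n , ([] ∷ []) , [-]
    ... | inj₁ (q , refl) = subst (IsPath G) (sym (back q)) (lq q l , uniq q u , unl q k)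
      where
      lq : ∀ q → 1 ≤ length (map (suc {n}) q) → 1 ≤ length q
      lq (x ∷ q) _ = s≤s z≤n
    paths : ∀ D → All (IsPath G⁺) D → All (IsPath G) (map (map π) D)
    paths [] [] = []
    paths (p ∷ D) (o ∷ os) = path p o ∷ paths D os
    eqs : ∀ (x y : Fin n) → ⌊ suc x ≟ suc y ⌋ ≡ ⌊ x ≟ y ⌋
    eqs x y with x ≟ y
    ... | yes _ = refl
    ... | no _ = refl
    uses-suc : ∀ q u v → usesEdge (map suc q) (suc u) (suc v) ≡ usesEdge q u v
    uses-suc [] u v = refl
    uses-suc (x ∷ []) u v = refl
    uses-suc (x ∷ y ∷ q) u v = cong₂ _∨_ (cong₂ _∨_ (cong₂ _∧_ (eqs x u) (eqs y v)) (cong₂ _∧_ (eqs x v) (eqs y u))) (uses-suc (y ∷ q) u v)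
    uses : ∀ p → IsPath G⁺ p → ∀ u v → usesEdge (map π p) u v ≡ usesEdge p (suc u) (suc v)
    uses p (_ , _ , k) u v with un p k
    ... | inj₂ refl = refl
    ... | inj₁ (q , refl) = trans (cong (λ l → usesEdge l u v) (back q)) (sym (uses-suc q u v))
    total : ∀ D → All (IsPath G⁺) D → ∀ u v → edgeMultiplicity (map (map π) D) u v ≡ edgeMultiplicity D (suc u) (suc v)
    total [] [] u v = refl
    total (p ∷ D) (o ∷ os) u v = cong₂ _+_ (cong b2n (uses p o u v)) (total D os u v)
    mults : ∀ u v → T (adj G u v) → edgeMultiplicity (map (map π) (D d)) u v ≡ 1
    mults u v t = trans (total (D d) (proj₁ pd) u v) (proj₂ pd (suc u) (suc v) t)

parity-split : ∀ n → (∃ λ k → n ≡ k + k × ⌈ n /2⌉ ≡ k × odd n ≡ false) ⊎ (∃ λ k → n ≡ suc (k + k) × ⌈ n /2⌉ ≡ suc k × odd n ≡ true)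
parity-split zero = inj₁ (0 , refl , refl , refl)
parity-split (suc zero) = inj₂ (0 , refl , refl , refl)
parity-split (suc (suc n)) with parity-split n
... | inj₁ (k , p , q , r) = inj₁ (suc k , cong suc (trans (cong suc p) (sym (+-suc k k))) , cong suc q , trans (not-involutive (odd n)) r)
... | inj₂ (k , p , q , r) = inj₂ (suc k , cong suc (trans (cong suc p) (cong suc (sym (+-suc k k)))) , cong suc q , trans (not-involutive (odd n)) r)

theorem1p3 : ∀ {n : ℕ} (G : Graph n) → Connected G →
    (∃ λ m → Σ (Graph m) λ H → InFamily H × EVSubgraphOf G H) →
    Σ (List (List (Fin n))) λ D → IsPathDecomposition G D × length D ≤ ⌈ n /2⌉
-- Separate because `project` needs a vertex to which trivial paths can be moved.
theorem1p3 {zero} G conn _ = [] , ([] , λ ()) , z≤n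
theorem1p3 {suc n} G conn (m , H , fam , sub) = go (parity-split (suc n))
  where
  hst : Host (FE G)
  hst = Emb.emb-host (subgraph-emb G H sub) (family-host H fam)
  go : (∃ λ k → suc n ≡ k + k × ⌈ suc n /2⌉ ≡ k × odd (suc n) ≡ false) ⊎ (∃ λ k → suc n ≡ suc (k + k) × ⌈ suc n /2⌉ ≡ suc k × odd (suc n) ≡ true) →
    Σ (List (List (Fin (suc n)))) λ D → IsPathDecomposition G D × length D ≤ ⌈ suc n /2⌉
  go (inj₁ (k , e , h , o)) = result (even-case G o conn hst)
    where
    result : Φ (isolate G) → Σ (List (List (Fin (suc n)))) λ D → IsPathDecomposition G D × length D ≤ ⌈ suc n /2⌉
    result (L , d , le) = proj₁ pr , proj₁ (proj₂ pr) , subst₂ _≤_ (sym (proj₂ (proj₂ pr))) (sym h) (half {suc n} k L (subst (λ x → L + L ≤ suc x) e le))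
      where
      pr = project G zero d
  go (inj₂ (k , e , h , o)) = result (odd-case o G conn hst)
    where
    result : (∃ λ L → Dc (adj G) L × L + L ≤ suc (suc n)) → Σ (List (List (Fin (suc n)))) λ D → IsPathDecomposition G D × length D ≤ ⌈ suc n /2⌉
    result (L , d , le) = D d , decomposition G d , subst₂ _≤_ (sym (len d)) (sym h)
      (half {suc n} (suc k) L (≤-trans (subst (λ x → L + L ≤ suc x) e le) (s≤s (s≤s (≤-trans (n≤1+n _) (≤-reflexive (sym (+-suc k k))))))))
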